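{- Let $h\in\mathbb{N}$ and let $H$ be any graph on $h$ vertices with $\chi(H)\ge 2$. For every $\alpha>0$ there exists a constant $\mu>0$ such that for every sufficiently large $n$ with $n\in h\mathbb{N}$, every $(n,1-\frac{1}{\chi^*(H)}+\alpha,\mu)$-incompatibility system $(G,\mathcal{F})$ contains a compatible $H$-factor. Moreover, the term $\alpha$ in the minimum degree condition cannot be omitted when $H$ is a complete $r$-partite graph $K_r(h_1,\dots,h_r)$ with $r\ge 3$: for every $0<\mu<\frac{\chi_{cr}(H)+1-r}{r}$ and every sufficiently large $n$ divisible by $h=h_1+\dots+h_r$, there exists an $(n,1-\frac{1}{\chi^*(H)}+\frac{\mu}{2},\mu)$-incompatibility system $(G,\mathcal{F})$ with no compatible $K_r(h_1,\dots,h_r)$-factor.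
   Context: All graphs are finite, simple, undirected. For graphs $H,G$, an $H$-tiling of $G$ is a collection of vertex-disjoint copies of $H$ in $G$; an $H$-factor is an $H$-tiling covering all vertices of $G$. An incompatibility system $\mathcal{F}$ over a graph $G=(V,E)$ is a family $\{F_v\}_{v\in V}$ where each $F_v\subseteq\{\{e,e'\}\in\binom{E}{2}: e\cap e'=\{v\}\}$. Edges $e,e'$ are incompatible if $\{e,e'\}\in F_v$ for some $v$, and compatible otherwise. A subgraph of $G$ is compatible if every pair of its edges is compatible. $\mathcal{F}$ is $\Delta$-bounded if for every vertex $v$ and every edge $e$ incident with $v$, at most $\Delta$ other edges incident with $v$ are incompatible with $e$ at $v$. For constants $\mu,\delta$ and $n\in\mathbb{N}$, an $(n,\delta,\mu)$-incompatibility system $(G,\mathcal{F})$ consists of an $n$-vertex graph $G$ with minimum degree $\delta(G)\ge\delta n$ and a $\mu n$-bounded incompatibility system $\mathcal{F}$ over $G$. $K_r(h_1,\dots,h_r)$ denotes the complete $r$-partite graph with parts of sizes $h_1,\dots,h_r$. Critical chromatic number: $\chi_{cr}(H)=(\chi(H)-1)|H|/(|H|-\sigma(H))$, where $\sigma(H)$ is the minimum, over all proper colorings of $H$ with $\chi(H)$ colors, of the size of the smallest color class. Definition of $\chi^*(H)$: let $k=\chi(H)$ and let $\mathcal{C}(H)$ be the set of proper $k$-colorings of $H$. For $c\in\mathcal{C}(H)$ with color class sizes $h^c_1\le\dots\le h^c_k$, let $D(c)=\{h^c_{i+1}-h^c_i: i\in[k-1]\}$ and $D(H)=\bigcup_{c\in\mathcal{C}(H)}D(c)$.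 Let $\mathrm{hcf}_\chi(H)$ be the highest common factor of the integers in $D(H)$ (with $\mathrm{hcf}_\chi(H)=\infty$ if $D(H)=\{0\}$), and $\mathrm{hcf}_c(H)$ the highest common factor of the orders of the components of $H$. If $\chi(H)>2$, set $\mathrm{hcf}(H)=1$ if $\mathrm{hcf}_\chi(H)=1$; if $\chi(H)=2$, set $\mathrm{hcf}(H)=1$ if $\mathrm{hcf}_c(H)=1$ and $\mathrm{hcf}_\chi(H)\le 2$. Then $\chi^*(H)=\chi_{cr}(H)$ if $\mathrm{hcf}(H)=1$, and $\chi^*(H)=\chi(H)$ otherwise.
   Formalization: The constants α and μ range over rational numbers rather than real numbers; this matters only in the "moreover" part, where the statement is proved for every rational μ with 0 < μ < (χ_cr(H)+1−r)/r. -}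

module Defs where

open import Data.Nat as ℕ using (ℕ; zero; suc; _∸_)
open import Data.Nat.Divisibility using (_∣_)
open import Data.Bool using (Bool; true; false)
open import Data.Fin as Fin using (Fin; toℕ)
open import Data.Integer using (+_)
open import Data.Rational as ℚ using (ℚ; 0ℚ; 1/_)
import Data.Rational.Properties as ℚP
open import Data.Product using (Σ; ∃; ∃-syntax; _×_; _,_)
open import Data.Sum using (_⊎_)
open import Relation.Nullary using (¬_; yes; no)
open import Relation.Nullary.Decidable using (⌊_⌋)
open import Relation.Binary.PropositionalEquality using (_≡_; _≢_)
open import Function.Bundles using (_⇔_)
open import Function.Definitions using (Injective; Surjective)

count : (n : ℕ) → (Fin n → Bool) → ℕ
count zero    P = 0
count (suc n) P with P Fin.zero
... | true  = suc (count n (λ i → P (Fin.suc i)))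
... | false = count n (λ i → P (Fin.suc i))

ℕ→ℚ : ℕ → ℚ
ℕ→ℚ n = (+ n) ℚ./ 1

-- a / b as a rational (only ever used with b > 0; convention a / 0 = 0)
frac : ℕ → ℕ → ℚ
frac a zero    = 0ℚ
frac a (suc b) = (+ a) ℚ./ suc b

-- reciprocal of a rational (only ever used for nonzero arguments;
-- convention 1/0 = 0)
inv : ℚ → ℚ
inv p with p ℚP.≟ 0ℚ
... | yes _  = 0ℚ
... | no p≢0 = 1/_ p {{ℚ.≢-nonZero p≢0}}

record Graph (n : ℕ) : Set where
  field
    adj    : Fin n → Fin n → Bool
    sym    : ∀ u v → adj u v ≡ adj v u
    irrefl : ∀ v → adj v v ≡ false
open Graph public

degree : ∀ {n} → Graph n → Fin n → ℕ
degree {n} G v = count n (adj G v)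

MinDegreeAtLeast : ∀ {n} → Graph n → ℚ → Set
MinDegreeAtLeast {n} G δ = ∀ v → δ ℚ.* ℕ→ℚ n ℚ.≤ ℕ→ℚ (degree G v)

-- Incompatibility systems.
-- An edge e ∋ v is determined by its other endpoint; a pair {e,e'} with
-- e ∩ e' = {v} is a pair {{v,u},{v,w}} with u ≢ w both adjacent to v.
-- inc v u w = true  means  {{v,u},{v,w}} ∈ F_v.

record IncompatibilitySystem {n : ℕ} (G : Graph n) : Set where
  field
    inc      : Fin n → Fin n → Fin n → Bool
    inc-sym  : ∀ v u w → inc v u w ≡ inc v w u
    inc-edge : ∀ v u w → inc v u w ≡ true →
               (adj G v u ≡ true) × (adj G v w ≡ true) × (u ≢ w)
open IncompatibilitySystem public

Bounded : ∀ {n} {G : Graph n} → IncompatibilitySystem G → ℚ → Set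
Bounded {n} {G} 𝓕 Δ =
  ∀ v u → adj G v u ≡ true → ℕ→ℚ (count n (inc 𝓕 v u)) ℚ.≤ Δ

IsIncSystem : ∀ n → (G : Graph n) → IncompatibilitySystem G → ℚ → ℚ → Set
IsIncSystem n G 𝓕 δ μ = MinDegreeAtLeast G δ × Bounded 𝓕 (μ ℚ.* ℕ→ℚ n)

CompatibleSubgraph : ∀ {n} {G : Graph n} → IncompatibilitySystem G →
                     (Fin n → Fin n → Set) → Set
CompatibleSubgraph {n} 𝓕 S =
  ∀ v u w → S v u → S v w → u ≢ w → inc 𝓕 v u w ≡ false

-- H-tilings and H-factors.
-- A tiling with m tiles is φ : Fin m → Fin h → Fin n where each φ i is an
-- injective homomorphism H → G (so its image is a copy of H in G) and the
-- copies are vertex-disjoint.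

record HTiling {h n : ℕ} (H : Graph h) (G : Graph n) : Set where
  field
    tiles    : ℕ
    φ        : Fin tiles → Fin h → Fin n
    hom      : ∀ i a b → adj H a b ≡ true → adj G (φ i a) (φ i b) ≡ true
    disjoint : ∀ i j a b → φ i a ≡ φ j b → (i ≡ j) × (a ≡ b)
open HTiling public

tilingEdges : ∀ {h n} {H : Graph h} {G : Graph n} → HTiling H G →
              Fin n → Fin n → Set
tilingEdges {H = H} T x y =
  ∃[ i ] ∃[ a ] ∃[ b ] (adj H a b ≡ true × φ T i a ≡ x × φ T i b ≡ y)

IsFactor : ∀ {h n} {H : Graph h} {G : Graph n} → HTiling H G → Set
IsFactor {n = n} T = ∀ (v : Fin n) → ∃[ i ] ∃[ a ] (φ T i a ≡ v)

HasCompatibleHFactor : ∀ {h n} (H : Graph h) (G : Graph n) →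
                       IncompatibilitySystem G → Set
HasCompatibleHFactor H G 𝓕 =
  Σ (HTiling H G) λ T → IsFactor T × CompatibleSubgraph 𝓕 (tilingEdges T)

ProperColouring : ∀ {h} (H : Graph h) (k : ℕ) → (Fin h → Fin k) → Set
ProperColouring H k c = ∀ a b → adj H a b ≡ true → c a ≢ c b

Colourable : ∀ {h} → Graph h → ℕ → Set
Colourable {h} H k = Σ (Fin h → Fin k) (ProperColouring H k)

IsChromaticNumber : ∀ {h} → Graph h → ℕ → Set
IsChromaticNumber H k = Colourable H k × (∀ j → j ℕ.< k → ¬ Colourable H j)

classSize : ∀ {h k} → (Fin h → Fin k) → Fin k → ℕ
classSize {h} c i = count h (λ v → ⌊ c v Fin.≟ i ⌋)

SmallestClass : ∀ {h k} → (Fin h → Fin k) → ℕ → Set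
SmallestClass c s = (∃[ i ] classSize c i ≡ s) × (∀ i → s ℕ.≤ classSize c i)

IsSigma : ∀ {h} → Graph h → ℕ → Set
IsSigma H s = ∃[ k ] (IsChromaticNumber H k ×
  (∃[ c ] (ProperColouring H k c × SmallestClass c s)) ×
  (∀ c → ProperColouring H k c → ∀ t → SmallestClass c t → s ℕ.≤ t))

criticalChromatic : (h k s : ℕ) → ℚ
criticalChromatic h k s = frac ((k ∸ 1) ℕ.* h) (h ∸ s)

IsCriticalChromatic : ∀ {h} → Graph h → ℚ → Set
IsCriticalChromatic {h} H x =
  ∃[ k ] ∃[ s ] (IsChromaticNumber H k × IsSigma H s × x ≡ criticalChromatic h k s)

-- g is the highest common factor of the set S ⊆ ℕ, in the divisibility
-- sense.  (If S ⊆ {0} this forces g = 0, which plays the role of the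
-- paper's "hcf = ∞"; hence "hcf ≤ 2" below additionally demands g > 0.)
IsHcf : (ℕ → Set) → ℕ → Set
IsHcf S g = (∀ x → S x → g ∣ x) × (∀ d → (∀ x → S x → d ∣ x) → d ∣ g)

InD : ∀ {h} (H : Graph h) (k : ℕ) → (Fin h → Fin k) → ℕ → Set
InD H k c d = Σ (Fin k → Fin k) λ π →
  Injective _≡_ _≡_ π × Surjective _≡_ _≡_ π ×
  (∀ i j → i Fin.≤ j → classSize c (π i) ℕ.≤ classSize c (π j)) ×
  (∃[ i ] ∃[ j ] (toℕ j ≡ suc (toℕ i) ×
                  d ≡ classSize c (π j) ∸ classSize c (π i)))

DH : ∀ {h} (H : Graph h) (k : ℕ) → ℕ → Set
DH H k d = ∃[ c ] (ProperColouring H k c × InD H k c d)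

data Reach {h} (H : Graph h) : Fin h → Fin h → Set where
  here : ∀ {a} → Reach H a a
  step : ∀ {a b c} → adj H a b ≡ true → Reach H b c → Reach H a c

ComponentOrder : ∀ {h} → Graph h → ℕ → Set
ComponentOrder {h} H x = ∃[ v ] Σ (Fin h → Bool) λ C →
  (∀ w → (C w ≡ true) ⇔ Reach H v w) × x ≡ count h C

HcfOne : ∀ {h} → Graph h → ℕ → Set
HcfOne H k =
  (2 ℕ.< k × IsHcf (DH H k) 1) ⊎
  (k ≡ 2 × IsHcf (ComponentOrder H) 1 ×
   ∃[ g ] (IsHcf (DH H k) g × 0 ℕ.< g × g ℕ.≤ 2))

IsChiStar : ∀ {h} → Graph h → ℚ → Set
IsChiStar H x = ∃[ k ] (IsChromaticNumber H k ×
  ((HcfOne H k × IsCriticalChromatic H x) ⊎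
   (¬ HcfOne H k × x ≡ ℕ→ℚ k)))

IsCompletePartite : ∀ {h} → Graph h → (r : ℕ) → (Fin r → ℕ) → Set
IsCompletePartite {h} H r hs = Σ (Fin h → Fin r) λ p →
  (∀ i → count h (λ v → ⌊ p v Fin.≟ i ⌋) ≡ hs i) ×
  (∀ a b → (adj H a b ≡ true) ⇔ (p a ≢ p b))

{-# OPTIONS --safe #-}
module Submission where

-- Sufficiency is proved by absorption.  If hcf(H) = 1, Bézout's identity applied to the differences of colour class
-- sizes produces unions of copies of H in which one vertex can be exchanged for another one, and the underlying graph
-- has degeneracy χ(H) - 1; if χ*(H) = χ(H), the minimum degree allows degeneracy χ(H), and exchanges inside single
-- copies of H suffice.
-- As the minimum degree allows greedy embeddings of such graphs with a positive proportion of all choices, every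
-- vertex set of size h has a positive proportion of absorbers.  Finitely many disjoint absorbers serving every such
-- set sufficiently often are selected one after the other, decreasing the sum of 2 ^ (missing absorbers of X) over X.
-- The other vertices are covered, up to a small remainder, by complete multipartite bottles with part sizes b, …, b, a,
-- which are unions of copies of H: each bottle is chosen so that a quadratic potential, measuring how far the uncovered
-- set deviates from inheriting the non-neighbour proportion of every vertex, stays small.  A dense relation has a dense
-- blow-up, so for small μ compatible blow-ups exist: incompatible configurations are too few to meet all of them.
--
-- For optimality, take a complete multipartite graph with a sparse graph inside every part and make, in every triangle
-- containing an inner edge, the other two edges incompatible.  Every edge of H lies in a triangle, so a compatible copy
-- of H uses no inner edge and is properly coloured by the parts.  Now either one part is too small for its share of
-- every copy, or the sizes of two parts differ by one while all class size differences of H share a factor.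

open import Defs hiding (here; step)
open import Data.Bool using (Bool; true; false; _∧_; _∨_; not; if_then_else_) renaming (T to IsTrue)
open import Data.Bool.ListAction using (all)
import Data.Bool.Properties as Bool
open import Data.Empty using (⊥; ⊥-elim)
open import Data.Fin as Fin using (Fin; toℕ; _↑ˡ_; _↑ʳ_)
open import Data.Fin.Permutation.Components using (transpose; transpose-inverse)
import Data.Fin.Properties as Fin
open import Data.Integer as ℤ using (ℤ; 0ℤ; 1ℤ)
import Data.Integer.Properties as ℤ
import Data.Integer.Tactic.RingSolver as ℤSolver
open import Data.List as List using (List; []; _∷_; _++_; map; length; concatMap; allFin; tabulate)
import Data.List.Membership.DecPropositional as DecMembership
open import Data.List.Membership.Propositional using (_∈_)
open import Data.List.Membership.Propositional.Properties as ∈ using (∈-++⁺ˡ; ∈-++⁺ʳ; ∈-++⁻; ∈-∃++; ∈-map⁺)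
import Data.List.Properties as L
open import Data.List.Relation.Binary.Permutation.Propositional using (_↭_; refl; prep; swap; trans; ↭-sym; ↭-refl; ↭-reflexive; ↭⇒↭ₛ)
open import Data.List.Relation.Binary.Permutation.Propositional.Properties using (↭-map-inv; ∈-resp-↭; shift; shifts; map⁺; ++⁺; ++⁺ˡ; ++-comm; ↭-length)
import Data.List.Relation.Binary.Permutation.Setoid.Properties as SetoidPermutation
open import Data.List.Relation.Unary.All as All using (All; []; _∷_)
import Data.List.Relation.Unary.All.Properties as All
open import Data.List.Relation.Unary.AllPairs using ([]; _∷_)
open import Data.List.Relation.Unary.Any using (here; there)
open import Data.List.Relation.Unary.Unique.Propositional using (Unique)
open import Data.List.Relation.Unary.Unique.Propositional.Properties using (filter⁺; allFin⁺) renaming (map⁺ to unique-map⁺)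
open import Data.Maybe using (Maybe; just; nothing)
import Data.Maybe.Properties as Maybe
open import Data.Nat
open import Data.Nat.Divisibility using (_∣_; divides; ∣m+n∣m⇒∣n; ∣m∣n⇒∣m+n; ∣-trans; ∣-reflexive; _∣0; ∣1⇒≡1; ∣⇒≤)
open import Data.Nat.DivMod using (m≡m%n+[m/n]*n; m%n<n; m/n*n≤m; /-monoˡ-≤; m*n/n≡m; m<n⇒m%n≡m; [m+kn]%n≡m%n; [m+n]%n≡m%n; %-distribˡ-+)
open import Data.Nat.GCD using (gcd; gcd[m,n]∣m; gcd[m,n]∣n; gcd-greatest; gcd-GCD; module Bézout)
open import Data.Nat.Properties
open import Data.Nat.Tactic.RingSolver using (solve-∀)
open import Data.Product using (Σ; ∃; ∃-syntax; _×_; _,_; proj₁; proj₂)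
import Data.Product.Properties as Prod
open import Data.Rational as ℚ using (ℚ; 0ℚ; 1ℚ; ½)
import Data.Rational.Properties as ℚ
open import Data.Rational.Solver using (module +-*-Solver)
import Data.Rational.Unnormalised as ℚᵘ
import Data.Rational.Unnormalised.Properties as ℚᵘ
open import Data.Sum using (_⊎_; inj₁; inj₂)
open import Data.Unit using (⊤; tt)
open import Data.Vec as Vec using (Vec; []; _∷_; lookup; toList; _[_]≔_)
import Data.Vec.Membership.Propositional.Properties as V∈
import Data.Vec.Properties as V
open import Function using (_∘_; id; Equivalence; _⇔_)
open import Relation.Binary.Definitions using (tri<; tri≈; tri>)
open import Relation.Binary.PropositionalEquality as ≡ using (_≡_; _≢_; cong; cong₂; subst; module ≡-Reasoning)
open import Relation.Nullary using (¬_; yes; no; contradiction; Dec)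
open import Relation.Nullary.Decidable using (⌊_⌋; _→-dec_; ¬?; toWitness)

-- Probabilities appear as counts: a family is dense if a constant times its size is at least the
-- number of all tuples, so estimates are inequalities between natural numbers and existence follows
-- from positive sums. `N` stands for `1 / α`, and `n / N` is the slack in the degree condition.
--
-- The almost tiling leaves a small but linear remainder, so every `h`-tuple must be served linearly
-- often, and the absorbers occupy linearly many vertices. The proportions are fixed so that the
-- absorbers use at most half of the slack; the other half pays for the deviation that the potential
-- controls. This deviation is the obstacle that shapes the covering argument: the degree condition
-- holds in `G`, but a set left over by arbitrary greedy choices need not inherit it. A bottle with
-- at least average correlation with the current deviation does not raise the potential to first
-- order. That such a bottle exists is where the shape `b, …, b, a` meets the degree condition: a
-- vertex misses at most the share of the uncovered set that belongs to a part of size `b`.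

private variable
  A ℬ : Set

-- Ring identities; terms are moved between the sides so that no subtraction of natural numbers occurs

identity₁ : ∀ a b c d → a * b * (c * d) ≡ a * c * (b * d)
identity₁ = solve-∀

identity₂ : ∀ a b c → a + (b + c) ≡ b + (a + c)
identity₂ = solve-∀

identity₃ : ∀ a b c → a * (b * c) ≡ a * c * b
identity₃ = solve-∀

identity₄ : ∀ v q s → 2 * (v * (q * s)) ≡ v * (2 * q) * s
identity₄ = solve-∀

identity₅ : ∀ l u v → l * (u * v) + l * (u * v) ≡ 2 * (v * (l * u))
identity₅ = solve-∀

identity₆ : ∀ a b c → a * (b * c) ≡ b * (a * c)
identity₆ = solve-∀

identity₇ : ∀ k t n s → k * (t * (n * s) + t * (n * s)) ≡ n * (k * (2 * (t * s)))
identity₇ = solve-∀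

identity₈ : ∀ u N K σP σx σy σ′ →
  u * N + (2 * u * (K * σP) + (2 * u * K * (σ′ + (σx + σy)) + N * u)) + 0 ≡
  u * (2 * K * σ′) + (2 * u * N + (2 * u * K * σP + 2 * K * (u * (σx + σy))))
identity₈ = solve-∀

identity₉ : ∀ a b c d → a * (b * (c * d)) ≡ a * (b * c) * d
identity₉ = solve-∀

integer-identity₁ : ∀ x y d → x ℤ.* d ℤ.+ y ℤ.* (ℤ.- d) ≡ (x ℤ.- y) ℤ.* d
integer-identity₁ = ℤSolver.solve-∀

integer-identity₂ : ∀ d b → d ℤ.+ b ℤ.- b ≡ d
integer-identity₂ = ℤSolver.solve-∀

integer-identity₃ : ∀ a b → 0ℤ ≡ 0ℤ ℤ.+ (0ℤ ℤ.* a ℤ.+ 0ℤ ℤ.* b)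
integer-identity₃ = ℤSolver.solve-∀

integer-identity₄ : ∀ x d → x ≡ x ℤ.+ (0ℤ ℤ.* d ℤ.+ 0ℤ ℤ.* (ℤ.- d))
integer-identity₄ = ℤSolver.solve-∀

integer-identity₅ : ∀ x y → y ≡ x ℤ.+ (0ℤ ℤ.* (x ℤ.- y) ℤ.+ 1ℤ ℤ.* (ℤ.- (x ℤ.- y)))
integer-identity₅ = ℤSolver.solve-∀

integer-identity₆ : ∀ x y → x ≡ y ℤ.+ (1ℤ ℤ.* (x ℤ.- y) ℤ.+ 0ℤ ℤ.* (ℤ.- (x ℤ.- y)))
integer-identity₆ = ℤSolver.solve-∀

integer-identity₇ : ∀ k x y → (k ℤ.+ 1ℤ ℤ.* (x ℤ.- y)) ℤ.+ (y ℤ.- x) ≡ k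
integer-identity₇ = ℤSolver.solve-∀

integer-identity₈ : ∀ y s x → y ℤ.+ s ≡ (x ℤ.+ s) ℤ.+ (y ℤ.- x)
integer-identity₈ = ℤSolver.solve-∀

integer-identity₉ : ∀ a b c a′ b′ c′ x y →
  (a ℤ.+ (b ℤ.* x ℤ.+ c ℤ.* y)) ℤ.+ (a′ ℤ.+ (b′ ℤ.* x ℤ.+ c′ ℤ.* y)) ≡
  (a ℤ.+ a′) ℤ.+ ((b ℤ.+ b′) ℤ.* x ℤ.+ (c ℤ.+ c′) ℤ.* y)
integer-identity₉ = ℤSolver.solve-∀

integer-identity₁₀ : ∀ b z → b ≡ (b ℤ.+ z) ℤ.+ ℤ.- z
integer-identity₁₀ = ℤSolver.solve-∀

integer-identity₁₁ : ∀ a b c d → (a ℤ.+ b) ℤ.+ (c ℤ.+ d) ≡ (a ℤ.+ c) ℤ.+ (b ℤ.+ d)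
integer-identity₁₁ = ℤSolver.solve-∀

identity₁₀ : ∀ t a → a + (t * 2 + a) ≡ (t + a) * 2
identity₁₀ = solve-∀

identity₁₁ : ∀ s b → s * 2 + b + b ≡ (s + b) * 2
identity₁₁ = solve-∀

integer-identity₁₂ : ∀ p r a b c d →
  ((p ℤ.* (a ℤ.- c) ℤ.+ r ℤ.* (b ℤ.- d)) ℤ.+ r ℤ.* (ℤ.- (1ℤ ℤ.* (c ℤ.- d)))) ℤ.+ r ℤ.* (1ℤ ℤ.* (a ℤ.- b)) ≡
  (p ℤ.+ r) ℤ.* (a ℤ.- c)
integer-identity₁₂ = ℤSolver.solve-∀

integer-identity₁₃ : ∀ x y d → x ≡ y ℤ.+ (0ℤ ℤ.* d ℤ.+ 1ℤ ℤ.* (x ℤ.- y))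
integer-identity₁₃ = ℤSolver.solve-∀

integer-identity₁₄ : ∀ x y d → x ≡ y ℤ.+ (1ℤ ℤ.* (x ℤ.- y) ℤ.+ 0ℤ ℤ.* d)
integer-identity₁₄ = ℤSolver.solve-∀

integer-identity₁₅ : ∀ x d d′ → x ≡ x ℤ.+ (0ℤ ℤ.* d ℤ.+ 0ℤ ℤ.* d′)
integer-identity₁₅ = ℤSolver.solve-∀

integer-identity₁₆ : ∀ x y → ℤ.- (x ℤ.- y) ≡ y ℤ.- x
integer-identity₁₆ = ℤSolver.solve-∀

identity₁₂ : ∀ a N u → a + 2 * (N * u) + a ≡ N * (2 * u) + 2 * a
identity₁₂ = solve-∀

identity₁₃ : ∀ a b c e → a + (2 * b + c) + e ≡ a + 2 * b + (c + e)
identity₁₃ = solve-∀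

identity₁₄ : ∀ n N D u γ →
  n + (2 * (N * n) + (2 * (N * u) + n) + 2 * N * (D + γ)) + 0 ≡
  2 * N * γ + (2 * (N * D + n) + 2 * (N * n) + 2 * N * u)
identity₁₄ = solve-∀

identity₁₅ : ∀ K T s → 2 * (2 * K * (2 * (T * s))) ≡ 8 * K * T * s
identity₁₅ = solve-∀

identity₁₆ : ∀ p → 2 * p + 2 * p * 1 ≡ 2 * (2 * p)
identity₁₆ = solve-∀

identity₁₇ : ∀ n u r v s → n + (u + r + (v + s)) + 0 ≡ v + (r + s) + (n + u)
identity₁₇ = solve-∀

identity₁₈ : ∀ n u r → n + (2 * (u + r) + n) + 0 ≡ 2 * u + (2 * n + 2 * r)
identity₁₈ = solve-∀

identity₁₉ : ∀ N n u r → 2 * (N * n) + (2 * N * (u + r) + n) + 0 ≡ 2 * (N * u) + n + (2 * N * n + 2 * (N * r))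
identity₁₉ = solve-∀

identity₂₀ : ∀ a b c d → a * (b * (c * d)) ≡ b * d * a * c
identity₂₀ = solve-∀

identity₂₁ : ∀ K Φ Φ₁ g →
  2 * (suc (suc (2 * K)) * Φ₁) + (2 * (K * g) + (2 * K + 2) * (2 * Φ)) + 2 * g ≡
  2 * (suc (2 * K) * Φ) + (2 * Φ + (2 * K + 2) * (2 * Φ₁ + g))
identity₂₁ = solve-∀

identity₂₂ : ∀ k s p → k * s * p ≡ k * (p * s)
identity₂₂ = solve-∀

identity₂₃ : ∀ a b c → a * (b * c) ≡ b * a * c
identity₂₃ = solve-∀

identity₂₄ : ∀ a b c → a + b + c ≡ a + (c + b)
identity₂₄ = solve-∀

identity₂₅ : ∀ a p z → 2 * p * a + z + p ≡ p * (a + suc a) + z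
identity₂₅ = solve-∀

identity₂₆ : ∀ a k p q → a * p * (a + suc k) + suc a * (q * a) + p * k ≡ suc a * q * a + suc a * (p * (a + k))
identity₂₆ = solve-∀

integer-identity₁₇ : ∀ p r → p ≡ r ℤ.+ (p ℤ.- r)
integer-identity₁₇ = ℤSolver.solve-∀

identity₂₇ : ∀ k b a u σ x q κ v M t →
  (u * b) * t + ((k * b + a) * σ + (k * b + a) * (x + u * v) + (k * b + a) * (q * M + κ * (k * v)) + (k * b + a) * q * v) ≡
  u * (b * (k * v + t) + a * v) + (k * b + a) * q * M + ((k * b + a) * σ + (k * b + a) * (x + (q + k * κ) * v))
identity₂₇ = solve-∀

identity₂₈ : ∀ k b a u σ x q κ v M s t →
  (k * b + a) * σ + ((k * b + a) * (x + u * v) + (k * b + a) * (q * M + κ * (k * v + t))) + (s * t + (k * b + a) * q * v) ≡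
  ((k * b + a) * κ + s) * t + ((k * b + a) * σ + (k * b + a) * (x + u * v) + (k * b + a) * (q * M + κ * (k * v)) + (k * b
    + a) * q * v)
identity₂₈ = solve-∀

identity₂₉ : ∀ a κ s v → a + κ * s + κ * v ≡ a + κ * (s + v)
identity₂₉ = solve-∀

identity₃₀ : ∀ e q κ i v → e + (q + suc i * κ) * v ≡ e + (q + i * κ) * v + κ * v
identity₃₀ = solve-∀

integer-identity₁₈ : ∀ u B u₀ q₁ n G₂ ΣT ΣU X Y →
  u ℤ.* ((u₀ ℤ.* ΣU ℤ.- u ℤ.* X) ℤ.- ((u₀ ℤ.* ΣT ℤ.- B ℤ.* X) ℤ.+ (u₀ ℤ.* ΣT ℤ.- B ℤ.* X)) ℤ.+ G₂) ℤ.+ ((u₀ ℤ.* (u ℤ.* ΣT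
    ℤ.+ B ℤ.* q₁ ℤ.* (Y ℤ.+ Y)) ℤ.+ u₀ ℤ.* (u ℤ.* ΣT ℤ.+ B ℤ.* q₁ ℤ.* (Y ℤ.+ Y)) ℤ.+ (B ℤ.* ((u₀ ℤ.* ΣU ℤ.- u ℤ.* X) ℤ.+ n
    ℤ.* ((u₀ ℤ.* q₁) ℤ.* (u₀ ℤ.* q₁))) ℤ.+ B ℤ.* ((u₀ ℤ.* ΣU ℤ.- u ℤ.* X) ℤ.+ n ℤ.* ((u₀ ℤ.* q₁) ℤ.* (u₀ ℤ.* q₁))))) ℤ.+ u
    ℤ.* (n ℤ.* ((u₀ ℤ.* B) ℤ.* (u₀ ℤ.* B)))) ≡
  (u ℤ.* (u₀ ℤ.* ΣU ℤ.- u ℤ.* X) ℤ.+ ((B ℤ.+ B) ℤ.* (n ℤ.* ((u₀ ℤ.* q₁) ℤ.* (u₀ ℤ.* q₁))) ℤ.+ u ℤ.* (n ℤ.* ((u₀ ℤ.* B) ℤ.*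
    (u₀ ℤ.* B))))) ℤ.+ ((u₀ ℤ.* (B ℤ.* ΣU) ℤ.+ u₀ ℤ.* (B ℤ.* ΣU) ℤ.+ (B ℤ.* ((u₀ ℤ.* q₁) ℤ.* (Y ℤ.+ Y)) ℤ.+ B ℤ.* ((u₀ ℤ.*
    q₁) ℤ.* (Y ℤ.+ Y)))) ℤ.+ u ℤ.* G₂)
integer-identity₁₈ = ℤSolver.solve-∀

integer-identity₁₉ : ∀ a l → (a ℤ.+ l) ℤ.+ ℤ.- l ≡ a
integer-identity₁₉ = ℤSolver.solve-∀

integer-identity₂₀ : ∀ i a → 0ℤ ℤ.+ a ≡ (1ℤ ℤ.* i ℤ.+ a) ℤ.+ ℤ.- i
integer-identity₂₀ = ℤSolver.solve-∀

identity₃₁ : ∀ y e → (y + e) * (y + y) + e * e ≡ y * y + (y + e) * (y + e)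
identity₃₁ = solve-∀

identity₃₂ : ∀ c e → c * (c + e + (c + e)) + e * e ≡ (c + e) * (c + e) + c * c
identity₃₂ = solve-∀

integer-identity₂₁ : ∀ B u q σ τ Y →
  B ℤ.* σ ℤ.+ (u ℤ.* (τ ℤ.+ B ℤ.* Y) ℤ.+ B ℤ.* q ℤ.* (Y ℤ.+ Y)) ≡
  (u ℤ.* τ ℤ.+ B ℤ.* q ℤ.* (Y ℤ.+ Y)) ℤ.+ B ℤ.* (σ ℤ.+ u ℤ.* Y)
integer-identity₂₁ = ℤSolver.solve-∀

integer-identity₂₂ : ∀ a b c → (a ℤ.+ (ℤ.- (1ℤ ℤ.+ 1ℤ)) ℤ.* b) ℤ.+ c ≡ a ℤ.- (b ℤ.+ b) ℤ.+ c
integer-identity₂₂ = ℤSolver.solve-∀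

integer-identity₂₃ : ∀ a b → (a ℤ.- b) ℤ.* (a ℤ.- b) ≡ (a ℤ.* a ℤ.+ (ℤ.- (1ℤ ℤ.+ 1ℤ)) ℤ.* (a ℤ.* b)) ℤ.+ b ℤ.* b
integer-identity₂₃ = ℤSolver.solve-∀

integer-identity₂₄ : ∀ u t s m l r → u ℤ.* s ℤ.- m ℤ.* r ≡ (u ℤ.* (t ℤ.+ s) ℤ.- m ℤ.* (l ℤ.+ r)) ℤ.- (u ℤ.* t ℤ.- m ℤ.* l)
integer-identity₂₄ = ℤSolver.solve-∀

integer-identity₂₅ : ∀ y u t m l → y ℤ.* (u ℤ.* t ℤ.- m ℤ.* l) ≡ u ℤ.* (t ℤ.* y) ℤ.+ (ℤ.- l) ℤ.* (m ℤ.* y)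
integer-identity₂₅ = ℤSolver.solve-∀

identity₃₃ : ∀ K T s → 2 * K * (2 * (T * s)) ≡ 4 * K * T * s
identity₃₃ = solve-∀

identity₃₄ : ∀ x B w → x + (B + w) ≡ B + x + w
identity₃₄ = solve-∀

identity₃₅ : ∀ E y → E * y * (E * y) ≡ E * E * (y * y)
identity₃₅ = solve-∀

identity₃₆ : ∀ R x u q g →
  u + (u + 4 * (R + R * q) + (2 * u + 4 * R * (x + g))) + 0 ≡
  4 * R * g + (4 * R * x + 4 * u + (2 * (2 * R) + 4 * R * q))
identity₃₆ = solve-∀

identity₃₇ : ∀ R x u q → 4 * R * x + (u + 4 * (R + R * q) + (2 * u + u)) + 0 ≡ 4 * R * q + (4 * R * x + 4 * u + (2 * (2 * R) + 0))
identity₃₇ = solve-∀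

identity₃₈ : ∀ E L u → 3 * (E * E) * (2 * (L * u)) ≡ 6 * (E * E * L) * u
identity₃₈ = solve-∀

identity₃₉ : ∀ x R b B → 6 * x * (4 * R * b * B) ≡ 24 * x * B * R * b
identity₃₉ = solve-∀

identity₄₀ : ∀ E n v → E * E * (3 * n * (v * v * v) * v) ≡ v * v * (v * v) * (3 * (E * E) * n)
identity₄₀ = solve-∀

identity₄₁ : ∀ R E p → R * R * (E * E * p) ≡ E * E * (R * R * p)
identity₄₁ = solve-∀

identity₄₂ : ∀ v R b → v * (R * R * b) ≡ R * R * (v * b)
identity₄₂ = solve-∀

identity₄₃ : ∀ x → x + x ≡ 2 * x
identity₄₃ = solve-∀

identity₄₄ : ∀ N L u n → 2 * N * (L * u) * n ≡ 2 * (N * L) * u * n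
identity₄₄ = solve-∀

identity₄₅ : ∀ N E u r v → 2 * (N * E * u * r + N * (v * v)) ≡ E * u * (2 * (N * r)) + 2 * N * v * v
identity₄₅ = solve-∀

identity₄₆ : ∀ u a k b → u * a + k * (u * b) ≡ (k * b + a) * u
identity₄₆ = solve-∀

identity₄₇ : ∀ B q k κ → B * (q + k * κ) ≡ B * q + k * (B * κ)
identity₄₇ = solve-∀

identity₄₈ : ∀ u n v w B →
  u * (3 * n * (v * v * v) * w) + ((B + B) * n * (v * v) * (u * v) + u * n * (v * v) * B * v) ≡
  u * (3 * n * (v * v * v) * (B + w))
identity₄₈ = solve-∀

identity₄₉ : ∀ R u p B n v q →
  R * R * (u * p + ((B + B) * (n * ((v * q) * (v * q))) + u * (n * ((v * B) * (v * B))))) ≡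
  u * (R * R * p) + ((B + B) * n * (v * v) * ((R * q) * (R * q)) + u * n * (v * v) * B * (R * R * B))
identity₄₉ = solve-∀

identity₅₀ : ∀ x B E u n → x + B * (E * u * n) ≡ x + E * u * B * n
identity₅₀ = solve-∀

identity₅₁ : ∀ E u N b v r B →
  E * u * (N * b * (v + r)) + N * B * (v * v) ≡
  E * N * v * (b * u) + b * (N * E * u * r) + B * (N * (v * v))
identity₅₁ = solve-∀

identity₅₂ : ∀ N B E u d v n → N * B * E * u * d + N * B * (v * v) + E * u * B * n ≡ E * u * (N * B * d + B * n) + N * B * (v * v)
identity₅₂ = solve-∀

identity₅₃ : ∀ N B E M u y n → N * B * E * (M * u + y) + E * u * B * n ≡ N * B * E * u * M + N * B * (E * y) + E * u * B * n
identity₅₃ = solve-∀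

identity₅₄ : ∀ E N v B nn u n → E * N * v * (B * nn) + E * u * B * n ≡ N * B * E * (v * nn) + E * u * B * n
identity₅₄ = solve-∀

integer-identity₂₆ : ∀ a b w → 1ℤ ℤ.* (a ℤ.- w) ℤ.+ ℤ.- (1ℤ ℤ.* (b ℤ.- w)) ≡ 1ℤ ℤ.* (a ℤ.- b)
integer-identity₂₆ = ℤSolver.solve-∀

identity₅₅ : ∀ x j m → x + j * suc m ≡ x + j + j * m
identity₅₅ = solve-∀

identity₅₆ : ∀ D l → D * l + D * l ≡ 2 * D * l
identity₅₆ = solve-∀

identity₅₇ : ∀ C p → suc (suc C) + (p + p) + C ≡ 2 * p + (suc C + suc C)
identity₅₇ = solve-∀

identity₅₈ : ∀ D N b n → D * (N * b * n) ≡ N * n * (D * b)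
identity₅₈ = solve-∀

identity₅₉ : ∀ B N D d n → B * (N * (D * d)) + D * (B * n) ≡ D * (N * B * d + B * n)
identity₅₉ = solve-∀

identity₆₀ : ∀ N K l β σ →
  2 * (2 * (N * (suc (suc (2 * K)) * (2 * l) * β + σ))) ≡
  2 * (2 * (N * (suc (suc (2 * K)) * 2 * β))) * l + 4 * (N * σ)
identity₆₀ = solve-∀

identity₆₁ : ∀ L s m → 2 * L * (s * suc m) ≡ 2 * L * s * m + 2 * L * s
identity₆₁ = solve-∀

identity₆₂ : ∀ s m → 2 * (s * suc m) ≡ 2 * s * m + 2 * s
identity₆₂ = solve-∀

identity₆₃ : ∀ C e z → C * suc (3 * C + suc e) + z + C * (3 * C + e) ≡ 2 * (C * suc (3 * C + e)) + z
identity₆₃ = solve-∀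

identity₆₄ : ∀ C → C + (C + C) ≡ 3 * C + 0
identity₆₄ = solve-∀

identity₆₅ : ∀ C z → C * suc (3 * C + 0) + z + (C * C * C + 2 * C + 1) ≡ suc C * (suc C * suc C) + z
identity₆₅ = solve-∀

integer-identity₂₇ : ∀ a q → a ℤ.* q ℤ.* ℤ.+ 1 ≡ a ℤ.* (q ℤ.* ℤ.+ 1)
integer-identity₂₇ = ℤSolver.solve-∀

identity₆₆ : ∀ ρ w → ρ * w + w ≡ suc ρ * w
identity₆₆ = solve-∀

identity₆₇ : ∀ ρ w s → ρ * (w + s) ≡ ρ * w + ρ * s
identity₆₇ = solve-∀

identity₆₈ : ∀ a b → a + (b + b) ≡ a + 2 * b
identity₆₈ = solve-∀

identity₆₉ : ∀ h w q ρ → h * (w * q + 1) + ρ * h ≡ w * (q * h) + (1 * h + ρ * h)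
identity₆₉ = solve-∀

identity₇₀ : ∀ ρ h Q → ρ * h * (Q + 1) ≡ h * (ρ * Q) + ρ * h
identity₇₀ = solve-∀

identity₇₁ : ∀ ρ h s q → ρ * h * (s * q) ≡ ρ * s * (q * h)
identity₇₁ = solve-∀

identity₇₂ : ∀ M e → M * (e + 1) ≡ M * e + M
identity₇₂ = solve-∀

identity₇₃ : ∀ s M q → s * M * q ≡ M * (s * q)
identity₇₃ = solve-∀

identity₇₄ : ∀ P q h → P * (q * h) + q ≡ suc (P * h) * q
identity₇₄ = solve-∀

identity₇₅ : ∀ a e → a + (e + 1) ≡ e + (a + 1)
identity₇₅ = solve-∀

identity₇₆ : ∀ q w s → q * (w + s) ≡ w * q + s * q
identity₇₆ = solve-∀

identity₇₇ : ∀ M B n P g b d s →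
  2 * M * B * n + B * P * n + ((2 * M * B * (g + 1 + s) + 2 * M * (b * n + 2 * B)) + (2 * B * (M + M * d) + B * (P * n))) + 0 ≡
  2 * M * B * g + 2 * M * b * n + ((2 * M * B * (n + d) + 2 * M * (B * s)) + (2 * B * (P * n) + B * (8 * M)))
identity₇₇ = solve-∀

identity₇₈ : ∀ ρ w s M → (ρ * (w + s) + w) * M ≡ suc ρ * w * M + ρ * s * M
identity₇₈ = solve-∀

identity₇₉ : ∀ r a → r + r * a + r ≡ r * (a + 2)
identity₇₉ = solve-∀

identity₈₀ : ∀ a d → suc a + d ≡ a + (d + 1)
identity₈₀ = solve-∀

identity₈₁ : ∀ n r → n + r + r ≡ 1 * n + 2 * r
identity₈₁ = solve-∀

identity₈₂ : ∀ ρ Q e n →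
  ρ * (suc ρ * Q) + (suc ρ * n + suc ρ * (e + 2) + ρ * suc ρ) + 0 ≡
  ρ * (n + suc ρ) + (suc ρ * (ρ * Q + e) + n + 2 * suc ρ)
identity₈₂ = solve-∀

identity₈₃ : ∀ M r e → M * (r * (e + 2)) ≡ r * (M * e) + 2 * r * M
identity₈₃ = solve-∀

identity₈₄ : ∀ r P n → r * (P * n) + n ≡ suc (P * r) * n
identity₈₄ = solve-∀

identity₈₅ : ∀ r a → r + r * suc a ≡ r * (a + 2)
identity₈₅ = solve-∀

-- Sums over lists

-- A certificate for linear arithmetic without subtraction: known inequalities are added up to
-- `lo ≤ hi`, a ring identity compares them with the goal, and `s` is what is given away.
≤-from : ∀ {a b lo hi} s → lo ≤ hi → a + hi + s ≡ b + lo → a ≤ b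
≤-from {a} {b} {lo} {hi} s le eq = +-cancelʳ-≤ lo a b (begin
  a + lo      ≤⟨ +-monoʳ-≤ a le ⟩
  a + hi      ≤⟨ m≤m+n _ s ⟩
  a + hi + s  ≡⟨ eq ⟩
  b + lo      ∎)
  where open ≤-Reasoning

𝟙 : Bool → ℕ
𝟙 true  = 1
𝟙 false = 0

𝟙≤1 : ∀ b → 𝟙 b ≤ 1
𝟙≤1 true  = ≤-refl
𝟙≤1 false = z≤n

𝟙-∧ : ∀ a b → 𝟙 (a ∧ b) ≡ 𝟙 a * 𝟙 b
𝟙-∧ true  b = ≡.sym (*-identityˡ _)
𝟙-∧ false b = ≡.refl

𝟙-mono : ∀ {a b} → (a ≡ true → b ≡ true) → 𝟙 a ≤ 𝟙 b
𝟙-mono {true}  f rewrite f ≡.refl = ≤-refl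
𝟙-mono {false} f = z≤n

∧-elimˡ : ∀ {a b} → a ∧ b ≡ true → a ≡ true
∧-elimˡ {true} _ = ≡.refl

∧-elimʳ : ∀ {a b} → a ∧ b ≡ true → b ≡ true
∧-elimʳ {true} p = p

∧-intro : ∀ {a b} → a ≡ true → b ≡ true → a ∧ b ≡ true
∧-intro ≡.refl ≡.refl = ≡.refl

S : List A → (A → ℕ) → ℕ
S []       f = 0
S (x ∷ xs) f = f x + S xs f

S-mono∈ : ∀ (xs : List A) {f g : A → ℕ} → (∀ {x} → x ∈ xs → f x ≤ g x) → S xs f ≤ S xs g
S-mono∈ []       h = z≤n
S-mono∈ (x ∷ xs) h = +-mono-≤ (h (here ≡.refl)) (S-mono∈ xs (h ∘ there))

S-mono : ∀ (xs : List A) {f g : A → ℕ} → (∀ x → f x ≤ g x) → S xs f ≤ S xs g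
S-mono xs h = S-mono∈ xs (λ {x} _ → h x)

S-cong∈ : ∀ (xs : List A) {f g : A → ℕ} → (∀ {x} → x ∈ xs → f x ≡ g x) → S xs f ≡ S xs g
S-cong∈ []       h = ≡.refl
S-cong∈ (x ∷ xs) h = cong₂ _+_ (h (here ≡.refl)) (S-cong∈ xs (h ∘ there))

S-cong : ∀ (xs : List A) {f g : A → ℕ} → (∀ x → f x ≡ g x) → S xs f ≡ S xs g
S-cong xs h = S-cong∈ xs (λ {x} _ → h x)

interchange : ∀ a b c d → (a + b) + (c + d) ≡ (a + c) + (b + d)
interchange = solve-∀

S-+ : ∀ (xs : List A) (f g : A → ℕ) → S xs (λ x → f x + g x) ≡ S xs f + S xs g
S-+ []       f g = ≡.refl
S-+ (x ∷ xs) f g rewrite S-+ xs f g = interchange (f x) (g x) _ _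

S-*ˡ : ∀ (xs : List A) c (f : A → ℕ) → S xs (λ x → c * f x) ≡ c * S xs f
S-*ˡ []       c f = ≡.sym (*-zeroʳ c)
S-*ˡ (x ∷ xs) c f rewrite S-*ˡ xs c f = ≡.sym (*-distribˡ-+ c (f x) _)

S-*ʳ : ∀ (xs : List A) c (f : A → ℕ) → S xs (λ x → f x * c) ≡ S xs f * c
S-*ʳ []       c f = ≡.refl
S-*ʳ (x ∷ xs) c f rewrite S-*ʳ xs c f = ≡.sym (*-distribʳ-+ c (f x) _)

S-const : ∀ (xs : List A) c → S xs (λ _ → c) ≡ length xs * c
S-const []       c = ≡.refl
S-const (x ∷ xs) c = cong (c +_) (S-const xs c)

S-zero : ∀ (xs : List A) → S xs (λ _ → 0) ≡ 0
S-zero xs = ≡.trans (S-const xs 0) (*-zeroʳ (length xs))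

S-++ : ∀ (xs ys : List A) (f : A → ℕ) → S (xs ++ ys) f ≡ S xs f + S ys f
S-++ []       ys f = ≡.refl
S-++ (x ∷ xs) ys f rewrite S-++ xs ys f = ≡.sym (+-assoc (f x) _ _)

S-map : ∀ (g : A → ℬ) (xs : List A) (f : ℬ → ℕ) → S (map g xs) f ≡ S xs (f ∘ g)
S-map g []       f = ≡.refl
S-map g (x ∷ xs) f = cong (f (g x) +_) (S-map g xs f)

S-concatMap : ∀ (g : A → List ℬ) (xs : List A) (f : ℬ → ℕ) →
              S (concatMap g xs) f ≡ S xs (λ x → S (g x) f)
S-concatMap g []       f = ≡.refl
S-concatMap g (x ∷ xs) f =
  ≡.trans (S-++ (g x) _ f) (cong (S (g x) f +_) (S-concatMap g xs f))

S-swap : ∀ (xs : List A) (ys : List ℬ) (f : A → ℬ → ℕ) →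
         S xs (λ x → S ys (f x)) ≡ S ys (λ y → S xs (λ x → f x y))
S-swap []       ys f = ≡.sym (S-zero ys)
S-swap (x ∷ xs) ys f rewrite S-swap xs ys f = ≡.sym (S-+ ys (f x) _)

S-↭ : ∀ {xs ys : List A} (f : A → ℕ) → xs ↭ ys → S xs f ≡ S ys f
S-↭ f refl          = ≡.refl
S-↭ f (prep x p)    = cong (f x +_) (S-↭ f p)
S-↭ f (swap {xs} x y p) rewrite S-↭ f p = identity₂ (f x) (f y) _
S-↭ f (trans p q)   = ≡.trans (S-↭ f p) (S-↭ f q)

S-∈ : ∀ {xs : List A} {x} (f : A → ℕ) → x ∈ xs → f x ≤ S xs f
S-∈ f (here ≡.refl) = m≤m+n _ _
S-∈ f (there p)     = ≤-trans (S-∈ f p) (m≤n+m _ _)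

S≤length* : ∀ (xs : List A) c {f : A → ℕ} → (∀ x → f x ≤ c) → S xs f ≤ length xs * c
S≤length* xs c h = ≤-trans (S-mono xs h) (≤-reflexive (S-const xs c))

S-positive : ∀ (xs : List A) f → 0 < S xs f → ∃[ x ] (x ∈ xs × 0 < f x)
S-positive (x ∷ xs) f lt with f x in eq
... | suc k = x , here ≡.refl , subst (0 <_) (≡.sym eq) z<s
... | zero  = let (y , y∈ , p) = S-positive xs f lt in y , there y∈ , p

S-𝟙 : ∀ (xs : List A) (P : A → Bool) → 0 < S xs (𝟙 ∘ P) → ∃[ x ] (x ∈ xs × P x ≡ true)
S-𝟙 xs P lt = let (x , x∈ , p) = S-positive xs (𝟙 ∘ P) lt in x , x∈ , 𝟙>0 p
  where 𝟙>0 : ∀ {b} → 0 < 𝟙 b → b ≡ true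
        𝟙>0 {true} _ = ≡.refl

S-weighted : ∀ (xs : List A) (w : A → ℕ) (P : A → Bool) → 0 < S xs (λ x → w x * 𝟙 (P x)) → ∃[ x ] (P x ≡ true)
S-weighted xs w P lt = let (x , _ , p) = S-positive xs _ lt in x , holds (w x) p
  where holds : ∀ k {b} → 0 < k * 𝟙 b → b ≡ true
        holds k {true}  _ = ≡.refl
        holds k {false} p = contradiction (subst (0 <_) (*-zeroʳ k) p) λ ()

S-avg : ∀ (xs : List A) (f g : A → ℕ) → 0 < S xs f → S xs g ≤ S xs f → ∃[ x ] (x ∈ xs × 0 < f x × g x ≤ f x)
S-avg (x ∷ xs) f g pos le with g x ≤? f x | f x in eq
... | yes p | suc m = x , here ≡.refl , subst (0 <_) (≡.sym eq) z<s , p′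
  where p′ : g x ≤ f x
        p′ = subst (g x ≤_) (≡.sym eq) (subst (g x ≤_) eq p)
... | yes p | zero =
    let g≡0 = n≤0⇒n≡0 (subst (g x ≤_) eq p)
        (y , y∈ , r) = S-avg xs f g pos (subst (λ k → k + S xs g ≤ S xs f) g≡0 le)
    in y , there y∈ , r
... | no np | m =
    let (y , y∈ , r) = S-avg xs f g (≤-trans (s≤s z≤n) gt) (<⇒≤ gt) in y , there y∈ , r
  where
    gt : S xs g < S xs f
    gt = +-cancelˡ-< (g x) _ _ (≤-<-trans le (+-monoˡ-< (S xs f) (subst (_< g x) eq (≰⇒> np))))

S-tabulate : ∀ n (h : Fin n → A) (f : A → ℕ) → S (tabulate h) f ≡ S (allFin n) (f ∘ h)
S-tabulate zero    h f = ≡.refl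
S-tabulate (suc n) h f = cong (f (h Fin.zero) +_)
  (≡.trans (S-tabulate n (h ∘ Fin.suc) f) (≡.sym (S-tabulate n Fin.suc (f ∘ h))))

count≡S : ∀ n (P : Fin n → Bool) → count n P ≡ S (allFin n) (𝟙 ∘ P)
count≡S zero    P = ≡.refl
count≡S (suc n) P with P Fin.zero
... | true  = cong suc (≡.trans (count≡S n _) (≡.sym (S-tabulate n Fin.suc (𝟙 ∘ P))))
... | false = ≡.trans (count≡S n _) (≡.sym (S-tabulate n Fin.suc (𝟙 ∘ P)))

length-allFin : ∀ n → length (allFin n) ≡ n
length-allFin n = L.length-tabulate id

-- Tuples, counting by one coordinate, and blow-ups of relations

vecs : List A → (p : ℕ) → List (Vec A p)
vecs xs zero    = [] ∷ []
vecs xs (suc p) = concatMap (λ x → map (x ∷_) (vecs xs p)) xs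

S-vecs : ∀ (xs : List A) p (f : Vec A (suc p) → ℕ) →
         S (vecs xs (suc p)) f ≡ S xs (λ x → S (vecs xs p) (λ v → f (x ∷ v)))
S-vecs xs p f = ≡.trans (S-concatMap _ xs f) (S-cong xs (λ x → S-map (x ∷_) (vecs xs p) f))

S-one : ∀ (xs : List A) → S xs (λ _ → 1) ≡ length xs
S-one xs = ≡.trans (S-const xs 1) (*-identityʳ _)

length-vecs : ∀ (xs : List A) p → length (vecs xs p) ≡ length xs ^ p
length-vecs xs zero    = ≡.refl
length-vecs xs (suc p) = begin
  length (vecs xs (suc p))                       ≡⟨ S-one (vecs xs (suc p)) ⟨
  S (vecs xs (suc p)) (λ _ → 1)                  ≡⟨ S-vecs xs p _ ⟩
  S xs (λ _ → S (vecs xs p) (λ _ → 1))           ≡⟨ S-const xs _ ⟩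
  length xs * S (vecs xs p) (λ _ → 1)            ≡⟨ cong (length xs *_) (≡.trans (S-one (vecs xs p)) (length-vecs xs p)) ⟩
  length xs * length xs ^ p                      ∎
  where open ≡-Reasoning

-- Resampling: every vector arises once for each value of its overwritten entry. A sum over vectors
-- can thus be bounded with all coordinates but one frozen, which is how incompatible triples are
-- counted.
S-update : ∀ (xs : List A) p (i : Fin p) (f : Vec A p → ℕ) →
  S (vecs xs p) (λ v → S xs (λ z → f (v [ i ]≔ z))) ≡ length xs * S (vecs xs p) f
S-update xs (suc p) Fin.zero f = begin
  S (vecs xs (suc p)) (λ v → S xs (λ z → f (v [ Fin.zero ]≔ z)))
    ≡⟨ S-vecs xs p _ ⟩
  S xs (λ x → S (vecs xs p) (λ v → S xs (λ z → f (z ∷ v))))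
    ≡⟨ S-const xs _ ⟩
  length xs * S (vecs xs p) (λ v → S xs (λ z → f (z ∷ v)))
    ≡⟨ cong (length xs *_) (≡.trans (S-swap (vecs xs p) xs (λ v z → f (z ∷ v))) (≡.sym (S-vecs xs p f))) ⟩
  length xs * S (vecs xs (suc p)) f ∎
  where open ≡-Reasoning
S-update xs (suc p) (Fin.suc i) f = begin
  S (vecs xs (suc p)) (λ v → S xs (λ z → f (v [ Fin.suc i ]≔ z)))
    ≡⟨ S-vecs xs p _ ⟩
  S xs (λ x → S (vecs xs p) (λ v → S xs (λ z → f (x ∷ (v [ i ]≔ z)))))
    ≡⟨ S-cong xs (λ x → S-update xs p i (λ v → f (x ∷ v))) ⟩
  S xs (λ x → length xs * S (vecs xs p) (λ v → f (x ∷ v)))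
    ≡⟨ S-*ˡ xs (length xs) _ ⟩
  length xs * S xs (λ x → S (vecs xs p) (λ v → f (x ∷ v)))
    ≡⟨ cong (length xs *_) (S-vecs xs p f) ⟨
  length xs * S (vecs xs (suc p)) f ∎
  where open ≡-Reasoning

coordinate-bound : ∀ (xs : List A) p (i : Fin p) (f : Vec A p → ℕ) D →
  (∀ v → S xs (λ z → f (v [ i ]≔ z)) ≤ D) → length xs * S (vecs xs p) f ≤ length xs ^ p * D
coordinate-bound xs p i f D h = begin
  length xs * S (vecs xs p) f                             ≡⟨ S-update xs p i f ⟨
  S (vecs xs p) (λ v → S xs (λ z → f (v [ i ]≔ z)))       ≤⟨ S≤length* (vecs xs p) D h ⟩
  length (vecs xs p) * D                                  ≡⟨ cong (_* D) (length-vecs xs p) ⟩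
  length xs ^ p * D                                       ∎
  where open ≤-Reasoning

coordinate-bound₂ : ∀ (xs : List A) .{{_ : NonZero (length xs)}} t q (i : Fin q) (j : Fin t) (f : Vec (Vec A t) q → ℕ) D →
  (∀ w → S xs (λ z → f (w [ i ]≔ (lookup w i [ j ]≔ z))) ≤ D) →
  length xs * S (vecs (vecs xs t) q) f ≤ (length xs ^ t) ^ q * D
coordinate-bound₂ xs t q i j f D h = *-cancelˡ-≤ N (begin
  N * (u * S (vecs (vecs xs t) q) f)
    ≡⟨ identity₆ N u _ ⟩
  u * (N * S (vecs (vecs xs t) q) f)
    ≡⟨ cong (λ l → u * (l * S (vecs (vecs xs t) q) f)) (length-vecs xs t) ⟨
  u * (length (vecs xs t) * S (vecs (vecs xs t) q) f)
    ≡⟨ cong (u *_) (S-update (vecs xs t) q i f) ⟨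
  u * S (vecs (vecs xs t) q) (λ w → S (vecs xs t) (λ vs → f (w [ i ]≔ vs)))
    ≡⟨ S-*ˡ (vecs (vecs xs t) q) u _ ⟨
  S (vecs (vecs xs t) q) (λ w → u * S (vecs xs t) (λ vs → f (w [ i ]≔ vs)))
    ≤⟨ S≤length* (vecs (vecs xs t) q) (N * D) (λ w → coordinate-bound xs t j (λ vs → f (w [ i ]≔ vs)) D (inner w)) ⟩
  length (vecs (vecs xs t) q) * (N * D)
    ≡⟨ cong (_* (N * D)) (≡.trans (length-vecs (vecs xs t) q) (cong (_^ q) (length-vecs xs t))) ⟩
  N ^ q * (N * D)
    ≡⟨ identity₆ (N ^ q) N D ⟩
  N * (N ^ q * D) ∎)
  where
  open ≤-Reasoning
  u = length xs
  N = u ^ t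
  instance
    N≢0 : NonZero N
    N≢0 = m^n≢0 u t
  inner : ∀ w vs → S xs (λ z → f (w [ i ]≔ (vs [ j ]≔ z))) ≤ D
  inner w vs = ≤-trans (≤-reflexive (S-cong xs (λ z → cong f (≡.sym (≡.trans
      (V.[]≔-idempotent w i)
      (cong (λ l → w [ i ]≔ (l [ j ]≔ z)) (V.lookup∘update i w vs)))))))
    (h (w [ i ]≔ vs))

allV : ∀ {t} → (A → Bool) → Vec A t → Bool
allV P []       = true
allV P (x ∷ xs) = P x ∧ allV P xs

allV-lookup : ∀ {t} (P : A → Bool) (v : Vec A t) → allV P v ≡ true → ∀ i → P (lookup v i) ≡ true
allV-lookup P (x ∷ v) h Fin.zero    = ∧-elimˡ h
allV-lookup P (x ∷ v) h (Fin.suc i) = allV-lookup P v (∧-elimʳ {P x} h) i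

S-allV : ∀ (xs : List A) t (P : A → Bool) → S (vecs xs t) (𝟙 ∘ allV P) ≡ S xs (𝟙 ∘ P) ^ t
S-allV xs zero    P = ≡.refl
S-allV xs (suc t) P = begin
  S (vecs xs (suc t)) (𝟙 ∘ allV P)
    ≡⟨ S-vecs xs t _ ⟩
  S xs (λ x → S (vecs xs t) (λ v → 𝟙 (P x ∧ allV P v)))
    ≡⟨ S-cong xs (λ x → ≡.trans (S-cong (vecs xs t) (λ v → 𝟙-∧ (P x) (allV P v))) (S-*ˡ (vecs xs t) (𝟙 (P x)) _)) ⟩
  S xs (λ x → 𝟙 (P x) * S (vecs xs t) (𝟙 ∘ allV P))
    ≡⟨ S-*ʳ xs _ (𝟙 ∘ P) ⟩
  S xs (𝟙 ∘ P) * S (vecs xs t) (𝟙 ∘ allV P)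
    ≡⟨ cong (S xs (𝟙 ∘ P) *_) (S-allV xs t P) ⟩
  S xs (𝟙 ∘ P) ^ suc t ∎
  where open ≡-Reasoning

-- the t-fold blow-up of a p-ary relation: every transversal satisfies it
blow : ∀ t p → (Vec A p → Bool) → Vec (Vec A t) p → Bool
blow t zero    P []        = P []
blow t (suc p) P (vs ∷ ws) = allV (λ v → blow t p (λ r → P (v ∷ r)) ws) vs

blow-transversal : ∀ t p (P : Vec A p → Bool) ws → blow t p P ws ≡ true →
  (c : Fin p → Fin t) → P (Vec.tabulate (λ i → lookup (lookup ws i) (c i))) ≡ true
blow-transversal t zero    P []        h c = h
blow-transversal t (suc p) P (vs ∷ ws) h c =
  blow-transversal t p (λ r → P (_ ∷ r)) ws (allV-lookup _ vs h (c Fin.zero)) (c ∘ Fin.suc)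

-- One summand alone suffices, depending on which of `a` and `u` is larger. This replaces the
-- convexity of powers at the price of a constant.
tangent : ∀ t a u → u ^ t * a ≤ a ^ suc t + u ^ suc t
tangent t a u with ≤-total a u
... | inj₁ a≤u = begin
  u ^ t * a              ≤⟨ *-monoʳ-≤ (u ^ t) a≤u ⟩
  u ^ t * u              ≡⟨ *-comm (u ^ t) u ⟩
  u ^ suc t              ≤⟨ m≤n+m _ _ ⟩
  a ^ suc t + u ^ suc t  ∎
  where open ≤-Reasoning
... | inj₂ u≤a = begin
  u ^ t * a              ≤⟨ *-monoˡ-≤ a (^-monoˡ-≤ t u≤a) ⟩
  a ^ t * a              ≡⟨ *-comm (a ^ t) a ⟩
  a ^ suc t              ≤⟨ m≤m+n _ _ ⟩
  a ^ suc t + u ^ suc t  ∎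
  where open ≤-Reasoning

^-distribʳ-* : ∀ m a b → (a * b) ^ m ≡ a ^ m * b ^ m
^-distribʳ-* zero    a b = ≡.refl
^-distribʳ-* (suc m) a b rewrite ^-distribʳ-* m a b = identity₁ a b (a ^ m) (b ^ m)

-- `tangent` is applied to `2 * q * d y`. The doubling produces `length ys * u ^ suc t` twice on the
-- left, and one of these copies pays for the summands `u ^ suc t`.
power-mean : ∀ (ys : List ℬ) (d : ℬ → ℕ) u q t → length ys * u ≤ q * S ys d →
  length ys * u ^ suc t ≤ (2 * q) ^ suc t * S ys (λ y → d y ^ suc t)
power-mean ys d u q t h = +-cancelʳ-≤ (length ys * u ^ suc t) _ _ (begin
  length ys * u ^ suc t + length ys * u ^ suc t
    ≡⟨ identity₅ (length ys) u (u ^ t) ⟩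
  2 * (u ^ t * (length ys * u))
    ≤⟨ *-monoʳ-≤ 2 (*-monoʳ-≤ (u ^ t) h) ⟩
  2 * (u ^ t * (q * S ys d))
    ≡⟨ identity₄ (u ^ t) q (S ys d) ⟩
  u ^ t * (2 * q) * S ys d
    ≡⟨ S-*ˡ ys (u ^ t * (2 * q)) d ⟨
  S ys (λ y → u ^ t * (2 * q) * d y)
    ≤⟨ S-mono ys (λ y → ≤-trans (≤-reflexive (*-assoc (u ^ t) (2 * q) (d y))) (tangent t (2 * q * d y) u)) ⟩
  S ys (λ y → (2 * q * d y) ^ suc t + u ^ suc t)
    ≡⟨ S-+ ys _ _ ⟩
  S ys (λ y → (2 * q * d y) ^ suc t) + S ys (λ y → u ^ suc t)
    ≡⟨ cong₂ _+_ (≡.trans (S-cong ys (λ y → ^-distribʳ-* (suc t) (2 * q) (d y))) (S-*ˡ ys ((2 * q) ^ suc t) _)) (S-const ys _) ⟩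
  (2 * q) ^ suc t * S ys (λ y → d y ^ suc t) + length ys * u ^ suc t ∎)
  where
  open ≤-Reasoning

blowK : ℕ → ℕ → ℕ → ℕ
blowK t zero    q = q
blowK t (suc p) q = (2 * blowK t p q) ^ t

pairs : List A → List ℬ → List (A × ℬ)
pairs xs ys = concatMap (λ x → map (x ,_) ys) xs

S-pairs : ∀ (xs : List A) (ys : List ℬ) (f : A × ℬ → ℕ) →
  S (pairs xs ys) f ≡ S xs (λ x → S ys (λ y → f (x , y)))
S-pairs xs ys f = ≡.trans (S-concatMap _ xs f) (S-cong xs (λ x → S-map (x ,_) ys f))

length-pairs : ∀ (xs : List A) (ys : List ℬ) → length (pairs xs ys) ≡ length xs * length ys
length-pairs xs ys = begin
  length (pairs xs ys)                ≡⟨ S-one (pairs xs ys) ⟨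
  S (pairs xs ys) (λ _ → 1)           ≡⟨ S-pairs xs ys _ ⟩
  S xs (λ _ → S ys (λ _ → 1))         ≡⟨ S-const xs _ ⟩
  length xs * S ys (λ _ → 1)          ≡⟨ cong (length xs *_) (S-one ys) ⟩
  length xs * length ys               ∎
  where open ≡-Reasoning

-- The family is what makes the induction work: the first coordinate joins the parameter `y` while
-- the remaining ones are blown up. Then `power-mean` over the pairs of a parameter and a blown-up
-- rest replaces the number of admissible first entries by the number of admissible tuples of them.
blow-family : ∀ (xs : List A) t p q (ys : List ℬ) (g : ℬ → Vec A p → Bool) →
  length ys * length xs ^ p ≤ q * S ys (λ y → S (vecs xs p) (𝟙 ∘ g y)) →
  length ys * (length xs ^ suc t) ^ p ≤
    blowK (suc t) p q * S ys (λ y → S (vecs (vecs xs (suc t)) p) (𝟙 ∘ blow (suc t) p (g y)))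
blow-family xs t zero    q ys g h = h
blow-family {A} {ℬ} xs t (suc p) q ys g h = begin
  length ys * (u ^ suc t * (u ^ suc t) ^ p)
    ≡⟨ identity₃ (length ys) (u ^ suc t) _ ⟩
  length ys * (u ^ suc t) ^ p * u ^ suc t
    ≡⟨ cong (_* u ^ suc t) len ⟨
  length Z * u ^ suc t
    ≤⟨ power-mean Z d u q₁ t one-step ⟩
  (2 * q₁) ^ suc t * S Z (λ z → d z ^ suc t)
    ≡⟨ cong ((2 * q₁) ^ suc t *_) (≡.trans (S-pairs ys W _) (S-cong ys (λ y → ≡.trans (S-cong W (λ w → ≡.sym (S-allV xs (suc t) _)))
         (≡.trans (S-swap W (vecs xs (suc t)) _) (≡.sym (S-vecs (vecs xs (suc t)) p _)))))) ⟩
  (2 * q₁) ^ suc t * S ys (λ y → S (vecs (vecs xs (suc t)) (suc p)) (𝟙 ∘ blow (suc t) (suc p) (g y))) ∎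
  where
  open ≤-Reasoning
  u = length xs
  q₁ = blowK (suc t) p q
  W = vecs (vecs xs (suc t)) p
  Z = pairs ys W
  d : ℬ × Vec (Vec A (suc t)) p → ℕ
  d (y , w) = S xs (λ x → 𝟙 (blow (suc t) p (λ r → g y (x ∷ r)) w))
  lenW : length W ≡ (u ^ suc t) ^ p
  lenW = ≡.trans (length-vecs (vecs xs (suc t)) p) (cong (_^ p) (length-vecs xs (suc t)))
  len : length Z ≡ length ys * (u ^ suc t) ^ p
  len = ≡.trans (length-pairs ys W) (cong (length ys *_) lenW)
  one-step : length Z * u ≤ q₁ * S Z d
  one-step = begin
    length Z * u
      ≡⟨ cong (_* u) len ⟩
    length ys * (u ^ suc t) ^ p * u
      ≡⟨ ≡.trans (≡.sym (identity₃ (length ys) u _)) (≡.sym (*-assoc (length ys) u _)) ⟩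
    length ys * u * (u ^ suc t) ^ p
      ≡⟨ cong (_* (u ^ suc t) ^ p) (length-pairs ys xs) ⟨
    length (pairs ys xs) * (u ^ suc t) ^ p
      ≤⟨ blow-family xs t p q (pairs ys xs) (λ { (y , x) r → g y (x ∷ r) }) (≤-trans
           (≤-reflexive (≡.trans (cong (_* u ^ p) (length-pairs ys xs)) (*-assoc (length ys) u _)))
           (≤-trans h (≤-reflexive (cong (q *_) (≡.trans (S-cong ys (λ y → S-vecs xs p _)) (≡.sym (S-pairs ys xs _))))))) ⟩
    q₁ * S (pairs ys xs) (λ { (y , x) → S W (𝟙 ∘ blow (suc t) p (λ r → g y (x ∷ r))) })
      ≡⟨ cong (q₁ *_) (≡.trans (S-pairs ys xs _) (S-cong ys (λ y → S-swap xs W _))) ⟩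
    q₁ * S ys (λ y → S W (λ w → d (y , w)))
      ≡⟨ cong (q₁ *_) (S-pairs ys W d) ⟨
    q₁ * S Z d ∎

blow-dense : ∀ (xs : List A) t p q (P : Vec A p → Bool) →
  length xs ^ p ≤ q * S (vecs xs p) (𝟙 ∘ P) →
  (length xs ^ suc t) ^ p ≤ blowK (suc t) p q * S (vecs (vecs xs (suc t)) p) (𝟙 ∘ blow (suc t) p P)
blow-dense xs t p q P h =
  ≡.subst₂ _≤_ (*-identityˡ ((length xs ^ suc t) ^ p)) (cong (blowK (suc t) p q *_) (+-identityʳ _))
    (blow-family xs t p q (tt ∷ []) (λ _ → P)
      (≡.subst₂ _≤_ (≡.sym (*-identityˡ (length xs ^ p))) (cong (q *_) (≡.sym (+-identityʳ _))) h))

-- Tilings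

Unique-↭ : {xs ys : List A} → xs ↭ ys → Unique xs → Unique ys
Unique-↭ {A} p = SetoidPermutation.Unique-resp-↭ (≡.setoid A) (↭⇒↭ₛ p)

unique-++ : ∀ (xs : List A) {ys} → Unique (xs ++ ys) →
  Unique xs × Unique ys × (∀ {x} → x ∈ xs → x ∈ ys → ⊥)
unique-++ []       u       = [] , u , λ ()
unique-++ (x ∷ xs) (p ∷ u) =
  let (a , b , d) = unique-++ xs u
  in All.++⁻ˡ xs p ∷ a , b , λ { (here ≡.refl) q → All.lookup (All.++⁻ʳ xs p) q ≡.refl
                              ; (there r) q → d r q }

unique-++⁺ : ∀ {xs ys : List A} → Unique xs → Unique ys → (∀ {x} → x ∈ xs → x ∈ ys → ⊥) → Unique (xs ++ ys)
unique-++⁺ []      v d = v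
unique-++⁺ {xs = x ∷ xs} (p ∷ u) v d =
  All.++⁺ p (All.tabulate (λ { y∈ ≡.refl → d (here ≡.refl) y∈ })) ∷ unique-++⁺ u v (λ a b → d (there a) b)

extract : ∀ {x : A} {xs} → x ∈ xs → ∃[ ys ] (xs ↭ x ∷ ys)
extract x∈ with ∈-∃++ x∈
... | as , bs , ≡.refl = as ++ bs , shift _ as bs

complement : ∀ (T : List A) {U} → Unique T → (∀ {x} → x ∈ T → x ∈ U) → ∃[ U′ ] (U ↭ T ++ U′)
complement []      {U} u T⊆U = U , ↭-refl
complement (x ∷ T) {U} (p ∷ u) T⊆U =
  let (U₁ , e₁) = extract (T⊆U (here ≡.refl))
      (U′ , e₂) = complement T u (λ {y} y∈ → drop-x y∈ (∈-resp-↭ e₁ (T⊆U (there y∈))))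
  in U′ , trans e₁ (prep x e₂)
  where
  drop-x : ∀ {y U₁} → y ∈ T → y ∈ x ∷ U₁ → y ∈ U₁
  drop-x y∈ (here ≡.refl) = contradiction ≡.refl (All.lookup p y∈)
  drop-x y∈ (there q)     = q

cnt : ∀ {q} → Fin q → List (Fin q) → ℕ
cnt i xs = S xs (λ y → 𝟙 ⌊ y Fin.≟ i ⌋)

𝟙≟-refl : ∀ {q} (i : Fin q) → 𝟙 ⌊ i Fin.≟ i ⌋ ≡ 1
𝟙≟-refl i with i Fin.≟ i
... | yes _ = ≡.refl
... | no ¬p = contradiction ≡.refl ¬p

cnt-∈ : ∀ {q} (i : Fin q) xs → 0 < cnt i xs → i ∈ xs
cnt-∈ i (x ∷ xs) lt with x Fin.≟ i
... | yes ≡.refl = here ≡.refl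
... | no _ = there (cnt-∈ i xs lt)

counts-↭ : ∀ {q} (xs ys : List (Fin q)) → (∀ i → cnt i xs ≡ cnt i ys) → xs ↭ ys
counts-↭ [] [] h = ↭-refl
counts-↭ [] (y ∷ ys) h = contradiction (≡.trans (h y) (cong (_+ cnt y ys) (𝟙≟-refl y))) λ ()
counts-↭ (x ∷ xs) ys h =
  let x∈ = cnt-∈ x ys (subst (0 <_) (h x) (subst (λ k → 0 < k + cnt x xs) (≡.sym (𝟙≟-refl x)) z<s))
      (ys′ , e) = extract x∈
  in trans (prep x (counts-↭ xs ys′ (λ i → +-cancelˡ-≡ (𝟙 ⌊ x Fin.≟ i ⌋) _ _ (≡.trans (h i) (S-↭ _ e))))) (↭-sym e)

S-≟≤1 : ∀ {n} (ys : List (Fin n)) → Unique ys → ∀ v → S ys (λ z → 𝟙 ⌊ z Fin.≟ v ⌋) ≤ 1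
S-≟≤1 []       _        v = z≤n
S-≟≤1 (y ∷ ys) (p ∷ us) v with y Fin.≟ v
... | yes ≡.refl = s≤s (≤-reflexive (≡.trans (S-cong∈ ys (λ {z} z∈ → others z z∈)) (S-zero ys)))
  where
  others : ∀ z → z ∈ ys → 𝟙 ⌊ z Fin.≟ y ⌋ ≡ 0
  others z z∈ with z Fin.≟ y
  ... | yes ≡.refl = contradiction ≡.refl (All.lookup p z∈)
  ... | no _       = ≡.refl
... | no _ = S-≟≤1 ys us v

concatMap-++ : ∀ (f : A → List ℬ) xs ys → concatMap f (xs ++ ys) ≡ concatMap f xs ++ concatMap f ys
concatMap-++ f []       ys = ≡.refl
concatMap-++ f (x ∷ xs) ys = ≡.trans (cong (f x ++_) (concatMap-++ f xs ys)) (≡.sym (L.++-assoc (f x) _ _))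

∈-toList-lookup : ∀ {m} (v : Vec A m) i → lookup v i ∈ toList v
∈-toList-lookup v i = V∈.∈-toList⁺ (V∈.∈-lookup i v)

toList-∈ : ∀ {m} (v : Vec A m) {x} → x ∈ toList v → ∃[ i ] (lookup v i ≡ x)
toList-∈ (y ∷ v) (here ≡.refl) = Fin.zero , ≡.refl
toList-∈ (y ∷ v) (there p) = let (i , e) = toList-∈ v p in Fin.suc i , e

toList-injective : ∀ {m} (v : Vec A m) → Unique (toList v) → ∀ i j → lookup v i ≡ lookup v j → i ≡ j
toList-injective (x ∷ v) u       Fin.zero    Fin.zero    e = ≡.refl
toList-injective (x ∷ v) (p ∷ u) Fin.zero    (Fin.suc j) e = contradiction e (All.lookup p (∈-toList-lookup v j))
toList-injective (x ∷ v) (p ∷ u) (Fin.suc i) Fin.zero    e = contradiction (≡.sym e) (All.lookup p (∈-toList-lookup v i))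
toList-injective (x ∷ v) (p ∷ u) (Fin.suc i) (Fin.suc j) e = cong Fin.suc (toList-injective v u i j e)

Hom : ∀ {h} → Graph h → {Q : Set} → (Q → Q → Bool) → Vec Q h → Set
Hom H E c = ∀ a b → adj H a b ≡ true → E (lookup c a) (lookup c b) ≡ true

module Tiling {h n : ℕ} (H : Graph h) (G : Graph n) (F : IncompatibilitySystem G) where

  -- Neither this nor `Tiled` asks for distinct vertices, so tiled lists can be concatenated without
  -- side conditions. Injectivity and disjointness are recovered in `tiled-factor` from the absence
  -- of repetitions in `allFin n`.
  Copy : Vec (Fin n) h → Set
  Copy c = (∀ a b → adj H a b ≡ true → adj G (lookup c a) (lookup c b) ≡ true)
         × (∀ a b b′ → adj H a b ≡ true → adj H a b′ ≡ true →
              inc F (lookup c a) (lookup c b) (lookup c b′) ≡ false)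

  Tiled : List (Fin n) → Set
  Tiled xs = ∃[ cs ] (All Copy cs × xs ↭ concatMap toList cs)

  tiled-[] : Tiled []
  tiled-[] = [] , [] , ↭-refl

  tiled-++ : ∀ {xs ys} → Tiled xs → Tiled ys → Tiled (xs ++ ys)
  tiled-++ (cs , p , e) (ds , q , f) = cs ++ ds , All.++⁺ p q ,
    trans (++⁺ e f) (↭-reflexive (≡.sym (concatMap-++ toList cs ds)))

  tiled-↭ : ∀ {xs ys} → xs ↭ ys → Tiled ys → Tiled xs
  tiled-↭ p (cs , q , e) = cs , q , trans p e

  -- the vertices of c occupy the positions of c in the concatenation, so uniqueness separates them
  positions : ∀ (cs : List (Vec (Fin n) h)) → Unique (concatMap toList cs) →
    ∀ i j a b → lookup (List.lookup cs i) a ≡ lookup (List.lookup cs j) b → i ≡ j × a ≡ b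
  positions (c ∷ cs) u Fin.zero Fin.zero a b e =
    ≡.refl , toList-injective c (proj₁ (unique-++ (toList c) u)) a b e
  positions (c ∷ cs) u Fin.zero (Fin.suc j) a b e =
    ⊥-elim (proj₂ (proj₂ (unique-++ (toList c) u)) (∈-toList-lookup c a)
      (subst (_∈ concatMap toList cs) (≡.sym e) (in-concat cs j b)))
    where
    in-concat : ∀ cs j b → lookup (List.lookup cs j) b ∈ concatMap toList cs
    in-concat (c ∷ cs) Fin.zero    b = ∈-++⁺ˡ (∈-toList-lookup c b)
    in-concat (c ∷ cs) (Fin.suc j) b = ∈-++⁺ʳ (toList c) (in-concat cs j b)
  positions (c ∷ cs) u (Fin.suc i) Fin.zero a b e =
    let (p , q) = positions (c ∷ cs) u Fin.zero (Fin.suc i) b a (≡.sym e) in ≡.sym p , ≡.sym q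
  positions (c ∷ cs) u (Fin.suc i) (Fin.suc j) a b e =
    let (p , q) = positions cs (proj₁ (proj₂ (unique-++ (toList c) u))) i j a b e in cong Fin.suc p , q

  covered : ∀ (cs : List (Vec (Fin n) h)) {v} → v ∈ concatMap toList cs →
    ∃[ i ] ∃[ a ] (lookup (List.lookup cs i) a ≡ v)
  covered (c ∷ cs) v∈ with ∈-++⁻ (toList c) v∈
  ... | inj₁ p = let (a , e) = toList-∈ c p in Fin.zero , a , e
  ... | inj₂ p = let (i , a , e) = covered cs p in Fin.suc i , a , e

  tiled-factor : Tiled (allFin n) → HasCompatibleHFactor H G F
  tiled-factor (cs , copies , e) = T , factor , compatible
    where
    dis : ∀ i j a b → lookup (List.lookup cs i) a ≡ lookup (List.lookup cs j) b → i ≡ j × a ≡ b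
    dis = positions cs (Unique-↭ e (allFin⁺ n))
    T : HTiling H G
    T = record { tiles = length cs ; φ = λ i a → lookup (List.lookup cs i) a
               ; hom = λ i → proj₁ (All.lookup copies (∈.∈-lookup i)) ; disjoint = dis }
    factor : IsFactor T
    factor v = covered cs (∈-resp-↭ e (∈.∈-allFin v))
    compatible : CompatibleSubgraph F (tilingEdges T)
    compatible v u w (i , a , b , ab , ≡.refl , ≡.refl) (j , a′ , b′ , ab′ , e′ , ≡.refl) _
      with dis j i a′ a e′
    ... | ≡.refl , ≡.refl = proj₂ (All.lookup copies (∈.∈-lookup i)) a b b′ ab ab′

  module _ {Q : Set} (E : Q → Q → Bool) where

    -- A piece of a compatible blow-up of the pattern `E`: adjacency is dictated by the labels, and
    -- no three entries carry an incompatibility. Hence only the multiset of labels matters, and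
    -- each of its decompositions into homomorphic images of `H` lifts to a tiling.
    Realises : List (Fin n × Q) → Set
    Realises ls = (∀ {p q} → p ∈ ls → q ∈ ls → E (proj₂ p) (proj₂ q) ≡ true → adj G (proj₁ p) (proj₁ q) ≡ true)
                × (∀ {p q r} → p ∈ ls → q ∈ ls → r ∈ ls → inc F (proj₁ p) (proj₁ q) (proj₁ r) ≡ false)

    split-labels : ∀ {m} (c : Vec Q m) rest (ls : List (Fin n × Q)) → map proj₂ ls ≡ toList c ++ rest →
      ∃[ w ] ∃[ ys ] (ls ≡ toList (Vec.zip w c) ++ ys × map proj₂ ys ≡ rest)
    split-labels []      rest ls e = [] , ls , ≡.refl , e
    split-labels (q ∷ c) rest ((v , q′) ∷ ls) e with L.∷-injective e
    ... | ≡.refl , e′ = let (w , ys , f , g) = split-labels c rest ls e′ in v ∷ w , ys , cong (_ ∷_) f , g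

    zip-∈ : ∀ {m} (w : Vec (Fin n) m) (c : Vec Q m) i {ys} → (lookup w i , lookup c i) ∈ toList (Vec.zip w c) ++ ys
    zip-∈ w c i = ∈-++⁺ˡ (subst (_∈ toList (Vec.zip w c)) (V.lookup-zip i w c) (∈-toList-lookup (Vec.zip w c) i))

    map-proj₁-zip : ∀ {m} (w : Vec (Fin n) m) (c : Vec Q m) → map proj₁ (toList (Vec.zip w c)) ≡ toList w
    map-proj₁-zip []      []      = ≡.refl
    map-proj₁-zip (v ∷ w) (q ∷ c) = cong (v ∷_) (map-proj₁-zip w c)

    place-ordered : ∀ cs → All (Hom H E) cs → ∀ ls → map proj₂ ls ≡ concatMap toList cs → Realises ls →
      Tiled (map proj₁ ls)
    place-ordered []       []       []  e r = tiled-[]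
    place-ordered (c ∷ cs) (p ∷ ps) ls e (adjs , incs) with split-labels c (concatMap toList cs) ls e
    ... | w , ys , ≡.refl , e′ =
      subst Tiled (≡.sym (≡.trans (L.map-++ proj₁ (toList (Vec.zip w c)) ys) (cong (_++ map proj₁ ys) (map-proj₁-zip w c))))
        (tiled-++ (w ∷ [] , ((λ a b ab → adjs (zip-∈ w c a) (zip-∈ w c b) (p a b ab))
                           , (λ a b b′ _ _ → incs (zip-∈ w c a) (zip-∈ w c b) (zip-∈ w c b′))) ∷ []
                  , ↭-reflexive (≡.sym (L.++-identityʳ (toList w))))
                  (place-ordered cs ps ys e′ ((λ x y → adjs (∈-++⁺ʳ zs x) (∈-++⁺ʳ zs y))
                     , λ x y z → incs (∈-++⁺ʳ zs x) (∈-++⁺ʳ zs y) (∈-++⁺ʳ zs z))))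
      where zs = toList (Vec.zip w c)

    place : ∀ cs → All (Hom H E) cs → ∀ ls → map proj₂ ls ↭ concatMap toList cs → Realises ls →
      Tiled (map proj₁ ls)
    place cs hs ls e (adjs , incs) with ↭-map-inv proj₂ e
    ... | ls′ , e₁ , e₂ = tiled-↭ (map⁺ proj₁ e₂) (place-ordered cs hs ls′ (≡.sym e₁)
        ((λ x y → adjs (∈-resp-↭ (↭-sym e₂) x) (∈-resp-↭ (↭-sym e₂) y))
        , λ x y z → incs (∈-resp-↭ (↭-sym e₂) x) (∈-resp-↭ (↭-sym e₂) y) (∈-resp-↭ (↭-sym e₂) z)))

-- Greedy embeddings

bump : Bool → ℕ → ℕ
bump true  k = suc k
bump false k = k

bump≤suc : ∀ b k → bump b k ≤ suc k
bump≤suc true  k = ≤-refl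
bump≤suc false k = n≤1+n k

bump-mono : ∀ b {k l} → k ≤ l → bump b k ≤ bump b l
bump-mono true  = s≤s
bump-mono false = id

-- len i already chosen vertices constrain vertex i; room i bounds the number
-- of constraints on i once all vertices before i have been chosen
Fits : ∀ p → (Fin p → Fin p → Bool) → (Fin p → ℕ) → (Fin p → ℕ) → Set
Fits zero    E len room = ⊤
Fits (suc p) E len room = len Fin.zero ≤ room Fin.zero ×
  Fits p (λ i j → E (Fin.suc i) (Fin.suc j)) (λ i → bump (E Fin.zero (Fin.suc i)) (len (Fin.suc i))) (room ∘ Fin.suc)

fits-mono : ∀ p {E len len′ room} → (∀ i → len i ≤ len′ i) → Fits p E len′ room → Fits p E len room
fits-mono zero    h f = tt
fits-mono (suc p) {E} h (a , f) = ≤-trans (h Fin.zero) a , fits-mono p (λ i → bump-mono (E Fin.zero (Fin.suc i)) (h (Fin.suc i))) f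

-- The crude count, in which every earlier vertex is taken to constrain vertex `i`.
fits-prefix : ∀ p {E len room} → (∀ i → len i + toℕ i ≤ room i) → Fits p E len room
fits-prefix zero    h = tt
fits-prefix (suc p) {E} {len} {room} h = subst (_≤ room Fin.zero) (+-identityʳ _) (h Fin.zero) ,
  fits-prefix p (λ i → ≤-trans (+-monoˡ-≤ (toℕ i) (bump≤suc (E Fin.zero (Fin.suc i)) (len (Fin.suc i))))
    (subst (_≤ room (Fin.suc i)) (+-suc (len (Fin.suc i)) (toℕ i)) (h (Fin.suc i))))

-- Without edges from the first block to the second, choosing the first block adds no constraint to
-- the second.
fits-separate : ∀ p r {E len room} → (∀ i j → E (i ↑ˡ r) (p ↑ʳ j) ≡ false) →
  Fits p (λ i j → E (i ↑ˡ r) (j ↑ˡ r)) (len ∘ (_↑ˡ r)) (room ∘ (_↑ˡ r)) →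
  Fits r (λ i j → E (p ↑ʳ i) (p ↑ʳ j)) (len ∘ (p ↑ʳ_)) (room ∘ (p ↑ʳ_)) →
  Fits (p + r) E len room
fits-separate zero    r sep f g = g
fits-separate (suc p) r {E} {len} {room} sep (a , f) g = a , fits-separate p r (λ i j → sep (Fin.suc i) j) f
  (fits-mono r (λ j → ≤-reflexive (cong (λ b → bump b (len (suc p ↑ʳ j))) (sep Fin.zero j))) g)

module Greedy {n : ℕ} (G : Graph n) where

  allAdj : List (Fin n) → Fin n → Bool
  allAdj l z = all (λ v → adj G v z) l

  allAdj-∈ : ∀ l {z v} → allAdj l z ≡ true → v ∈ l → adj G v z ≡ true
  allAdj-∈ (v ∷ l) h (here ≡.refl) = ∧-elimˡ h
  allAdj-∈ (v ∷ l) h (there p)     = allAdj-∈ l (∧-elimʳ {adj G v _} h) p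

  extend : Bool → Fin n → List (Fin n) → List (Fin n)
  extend true  u l = u ∷ l
  extend false u l = l

  length-extend : ∀ b u l → length (extend b u l) ≡ bump b (length l)
  length-extend true  u l = ≡.refl
  length-extend false u l = ≡.refl

  ∈-extend : ∀ b {u l v} → v ∈ l → v ∈ extend b u l
  ∈-extend true  = there
  ∈-extend false = id

  -- C i lists the vertices that vertex i has to be adjacent to, Z i restricts vertex i itself
  greedy : ∀ p → (Fin p → Fin p → Bool) → (Fin p → Fin n → Bool) → (Fin p → List (Fin n)) → Vec (Fin n) p → Bool
  greedy zero    E Z C []       = true
  greedy (suc p) E Z C (u ∷ us) = (Z Fin.zero u ∧ allAdj (C Fin.zero) u) ∧
    greedy p (λ i j → E (Fin.suc i) (Fin.suc j)) (Z ∘ Fin.suc)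
      (λ i → extend (E Fin.zero (Fin.suc i)) u (C (Fin.suc i))) us

  greedy-Z : ∀ p E Z C us → greedy p E Z C us ≡ true → ∀ i → Z i (lookup us i) ≡ true
  greedy-Z (suc p) E Z C (u ∷ us) h Fin.zero = ∧-elimˡ (∧-elimˡ h)
  greedy-Z (suc p) E Z C (u ∷ us) h (Fin.suc i) =
    greedy-Z p _ _ _ us (∧-elimʳ {Z Fin.zero u ∧ allAdj (C Fin.zero) u} h) i

  greedy-C : ∀ p E Z C us → greedy p E Z C us ≡ true → ∀ i {v} → v ∈ C i → adj G v (lookup us i) ≡ true
  greedy-C (suc p) E Z C (u ∷ us) h Fin.zero v∈ =
    allAdj-∈ (C Fin.zero) (∧-elimʳ {Z Fin.zero u} (∧-elimˡ h)) v∈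
  greedy-C (suc p) E Z C (u ∷ us) h (Fin.suc i) v∈ =
    greedy-C p _ _ _ us (∧-elimʳ {Z Fin.zero u ∧ allAdj (C Fin.zero) u} h) i (∈-extend (E Fin.zero (Fin.suc i)) v∈)

  greedy-< : ∀ p E Z C us → greedy p E Z C us ≡ true → ∀ i j → i Fin.< j → E i j ≡ true →
    adj G (lookup us i) (lookup us j) ≡ true
  greedy-< (suc p) E Z C (u ∷ us) h Fin.zero (Fin.suc j) _ e =
    greedy-C p _ _ _ us (∧-elimʳ {Z Fin.zero u ∧ allAdj (C Fin.zero) u} h) j
      (subst (λ b → u ∈ extend b u (C (Fin.suc j))) (≡.sym e) (here ≡.refl))
  greedy-< (suc p) E Z C (u ∷ us) h (Fin.suc i) (Fin.suc j) (s≤s lt) e =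
    greedy-< p _ _ _ us (∧-elimʳ {Z Fin.zero u ∧ allAdj (C Fin.zero) u} h) i j lt e

  -- `Good` is an invariant of the chosen vertices, because the lower bound `γ` on extensions may
  -- hold only for well-behaved ones. For bottles these are the vertices with few non-neighbours in
  -- the uncovered set.
  greedy-dense : ∀ (xs : List (Fin n)) (Good : Fin n → Set) γ p E Z C room →
    Fits p E (length ∘ C) room →
    (∀ i → All Good (C i)) → (∀ i z → Z i z ≡ true → Good z) →
    (∀ i l → All Good l → length l ≤ room i → γ ≤ S xs (λ z → 𝟙 (Z i z ∧ allAdj l z))) →
    γ ^ p ≤ S (vecs xs p) (𝟙 ∘ greedy p E Z C)
  greedy-dense xs Good γ zero    E Z C room f gC gZ ch = ≤-refl
  greedy-dense xs Good γ (suc p) E Z C room (f₀ , f) gC gZ ch = begin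
    γ * γ ^ p
      ≤⟨ *-monoˡ-≤ (γ ^ p) (ch Fin.zero (C Fin.zero) (gC Fin.zero) f₀) ⟩
    S xs (𝟙 ∘ ok) * γ ^ p
      ≡⟨ S-*ʳ xs (γ ^ p) (𝟙 ∘ ok) ⟨
    S xs (λ u → 𝟙 (ok u) * γ ^ p)
      ≤⟨ S-mono xs inner ⟩
    S xs (λ u → S (vecs xs p) (λ us → 𝟙 (greedy (suc p) E Z C (u ∷ us))))
      ≡⟨ S-vecs xs p _ ⟨
    S (vecs xs (suc p)) (𝟙 ∘ greedy (suc p) E Z C) ∎
    where
    open ≤-Reasoning
    ok : Fin n → Bool
    ok u = Z Fin.zero u ∧ allAdj (C Fin.zero) u
    C′ : Fin n → Fin p → List (Fin n)
    C′ u i = extend (E Fin.zero (Fin.suc i)) u (C (Fin.suc i))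
    good-extend : ∀ b {u l} → Good u → All Good l → All Good (extend b u l)
    good-extend true  g gl = g ∷ gl
    good-extend false g gl = gl
    inner : ∀ u → 𝟙 (ok u) * γ ^ p ≤ S (vecs xs p) (λ us → 𝟙 (greedy (suc p) E Z C (u ∷ us)))
    inner u with ok u in eq
    ... | false = z≤n
    ... | true  = ≤-trans (≤-reflexive (*-identityˡ (γ ^ p)))
      (greedy-dense xs Good γ p _ (Z ∘ Fin.suc) (C′ u) (room ∘ Fin.suc)
        (fits-mono p (λ i → ≤-reflexive (length-extend (E Fin.zero (Fin.suc i)) u (C (Fin.suc i)))) f)
        (λ i → good-extend (E Fin.zero (Fin.suc i)) (gZ Fin.zero u (∧-elimˡ eq)) (gC (Fin.suc i)))
        (λ i → gZ (Fin.suc i)) (λ i → ch (Fin.suc i)))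

get : ∀ {q t} → Vec (Vec A t) q → Fin q → Fin t → A
get w i j = lookup (lookup w i) j

module BlownGreedy {n : ℕ} (G : Graph n) where
  open Greedy G

  module _ t p E Z C (w : Vec (Vec (Fin n) t) p) (h : blow t p (greedy p E Z C) w ≡ true) where

    private
      trans-at : ∀ (c : Fin p → Fin t) → greedy p E Z C (Vec.tabulate (λ i → get w i (c i))) ≡ true
      trans-at = blow-transversal t p (greedy p E Z C) w h

      at : ∀ (c : Fin p → Fin t) i → lookup (Vec.tabulate (λ i → get w i (c i))) i ≡ get w i (c i)
      at c i = V.lookup∘tabulate _ i

    blown-Z : ∀ i j → Z i (get w i j) ≡ true
    blown-Z i j = subst (λ v → Z i v ≡ true) (at (λ _ → j) i) (greedy-Z p E Z C _ (trans-at (λ _ → j)) i)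

    blown-C : ∀ i j {v} → v ∈ C i → adj G v (get w i j) ≡ true
    blown-C i j {v} v∈ = subst (λ u → adj G v u ≡ true) (at (λ _ → j) i) (greedy-C p E Z C _ (trans-at (λ _ → j)) i v∈)

    blown-< : ∀ i i′ j j′ → i Fin.< i′ → E i i′ ≡ true → adj G (get w i j) (get w i′ j′) ≡ true
    blown-< i i′ j j′ lt e = ≡.subst₂ (λ u v → adj G u v ≡ true)
        (≡.trans (at c i) (cong (get w i) c-i)) (≡.trans (at c i′) (cong (get w i′) c-i′))
        (greedy-< p E Z C _ (trans-at c) i i′ lt e)
      where
      -- A transversal through both prescribed entries exists because they lie in different rows.
      c : Fin p → Fin t
      c k with k Fin.≟ i
      ... | yes _ = j
      ... | no  _ = j′
      c-i : c i ≡ j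
      c-i with i Fin.≟ i
      ... | yes _ = ≡.refl
      ... | no ¬p = contradiction ≡.refl ¬p
      c-i′ : c i′ ≡ j′
      c-i′ with i′ Fin.≟ i
      ... | yes e′ = contradiction (cong toℕ (≡.sym e′)) (<⇒≢ lt)
      ... | no  _ = ≡.refl

    blown-adj : (∀ i i′ → E i i′ ≡ E i′ i) → (∀ i → E i i ≡ false) →
      ∀ i i′ j j′ → E i i′ ≡ true → adj G (get w i j) (get w i′ j′) ≡ true
    blown-adj E-sym E-irr i i′ j j′ e with Fin.<-cmp i i′
    ... | tri< lt _ _      = blown-< i i′ j j′ lt e
    ... | tri≈ _ ≡.refl _  = contradiction (≡.trans (≡.sym e) (E-irr i)) λ ()
    ... | tri> _ _ gt      = ≡.trans (Graph.sym G _ _) (blown-< i′ i j′ j gt (≡.trans (E-sym i′ i) e))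

-- Blow-ups without incompatibilities and coincidences

module _ (q t : ℕ) where

  Coord : Set
  Coord = Fin q × Fin t

  _≟C_ : (c d : Maybe Coord) → Dec (c ≡ d)
  _≟C_ = Maybe.≡-dec (Prod.≡-dec Fin._≟_ Fin._≟_)

  coords : List Coord
  coords = pairs (allFin q) (allFin t)

  coords⁺ : List (Maybe Coord)
  coords⁺ = nothing ∷ map just coords

  triples : ℕ
  triples = length coords⁺ * (length coords⁺ * length coords)

module Clean {n : ℕ} {G : Graph n} (F : IncompatibilitySystem G) where

  module _ (q t : ℕ) where

    entry : Fin n → Vec (Vec (Fin n) t) q → Maybe (Coord q t) → Fin n
    entry x w nothing        = x
    entry x w (just (i , j)) = get w i j

    -- `nothing` addresses the root `x`. The entry at `e` is the one to be resampled, so `c` and `d`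
    -- must differ from it. The excluded cases are harmless, since `inc` fails when a vertex is
    -- repeated there, and the root never has to come last by the symmetry of `inc`.
    clash : Fin n → Vec (Vec (Fin n) t) q → Maybe (Coord q t) → Maybe (Coord q t) → Coord q t → Bool
    clash x w c d e with _≟C_ q t c (just e) | _≟C_ q t d (just e)
    ... | no _ | no _ = inc F (entry x w c) (entry x w d) (entry x w (just e)) ∨ ⌊ entry x w (just e) Fin.≟ entry x w c ⌋
    ... | _    | _    = false

    clashes : Fin n → Vec (Vec (Fin n) t) q → ℕ
    clashes x w = S (coords⁺ q t) λ c → S (coords⁺ q t) λ d → S (coords q t) λ e → 𝟙 (clash x w c d e)

    clean : Fin n → Vec (Vec (Fin n) t) q → Bool
    clean x w = clashes x w ≡ᵇ 0

    ∈-coords : ∀ c → c ∈ (coords q t)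
    ∈-coords (i , j) = go (allFin q) (∈.∈-allFin i)
      where
      go : ∀ is → i ∈ is → (i , j) ∈ pairs is (allFin t)
      go (k ∷ is) (here ≡.refl) = ∈-++⁺ˡ (∈-map⁺ (k ,_) (∈.∈-allFin j))
      go (k ∷ is) (there p)     = ∈-++⁺ʳ (map (k ,_) (allFin t)) (go is p)

    ∈-coords⁺ : ∀ c → c ∈ (coords⁺ q t)
    ∈-coords⁺ nothing  = here ≡.refl
    ∈-coords⁺ (just c) = there (∈-map⁺ just (∈-coords c))

    module _ (x : Fin n) (w : Vec (Vec (Fin n) t) q) (h : clean x w ≡ true) where

      no-clash : ∀ c d e → clash x w c d e ≡ false
      no-clash c d e with clash x w c d e in eq
      ... | false = ≡.refl
      ... | true  = contradiction (≤-trans pos (≤-reflexive (≡ᵇ⇒≡ (clashes x w) 0 (subst IsTrue (≡.sym h) tt)))) λ ()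
        where
        pos : 1 ≤ clashes x w
        pos = ≤-trans (subst (λ b → 1 ≤ 𝟙 b) (≡.sym eq) ≤-refl)
          (≤-trans (S-∈ (λ e → 𝟙 (clash x w c d e)) (∈-coords e))
          (≤-trans (S-∈ (λ d → S (coords q t) λ e → 𝟙 (clash x w c d e)) (∈-coords⁺ d)) (S-∈ (λ c → S (coords⁺ q t) λ d → S (coords q t) λ e → 𝟙 (clash x w c d e)) (∈-coords⁺ c))))

      private
        open-clash : ∀ c d e → c ≢ just e → d ≢ just e →
          inc F (entry x w c) (entry x w d) (entry x w (just e)) ∨ ⌊ entry x w (just e) Fin.≟ entry x w c ⌋ ≡ false
        open-clash c d e c≢ d≢ with no-clash c d e
        ... | nc with _≟C_ q t c (just e) | _≟C_ q t d (just e)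
        ... | no _  | no _  = nc
        ... | yes p | _     = contradiction p c≢
        ... | no _  | yes p = contradiction p d≢

        ∨-false : ∀ {a b} → a ∨ b ≡ false → a ≡ false × b ≡ false
        ∨-false {false} p = ≡.refl , p

      clean-distinct : ∀ c e → c ≢ just e → entry x w c ≢ entry x w (just e)
      clean-distinct c e ne eq with proj₂ (∨-false {inc F (entry x w c) (entry x w c) (entry x w (just e))} (open-clash c c e ne ne))
      ... | f with entry x w (just e) Fin.≟ entry x w c
      ... | no ¬p = ¬p (≡.sym eq)

      private
        inc-irr : ∀ v u → inc F v u u ≡ false
        inc-irr v u with inc F v u u in eq
        ... | false = ≡.refl
        ... | true  = contradiction ≡.refl (proj₂ (proj₂ (inc-edge F v u u eq)))
        inc-loop : ∀ v u → inc F v u v ≡ false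
        inc-loop v u with inc F v u v in eq
        ... | false = ≡.refl
        ... | true  = contradiction (≡.trans (≡.sym (proj₁ (proj₂ (inc-edge F v u v eq)))) (irrefl G v)) λ ()

      clean-inc-just : ∀ c d e → inc F (entry x w c) (entry x w d) (entry x w (just e)) ≡ false
      clean-inc-just c d e with _≟C_ q t c (just e) | _≟C_ q t d (just e)
      ... | yes ≡.refl | _          = inc-loop _ _
      ... | no _       | yes ≡.refl = inc-irr _ _
      ... | no c≢      | no d≢      = proj₁ (∨-false (open-clash c d e c≢ d≢))

      clean-inc : ∀ c d e → inc F (entry x w c) (entry x w d) (entry x w e) ≡ false
      clean-inc c d        (just e) = clean-inc-just c d e
      clean-inc c (just d) nothing  = ≡.trans (inc-sym F _ _ _) (clean-inc-just c nothing d)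
      clean-inc c nothing  nothing  = inc-irr _ _

    module _ (xs : List (Fin n)) (uniq : Unique xs) .{{_ : NonZero (length xs)}}
             (m : ℕ) (few : ∀ v u → S xs (𝟙 ∘ inc F v u) ≤ m) where

      private
        u = length xs
        N = (u ^ t) ^ q

      -- With all entries except the one at `e` fixed, at most `m` of its values are incompatible
      -- and at most one coincides with the entry at `c`; this is the origin of `suc m`.
      clash-count : ∀ x c d e → u * S (vecs (vecs xs t) q) (λ w → 𝟙 (clash x w c d e)) ≤ N * suc m
      clash-count x c d e@(i , j) = coordinate-bound₂ xs t q i j (λ w → 𝟙 (clash x w c d e)) (suc m) bound
        where
        upd : Vec (Vec (Fin n) t) q → Fin n → Vec (Vec (Fin n) t) q
        upd w z = w [ i ]≔ (lookup w i [ j ]≔ z)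
        upd-same : ∀ w z → get (upd w z) i j ≡ z
        upd-same w z = ≡.trans (cong (λ r → lookup r j) (V.lookup∘update i w _)) (V.lookup∘update j (lookup w i) z)
        upd-other : ∀ w z c → c ≢ just e → entry x (upd w z) c ≡ entry x w c
        upd-other w z nothing ne = ≡.refl
        upd-other w z (just (i′ , j′)) ne with i′ Fin.≟ i
        ... | no i≢ = cong (λ r → lookup r j′) (V.lookup∘update′ i≢ w _)
        ... | yes ≡.refl with j′ Fin.≟ j
        ...   | yes ≡.refl = contradiction ≡.refl ne
        ...   | no j≢ = ≡.trans (cong (λ r → lookup r j′) (V.lookup∘update i w _)) (V.lookup∘update′ j≢ (lookup w i) z)
        𝟙-∨ : ∀ a b → 𝟙 (a ∨ b) ≤ 𝟙 a + 𝟙 b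
        𝟙-∨ true  b = s≤s z≤n
        𝟙-∨ false b = ≤-refl
        bound : ∀ w → S xs (λ z → 𝟙 (clash x (upd w z) c d e)) ≤ suc m
        bound w with _≟C_ q t c (just e) | _≟C_ q t d (just e)
        ... | yes _ | _     = ≤-trans (≤-reflexive (S-zero xs)) z≤n
        ... | no _  | yes _ = ≤-trans (≤-reflexive (S-zero xs)) z≤n
        ... | no c≢ | no d≢ = begin
          S xs (λ z → 𝟙 (inc F (entry x (upd w z) c) (entry x (upd w z) d) (get (upd w z) i j) ∨ ⌊ get (upd w z) i j Fin.≟ entry x (upd w z) c ⌋))
            ≡⟨ S-cong xs (λ z → cong 𝟙 (≡.trans (cong₂ (λ a b → inc F a b _ ∨ ⌊ _ Fin.≟ a ⌋) (upd-other w z c c≢) (upd-other w z d d≢))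
                 (cong (λ a → inc F (entry x w c) (entry x w d) a ∨ ⌊ a Fin.≟ entry x w c ⌋) (upd-same w z)))) ⟩
          S xs (λ z → 𝟙 (inc F (entry x w c) (entry x w d) z ∨ ⌊ z Fin.≟ entry x w c ⌋))
            ≤⟨ S-mono xs (λ z → 𝟙-∨ (inc F (entry x w c) (entry x w d) z) _) ⟩
          S xs (λ z → 𝟙 (inc F (entry x w c) (entry x w d) z) + 𝟙 ⌊ z Fin.≟ entry x w c ⌋)
            ≡⟨ S-+ xs _ _ ⟩
          S xs (λ z → 𝟙 (inc F (entry x w c) (entry x w d) z)) + S xs (λ z → 𝟙 ⌊ z Fin.≟ entry x w c ⌋)
            ≤⟨ +-mono-≤ (few (entry x w c) (entry x w d)) (S-≟≤1 xs uniq (entry x w c)) ⟩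
          m + 1
            ≡⟨ +-comm m 1 ⟩
          suc m ∎
          where open ≤-Reasoning

      clashes-count : ∀ x → u * S (vecs (vecs xs t) q) (clashes x) ≤ triples q t * (N * suc m)
      clashes-count x = begin
        u * S W (clashes x)
          ≡⟨ cong (u *_) (≡.trans (S-swap W (coords⁺ q t) _) (S-cong (coords⁺ q t) (λ c →
               ≡.trans (S-swap W (coords⁺ q t) _) (S-cong (coords⁺ q t) (λ d → S-swap W (coords q t) _))))) ⟩
        u * (S (coords⁺ q t) λ c → S (coords⁺ q t) λ d → S (coords q t) λ e → S W (λ w → 𝟙 (clash x w c d e)))
          ≡⟨ ≡.trans (≡.sym (S-*ˡ (coords⁺ q t) u _)) (S-cong (coords⁺ q t) (λ c → ≡.trans (≡.sym (S-*ˡ (coords⁺ q t) u _))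
               (S-cong (coords⁺ q t) (λ d → ≡.sym (S-*ˡ (coords q t) u _))))) ⟩
        (S (coords⁺ q t) λ c → S (coords⁺ q t) λ d → S (coords q t) λ e → u * S W (λ w → 𝟙 (clash x w c d e)))
          ≤⟨ S≤length* (coords⁺ q t) _ (λ c → S≤length* (coords⁺ q t) _ (λ d → S≤length* (coords q t) _ (λ e → clash-count x c d e))) ⟩
        length (coords⁺ q t) * (length (coords⁺ q t) * (length (coords q t) * (N * suc m)))
          ≡⟨ identity₉ (length (coords⁺ q t)) (length (coords⁺ q t)) (length (coords q t)) (N * suc m) ⟩
        triples q t * (N * suc m) ∎
        where
        open ≤-Reasoning
        W = vecs (vecs xs t) q

      -- Markov's inequality: a configuration that is not clean has at least one clash, and clashes
      -- are so rare that half of the guaranteed number of elements of `P` survives for both roots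
      -- together.
      clean-dense : ∀ x y K (P : Vec (Vec (Fin n) t) q → Bool) → N ≤ K * S (vecs (vecs xs t) q) (𝟙 ∘ P) →
        2 * K * (2 * (triples q t * suc m)) ≤ u →
        N ≤ 2 * K * S (vecs (vecs xs t) q) (λ w → 𝟙 (P w ∧ (clean x w ∧ clean y w)))
      clean-dense x y K P dense small = *-cancelˡ-≤ u (≤-from 0 combined (identity₈ u N K σP σx σy σ′))
        where
        W = vecs (vecs xs t) q
        σP = S W (𝟙 ∘ P)
        σx = S W (clashes x)
        σy = S W (clashes y)
        σ′ = S W (λ w → 𝟙 (P w ∧ (clean x w ∧ clean y w)))
        pointwise : ∀ p a b → 𝟙 p ≤ 𝟙 (p ∧ ((a ≡ᵇ 0) ∧ (b ≡ᵇ 0))) + (a + b)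
        pointwise false a       b       = z≤n
        pointwise true  zero    zero    = ≤-refl
        pointwise true  zero    (suc b) = s≤s z≤n
        pointwise true  (suc a) b       = s≤s z≤n
        lost : σP ≤ σ′ + (σx + σy)
        lost = ≤-trans (S-mono W (λ w → pointwise (P w) (clashes x w) (clashes y w)))
          (≤-reflexive (≡.trans (S-+ W _ _) (cong (σ′ +_) (S-+ W (clashes x) (clashes y)))))
        open ≤-Reasoning
        few-lost : 2 * K * (u * (σx + σy)) ≤ N * u
        few-lost = begin
          2 * K * (u * (σx + σy))
            ≡⟨ cong (2 * K *_) (*-distribˡ-+ u σx σy) ⟩
          2 * K * (u * σx + u * σy)
            ≤⟨ *-monoʳ-≤ (2 * K) (+-mono-≤ (clashes-count x) (clashes-count y)) ⟩
          2 * K * (triples q t * (N * suc m) + triples q t * (N * suc m))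
            ≡⟨ identity₇ (2 * K) (triples q t) N (suc m) ⟩
          N * (2 * K * (2 * (triples q t * suc m)))
            ≤⟨ *-monoʳ-≤ N small ⟩
          N * u ∎
        combined : 2 * u * N + (2 * u * K * σP + 2 * K * (u * (σx + σy))) ≤
                   2 * u * (K * σP) + (2 * u * K * (σ′ + (σx + σy)) + N * u)
        combined = +-mono-≤ (*-monoʳ-≤ (2 * u) dense) (+-mono-≤ (*-monoʳ-≤ (2 * u * K) lost) few-lost)

-- The lattice of vertex exchanges

∈-vecs : ∀ {xs : List A} → (∀ x → x ∈ xs) → ∀ {p} (v : Vec A p) → v ∈ vecs xs p
∈-vecs all∈ []      = here ≡.refl
∈-vecs {xs = xs} all∈ {suc p} (x ∷ v) = go xs (all∈ x)
  where
  go : ∀ ys → x ∈ ys → (x ∷ v) ∈ concatMap (λ y → map (y ∷_) (vecs xs p)) ys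
  go (y ∷ ys) (here ≡.refl) = ∈-++⁺ˡ (∈-map⁺ (y ∷_) (∈-vecs all∈ v))
  go (y ∷ ys) (there q)     = ∈-++⁺ʳ (map (y ∷_) (vecs xs p)) (go ys q)

∈-pairs : ∀ {xs : List A} {ys : List ℬ} {x y} → x ∈ xs → y ∈ ys → (x , y) ∈ pairs xs ys
∈-pairs {xs = x ∷ xs} (here ≡.refl) q = ∈-++⁺ˡ (∈-map⁺ (x ,_) q)
∈-pairs {xs = x ∷ xs} {ys} (there p) q = ∈-++⁺ʳ (map (x ,_) ys) (∈-pairs p q)

gcds : (A → ℕ) → List A → ℕ
gcds f []       = 0
gcds f (x ∷ xs) = gcd (f x) (gcds f xs)

gcds-∣ : ∀ (f : A → ℕ) {x xs} → x ∈ xs → gcds f xs ∣ f x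
gcds-∣ f {xs = x ∷ xs} (here ≡.refl) = gcd[m,n]∣m (f x) (gcds f xs)
gcds-∣ f {xs = x ∷ xs} (there p)     = ∣-trans (gcd[m,n]∣n (f x) (gcds f xs)) (gcds-∣ f p)

gcds-greatest : ∀ (f : A → ℕ) xs {d} → (∀ x → d ∣ f x) → d ∣ gcds f xs
gcds-greatest f []       h = _ ∣0
gcds-greatest f (x ∷ xs) h = gcd-greatest (h x) (gcds-greatest f xs h)

record Subgroup (P : ℤ → Set) : Set where
  field
    zeroᴾ : P 0ℤ
    addᴾ  : ∀ {x y} → P x → P y → P (x ℤ.+ y)
    negᴾ  : ∀ {x} → P x → P (ℤ.- x)

  multᴾ : ∀ k {m} → P (ℤ.+ m) → P (ℤ.+ (k * m))
  multᴾ zero    p = zeroᴾ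
  multᴾ (suc k) p = addᴾ p (multᴾ k p)

  subᴾ : ∀ {x y} → P x → P y → P (x ℤ.- y)
  subᴾ p q = addᴾ p (negᴾ q)

  gcdᴾ : ∀ {m n} → P (ℤ.+ m) → P (ℤ.+ n) → P (ℤ.+ gcd m n)
  gcdᴾ {m} {n} p q with Bézout.identity (gcd-GCD m n)
  ... | Bézout.+- x y eq = subst P (cancel (gcd m n) (x * m) (y * n) eq) (subᴾ (multᴾ x p) (multᴾ y q))
    where
    cancel : ∀ d a b → d + b ≡ a → ℤ.+ a ℤ.- ℤ.+ b ≡ ℤ.+ d
    cancel d a b ≡.refl = integer-identity₂ (ℤ.+ d) (ℤ.+ b)
  ... | Bézout.-+ x y eq = subst P (cancel (gcd m n) (y * n) (x * m) eq) (subᴾ (multᴾ y q) (multᴾ x p))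
    where
    cancel : ∀ d a b → d + b ≡ a → ℤ.+ a ℤ.- ℤ.+ b ≡ ℤ.+ d
    cancel d a b ≡.refl = integer-identity₂ (ℤ.+ d) (ℤ.+ b)

  gcdsᴾ : ∀ (f : A → ℕ) xs → (∀ x → P (ℤ.+ f x)) → P (ℤ.+ gcds f xs)
  gcdsᴾ f []       h = zeroᴾ
  gcdsᴾ f (x ∷ xs) h = gcdᴾ (h x) (gcdsᴾ f xs h)

  monusᴾ : ∀ m n → P (ℤ.+ m ℤ.- ℤ.+ n) → P (ℤ.+ (m ∸ n))
  monusᴾ m n p with ≤-total n m
  ... | inj₁ n≤m = subst P (≡.trans (ℤ.m-n≡m⊖n m n) (ℤ.⊖-≥ n≤m)) p
  ... | inj₂ m≤n = subst (P ∘ ℤ.+_) (≡.sym (m≤n⇒m∸n≡0 m≤n)) zeroᴾ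

δ : ∀ {q} → Fin q → Fin q → ℤ
δ a i = ℤ.+ 𝟙 ⌊ a Fin.≟ i ⌋

module Lattice {h : ℕ} (H : Graph h) {q : ℕ} (E : Fin q → Fin q → Bool) where

  labels : List (Vec (Fin q) h) → List (Fin q)
  labels = concatMap toList

  cntL : List (Vec (Fin q) h) → Fin q → ℕ
  cntL A i = cnt i (labels A)

  -- differences of label counts of two families of homomorphisms
  record InL (z : Fin q → ℤ) : Set where
    constructor inL
    field
      {plus minus} : List (Vec (Fin q) h)
      plus-homs    : All (Hom H E) plus
      minus-homs   : All (Hom H E) minus
      difference   : ∀ i → ℤ.+ cntL plus i ≡ ℤ.+ cntL minus i ℤ.+ z i

  cntL-++ : ∀ A B i → cntL (A ++ B) i ≡ cntL A i + cntL B i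
  cntL-++ A B i = ≡.trans (cong (cnt i) (concatMap-++ toList A B)) (S-++ (labels A) (labels B) _)

  InL-resp : ∀ {z z′} → (∀ i → z i ≡ z′ i) → InL z → InL z′
  InL-resp e (inL {A} {B} p q f) = inL p q λ i → ≡.trans (f i) (cong (ℤ._+_ (ℤ.+ cntL B i)) (e i))

  InL-0 : InL (λ _ → 0ℤ)
  InL-0 = inL {plus = []} {[]} [] [] λ i → ≡.refl

  InL-+ : ∀ {z z′} → InL z → InL z′ → InL (λ i → z i ℤ.+ z′ i)
  InL-+ {z} {z′} (inL {A} {B} p q f) (inL {A′} {B′} p′ q′ f′) =
    inL (All.++⁺ p p′) (All.++⁺ q q′) λ i → begin
      ℤ.+ cntL (A ++ A′) i                                       ≡⟨ cong ℤ.+_ (cntL-++ A A′ i) ⟩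
      ℤ.+ cntL A i ℤ.+ ℤ.+ cntL A′ i                               ≡⟨ cong₂ ℤ._+_ (f i) (f′ i) ⟩
      (ℤ.+ cntL B i ℤ.+ z i) ℤ.+ (ℤ.+ cntL B′ i ℤ.+ z′ i)          ≡⟨ integer-identity₁₁ (ℤ.+ cntL B i) (z i) (ℤ.+ cntL B′ i) (z′ i) ⟩
      (ℤ.+ cntL B i ℤ.+ ℤ.+ cntL B′ i) ℤ.+ (z i ℤ.+ z′ i)          ≡⟨ cong (λ k → ℤ.+ k ℤ.+ (z i ℤ.+ z′ i)) (cntL-++ B B′ i) ⟨
      ℤ.+ cntL (B ++ B′) i ℤ.+ (z i ℤ.+ z′ i) ∎
    where
    open ≡-Reasoning

  InL-neg : ∀ {z} → InL z → InL (λ i → ℤ.- z i)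
  InL-neg {z} (inL {A} {B} p q f) = inL q p λ i →
    ≡.trans (integer-identity₁₀ (ℤ.+ cntL B i) (z i)) (cong (ℤ._+ ℤ.- z i) (≡.sym (f i)))

  InL-scale : ∀ k {z} → InL z → InL (λ i → ℤ.+ k ℤ.* z i)
  InL-scale zero {z} p = InL-resp (λ i → ≡.sym (ℤ.*-zeroˡ (z i))) InL-0
  InL-scale (suc k) {z} p = InL-resp (λ i → ≡.sym (ℤ.suc-* (ℤ.+ k) (z i))) (InL-+ p (InL-scale k p))

  -- `d` labels `b` can be replaced by `d` labels `a`. The admissible `d` form a subgroup of the
  -- integers, so a single label can be exchanged once the available amounts have greatest common
  -- divisor one.
  Transfer : Fin q → Fin q → ℤ → Set
  Transfer a b d = InL (λ i → d ℤ.* (δ a i ℤ.- δ b i))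

  transfer-subgroup : ∀ a b → Subgroup (Transfer a b)
  transfer-subgroup a b = record
    { zeroᴾ = InL-resp (λ i → ≡.sym (ℤ.*-zeroˡ (δ a i ℤ.- δ b i))) InL-0
    ; addᴾ  = λ {x} {y} p q → InL-resp (λ i → ≡.sym (ℤ.*-distribʳ-+ (δ a i ℤ.- δ b i) x y)) (InL-+ p q)
    ; negᴾ  = λ {x} p → InL-resp (λ i → ℤ.neg-distribˡ-* x _) (InL-neg p)
    }

  HomF : (Fin h → Fin q) → Set
  HomF φ = ∀ a b → adj H a b ≡ true → E (φ a) (φ b) ≡ true

  homF→hom : ∀ {φ} → HomF φ → Hom H E (Vec.tabulate φ)
  homF→hom {φ} p a b ab = ≡.subst₂ (λ x y → E x y ≡ true) (≡.sym (V.lookup∘tabulate φ a)) (≡.sym (V.lookup∘tabulate φ b)) (p a b ab)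

  cnt-tabulate : ∀ (φ : Fin h → Fin q) i → cntL (Vec.tabulate φ ∷ []) i ≡ S (allFin h) (λ v → 𝟙 ⌊ φ v Fin.≟ i ⌋)
  cnt-tabulate φ i = ≡.trans (cong (cnt i) (≡.trans (L.++-identityʳ _) (toList-tabulate φ))) (S-tabulate h φ _)
    where
    toList-tabulate : ∀ {m} (f : Fin m → Fin q) → toList (Vec.tabulate f) ≡ tabulate f
    toList-tabulate {zero}  f = ≡.refl
    toList-tabulate {suc m} f = cong (f Fin.zero ∷_) (toList-tabulate (f ∘ Fin.suc))

  S-difference : ∀ (vs : List A) (f f′ p r : A → ℕ) D₁ D₂ →
    (∀ v → ℤ.+ f v ≡ ℤ.+ f′ v ℤ.+ (ℤ.+ p v ℤ.* D₁ ℤ.+ ℤ.+ r v ℤ.* D₂)) →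
    ℤ.+ S vs f ≡ ℤ.+ S vs f′ ℤ.+ (ℤ.+ S vs p ℤ.* D₁ ℤ.+ ℤ.+ S vs r ℤ.* D₂)
  S-difference []       f f′ p r D₁ D₂ e = integer-identity₃ D₁ D₂
  S-difference (v ∷ vs) f f′ p r D₁ D₂ e =
    ≡.trans (cong₂ ℤ._+_ (e v) (S-difference vs f f′ p r D₁ D₂ e))
      (integer-identity₉ (ℤ.+ f′ v) (ℤ.+ p v) (ℤ.+ r v) (ℤ.+ S vs f′) (ℤ.+ S vs p) (ℤ.+ S vs r) D₁ D₂)

  difference-in-L : ∀ {φ φ′} → HomF φ → HomF φ′ → (p r : Fin h → ℕ) (D₁ D₂ : Fin q → ℤ) →
    (∀ i v → δ (φ v) i ≡ δ (φ′ v) i ℤ.+ (ℤ.+ p v ℤ.* D₁ i ℤ.+ ℤ.+ r v ℤ.* D₂ i)) →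
    InL (λ i → ℤ.+ S (allFin h) p ℤ.* D₁ i ℤ.+ ℤ.+ S (allFin h) r ℤ.* D₂ i)
  difference-in-L {φ} {φ′} hφ hφ′ p r D₁ D₂ e =
    inL {plus = Vec.tabulate φ ∷ []} {Vec.tabulate φ′ ∷ []} (homF→hom hφ ∷ []) (homF→hom hφ′ ∷ []) λ i →
      ≡.subst₂ (λ x y → ℤ.+ x ≡ ℤ.+ y ℤ.+ (ℤ.+ S (allFin h) p ℤ.* D₁ i ℤ.+ ℤ.+ S (allFin h) r ℤ.* D₂ i)) (≡.sym (cnt-tabulate φ i)) (≡.sym (cnt-tabulate φ′ i))
        (S-difference (allFin h) _ _ p r (D₁ i) (D₂ i) (e i))

  -- s completes both a and b to a union of homomorphic images of H
  record Exchange (a b : Fin q) : Set where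
    field
      homsₐ homsᵦ : List (Vec (Fin q) h)
      rest        : List (Fin q)
      validₐ      : All (Hom H E) homsₐ
      validᵦ      : All (Hom H E) homsᵦ
      completeₐ   : a ∷ rest ↭ labels homsₐ
      completeᵦ   : b ∷ rest ↭ labels homsᵦ

  -- As `a ≢ b`, the label `a` occurs in `plus` once more than in `minus`, hence at all. Removing
  -- that occurrence leaves a list that together with `b` has exactly the label counts of `minus`.
  transfer-exchange : ∀ {a b} → a ≢ b → Transfer a b 1ℤ → Exchange a b
  transfer-exchange {a} {b} a≢b (inL {A} {B} p q f) = record
    { homsₐ = A ; homsᵦ = B ; rest = proj₁ ex ; validₐ = p ; validᵦ = q
    ; completeₐ = ↭-sym (proj₂ ex) ; completeᵦ = counts-↭ _ _ eq }
    where
    δba : δ b a ≡ 0ℤ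
    δba with b Fin.≟ a
    ... | yes e = contradiction (≡.sym e) a≢b
    ... | no _  = ≡.refl
    one : cntL A a ≡ cntL B a + 1
    one = ℤ.+-injective (≡.trans (f a) (cong (ℤ._+_ (ℤ.+ cntL B a))
      (≡.trans (cong (λ y → 1ℤ ℤ.* (δ a a ℤ.- y)) δba) (cong (λ k → 1ℤ ℤ.* (ℤ.+ k ℤ.- 0ℤ)) (𝟙≟-refl a)))))
    ex = extract (cnt-∈ a (labels A) (subst (0 <_) (≡.sym (≡.trans one (+-comm _ 1))) z<s))
    s = proj₁ ex
    eq : ∀ i → cnt i (b ∷ s) ≡ cnt i (labels B)
    eq i = ℤ.+-injective (e₂ (δ b i) (ℤ.+ cnt i s) (ℤ.+ cntL B i) (δ a i)
      (≡.trans (cong ℤ.+_ (≡.sym (S-↭ _ (proj₂ ex)))) (f i)))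
      where
      e₂ : ∀ y s k x → x ℤ.+ s ≡ k ℤ.+ 1ℤ ℤ.* (x ℤ.- y) → y ℤ.+ s ≡ k
      e₂ y s k x e = begin
        y ℤ.+ s                                      ≡⟨ integer-identity₈ y s x ⟩
        (x ℤ.+ s) ℤ.+ (y ℤ.- x)                      ≡⟨ cong (ℤ._+ (y ℤ.- x)) e ⟩
        (k ℤ.+ 1ℤ ℤ.* (x ℤ.- y)) ℤ.+ (y ℤ.- x)       ≡⟨ integer-identity₇ k x y ⟩
        k ∎
        where
        open ≡-Reasoning

-- Exchanges from permuted colour classes

transpose-ˡ : ∀ {n} (i j : Fin n) → transpose i j i ≡ j
transpose-ˡ i j with i Fin.≟ i
... | yes _ = ≡.refl
... | no ¬p = contradiction ≡.refl ¬p

transpose-ʳ : ∀ {n} (i j : Fin n) → transpose i j j ≡ i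
transpose-ʳ i j with j Fin.≟ i
... | yes e = e
... | no _ with j Fin.≟ j
...   | yes _ = ≡.refl
...   | no ¬p = contradiction ≡.refl ¬p

transpose-other : ∀ {n} (i j k : Fin n) → k ≢ i → k ≢ j → transpose i j k ≡ k
transpose-other i j k k≢i k≢j with k Fin.≟ i
... | yes e = contradiction e k≢i
... | no _ with k Fin.≟ j
...   | yes e = contradiction e k≢j
...   | no _  = ≡.refl

transpose-injective : ∀ {n} (i j : Fin n) {x y} → transpose i j x ≡ transpose i j y → x ≡ y
transpose-injective i j {x} {y} e = begin
  x                                ≡⟨ transpose-inverse j i ⟨
  transpose j i (transpose i j x)  ≡⟨ cong (transpose j i) e ⟩
  transpose j i (transpose i j y)  ≡⟨ transpose-inverse j i ⟩
  y ∎
  where open ≡-Reasoning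

count-cong : ∀ n {P Q : Fin n → Bool} → (∀ i → P i ≡ Q i) → count n P ≡ count n Q
count-cong n {P} {Q} e = ≡.trans (count≡S n P) (≡.trans (S-cong (allFin n) (λ i → cong 𝟙 (e i))) (≡.sym (count≡S n Q)))

proper? : ∀ {h} (H : Graph h) k (c : Fin h → Fin k) → Dec (ProperColouring H k c)
proper? H k c = Fin.all? λ a → Fin.all? λ b → (adj H a b Bool.≟ true) →-dec ¬? (c a Fin.≟ c b)

swap-pointwise : ∀ {k q} (ι : Fin k → Fin q) (π : Fin k → Fin k) {a b i j} → i ≢ j → π i ≡ a → π j ≡ b →
  (∀ {x y} → π x ≡ π y → x ≡ y) → ∀ l x →
  δ (ι (π x)) l ≡ δ (ι (transpose a b (π x))) l ℤ.+
    (ℤ.+ 𝟙 ⌊ x Fin.≟ i ⌋ ℤ.* (δ (ι a) l ℤ.- δ (ι b) l) ℤ.+ ℤ.+ 𝟙 ⌊ x Fin.≟ j ⌋ ℤ.* (ℤ.- (δ (ι a) l ℤ.- δ (ι b) l)))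
swap-pointwise ι π {a} {b} {i} {j} i≢j ≡.refl ≡.refl inj l x with x Fin.≟ i | x Fin.≟ j
... | yes ≡.refl | yes e = contradiction e i≢j
... | yes ≡.refl | no _ rewrite transpose-ˡ a b = integer-identity₆ (δ (ι a) l) (δ (ι b) l)
... | no _ | yes ≡.refl rewrite transpose-ʳ a b = integer-identity₅ (δ (ι a) l) (δ (ι b) l)
... | no x≢i | no x≢j rewrite transpose-other a b (π x) (x≢i ∘ inj) (x≢j ∘ inj) = integer-identity₄ (δ (ι (π x)) l) (δ (ι a) l ℤ.- δ (ι b) l)

module Colourings {h : ℕ} (H : Graph h) (k : ℕ) where

  Triple : Set
  Triple = (Vec (Fin k) h × Fin k) × Fin k

  allTriples : List Triple
  allTriples = pairs (pairs (vecs (allFin k) h) (allFin k)) (allFin k)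

  -- All ordered pairs of classes are listed, so truncated subtraction loses nothing: a negative
  -- difference reappears with the classes interchanged.
  gap : Triple → ℕ
  gap ((c , i) , j) with proper? H k (lookup c)
  ... | yes _ = classSize (lookup c) i ∸ classSize (lookup c) j
  ... | no _  = 0

  gapGcd : ℕ
  gapGcd = gcds gap allTriples

  gapGcd-∣ : ∀ c → ProperColouring H k c → ∀ i j → gapGcd ∣ classSize c i ∸ classSize c j
  gapGcd-∣ c pr i j = subst (gapGcd ∣_) eq (gcds-∣ gap {x = (v , i) , j}
      (∈-pairs (∈-pairs (∈-vecs ∈.∈-allFin v) (∈.∈-allFin i)) (∈.∈-allFin j)))
    where
    v = Vec.tabulate c
    size : ∀ i → classSize (lookup v) i ≡ classSize c i
    size i = count-cong h (λ a → cong (λ x → ⌊ x Fin.≟ i ⌋) (V.lookup∘tabulate c a))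
    eq : gap ((v , i) , j) ≡ classSize c i ∸ classSize c j
    eq with proper? H k (lookup v)
    ... | yes _ = cong₂ _∸_ (size i) (size j)
    ... | no ¬p = contradiction (λ a b ab e → pr a b ab (≡.trans (≡.sym (V.lookup∘tabulate c a)) (≡.trans e (V.lookup∘tabulate c b)))) ¬p

  hcf-gapGcd : IsHcf (DH H k) 1 → gapGcd ≡ 1
  hcf-gapGcd (_ , greatest) = ∣1⇒≡1 (greatest gapGcd λ { x (c , pr , π , _ , _ , _ , i , j , _ , ≡.refl) → gapGcd-∣ c pr (π j) (π i) })

  module _ {q : ℕ} (E : Fin q → Fin q → Bool) (ι : Fin k → Fin q) (ι-hom : ∀ i j → i ≢ j → E (ι i) (ι j) ≡ true) where
    open Lattice H E

    colour-hom : ∀ c → ProperColouring H k c → (π : Fin k → Fin k) → (∀ {x y} → π x ≡ π y → x ≡ y) → HomF (λ v → ι (π (c v)))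
    colour-hom c pr π inj a b ab = ι-hom _ _ (λ e → pr a b ab (inj e))

    -- The colouring is mapped into the clique with class `i` at `a` and class `j` at `b`, and once
    -- more with `a` and `b` interchanged. The two homomorphisms differ only on these two classes.
    colour-transfer : ∀ a b → a ≢ b → ∀ c → ProperColouring H k c → ∀ i j →
      Transfer (ι a) (ι b) (ℤ.+ classSize c i ℤ.- ℤ.+ classSize c j)
    colour-transfer a b a≢b c pr i j with i Fin.≟ j
    ... | yes ≡.refl = subst (Transfer (ι a) (ι b)) (≡.sym (ℤ.+-inverseʳ (ℤ.+ classSize c i))) (Subgroup.zeroᴾ (transfer-subgroup (ι a) (ι b)))
    ... | no i≢j = InL-resp total (difference-in-L (colour-hom c pr π π-inj)
        (colour-hom c pr (transpose a b ∘ π) (λ e → π-inj (transpose-injective a b e)))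
        (λ v → 𝟙 ⌊ c v Fin.≟ i ⌋) (λ v → 𝟙 ⌊ c v Fin.≟ j ⌋)
        (λ l → δ (ι a) l ℤ.- δ (ι b) l) (λ l → ℤ.- (δ (ι a) l ℤ.- δ (ι b) l)) 
        (λ l v → swap-pointwise ι π i≢j π-i π-j π-inj l (c v)))
      where
      -- The first transposition carries `i` to `a`; the second carries the image of `j` to `b` and
      -- leaves `a` alone.
      t₁ = transpose i a
      π : Fin k → Fin k
      π x = transpose (t₁ j) b (t₁ x)
      π-inj : ∀ {x y} → π x ≡ π y → x ≡ y
      π-inj e = transpose-injective i a (transpose-injective (t₁ j) b e)
      π-i : π i ≡ a
      π-i = ≡.trans (cong (transpose (t₁ j) b) (transpose-ˡ i a))
        (transpose-other (t₁ j) b a (λ e → i≢j (transpose-injective i a (≡.trans (transpose-ˡ i a) e))) a≢b)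
      π-j : π j ≡ b
      π-j = transpose-ˡ (t₁ j) b
      total : ∀ l → ℤ.+ S (allFin h) (λ v → 𝟙 ⌊ c v Fin.≟ i ⌋) ℤ.* (δ (ι a) l ℤ.- δ (ι b) l) ℤ.+
                    ℤ.+ S (allFin h) (λ v → 𝟙 ⌊ c v Fin.≟ j ⌋) ℤ.* (ℤ.- (δ (ι a) l ℤ.- δ (ι b) l)) ≡
                    (ℤ.+ classSize c i ℤ.- ℤ.+ classSize c j) ℤ.* (δ (ι a) l ℤ.- δ (ι b) l)
      total l = ≡.trans (integer-identity₁ (ℤ.+ S (allFin h) (λ v → 𝟙 ⌊ c v Fin.≟ i ⌋)) (ℤ.+ S (allFin h) (λ v → 𝟙 ⌊ c v Fin.≟ j ⌋)) (δ (ι a) l ℤ.- δ (ι b) l))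
        (≡.sym (cong₂ (λ x y → (ℤ.+ x ℤ.- ℤ.+ y) ℤ.* (δ (ι a) l ℤ.- δ (ι b) l)) (count≡S h _) (count≡S h _)))

    gap-transfer : ∀ a b → a ≢ b → Transfer (ι a) (ι b) (ℤ.+ gapGcd)
    gap-transfer a b a≢b = gcdsᴾ gap allTriples each
      where
      open Subgroup (transfer-subgroup (ι a) (ι b))
      each : ∀ x → Transfer (ι a) (ι b) (ℤ.+ gap x)
      each ((c , i) , j) with proper? H k (lookup c)
      ... | yes pr = monusᴾ (classSize (lookup c) i) (classSize (lookup c) j) (colour-transfer a b a≢b (lookup c) pr i j)
      ... | no _   = zeroᴾ

-- Exchanges from components of bipartite graphs

Closed : ∀ {h} → Graph h → Vec Bool h → Set
Closed {h} H C = ∀ a b → adj H a b ≡ true → lookup C a ≡ lookup C b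

closed? : ∀ {h} (H : Graph h) (C : Vec Bool h) → Dec (Closed H C)
closed? H C = Fin.all? λ a → Fin.all? λ b → (adj H a b Bool.≟ true) →-dec (lookup C a Bool.≟ lookup C b)

Reach-snoc : ∀ {h} {H : Graph h} {a b c} → Reach H a b → adj H b c ≡ true → Reach H a c
Reach-snoc Reach.here        e = Reach.step e Reach.here
Reach-snoc (Reach.step d r)  e = Reach.step d (Reach-snoc r e)

flip₂ : Fin 2 → Fin 2
flip₂ Fin.zero           = Fin.suc Fin.zero
flip₂ (Fin.suc Fin.zero) = Fin.zero

flip₂-injective : ∀ {x y} → flip₂ x ≡ flip₂ y → x ≡ y
flip₂-injective {Fin.zero}           {Fin.zero}           e = ≡.refl
flip₂-injective {Fin.zero}           {Fin.suc Fin.zero} ()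
flip₂-injective {Fin.suc Fin.zero}   {Fin.zero}         ()
flip₂-injective {Fin.suc Fin.zero}   {Fin.suc Fin.zero}   e = ≡.refl

≢⇒flip₂ : ∀ {x y} → x ≢ y → y ≡ flip₂ x
≢⇒flip₂ {Fin.zero}         {Fin.zero}         p = contradiction ≡.refl p
≢⇒flip₂ {Fin.zero}         {Fin.suc Fin.zero} p = ≡.refl
≢⇒flip₂ {Fin.suc Fin.zero} {Fin.zero}         p = ≡.refl
≢⇒flip₂ {Fin.suc Fin.zero} {Fin.suc Fin.zero} p = contradiction ≡.refl p

-- closed vertex sets are the unions of components
module Bipartite {h : ℕ} (H : Graph h) where

  closedSets : List (Vec Bool h)
  closedSets = vecs (true ∷ false ∷ []) h

  ∈-closedSets : ∀ C → C ∈ closedSets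
  ∈-closedSets = ∈-vecs λ { true → here ≡.refl ; false → there (here ≡.refl) }

  order : Vec Bool h → ℕ
  order C = S (allFin h) (λ v → 𝟙 (lookup C v))

  part : Vec Bool h → (Fin h → Fin 2) → Fin 2 → ℕ
  part C c o = S (allFin h) (λ v → 𝟙 (lookup C v ∧ ⌊ c v Fin.≟ o ⌋))

  order-part : ∀ C c o → order C ≡ part C c o + part C c (flip₂ o)
  order-part C c o = ≡.trans (S-cong (allFin h) (λ v → split (lookup C v) (c v) o)) (S-+ (allFin h) _ _)
    where
    split : ∀ b x o → 𝟙 b ≡ 𝟙 (b ∧ ⌊ x Fin.≟ o ⌋) + 𝟙 (b ∧ ⌊ x Fin.≟ flip₂ o ⌋)
    split false x o = ≡.refl
    split true Fin.zero           Fin.zero           = ≡.refl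
    split true Fin.zero           (Fin.suc Fin.zero) = ≡.refl
    split true (Fin.suc Fin.zero) Fin.zero           = ≡.refl
    split true (Fin.suc Fin.zero) (Fin.suc Fin.zero) = ≡.refl

  Flip : Set
  Flip = (Vec Bool h × Vec (Fin 2) h) × Fin 2

  allFlips : List Flip
  allFlips = pairs (pairs closedSets (vecs (allFin 2) h)) (allFin 2)

  -- Flipping the two colours on a union of components trades this many labels. Such trades are
  -- finer than those from swapping the colours of all of `H`, which is why a common factor two of
  -- the class differences can be tolerated.
  imbalance : Flip → ℕ
  imbalance ((C , c) , o) with closed? H C | proper? H 2 (lookup c)
  ... | yes _ | yes _ = part C (lookup c) o ∸ part C (lookup c) (flip₂ o)
  ... | _     | _     = 0

  closedOrder : Vec Bool h → ℕ
  closedOrder C with closed? H C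
  ... | yes _ = order C
  ... | no _  = 0

  flipGcd orderGcd : ℕ
  flipGcd  = gcds imbalance allFlips
  orderGcd = gcds closedOrder closedSets

  flipGcd-∣ : ∀ C → Closed H C → ∀ c → ProperColouring H 2 (lookup c) → ∀ o →
    flipGcd ∣ part C (lookup c) o ∸ part C (lookup c) (flip₂ o)
  flipGcd-∣ C cl c pr o = subst (flipGcd ∣_) eq (gcds-∣ imbalance
      (∈-pairs (∈-pairs (∈-closedSets C) (∈-vecs ∈.∈-allFin c)) (∈.∈-allFin o)))
    where
    eq : imbalance ((C , c) , o) ≡ part C (lookup c) o ∸ part C (lookup c) (flip₂ o)
    eq with closed? H C | proper? H 2 (lookup c)
    ... | yes _ | yes _ = ≡.refl
    ... | no ¬p | _     = contradiction cl ¬p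
    ... | yes _ | no ¬p = contradiction pr ¬p

  flipGcd-∣-order : ∀ C → Closed H C → ∀ c → ProperColouring H 2 (lookup c) → flipGcd ≡ 2 → 2 ∣ order C
  flipGcd-∣-order C cl c pr g≡2 = subst (2 ∣_) (≡.sym (order-part C (lookup c) Fin.zero))
      (even (part C (lookup c) Fin.zero) (part C (lookup c) (Fin.suc Fin.zero))
        (subst (_∣ _) g≡2 (flipGcd-∣ C cl c pr Fin.zero)) (subst (_∣ _) g≡2 (flipGcd-∣ C cl c pr (Fin.suc Fin.zero))))
    where
    even : ∀ a b → 2 ∣ a ∸ b → 2 ∣ b ∸ a → 2 ∣ a + b
    even a b (divides s e) (divides t f) with ≤-total b a
    ... | inj₁ b≤a = divides (s + b) (≡.trans (cong (λ k → k + b) (≡.trans (≡.sym (m∸n+n≡m b≤a)) (cong (λ k → k + b) e))) (identity₁₁ s b))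
    ... | inj₂ a≤b = divides (t + a) (≡.trans (cong (λ k → a + k) (≡.trans (≡.sym (m∸n+n≡m a≤b)) (cong (λ k → k + a) f))) (identity₁₀ t a))

  component-closed : ∀ {v} {C : Fin h → Bool} → (∀ w → (C w ≡ true) ⇔ Reach H v w) → Closed H (Vec.tabulate C)
  component-closed {v} {C} eqv a b ab = ≡.trans (V.lookup∘tabulate C a) (≡.trans same (≡.sym (V.lookup∘tabulate C b)))
    where
    forth : ∀ {a b} → adj H a b ≡ true → C a ≡ true → C b ≡ true
    forth ab Ca = Equivalence.from (eqv _) (Reach-snoc (Equivalence.to (eqv _) Ca) ab)
    same : C a ≡ C b
    same with C a in ea | C b in eb
    ... | true  | true  = ≡.refl
    ... | false | false = ≡.refl
    ... | true  | false = contradiction (≡.trans (≡.sym eb) (forth ab ea)) λ ()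
    ... | false | true  = contradiction (≡.trans (≡.sym ea) (forth (≡.trans (Graph.sym H b a) ab) eb)) λ ()

  order-tabulate : ∀ C → order (Vec.tabulate C) ≡ count h C
  order-tabulate C = ≡.trans (S-cong (allFin h) (λ v → cong 𝟙 (V.lookup∘tabulate C v))) (≡.sym (count≡S h C))

  component-gcd : ∀ g → (∀ C → Closed H C → g ∣ order C) → IsHcf (ComponentOrder H) 1 → g ≡ 1
  component-gcd g div (_ , greatest) = ∣1⇒≡1 (greatest g λ { x (v , C , eqv , ≡.refl) →
    subst (g ∣_) (order-tabulate C) (div (Vec.tabulate C) (component-closed eqv)) })

  orderGcd≡1 : IsHcf (ComponentOrder H) 1 → orderGcd ≡ 1
  orderGcd≡1 = component-gcd orderGcd div
    where
    div : ∀ C → Closed H C → orderGcd ∣ order C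
    div C cl = subst (orderGcd ∣_) eq (gcds-∣ closedOrder (∈-closedSets C))
      where
      eq : closedOrder C ≡ order C
      eq with closed? H C
      ... | yes _ = ≡.refl
      ... | no ¬p = contradiction cl ¬p

  -- Flipping everything shows that `flipGcd` divides `g`, so it is one or two. If it were two, both
  -- colour classes of every closed set would have the same parity, every component would have even
  -- order, and two would divide the common factor one of the component orders.
  flipGcd≡1 : Colourable H 2 → IsHcf (ComponentOrder H) 1 → ∀ g → IsHcf (DH H 2) g → 0 < g → g ≤ 2 → flipGcd ≡ 1
  flipGcd≡1 (c₀ , pr₀) comp g (_ , greatest) 0<g g≤2 = cases flipGcd ≡.refl
      (≤-trans (∣⇒≤ {{>-nonZero 0<g}} (greatest flipGcd divides-all)) g≤2)
      (λ e → n≮0 (subst (0 <_) (0∣⇒≡0′ (subst (_∣ g) e (greatest flipGcd divides-all))) 0<g))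
    where
    0∣⇒≡0′ : 0 ∣ g → g ≡ 0
    0∣⇒≡0′ (divides q e) = ≡.trans e (*-zeroʳ q)
    everything : Vec Bool h
    everything = Vec.replicate h true
    part-all : ∀ c o → part everything (lookup (Vec.tabulate c)) o ≡ classSize c o
    part-all c o = ≡.trans (S-cong (allFin h) (λ v → cong₂ (λ b x → 𝟙 (b ∧ ⌊ x Fin.≟ o ⌋)) (V.lookup-replicate v true) (V.lookup∘tabulate c v)))
      (≡.sym (count≡S h _))
    proper-tabulate : ∀ {c} → ProperColouring H 2 c → ProperColouring H 2 (lookup (Vec.tabulate c))
    proper-tabulate {c} pr a b ab e = pr a b ab (≡.trans (≡.sym (V.lookup∘tabulate c a)) (≡.trans e (V.lookup∘tabulate c b)))
    divides-all : ∀ x → DH H 2 x → flipGcd ∣ x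
    divides-all x (c , pr , π , _ , _ , _ , i , j , _ , ≡.refl) with π i Fin.≟ π j
    ... | yes e = subst (flipGcd ∣_) (≡.sym (≡.trans (cong (λ k → classSize c (π j) ∸ classSize c k) e) (n∸n≡0 (classSize c (π j))))) (flipGcd ∣0)
    ... | no ne = subst (flipGcd ∣_) (cong₂ _∸_ (part-all c (π j)) (≡.trans (cong (part everything (lookup (Vec.tabulate c))) (≡.sym (≢⇒flip₂ (ne ∘ ≡.sym)))) (part-all c (π i))))
        (flipGcd-∣ everything (λ a b _ → ≡.trans (V.lookup-replicate a true) (≡.sym (V.lookup-replicate b true))) (Vec.tabulate c) (proper-tabulate pr) (π j))
    cases : ∀ m → flipGcd ≡ m → m ≤ 2 → m ≢ 0 → flipGcd ≡ 1
    cases 0 e _ m≢0 = contradiction ≡.refl m≢0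
    cases 1 e _ _ = e
    cases 2 e _ _ = contradiction (component-gcd 2 (λ C cl → flipGcd-∣-order C cl (Vec.tabulate c₀) (proper-tabulate pr₀) e) comp) λ ()
    cases (suc (suc (suc m))) e (s≤s (s≤s ())) _

  module _ {q : ℕ} (E : Fin q → Fin q → Bool) (ι : Fin 2 → Fin 2 → Fin q)
           (ι-hom : ∀ s i → E (ι s i) (ι s (flip₂ i)) ≡ true) where
    open Lattice H E

    private
      o₀ o₁ : Fin 2
      o₀ = Fin.zero
      o₁ = Fin.suc Fin.zero

    ι-hom′ : ∀ s {i j} → i ≢ j → E (ι s i) (ι s j) ≡ true
    ι-hom′ s {i} ne = subst (λ j → E (ι s i) (ι s j) ≡ true) (≡.sym (≢⇒flip₂ ne)) (ι-hom s i)

    plain-hom : ∀ s c → ProperColouring H 2 c → HomF (λ v → ι s (c v))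
    plain-hom s c pr a b ab = ι-hom′ s (pr a b ab)

    flipOn : Bool → Fin 2 → Fin 2
    flipOn b x = if b then flip₂ x else x

    flip-hom : ∀ s C → Closed H C → ∀ c → ProperColouring H 2 c → HomF (λ v → ι s (flipOn (lookup C v) (c v)))
    flip-hom s C cl c pr a b ab rewrite cl a b ab = ι-hom′ s (λ e → pr a b ab (inj (lookup C b) e))
      where
      inj : ∀ β {x y} → flipOn β x ≡ flipOn β y → x ≡ y
      inj true  = flip₂-injective
      inj false = id

    side : Bool → Fin 2
    side b = if b then o₁ else o₀

    move-hom : ∀ C → Closed H C → ∀ c → ProperColouring H 2 c → HomF (λ v → ι (side (lookup C v)) (c v))
    move-hom C cl c pr a b ab rewrite cl a b ab = ι-hom′ (side (lookup C b)) (pr a b ab)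

    flip-transfer : ∀ s C → Closed H C → ∀ c → ProperColouring H 2 c → ∀ o →
      Transfer (ι s o₀) (ι s o₁) (ℤ.+ part C c o ℤ.- ℤ.+ part C c (flip₂ o))
    flip-transfer s C cl c pr Fin.zero = InL-resp (λ l → integer-identity₁ (ℤ.+ part C c o₀) (ℤ.+ part C c o₁) (D l))
      (difference-in-L (plain-hom s c pr) (flip-hom s C cl c pr) (λ v → 𝟙 (lookup C v ∧ ⌊ c v Fin.≟ o₀ ⌋)) (λ v → 𝟙 (lookup C v ∧ ⌊ c v Fin.≟ o₁ ⌋))
        D (λ l → ℤ.- D l) (λ l v → pointwise l (lookup C v) (c v)))
      where
      D : Fin q → ℤ
      D l = δ (ι s o₀) l ℤ.- δ (ι s o₁) l
      pointwise : ∀ l b x → δ (ι s x) l ≡ δ (ι s (flipOn b x)) l ℤ.+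
        (ℤ.+ 𝟙 (b ∧ ⌊ x Fin.≟ o₀ ⌋) ℤ.* D l ℤ.+ ℤ.+ 𝟙 (b ∧ ⌊ x Fin.≟ o₁ ⌋) ℤ.* (ℤ.- D l))
      pointwise l false x                  = integer-identity₄ (δ (ι s x) l) (D l)
      pointwise l true  Fin.zero           = integer-identity₆ (δ (ι s o₀) l) (δ (ι s o₁) l)
      pointwise l true  (Fin.suc Fin.zero) = integer-identity₅ (δ (ι s o₀) l) (δ (ι s o₁) l)
    flip-transfer s C cl c pr (Fin.suc Fin.zero) = subst (Transfer (ι s o₀) (ι s o₁)) (integer-identity₁₆ (ℤ.+ part C c o₀) (ℤ.+ part C c o₁))
      (Subgroup.negᴾ (transfer-subgroup (ι s o₀) (ι s o₁)) {x = ℤ.+ part C c o₀ ℤ.- ℤ.+ part C c o₁} (flip-transfer s C cl c pr Fin.zero))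

    flipGcd-transfer : ∀ s → Transfer (ι s o₀) (ι s o₁) (ℤ.+ flipGcd)
    flipGcd-transfer s = gcdsᴾ imbalance allFlips each
      where
      open Subgroup (transfer-subgroup (ι s o₀) (ι s o₁))
      each : ∀ x → Transfer (ι s o₀) (ι s o₁) (ℤ.+ imbalance x)
      each ((C , c) , o) with closed? H C | proper? H 2 (lookup c)
      ... | yes cl | yes pr = monusᴾ (part C (lookup c) o) (part C (lookup c) (flip₂ o)) (flip-transfer s C cl (lookup c) pr o)
      ... | no _   | _      = zeroᴾ
      ... | yes _  | no _   = zeroᴾ

    module _ (colourable : Colourable H 2) (flipGcd≡1 : flipGcd ≡ 1) where

      private
        c = proj₁ colourable
        pr = proj₂ colourable

      -- Moving `C` from one edge of the pattern to the other moves its two colour classes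
      -- separately. Unit transfers along each edge, available because `flipGcd` is one, convert the
      -- second class into the first colour on both sides, so all of `order C` is moved between two
      -- fixed vertices.
      move-transfer : ∀ C → Closed H C → Transfer (ι o₀ o₀) (ι o₁ o₀) (ℤ.+ order C)
      move-transfer C cl = InL-resp eq (InL-+ (InL-+ moved (InL-scale r (InL-neg (unit o₁)))) (InL-scale r (unit o₀)))
        where
        unit : ∀ s → Transfer (ι s o₀) (ι s o₁) 1ℤ
        unit s = subst (λ k → Transfer (ι s o₀) (ι s o₁) (ℤ.+ k)) flipGcd≡1 (flipGcd-transfer s)
        r = part C c o₁
        D₀ D₁ : Fin q → ℤ
        D₀ l = δ (ι o₀ o₀) l ℤ.- δ (ι o₁ o₀) l
        D₁ l = δ (ι o₀ o₁) l ℤ.- δ (ι o₁ o₁) l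
        pointwise : ∀ l b x → δ (ι o₀ x) l ≡ δ (ι (side b) x) l ℤ.+
          (ℤ.+ 𝟙 (b ∧ ⌊ x Fin.≟ o₀ ⌋) ℤ.* D₀ l ℤ.+ ℤ.+ 𝟙 (b ∧ ⌊ x Fin.≟ o₁ ⌋) ℤ.* D₁ l)
        pointwise l false x                  = integer-identity₁₅ (δ (ι o₀ x) l) (D₀ l) (D₁ l)
        pointwise l true  Fin.zero           = integer-identity₁₄ (δ (ι o₀ o₀) l) (δ (ι o₁ o₀) l) (D₁ l)
        pointwise l true  (Fin.suc Fin.zero) = integer-identity₁₃ (δ (ι o₀ o₁) l) (δ (ι o₁ o₁) l) (D₀ l)
        moved : InL (λ l → ℤ.+ part C c o₀ ℤ.* D₀ l ℤ.+ ℤ.+ r ℤ.* D₁ l)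
        moved = difference-in-L (plain-hom o₀ c pr) (move-hom C cl c pr) _ _ D₀ D₁ (λ l v → pointwise l (lookup C v) (c v))
        eq : ∀ l → _ ≡ ℤ.+ order C ℤ.* D₀ l
        eq l = ≡.trans (integer-identity₁₂ (ℤ.+ part C c o₀) (ℤ.+ r) (δ (ι o₀ o₀) l) (δ (ι o₀ o₁) l) (δ (ι o₁ o₀) l) (δ (ι o₁ o₁) l))
          (cong (λ k → ℤ.+ k ℤ.* D₀ l) (≡.sym (order-part C c o₀)))

      orderGcd-transfer : Transfer (ι o₀ o₀) (ι o₁ o₀) (ℤ.+ orderGcd)
      orderGcd-transfer = gcdsᴾ closedOrder closedSets each
        where
        open Subgroup (transfer-subgroup (ι o₀ o₀) (ι o₁ o₀))
        each : ∀ C → Transfer (ι o₀ o₀) (ι o₁ o₀) (ℤ.+ closedOrder C)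
        each C with closed? H C
        ... | yes cl = move-transfer C cl
        ... | no _   = zeroᴾ

-- Patterns and absorbers

-- A pattern is a graph on Fin vertices with two marked vertices, the twins of a and b, which can be
-- exchanged in unions of copies of H; depth bounds its degeneracy when the twins come first.
record Pattern {h : ℕ} (H : Graph h) : Set where
  field
    vertices : ℕ
    E        : Fin vertices → Fin vertices → Bool
    E-sym    : ∀ i j → E i j ≡ E j i
    E-irr    : ∀ i → E i i ≡ false
    a b      : Fin vertices
    exchange : Lattice.Exchange H E a b
    tile     : Vec (Fin vertices) h
    tile-hom : Hom H E tile
    depth    : ℕ
    fits     : Fits vertices E (λ i → bump (E a i) (bump (E b i) 0)) (λ _ → depth)

module PatternConstants {h : ℕ} {H : Graph h} (P : Pattern H) where
  open Pattern P
  open Lattice.Exchange exchange using (rest)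

  -- Room for one entry per element of `rest` or of a tile. The successor is there because density
  -- is only proved for blow-ups of positive thickness.
  thickness : ℕ
  thickness = suc (length rest + h)

  size : ℕ
  size = vertices * thickness

  bodySize : ℕ
  bodySize = h + h * length rest

  module _ (N : ℕ) where

    baseK : ℕ
    baseK = blowK thickness vertices ((2 * N) ^ vertices)

    sparsity : ℕ
    sparsity = 8 * baseK * triples vertices thickness

    -- The factor `(2 ^ thickness) ^ vertices` is the loss from counting inside a set that contains
    -- at least half of all vertices.
    reachK : ℕ
    reachK = (2 ^ thickness) ^ vertices * (2 * baseK)

missed-all : ∀ {n} (G : Graph n) (U : List (Fin n)) (Z : Fin n → Bool) d l →
  All (λ v → S U (λ z → 𝟙 (not (adj G v z))) ≤ d) l →
  S U (𝟙 ∘ Z) ≤ S U (λ z → 𝟙 (Z z ∧ Greedy.allAdj G l z)) + length l * d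
missed-all {n} G U Z d l nd = ≤-trans (S-mono U (λ z → pointwise z (Z z)))
    (≤-trans (≤-reflexive (S-+ U _ _)) (+-monoʳ-≤ _ (≤-trans (≤-reflexive (S-swap U l _)) (missed l nd))))
  where
  open Greedy G
  misses : List (Fin n) → Fin n → ℕ
  misses l z = S l (λ v → 𝟙 (not (adj G v z)))
  allAdj-or : ∀ l z → 1 ≤ 𝟙 (allAdj l z) + misses l z
  allAdj-or []      z = ≤-refl
  allAdj-or (v ∷ l) z with adj G v z
  ... | true  = allAdj-or l z
  ... | false = s≤s z≤n
  pointwise : ∀ z b → 𝟙 b ≤ 𝟙 (b ∧ allAdj l z) + misses l z
  pointwise z false = z≤n
  pointwise z true  = allAdj-or l z
  missed : ∀ l → All (λ v → S U (λ z → 𝟙 (not (adj G v z))) ≤ d) l →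
    S l (λ v → S U (λ z → 𝟙 (not (adj G v z)))) ≤ length l * d
  missed []      []       = z≤n
  missed (v ∷ l) (p ∷ ps) = +-mono-≤ p (missed l ps)

-- a labelled selection of entries of a blow-up, one for each element of s
module Picking {h n : ℕ} (H : Graph h) {G : Graph n} (F : IncompatibilitySystem G) {q : ℕ} (E : Fin q → Fin q → Bool)
    (E-sym : ∀ i j → E i j ≡ E j i) (E-irr : ∀ i → E i i ≡ false) (t : ℕ) where
  open Tiling H G F
  open Clean F

  -- Element number `j` of `s` takes its entry from column `j`, so distinct coordinates, hence
  -- distinct vertices in a clean blow-up, are used even if `s` repeats labels.
  pick : ∀ {m} → m ≤ t → Vec (Fin q) m → Vec (Vec (Fin n) t) q → Vec (Fin n × Fin q) m
  pick le s w = Vec.tabulate λ j → get w (lookup s j) (Fin.inject≤ j le) , lookup s j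

  lookup-pick : ∀ {m} (le : m ≤ t) s w j → lookup (pick le s w) j ≡ (get w (lookup s j) (Fin.inject≤ j le) , lookup s j)
  lookup-pick le s w j = V.lookup∘tabulate _ j

  labels-pick : ∀ {m} (le : m ≤ t) s w → map proj₂ (toList (pick le s w)) ≡ toList s
  labels-pick le s w = ≡.trans (≡.sym (V.toList-map proj₂ (pick le s w)))
    (cong toList (≡.trans (≡.sym (V.tabulate-∘ proj₂ _)) (V.tabulate∘lookup s)))

  pick∈ : ∀ {m} (le : m ≤ t) s w {p} → p ∈ toList (pick le s w) →
    ∃[ i ] ∃[ j ] (p ≡ (get w i j , i))
  pick∈ le s w p∈ = let (j , e) = toList-∈ (pick le s w) p∈ in
    lookup s j , Fin.inject≤ j le , ≡.trans (≡.sym e) (lookup-pick le s w j)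

  module _ (w : Vec (Vec (Fin n) t) q) (adj-entries : ∀ i i′ j j′ → E i i′ ≡ true → adj G (get w i j) (get w i′ j′) ≡ true)
           (z : Fin n) (cl : clean q t z w ≡ true) where

    realises-root : ∀ c → (∀ i j → E c i ≡ true → adj G z (get w i j) ≡ true) →
      ∀ {m} (le : m ≤ t) s → Realises E ((z , c) ∷ toList (pick le s w))
    realises-root c adj-z le s = adjs , incs
      where
      adjs : ∀ {p q} → p ∈ (z , c) ∷ toList (pick le s w) → q ∈ (z , c) ∷ toList (pick le s w) →
        E (proj₂ p) (proj₂ q) ≡ true → adj G (proj₁ p) (proj₁ q) ≡ true
      adjs (here ≡.refl) (here ≡.refl) e = contradiction (≡.trans (≡.sym e) (E-irr c)) λ ()
      adjs (here ≡.refl) (there q∈) e with pick∈ le s w q∈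
      ... | i , j , ≡.refl = adj-z i j e
      adjs (there p∈) (here ≡.refl) e with pick∈ le s w p∈
      ... | i , j , ≡.refl = ≡.trans (Graph.sym G _ _) (adj-z i j (≡.trans (E-sym c i) e))
      adjs (there p∈) (there q∈) e with pick∈ le s w p∈ | pick∈ le s w q∈
      ... | i , j , ≡.refl | i′ , j′ , ≡.refl = adj-entries i i′ j j′ e
      coord : ∀ {p} → p ∈ (z , c) ∷ toList (pick le s w) → ∃[ κ ] (proj₁ p ≡ entry q t z w κ)
      coord (here ≡.refl) = nothing , ≡.refl
      coord (there p∈) with pick∈ le s w p∈
      ... | i , j , ≡.refl = just (i , j) , ≡.refl
      incs : ∀ {p q r} → p ∈ (z , c) ∷ toList (pick le s w) → q ∈ (z , c) ∷ toList (pick le s w) →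
        r ∈ (z , c) ∷ toList (pick le s w) → inc F (proj₁ p) (proj₁ q) (proj₁ r) ≡ false
      incs p∈ q∈ r∈ with coord p∈ | coord q∈ | coord r∈
      ... | κ , e | κ′ , e′ | κ″ , e″ rewrite e | e′ | e″ = clean-inc q t z w cl κ κ′ κ″

    realises-pick : ∀ {m} (le : m ≤ t) s → Realises E (toList (pick le s w))
    realises-pick le s = (λ p∈ q∈ e → adjs (pick∈ le s w p∈) (pick∈ le s w q∈) e)
        , λ p∈ q∈ r∈ → incs (pick∈ le s w p∈) (pick∈ le s w q∈) (pick∈ le s w r∈)
      where
      Entry : Fin n × Fin q → Set
      Entry p = ∃[ i ] ∃[ j ] (p ≡ (get w i j , i))
      adjs : ∀ {p r} → Entry p → Entry r → E (proj₂ p) (proj₂ r) ≡ true → adj G (proj₁ p) (proj₁ r) ≡ true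
      adjs (i , j , ≡.refl) (i′ , j′ , ≡.refl) = adj-entries i i′ j j′
      incs : ∀ {p r s} → Entry p → Entry r → Entry s → inc F (proj₁ p) (proj₁ r) (proj₁ s) ≡ false
      incs (i , j , ≡.refl) (i′ , j′ , ≡.refl) (i″ , j″ , ≡.refl) = clean-inc q t z w cl (just (i , j)) (just (i′ , j′)) (just (i″ , j″))

    private
      distinct : ∀ {m} (le : m ≤ t) s j j′ → j ≢ j′ → get w (lookup s j) (Fin.inject≤ j le) ≢ get w (lookup s j′) (Fin.inject≤ j′ le)
      distinct le s j j′ ne = clean-distinct q t z w cl (just (lookup s j , Fin.inject≤ j le)) (lookup s j′ , Fin.inject≤ j′ le)
        λ e → ne (Fin.inject≤-injective le le j j′ (cong proj₂ (Maybe.just-injective e)))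

      unique-toList : ∀ {m} (v : Vec (Fin n) m) → (∀ j j′ → j ≢ j′ → lookup v j ≢ lookup v j′) → Unique (toList v)
      unique-toList []      h = []
      unique-toList (u ∷ v) h = All.tabulate (λ u∈ e → let (j , e′) = toList-∈ v u∈ in h Fin.zero (Fin.suc j) (λ ()) (≡.trans e (≡.sym e′)))
        ∷ unique-toList v (λ j j′ ne → h (Fin.suc j) (Fin.suc j′) (ne ∘ Fin.suc-injective))

      lookup-proj : ∀ {m} (le : m ≤ t) s j → lookup (Vec.map proj₁ (pick le s w)) j ≡ get w (lookup s j) (Fin.inject≤ j le)
      lookup-proj le s j = ≡.trans (V.lookup-map j proj₁ (pick le s w)) (cong proj₁ (lookup-pick le s w j))

    unique-pick : ∀ {m} (le : m ≤ t) s → Unique (toList (Vec.map proj₁ (pick le s w)))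
    unique-pick le s = unique-toList _ λ j j′ ne e → distinct le s j j′ ne
      (≡.trans (≡.sym (lookup-proj le s j)) (≡.trans e (lookup-proj le s j′)))

module Reachability {h n : ℕ} {H : Graph h} {G : Graph n} (F : IncompatibilitySystem G) (P : Pattern H) where
  open Pattern P
  open Lattice.Exchange exchange
  open Tiling H G F
  open Greedy G
  open Clean F
  open PatternConstants P

  t : ℕ
  t = thickness

  Blown : Set
  Blown = Vec (Vec (Fin n) t) vertices

  roots : Fin n → Fin n → Fin vertices → List (Fin n)
  roots x y i = extend (E a i) x (extend (E b i) y [])

  free : Fin vertices → Fin n → Bool
  free _ _ = true

  -- The same list `active w` is then tiled together with `x` as well as with `y`, and `tileOf w`
  -- supplies a plain copy of `H`, which absorbers need as an intermediate tile.
  reach : Fin n → Fin n → Blown → Bool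
  reach x y w = blow t vertices (greedy vertices E free (roots x y)) w ∧ (clean vertices t x w ∧ clean vertices t y w)

  open Picking H F E E-sym E-irr t public

  restV : Vec (Fin vertices) (length rest)
  restV = Vec.fromList rest

  rest≤ : length rest ≤ t
  rest≤ = ≤-trans (m≤m+n (length rest) h) (n≤1+n _)

  h≤ : h ≤ t
  h≤ = ≤-trans (m≤n+m h (length rest)) (n≤1+n _)

  active : Blown → List (Fin n)
  active w = map proj₁ (toList (pick rest≤ restV w))

  tileOf : Blown → Vec (Fin n) h
  tileOf w = Vec.map proj₁ (pick h≤ tile w)

  entries : Blown → List (Fin n)
  entries w = concatMap toList (toList w)

  get∈entries : ∀ w i j → get w i j ∈ entries w
  get∈entries w i j = go w i
    where
    go : ∀ {q} (w : Vec (Vec (Fin n) t) q) i → get w i j ∈ concatMap toList (toList w)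
    go (r ∷ w) Fin.zero    = ∈-++⁺ˡ (∈-toList-lookup r j)
    go (r ∷ w) (Fin.suc i) = ∈-++⁺ʳ (toList r) (go w i)

  active⊆entries : ∀ w {v} → v ∈ active w → v ∈ entries w
  active⊆entries w v∈ with ∈.∈-map⁻ proj₁ v∈
  ... | p , p∈ , ≡.refl with pick∈ rest≤ restV w p∈
  ... | i , j , ≡.refl = get∈entries w i j

  tileOf⊆entries : ∀ w {v} → v ∈ toList (tileOf w) → v ∈ entries w
  tileOf⊆entries w v∈ with toList-∈ (tileOf w) v∈
  ... | j , e = subst (_∈ entries w) (≡.trans (≡.sym (≡.trans (V.lookup-map j proj₁ (pick h≤ tile w)) (cong proj₁ (lookup-pick h≤ tile w j)))) e)
                  (get∈entries w (lookup tile j) (Fin.inject≤ j h≤))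

  module _ {x y : Fin n} {w : Blown} (r : reach x y w ≡ true) where

    private
      blown : blow t vertices (greedy vertices E free (roots x y)) w ≡ true
      blown = ∧-elimˡ r
      cleans : clean vertices t x w ∧ clean vertices t y w ≡ true
      cleans = ∧-elimʳ {blow t vertices (greedy vertices E free (roots x y)) w} r
      clean-x : clean vertices t x w ≡ true
      clean-x = ∧-elimˡ cleans
      clean-y : clean vertices t y w ≡ true
      clean-y = ∧-elimʳ {clean vertices t x w} cleans

    open BlownGreedy G

    private
      adj-entries : ∀ i i′ j j′ → E i i′ ≡ true → adj G (get w i j) (get w i′ j′) ≡ true
      adj-entries = blown-adj t vertices E free (roots x y) w blown E-sym E-irr

      adj-x : ∀ i j → E a i ≡ true → adj G x (get w i j) ≡ true
      adj-x i j e = blown-C t vertices E free (roots x y) w blown i j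
        (subst (λ β → x ∈ extend β x (extend (E b i) y [])) (≡.sym e) (here ≡.refl))

      adj-y : ∀ i j → E b i ≡ true → adj G y (get w i j) ≡ true
      adj-y i j e = blown-C t vertices E free (roots x y) w blown i j
        (∈-extend (E a i) (subst (λ β → y ∈ extend β y []) (≡.sym e) (here ≡.refl)))

    reach-x : Tiled (x ∷ active w)
    reach-x = place E homsₐ validₐ ((x , a) ∷ toList (pick rest≤ restV w))
      (subst (λ l → a ∷ l ↭ concatMap toList homsₐ) (≡.sym (≡.trans (labels-pick rest≤ restV w) (V.toList∘fromList rest))) completeₐ)
      (realises-root w adj-entries x clean-x a adj-x rest≤ restV)

    reach-y : Tiled (y ∷ active w)
    reach-y = place E homsᵦ validᵦ ((y , b) ∷ toList (pick rest≤ restV w))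
      (subst (λ l → b ∷ l ↭ concatMap toList homsᵦ) (≡.sym (≡.trans (labels-pick rest≤ restV w) (V.toList∘fromList rest))) completeᵦ)
      (realises-root w adj-entries y clean-y b adj-y rest≤ restV)

    reach-tile : Tiled (toList (tileOf w))
    reach-tile = subst Tiled (≡.sym (V.toList-map proj₁ (pick h≤ tile w)))
      (place E (tile ∷ []) (tile-hom ∷ []) (toList (pick h≤ tile w))
        (↭-reflexive (≡.trans (labels-pick h≤ tile w) (≡.sym (L.++-identityʳ _))))
        (realises-pick w adj-entries x clean-x h≤ tile))

    reach-unique-active : Unique (active w)
    reach-unique-active = subst Unique (V.toList-map proj₁ (pick rest≤ restV w)) (unique-pick w adj-entries x clean-x rest≤ restV)

    reach-unique-tile : Unique (toList (tileOf w))
    reach-unique-tile = unique-pick w adj-entries x clean-x h≤ tile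

  module _ (N d m : ℕ) .{{_ : NonZero n}} .{{_ : NonZero N}}
           (nd : ∀ v → S (allFin n) (λ z → 𝟙 (not (adj G v z))) ≤ d)
           (few : ∀ v u → S (allFin n) (𝟙 ∘ inc F v u) ≤ m)
           (room : N * (depth * d) + n ≤ N * n)
           (sparse : sparsity N * suc m ≤ n) where

    module _ (U : List (Fin n)) (uniq : Unique U) (sub : ∀ f → S U f ≤ S (allFin n) f)
             (large : 2 * (N * n) ≤ 2 * (N * length U) + n) where

      private
        u = length U

        u≤n : u ≤ n
        u≤n = ≡.subst₂ _≤_ (S-one U) (≡.trans (S-one (allFin n)) (length-allFin n)) (sub (λ _ → 1))

        n≤2u : n ≤ 2 * u
        n≤2u = *-cancelˡ-≤ N (≤-from (N * n ∸ n) large eq)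
          where
          n≤Nn : n ≤ N * n
          n≤Nn = m≤n*m n N
          eq : N * n + (2 * (N * u) + n) + (N * n ∸ n) ≡ N * (2 * u) + 2 * (N * n)
          eq = ≡.trans (identity₁₃ (N * n) (N * u) n (N * n ∸ n)) (≡.trans (cong (λ z → N * n + 2 * (N * u) + z) (m+[n∸m]≡n n≤Nn)) (identity₁₂ (N * n) N u))

        γ = u ∸ depth * d

        many : ∀ (i : Fin vertices) l → All (λ _ → ⊤) l → length l ≤ depth →
          γ ≤ S U (λ z → 𝟙 (free i z ∧ allAdj l z))
        many i l _ le = m≤n+o⇒m∸n≤o u (depth * d) (begin
          u                                           ≡⟨ S-one U ⟨
          S U (λ _ → 1)                               ≤⟨ missed-all G U (λ _ → true) d l (All.tabulate (λ {v} _ → ≤-trans (sub _) (nd v))) ⟩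
          S U (𝟙 ∘ allAdj l) + length l * d           ≤⟨ +-monoʳ-≤ _ (*-monoˡ-≤ d le) ⟩
          S U (𝟙 ∘ allAdj l) + depth * d              ≡⟨ +-comm _ (depth * d) ⟩
          depth * d + S U (𝟙 ∘ allAdj l)              ∎)
          where open ≤-Reasoning

        -- By `room`, any `depth` vertices have at least `n / N` common neighbours, and by `large`
        -- at most half of this number is lost outside `U`.
        γ-large : u ≤ 2 * N * γ
        γ-large = ≤-trans u≤n (≤-from 0 (+-mono-≤ (+-mono-≤ (*-monoʳ-≤ 2 room) large) (*-monoʳ-≤ (2 * N) (m≤n+m∸n u (depth * d))))
          (identity₁₄ n N (depth * d) u γ))

        instance
          u≢0 : NonZero u
          u≢0 = ≢-nonZero λ e → <⇒≱ (>-nonZero⁻¹ n) (subst (λ k → n ≤ 2 * k) e n≤2u)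

      reach-dense : ∀ x y → (u ^ t) ^ vertices ≤ 2 * baseK N * S (vecs (vecs U t) vertices) (𝟙 ∘ reach x y)
      reach-dense x y = clean-dense vertices t U uniq m (λ v w → ≤-trans (sub _) (few v w)) x y (baseK N) _
        (blow-dense U (length rest + h) vertices ((2 * N) ^ vertices) (greedy vertices E free (roots x y)) (begin
          u ^ vertices                      ≤⟨ ^-monoˡ-≤ vertices γ-large ⟩
          (2 * N * γ) ^ vertices            ≡⟨ ^-distribʳ-* vertices (2 * N) γ ⟩
          (2 * N) ^ vertices * γ ^ vertices ≤⟨ *-monoʳ-≤ ((2 * N) ^ vertices) (greedy-dense U (λ _ → ⊤) γ vertices E free (roots x y) (λ _ → depth)
              (fits-mono vertices (λ i → ≤-reflexive (len i)) fits) (λ i → All.tabulate (λ _ → tt)) (λ _ _ _ → tt) many) ⟩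
          (2 * N) ^ vertices * S (vecs U vertices) (𝟙 ∘ greedy vertices E free (roots x y)) ∎))
        (*-cancelˡ-≤ 2 (begin
          2 * (2 * baseK N * (2 * (triples vertices thickness * suc m))) ≡⟨ identity₁₅ (baseK N) (triples vertices thickness) (suc m) ⟩
          sparsity N * suc m ≤⟨ sparse ⟩
          n ≤⟨ n≤2u ⟩
          2 * u ∎))
        where
        open ≤-Reasoning
        len : ∀ i → length (roots x y i) ≡ bump (E a i) (bump (E b i) 0)
        len i = ≡.trans (length-extend (E a i) x _) (cong (bump (E a i)) (length-extend (E b i) y []))

module _ {n : ℕ} where
  open DecMembership (Fin._≟_ {n}) public using (_∈?_)

memb : ∀ {n} → List (Fin n) → Fin n → Bool
memb U z = ⌊ z ∈? U ⌋

memb⇒∈ : ∀ {n} {U : List (Fin n)} {z} → memb U z ≡ true → z ∈ U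
memb⇒∈ {U = U} {z} e with z ∈? U
... | yes p = p

∈⇒memb : ∀ {n} {U : List (Fin n)} {z} → z ∈ U → memb U z ≡ true
∈⇒memb {U = U} {z} p with z ∈? U
... | yes _ = ≡.refl
... | no ¬p = contradiction p ¬p

minus : ∀ {n} → List (Fin n) → List (Fin n) → List (Fin n)
minus U l = List.filter (λ z → ¬? (z ∈? l)) U

minus-unique : ∀ {n} {U : List (Fin n)} l → Unique U → Unique (minus U l)
minus-unique l = filter⁺ (λ z → ¬? (z ∈? l))

minus-∈ : ∀ {n} (U l : List (Fin n)) {z} → z ∈ minus U l → z ∈ U × ¬ (z ∈ l)
minus-∈ U l = ∈.∈-filter⁻ (λ z → ¬? (z ∈? l)) {xs = U}

S-memb≤ : ∀ {n} (U l : List (Fin n)) → Unique U → S U (𝟙 ∘ memb l) ≤ length l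
S-memb≤ U l u = begin
  S U (𝟙 ∘ memb l)                               ≤⟨ S-mono U (λ z → hit z l) ⟩
  S U (λ z → S l (λ v → 𝟙 ⌊ z Fin.≟ v ⌋))        ≡⟨ S-swap U l _ ⟩
  S l (λ v → S U (λ z → 𝟙 ⌊ z Fin.≟ v ⌋))        ≤⟨ S≤length* l 1 (λ v → S-≟≤1 U u v) ⟩
  length l * 1                                   ≡⟨ *-identityʳ _ ⟩
  length l ∎
  where
  open ≤-Reasoning
  hit : ∀ z l → 𝟙 (memb l z) ≤ S l (λ v → 𝟙 ⌊ z Fin.≟ v ⌋)
  hit z l with memb l z in eq
  ... | false = z≤n
  ... | true  = ≤-trans (≤-reflexive (≡.sym (𝟙≟-refl z))) (S-∈ (λ v → 𝟙 ⌊ z Fin.≟ v ⌋) (memb⇒∈ eq))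

length-minus : ∀ {n} (U l : List (Fin n)) → Unique U → length U ≤ length (minus U l) + length l
length-minus U l u = ≤-trans (≤-reflexive (go U)) (+-monoʳ-≤ _ (S-memb≤ U l u))
  where
  go : ∀ U → length U ≡ length (minus U l) + S U (𝟙 ∘ memb l)
  go [] = ≡.refl
  go (z ∷ U) with z ∈? l
  ... | yes _ = ≡.trans (cong suc (go U)) (≡.sym (+-suc _ _))
  ... | no _  = cong suc (go U)

S-sub : ∀ {n} {U : List (Fin n)} → Unique U → ∀ f → S U f ≤ S (allFin n) f
S-sub {n} {U} u f = let (U′ , e) = complement U u (λ _ → ∈.∈-allFin _) in
  ≤-trans (m≤m+n _ (S U′ f)) (≤-reflexive (≡.trans (≡.sym (S-++ U U′ f)) (≡.sym (S-↭ f e))))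

S-restrict : ∀ {n} {U : List (Fin n)} → Unique U → ∀ f → S U f ≤ S (allFin n) (λ z → 𝟙 (memb U z) * f z)
S-restrict {U = U} u f = ≤-trans
  (≤-reflexive (S-cong∈ U (λ {z} z∈ → ≡.sym (≡.trans (cong (λ b → 𝟙 b * f z) (∈⇒memb z∈)) (*-identityˡ (f z))))))
  (S-sub u _)

vecs-restrict : ∀ (xs ys : List A) (In : A → Bool) → (∀ f → S xs f ≤ S ys (λ z → 𝟙 (In z) * f z)) →
  ∀ p f → S (vecs xs p) f ≤ S (vecs ys p) (λ v → 𝟙 (allV In v) * f v)
vecs-restrict xs ys In h zero f = +-monoˡ-≤ 0 (≤-reflexive (≡.sym (*-identityˡ (f []))))
vecs-restrict xs ys In h (suc p) f = begin
  S (vecs xs (suc p)) f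
    ≡⟨ S-vecs xs p f ⟩
  S xs (λ x → S (vecs xs p) (λ v → f (x ∷ v)))
    ≤⟨ S-mono xs (λ x → vecs-restrict xs ys In h p (λ v → f (x ∷ v))) ⟩
  S xs (λ x → S (vecs ys p) (λ v → 𝟙 (allV In v) * f (x ∷ v)))
    ≤⟨ h _ ⟩
  S ys (λ z → 𝟙 (In z) * S (vecs ys p) (λ v → 𝟙 (allV In v) * f (z ∷ v)))
    ≡⟨ S-cong ys (λ z → ≡.trans (≡.sym (S-*ˡ (vecs ys p) (𝟙 (In z)) _)) (S-cong (vecs ys p) (λ v →
         ≡.trans (≡.sym (*-assoc (𝟙 (In z)) _ _)) (cong (_* f (z ∷ v)) (≡.sym (𝟙-∧ (In z) (allV In v))))))) ⟩
  S ys (λ z → S (vecs ys p) (λ v → 𝟙 (allV In (z ∷ v)) * f (z ∷ v)))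
    ≡⟨ S-vecs ys p _ ⟨
  S (vecs ys (suc p)) (λ v → 𝟙 (allV In v) * f v) ∎
  where open ≤-Reasoning

-- Selecting a reserve of absorbers

bernoulli : ∀ a k → a ^ k * (a + k) ≤ suc a ^ k * a
bernoulli a zero    = ≤-reflexive (cong (λ k → k + 0) (+-identityʳ a))
bernoulli a (suc k) = ≤-from (a ^ k * k) (*-monoʳ-≤ (suc a) (bernoulli a k)) (identity₂₆ a k (a ^ k) (suc a ^ k))

halving : ∀ a → .{{_ : NonZero a}} → 2 * a ^ suc a ≤ suc a ^ suc a
halving a = *-cancelʳ-≤ _ _ a (≤-trans (≤-from (a ^ suc a) ≤-refl (identity₂₅ a (a ^ suc a) 0)) (bernoulli a (suc a)))

halving-^ : ∀ a → .{{_ : NonZero a}} → ∀ l → 2 ^ l * a ^ (suc a * l) ≤ suc a ^ (suc a * l)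
halving-^ a l = ≡.subst₂ _≤_
  (≡.trans (^-distribʳ-* l 2 (a ^ suc a)) (cong (2 ^ l *_) (^-*-assoc a (suc a) l)))
  (^-*-assoc (suc a) (suc a) l) (^-monoˡ-≤ l (halving a))

-- With `Q = 2 * K₀ + 2`, each round multiplies the potential by at most `(Q - 1) / Q`, and `Q`
-- rounds halve it. After `Q * (2 * l)` rounds the factor `2 ^ (2 * l)` is gained: one `2 ^ l`
-- outweighs the number of tuples, the other yields `l` absorbers for each.
reserveSize : ℕ → ℕ → ℕ
reserveSize K₀ l = suc (suc (2 * K₀)) * (2 * l)

module Selection {h n : ℕ} (H : Graph h) (G : Graph n) (F : IncompatibilitySystem G)
    .{{_ : NonZero n}} {Candidate : Set} (candidates : List Candidate) (nonempty : 0 < length candidates)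
    (good : List (Fin n) → Vec (Fin n) h → Candidate → Bool) (bodyOf : Candidate → List (Fin n))
    (bodySize : ℕ) (length-bodyOf : ∀ ω → length (bodyOf ω) ≡ bodySize) (K₀ N loss : ℕ)
    (good-dense : ∀ r U → Unique U → n ≤ length U + r → 2 * (N * (r + loss)) ≤ n → ∀ X →
      length candidates ≤ K₀ * S candidates (𝟙 ∘ good U X))
    (good-∈ : ∀ {U ω X} → good U X ω ≡ true → ∀ {v} → v ∈ bodyOf ω → v ∈ U)
    (good-unique : ∀ {U ω X} → good U X ω ≡ true → Unique (bodyOf ω))
    (good-tiled : ∀ {U ω X} → good U X ω ≡ true → Tiling.Tiled H G F (bodyOf ω))
    (good-absorb : ∀ {U ω X} → good U X ω ≡ true → Tiling.Tiled H G F (toList X ++ bodyOf ω)) where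
  open Tiling H G F

  Index : Set
  Index = Vec (Fin n) h

  indices : List Index
  indices = vecs (allFin n) h

  record Absorber : Set where
    field
      body        : List (Fin n)
      body-unique : Unique body
      body-tiled  : Tiled body
      serves      : Index → Bool
      absorb      : ∀ X → serves X ≡ true → Tiled (toList X ++ body)
  open Absorber public

  private
    Q₁ Q : ℕ
    Q₁ = suc (2 * K₀)
    Q  = suc Q₁

  bodies : List Absorber → List (Fin n)
  bodies = concatMap body

  record Selected (s : ℕ) (U : List (Fin n)) (e : Index → ℕ) : Set where
    field
      chosen   : List Absorber
      e′       : Index → ℕ
      unique   : Unique (bodies chosen)
      inside   : ∀ {v} → v ∈ bodies chosen → v ∈ U
      short    : length (bodies chosen) ≤ s * bodySize
      balance  : ∀ X → e X ≡ e′ X + S chosen (λ c → 𝟙 (serves c X))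
      decrease : Q ^ s * S indices (λ X → 2 ^ e′ X) ≤ Q₁ ^ s * S indices (λ X → 2 ^ e X)

  -- A round lowers each `e X` by at most one, so `s ≤ e X` keeps the truncated subtraction exact.
  -- The term `loss` is the number of vertices blocked while a single candidate is being built, in
  -- addition to the bodies chosen before.
  select : ∀ s r U → Unique U → n ≤ length U + r → 2 * (N * (r + s * bodySize + loss)) ≤ n →
    (e : Index → ℕ) → (∀ X → s ≤ e X) → Selected s U e
  select zero r U uniq n≤ small e s≤e = record
    { chosen = [] ; e′ = e ; unique = [] ; inside = λ () ; short = z≤n
    ; balance = λ X → ≡.sym (+-identityʳ (e X)) ; decrease = ≤-refl }
  select (suc s) r U uniq n≤ small e s≤e = record
    { chosen = A₀ ∷ chosen ; e′ = e′
    ; unique = unique-++⁺ (body-unique A₀) unique (λ p q → proj₂ (minus-∈ U (bodyOf ω) (inside q)) p)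
    ; inside = λ v∈ → inside′ (∈-++⁻ (bodyOf ω) v∈)
    ; short = ≤-trans (≤-reflexive (L.length-++ (bodyOf ω))) (+-mono-≤ (≤-reflexive (length-bodyOf ω)) short)
    ; balance = λ X → ≡.trans (balance₁ X) (≡.trans (cong (_+ 𝟙 (good U X ω)) (balance X)) (identity₂₄ (e′ X) _ (𝟙 (good U X ω))))
    ; decrease = begin
        Q * Q ^ s * S indices (λ X → 2 ^ e′ X)      ≡⟨ *-assoc Q (Q ^ s) _ ⟩
        Q * (Q ^ s * S indices (λ X → 2 ^ e′ X))    ≤⟨ *-monoʳ-≤ Q decrease ⟩
        Q * (Q₁ ^ s * Φ₁)                           ≡⟨ identity₆ Q (Q₁ ^ s) Φ₁ ⟩
        Q₁ ^ s * (Q * Φ₁)                           ≤⟨ *-monoʳ-≤ (Q₁ ^ s) drop-Φ ⟩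
        Q₁ ^ s * (Q₁ * Φ)                           ≡⟨ identity₂₃ (Q₁ ^ s) Q₁ Φ ⟩
        Q₁ * Q₁ ^ s * Φ                             ∎ }
    where
    open ≤-Reasoning
    Φ = S indices (λ X → 2 ^ e X)
    gain : Candidate → ℕ
    gain ω = S indices (λ X → 2 ^ e X * 𝟙 (good U X ω))
    total : length candidates * Φ ≤ K₀ * S candidates gain
    total = begin
      length candidates * Φ
        ≡⟨ S-*ˡ indices (length candidates) _ ⟨
      S indices (λ X → length candidates * 2 ^ e X)
        ≤⟨ S-mono indices (λ X → *-monoˡ-≤ (2 ^ e X) (good-dense r U uniq n≤ small′ X)) ⟩
      S indices (λ X → K₀ * S candidates (𝟙 ∘ good U X) * 2 ^ e X)
        ≡⟨ S-cong indices (λ X → ≡.trans (identity₂₂ K₀ (S candidates (𝟙 ∘ good U X)) (2 ^ e X)) (cong (K₀ *_) (≡.sym (S-*ˡ candidates (2 ^ e X) _)))) ⟩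
      S indices (λ X → K₀ * S candidates (λ ω → 2 ^ e X * 𝟙 (good U X ω)))
        ≡⟨ ≡.trans (S-*ˡ indices K₀ _) (cong (K₀ *_) (S-swap indices candidates _)) ⟩
      K₀ * S candidates gain ∎
      where
      small′ : 2 * (N * (r + loss)) ≤ n
      small′ = ≤-trans (*-monoʳ-≤ 2 (*-monoʳ-≤ N (+-monoˡ-≤ (loss) (m≤m+n r (suc s * bodySize))))) small
    best : ∃[ ω ] (ω ∈ candidates × 0 < K₀ * gain ω × Φ ≤ K₀ * gain ω)
    best = S-avg candidates (λ ω → K₀ * gain ω) (λ _ → Φ) (≤-trans total>0 total′) total′
      where
      total′ : S candidates (λ _ → Φ) ≤ S candidates (λ ω → K₀ * gain ω)
      total′ = ≡.subst₂ _≤_ (≡.sym (S-const candidates Φ)) (≡.sym (S-*ˡ candidates K₀ gain)) total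
      Φ>0 : 0 < Φ
      Φ>0 = ≤-trans (m^n>0 2 (e X₀)) (S-∈ (λ X → 2 ^ e X) (∈-vecs ∈.∈-allFin X₀))
        where X₀ : Index
              X₀ = Vec.replicate h (Fin.fromℕ< (>-nonZero⁻¹ n))
      total>0 : 0 < S candidates (λ _ → Φ)
      total>0 = ≤-trans (*-mono-≤ nonempty Φ>0) (≤-reflexive (≡.sym (S-const candidates Φ)))
    ω = proj₁ best
    witness : ∃[ X ] (good U X ω ≡ true)
    witness = S-weighted indices (λ X → 2 ^ e X) (λ X → good U X ω) (positive K₀ (proj₁ (proj₂ (proj₂ best))))
      where
      positive : ∀ k {x} → 0 < k * x → 0 < x
      positive k {zero}  lt = contradiction (subst (0 <_) (*-zeroʳ k) lt) λ ()
      positive k {suc x} lt = z<s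
    gω = proj₂ witness
    A₀ : Absorber
    A₀ = record { body = bodyOf ω ; body-unique = good-unique {U} {ω} gω ; body-tiled = good-tiled {U} {ω} gω
                ; serves = λ X → good U X ω ; absorb = λ X g → good-absorb {U} {ω} g }
    U₁ = minus U (bodyOf ω)
    e₁ : Index → ℕ
    e₁ X = e X ∸ 𝟙 (good U X ω)
    𝟙≤e : ∀ X → 𝟙 (good U X ω) ≤ e X
    𝟙≤e X = ≤-trans (𝟙≤1 _) (≤-trans (s≤s z≤n) (s≤e X))
    balance₁ : ∀ X → e X ≡ e₁ X + 𝟙 (good U X ω)
    balance₁ X = ≡.sym (m∸n+n≡m (𝟙≤e X))
    rec : Selected s U₁ e₁
    rec = select s (r + bodySize) U₁ (minus-unique (bodyOf ω) uniq)
      (≤-from 0 (+-mono-≤ n≤ (≤-trans (length-minus U (bodyOf ω) uniq) (≤-reflexive (cong (length U₁ +_) (length-bodyOf ω)))))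
        (identity₁₇ n (length U) r (length U₁) bodySize))
      (≤-trans (≤-reflexive (cong (λ z → 2 * (N * (z + loss))) (+-assoc r bodySize (s * bodySize)))) small)
      e₁ (λ X → ∸-mono (s≤e X) (𝟙≤1 (good U X ω)))
    open Selected rec
    Φ₁ = S indices (λ X → 2 ^ e₁ X)
    inside′ : ∀ {v} → v ∈ bodyOf ω ⊎ v ∈ bodies chosen → v ∈ U
    inside′ (inj₁ p) = good-∈ {U} {ω} gω p
    inside′ (inj₂ p) = proj₁ (minus-∈ U (bodyOf ω) (inside p))
    -- Each tuple served by `ω` has its summand halved, so the potential drops by half of `gain ω`.
    halves : 2 * Φ₁ + gain ω ≡ 2 * Φ
    halves = ≡.trans (cong (_+ gain ω) (≡.sym (S-*ˡ indices 2 _))) (≡.trans (≡.sym (S-+ indices _ _))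
      (≡.trans (S-cong indices (λ X → pointwise (e X) (good U X ω) (𝟙≤e X))) (S-*ˡ indices 2 _)))
      where
      pointwise : ∀ k b → 𝟙 b ≤ k → 2 * 2 ^ (k ∸ 𝟙 b) + 2 ^ k * 𝟙 b ≡ 2 * 2 ^ k
      pointwise k       false _ = ≡.trans (cong (2 * 2 ^ k +_) (*-zeroʳ (2 ^ k))) (+-identityʳ _)
      pointwise (suc k) true  _ = identity₁₆ (2 ^ k)
    -- Q = 2 K₀ + 2 and Φ ≤ K₀ gain
    drop-Φ : Q * Φ₁ ≤ Q₁ * Φ
    drop-Φ = *-cancelˡ-≤ 2 (≤-from (2 * gain ω) (+-mono-≤ (*-monoʳ-≤ 2 (proj₂ (proj₂ (proj₂ best)))) (≤-reflexive (cong (λ z → (2 * K₀ + 2) * z) halves)))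
      (identity₂₁ K₀ Φ Φ₁ (gain ω)))

  record Reserve (l : ℕ) : Set where
    field
      chosen : List Absorber
      unique : Unique (bodies chosen)
      short  : length (bodies chosen) ≤ reserveSize K₀ l * bodySize
      plenty : ∀ X → l ≤ S chosen (λ c → 𝟙 (serves c X))

  reserve : ∀ l → n ^ h ≤ 2 ^ l → 2 * (N * (reserveSize K₀ l * bodySize + loss)) ≤ n → Reserve l
  reserve l pow small = record { chosen = chosen ; unique = unique ; short = short ; plenty = plenty }
    where
    s = reserveSize K₀ l
    open Selected (select s 0 (allFin n) (allFin⁺ n) (≤-reflexive (≡.sym (≡.trans (+-identityʳ _) (length-allFin n)))) small (λ _ → s) (λ _ → ≤-refl))
    plenty : ∀ X → l ≤ S chosen (λ c → 𝟙 (serves c X))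
    -- All exponents start at `s`, so the summand of `X` ends as `2 ^ (s ∸ c)`. It is at most the
    -- whole final potential, and comparison with `n ^ h ≤ 2 ^ l` leaves `l ≤ c`.
    plenty X = ≮⇒≥ λ lt → <⇒≱ (^-monoʳ-< 2 (s≤s (s≤s z≤n)) (+-monoʳ-< l lt)) (begin
        2 ^ (l + l)            ≡⟨ cong (λ z → 2 ^ (l + z)) (+-identityʳ l) ⟨
        2 ^ (2 * l)            ≤⟨ main ⟩
        n ^ h * 2 ^ c          ≤⟨ *-monoˡ-≤ (2 ^ c) pow ⟩
        2 ^ l * 2 ^ c          ≡⟨ ^-distribˡ-+-* 2 l c ⟨
        2 ^ (l + c)            ∎)
      where
      open ≤-Reasoning
      c = S chosen (λ c → 𝟙 (serves c X))
      instance
        Q₁^≢0 : NonZero (Q₁ ^ s)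
        Q₁^≢0 = m^n≢0 Q₁ s
        2^≢0 : NonZero (2 ^ e′ X)
        2^≢0 = m^n≢0 2 (e′ X)
      main : 2 ^ (2 * l) ≤ n ^ h * 2 ^ c
      main = *-cancelʳ-≤ _ _ (Q₁ ^ s) (*-cancelʳ-≤ _ _ (2 ^ e′ X) (begin
        2 ^ (2 * l) * Q₁ ^ s * 2 ^ e′ X                   ≤⟨ *-monoˡ-≤ (2 ^ e′ X) (halving-^ Q₁ (2 * l)) ⟩
        Q ^ s * 2 ^ e′ X                                  ≤⟨ *-monoʳ-≤ (Q ^ s) (S-∈ (λ X → 2 ^ e′ X) (∈-vecs ∈.∈-allFin X)) ⟩
        Q ^ s * S indices (λ X → 2 ^ e′ X)                ≤⟨ decrease ⟩
        Q₁ ^ s * S indices (λ X → 2 ^ s)                  ≡⟨ cong (Q₁ ^ s *_) (≡.trans (S-const indices _) (cong (_* 2 ^ s) (≡.trans (length-vecs (allFin n) h) (cong (_^ h) (length-allFin n))))) ⟩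
        Q₁ ^ s * (n ^ h * 2 ^ s)                          ≡⟨ cong (λ z → Q₁ ^ s * (n ^ h * z)) (≡.trans (cong (2 ^_) (balance X)) (^-distribˡ-+-* 2 (e′ X) c)) ⟩
        Q₁ ^ s * (n ^ h * (2 ^ e′ X * 2 ^ c))             ≡⟨ identity₂₀ (Q₁ ^ s) (n ^ h) (2 ^ e′ X) (2 ^ c) ⟩
        n ^ h * 2 ^ c * Q₁ ^ s * 2 ^ e′ X                 ∎))

  bodies-tiled : ∀ cs → Tiled (bodies cs)
  bodies-tiled []       = tiled-[]
  bodies-tiled (c ∷ cs) = tiled-++ (body-tiled c) (bodies-tiled cs)

  -- Using one absorber costs any other tuple at most one of its servers, so the tuples can be
  -- served in any order, even if they all compete for the same absorbers.
  absorb-all : ∀ (Xs : List Index) cs → (∀ X → length Xs ≤ S cs (λ c → 𝟙 (serves c X))) → Tiled (concatMap toList Xs ++ bodies cs)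
  absorb-all []       cs enough = bodies-tiled cs
  absorb-all (X ∷ Xs) cs enough with server cs (≤-trans (s≤s z≤n) (enough X))
    where
    server : ∀ cs → 0 < S cs (λ c → 𝟙 (serves c X)) → ∃[ c ] ∃[ cs′ ] (cs ↭ c ∷ cs′ × serves c X ≡ true)
    server (c ∷ cs) lt with serves c X in eq
    ... | true  = c , cs , ↭-refl , eq
    ... | false = let (c′ , cs′ , p , e) = server cs lt in c′ , c ∷ cs′ , trans (prep c p) (_↭_.swap c c′ ↭-refl) , e
  ... | c , cs′ , p , sv = tiled-↭ (trans (++⁺ˡ (toList X ++ concatMap toList Xs) (concat-↭ p)) (rearrange (toList X) (concatMap toList Xs) (body c) (bodies cs′)))
      (tiled-++ (absorb c X sv) (absorb-all Xs cs′ enough′))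
    where
    concat-↭ : ∀ {cs ds} → cs ↭ ds → bodies cs ↭ bodies ds
    concat-↭ _↭_.refl = ↭-refl
    concat-↭ (prep x p) = ++⁺ˡ (body x) (concat-↭ p)
    concat-↭ (_↭_.swap x y p) = trans (shifts (body x) (body y)) (++⁺ˡ (body y) (++⁺ˡ (body x) (concat-↭ p)))
    concat-↭ (trans p q) = trans (concat-↭ p) (concat-↭ q)
    rearrange : ∀ (as bs cs ds : List (Fin n)) → (as ++ bs) ++ (cs ++ ds) ↭ (as ++ cs) ++ (bs ++ ds)
    rearrange as bs cs ds = trans (↭-reflexive (L.++-assoc as bs (cs ++ ds)))
      (trans (++⁺ˡ as (shifts bs cs)) (↭-reflexive (≡.sym (L.++-assoc as cs (bs ++ ds)))))
    enough′ : ∀ Y → length Xs ≤ S cs′ (λ c → 𝟙 (serves c Y))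
    enough′ Y = ≤-pred (≤-trans (enough Y) (≤-trans (≤-reflexive (S-↭ _ p)) (+-monoˡ-≤ _ (𝟙≤1 (serves c Y)))))

-- Absorbers of tuples of `h` vertices

module Absorption {h n : ℕ} {H : Graph h} {G : Graph n} (F : IncompatibilitySystem G) (P : Pattern H)
    (N d m : ℕ) .{{_ : NonZero n}} .{{_ : NonZero N}}
    (nd : ∀ v → S (allFin n) (λ z → 𝟙 (not (adj G v z))) ≤ d)
    (few : ∀ v u → S (allFin n) (𝟙 ∘ inc F v u) ≤ m)
    (room : N * (Pattern.depth P * d) + n ≤ N * n)
    (sparse : PatternConstants.sparsity P N * suc m ≤ n) where
  open Pattern P
  open Lattice.Exchange exchange using (rest)
  open PatternConstants P using (size; bodySize; baseK; reachK)
  open Reachability F P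
  open Tiling H G F

  blowns : List Blown
  blowns = vecs (vecs (allFin n) t) vertices

  within : List (Fin n) → Blown → Bool
  within U = allV (allV (memb U))

  within-∈ : ∀ {U w} → within U w ≡ true → ∀ {v} → v ∈ entries w → v ∈ U
  within-∈ {U} {w} = go w
    where
    inner : ∀ {p} (r : Vec (Fin n) p) → allV (memb U) r ≡ true → ∀ {v} → v ∈ toList r → v ∈ U
    inner (z ∷ r) e (here ≡.refl) = memb⇒∈ (∧-elimˡ e)
    inner (z ∷ r) e (there v∈)    = inner r (∧-elimʳ {memb U z} e) v∈
    go : ∀ {q} (w : Vec (Vec (Fin n) t) q) → allV (allV (memb U)) w ≡ true → ∀ {v} → v ∈ concatMap toList (toList w) → v ∈ U
    go (r ∷ w) e v∈ with ∈-++⁻ (toList r) v∈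
    ... | inj₁ p = inner r (∧-elimˡ e) p
    ... | inj₂ p = go w (∧-elimʳ {allV (memb U) r} e) p

  length-entries : ∀ w → length (entries w) ≡ size
  length-entries w = go w
    where
    go : ∀ {q} (w : Vec (Vec (Fin n) t) q) → length (concatMap toList (toList w)) ≡ q * t
    go [] = ≡.refl
    go (r ∷ w) = ≡.trans (L.length-++ (toList r)) (cong₂ _+_ (V.length-toList r) (go w))

  blownN : ℕ
  blownN = (n ^ t) ^ vertices

  K₂ : ℕ
  K₂ = reachK N

  reach-within-dense : ∀ r U → Unique U → n ≤ length U + r → 2 * (N * r) ≤ n → ∀ x y →
    blownN ≤ K₂ * S blowns (λ w → 𝟙 (reach x y w ∧ within U w))
  reach-within-dense r U uniq n≤ small x y = begin
    (n ^ t) ^ vertices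
      ≤⟨ ^-monoˡ-≤ vertices (^-monoˡ-≤ t n≤2u) ⟩
    ((2 * u) ^ t) ^ vertices
      ≡⟨ ≡.trans (cong (_^ vertices) (^-distribʳ-* t 2 u)) (^-distribʳ-* vertices (2 ^ t) (u ^ t)) ⟩
    (2 ^ t) ^ vertices * (u ^ t) ^ vertices
      ≤⟨ *-monoʳ-≤ ((2 ^ t) ^ vertices) (reach-dense N d m nd few room sparse U uniq (S-sub uniq) large x y) ⟩
    (2 ^ t) ^ vertices * (2 * baseK N * S (vecs (vecs U t) vertices) (𝟙 ∘ reach x y))
      ≡⟨ *-assoc ((2 ^ t) ^ vertices) _ _ ⟨
    K₂ * S (vecs (vecs U t) vertices) (𝟙 ∘ reach x y)
      ≤⟨ *-monoʳ-≤ K₂ (vecs-restrict (vecs U t) (vecs (allFin n) t) (allV (memb U))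
           (vecs-restrict U (allFin n) (memb U) (S-restrict uniq) t) vertices (𝟙 ∘ reach x y)) ⟩
    K₂ * S blowns (λ w → 𝟙 (within U w) * 𝟙 (reach x y w))
      ≡⟨ cong (K₂ *_) (S-cong blowns (λ w → ≡.trans (*-comm (𝟙 (within U w)) _) (≡.sym (𝟙-∧ (reach x y w) (within U w))))) ⟩
    K₂ * S blowns (λ w → 𝟙 (reach x y w ∧ within U w)) ∎
    where
    open ≤-Reasoning
    u = length U
    large : 2 * (N * n) ≤ 2 * (N * u) + n
    large = ≤-from 0 (+-mono-≤ (*-monoʳ-≤ (2 * N) n≤) small) (identity₁₉ N n u r)
    n≤2u : n ≤ 2 * u
    n≤2u = ≤-from 0 (+-mono-≤ (*-monoʳ-≤ 2 n≤) (≤-trans (*-monoʳ-≤ 2 (m≤n*m r N)) small)) (identity₁₈ n u r)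

  -- Each blow-up is drawn from what the previous ones leave. All of `entries w` is discarded
  -- although only part of it is used, which costs a constant and makes disjointness immediate.
  absorbs : List (Fin n) → ∀ {k} → Vec (Fin n × Fin n) k → Vec Blown k → Bool
  absorbs U []             []       = true
  absorbs U ((x , y) ∷ ps) (w ∷ ws) = (reach x y w ∧ within U w) ∧ absorbs (minus U (entries w)) ps ws

  S-∧ : ∀ (xs : List A) (ys : List ℬ) (f : A → Bool) (g : A → ℬ → Bool) {a b} k l →
    b ≤ l * S xs (𝟙 ∘ f) → (∀ x → f x ≡ true → a ≤ k * S ys (𝟙 ∘ g x)) →
    b * a ≤ l * k * S xs (λ x → S ys (λ y → 𝟙 (f x ∧ g x y)))
  S-∧ xs ys f g {a} {b} k l p h = begin
    b * a                                                    ≤⟨ *-monoˡ-≤ a p ⟩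
    l * S xs (𝟙 ∘ f) * a                                     ≡⟨ ≡.trans (*-assoc l _ a) (cong (l *_) (≡.sym (S-*ʳ xs a (𝟙 ∘ f)))) ⟩
    l * S xs (λ x → 𝟙 (f x) * a)                             ≤⟨ *-monoʳ-≤ l (S-mono xs pointwise) ⟩
    l * S xs (λ x → k * S ys (λ y → 𝟙 (f x ∧ g x y)))        ≡⟨ ≡.trans (cong (l *_) (S-*ˡ xs k _)) (≡.sym (*-assoc l k _)) ⟩
    l * k * S xs (λ x → S ys (λ y → 𝟙 (f x ∧ g x y)))        ∎
    where
    open ≤-Reasoning
    pointwise : ∀ x → 𝟙 (f x) * a ≤ k * S ys (λ y → 𝟙 (f x ∧ g x y))
    pointwise x with f x in eq
    ... | false = z≤n
    ... | true  = ≤-trans (≤-reflexive (*-identityˡ a)) (h x eq)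

  private
    shrink : ∀ {r} U w → Unique U → n ≤ length U + r → n ≤ length (minus U (entries w)) + (r + size)
    shrink {r} U w uniq n≤ = ≤-from 0 (+-mono-≤ n≤ (≤-trans (length-minus U (entries w) uniq)
        (≤-reflexive (cong (length (minus U (entries w)) +_) (length-entries w)))))
      (identity₁₇ n (length U) r (length (minus U (entries w))) size)

  absorbs-dense : ∀ k (ps : Vec (Fin n × Fin n) k) r U → Unique U → n ≤ length U + r → 2 * (N * (r + k * size)) ≤ n →
    blownN ^ k ≤ K₂ ^ k * S (vecs blowns k) (𝟙 ∘ absorbs U ps)
  absorbs-dense zero [] r U uniq n≤ small = ≤-refl
  absorbs-dense (suc k) ((x , y) ∷ ps) r U uniq n≤ small = ≤-trans
    (S-∧ blowns (vecs blowns k) (λ w → reach x y w ∧ within U w) (λ w → absorbs (minus U (entries w)) ps) (K₂ ^ k) K₂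
      (reach-within-dense r U uniq n≤ (≤-trans (*-monoʳ-≤ 2 (*-monoʳ-≤ N (m≤m+n r _))) small) x y)
      (λ w _ → absorbs-dense k ps (r + size) (minus U (entries w)) (minus-unique (entries w) uniq) (shrink U w uniq n≤)
        (≤-trans (≤-reflexive (cong (λ z → 2 * (N * z)) (+-assoc r size (k * size)))) small)))
    (≤-reflexive (cong (K₂ ^ suc k *_) (≡.sym (S-vecs blowns k _))))

  actives : ∀ {k} → Vec Blown k → List (Fin n)
  actives ws = concatMap active (toList ws)

  firsts seconds : ∀ {k} → Vec (Fin n × Fin n) k → List (Fin n)
  firsts ps  = map proj₁ (toList ps)
  seconds ps = map proj₂ (toList ps)

  private
    interleave : ∀ x (xs as bs : List (Fin n)) → (x ∷ xs) ++ (as ++ bs) ↭ (x ∷ as) ++ (xs ++ bs)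
    interleave x xs as bs = prep x (shifts xs as)

  absorbs-firsts : ∀ U {k} (ps : Vec (Fin n × Fin n) k) ws → absorbs U ps ws ≡ true → Tiled (firsts ps ++ actives ws)
  absorbs-firsts U []             []       e = tiled-[]
  absorbs-firsts U ((x , y) ∷ ps) (w ∷ ws) e = tiled-↭ (interleave x (firsts ps) (active w) (actives ws))
    (tiled-++ (reach-x {x} {y} (∧-elimˡ (∧-elimˡ e)))
      (absorbs-firsts _ ps ws (∧-elimʳ {reach x y w ∧ within U w} e)))

  absorbs-seconds : ∀ U {k} (ps : Vec (Fin n × Fin n) k) ws → absorbs U ps ws ≡ true → Tiled (seconds ps ++ actives ws)
  absorbs-seconds U []             []       e = tiled-[]
  absorbs-seconds U ((x , y) ∷ ps) (w ∷ ws) e = tiled-↭ (interleave y (seconds ps) (active w) (actives ws))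
    (tiled-++ (reach-y {x} {y} (∧-elimˡ (∧-elimˡ e)))
      (absorbs-seconds _ ps ws (∧-elimʳ {reach x y w ∧ within U w} e)))

  absorbs-∈ : ∀ U {k} (ps : Vec (Fin n × Fin n) k) ws → absorbs U ps ws ≡ true → ∀ {v} → v ∈ actives ws → v ∈ U
  absorbs-∈ U ((x , y) ∷ ps) (w ∷ ws) e v∈ with ∈-++⁻ (active w) v∈
  ... | inj₁ p = within-∈ {U} {w} (∧-elimʳ {reach x y w} (∧-elimˡ e)) (active⊆entries w p)
  ... | inj₂ p = proj₁ (minus-∈ U (entries w) (absorbs-∈ (minus U (entries w)) ps ws (∧-elimʳ {reach x y w ∧ within U w} e) p))

  absorbs-unique : ∀ U {k} (ps : Vec (Fin n × Fin n) k) ws → absorbs U ps ws ≡ true → Unique (actives ws)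
  absorbs-unique U []             []       e = []
  absorbs-unique U ((x , y) ∷ ps) (w ∷ ws) e = unique-++⁺ (reach-unique-active {x} {y} (∧-elimˡ (∧-elimˡ e)))
    (absorbs-unique _ ps ws e′)
    (λ p q → proj₂ (minus-∈ U (entries w) (absorbs-∈ (minus U (entries w)) ps ws e′ q)) (active⊆entries w p))
    where e′ = ∧-elimʳ {reach x y w ∧ within U w} e

  Index : Set
  Index = Vec (Fin n) h

  Candidate : Set
  Candidate = Blown × Vec Blown h

  indices : List Index
  indices = vecs (allFin n) h

  candidates : List Candidate
  candidates = pairs blowns (vecs blowns h)

  module _ (v₀ : Fin n) where

    len : length blowns ≡ blownN
    len = ≡.trans (length-vecs (vecs (allFin n) t) vertices)
      (cong (_^ vertices) (≡.trans (length-vecs (allFin n) t) (cong (_^ t) (length-allFin n))))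

    -- The blow-up `w` provides a copy `Y` of `H`, and `ws` links each vertex of `X` with the
    -- corresponding vertex of `Y`. Without `X`, the links are tiled together with the vertices of
    -- `Y`; with `X`, they are tiled together with `X`, and `Y` is a tile by itself. The roots `v₀`
    -- of the first blow-up are arbitrary and do not belong to the absorber.
    good : List (Fin n) → Index → Candidate → Bool
    good U X (w , ws) = (reach v₀ v₀ w ∧ within U w) ∧ absorbs (minus U (entries w)) (Vec.zip X (tileOf w)) ws

    good-dense : ∀ r U → Unique U → n ≤ length U + r → 2 * (N * (r + suc h * size)) ≤ n → ∀ X →
      length candidates ≤ K₂ ^ suc h * S candidates (𝟙 ∘ good U X)
    good-dense r U uniq n≤ small X = begin
      length candidates
        ≡⟨ ≡.trans (length-pairs blowns (vecs blowns h)) (cong₂ _*_ len (≡.trans (length-vecs blowns h) (cong (_^ h) len))) ⟩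
      blownN * blownN ^ h
        ≤⟨ S-∧ blowns (vecs blowns h) (λ w → reach v₀ v₀ w ∧ within U w) (λ w → absorbs (minus U (entries w)) (Vec.zip X (tileOf w))) (K₂ ^ h) K₂
            (reach-within-dense r U uniq n≤ (≤-trans (*-monoʳ-≤ 2 (*-monoʳ-≤ N (m≤m+n r _))) small) v₀ v₀)
            (λ w _ → absorbs-dense h (Vec.zip X (tileOf w)) (r + size) (minus U (entries w)) (minus-unique (entries w) uniq) (shrink U w uniq n≤)
              (≤-trans (≤-reflexive (cong (λ z → 2 * (N * z)) (+-assoc r size (h * size)))) small)) ⟩
      K₂ * K₂ ^ h * S blowns (λ w → S (vecs blowns h) (λ ws → 𝟙 (good U X (w , ws))))
        ≡⟨ cong (K₂ ^ suc h *_) (S-pairs blowns (vecs blowns h) _) ⟨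
      K₂ ^ suc h * S candidates (𝟙 ∘ good U X) ∎
      where open ≤-Reasoning

    bodyOf : Candidate → List (Fin n)
    bodyOf (w , ws) = toList (tileOf w) ++ actives ws

    length-actives : ∀ {k} (ws : Vec Blown k) → length (actives ws) ≡ k * length rest
    length-actives []       = ≡.refl
    length-actives (w ∷ ws) = ≡.trans (L.length-++ (active w))
      (cong₂ _+_ (≡.trans (L.length-map proj₁ (toList (pick rest≤ restV w))) (V.length-toList (pick rest≤ restV w))) (length-actives ws))

    length-bodyOf : ∀ ω → length (bodyOf ω) ≡ bodySize
    length-bodyOf (w , ws) = ≡.trans (L.length-++ (toList (tileOf w))) (cong₂ _+_ (V.length-toList (tileOf w)) (length-actives ws))

    module _ {U : List (Fin n)} {ω : Candidate} where

      private
        w  = proj₁ ω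
        ws = proj₂ ω

        module _ {X : Index} (g : good U X ω ≡ true) where
          r : reach v₀ v₀ w ≡ true
          r = ∧-elimˡ (∧-elimˡ g)
          i : within U w ≡ true
          i = ∧-elimʳ {reach v₀ v₀ w} (∧-elimˡ g)
          a′ : absorbs (minus U (entries w)) (Vec.zip X (tileOf w)) ws ≡ true
          a′ = ∧-elimʳ {reach v₀ v₀ w ∧ within U w} g

        firsts-zip : ∀ {k} (X Y : Vec (Fin n) k) → firsts (Vec.zip X Y) ≡ toList X
        firsts-zip []      []      = ≡.refl
        firsts-zip (x ∷ X) (y ∷ Y) = cong (x ∷_) (firsts-zip X Y)

        seconds-zip : ∀ {k} (X Y : Vec (Fin n) k) → seconds (Vec.zip X Y) ≡ toList Y
        seconds-zip []      []      = ≡.refl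
        seconds-zip (x ∷ X) (y ∷ Y) = cong (y ∷_) (seconds-zip X Y)

      good-∈ : ∀ {X} → good U X ω ≡ true → ∀ {v} → v ∈ bodyOf ω → v ∈ U
      good-∈ {X} g v∈ with ∈-++⁻ (toList (tileOf w)) v∈
      ... | inj₁ p = within-∈ {U} {w} (i {X} g) (tileOf⊆entries w p)
      ... | inj₂ p = proj₁ (minus-∈ U (entries w) (absorbs-∈ _ (Vec.zip X (tileOf w)) ws (a′ {X} g) p))

      good-unique : ∀ {X} → good U X ω ≡ true → Unique (bodyOf ω)
      good-unique {X} g = unique-++⁺ (reach-unique-tile {v₀} {v₀} (r {X} g)) (absorbs-unique _ (Vec.zip X (tileOf w)) ws (a′ {X} g))
        (λ p q → proj₂ (minus-∈ U (entries w) (absorbs-∈ _ (Vec.zip X (tileOf w)) ws (a′ {X} g) q)) (tileOf⊆entries w p))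

      good-tiled : ∀ {X} → good U X ω ≡ true → Tiled (bodyOf ω)
      good-tiled {X} g = subst (λ l → Tiled (l ++ actives ws)) (seconds-zip X (tileOf w)) (absorbs-seconds _ (Vec.zip X (tileOf w)) ws (a′ {X} g))

      good-absorb : ∀ {X} → good U X ω ≡ true → Tiled (toList X ++ bodyOf ω)
      good-absorb {X} g = tiled-↭ (shifts (toList X) (toList (tileOf w)))
        (tiled-++ (reach-tile {v₀} {v₀} (r {X} g))
          (subst (λ l → Tiled (l ++ actives ws)) (firsts-zip X (tileOf w)) (absorbs-firsts _ (Vec.zip X (tileOf w)) ws (a′ {X} g))))

    private
      nonempty : 0 < length candidates
      nonempty = subst (0 <_) (≡.sym (≡.trans (length-pairs blowns (vecs blowns h)) (cong (length blowns *_) (length-vecs blowns h))))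
          (m^n>0 (length blowns) {{>-nonZero blowns>0}} (suc h))
        where
        blowns>0 : 0 < length blowns
        blowns>0 = subst (0 <_) (≡.sym len) (m^n>0 (n ^ t) {{m^n≢0 n t}} vertices)

    open Selection H G F candidates nonempty good bodyOf bodySize length-bodyOf (K₂ ^ suc h) N (suc h * size)
      good-dense (λ {U} {ω} {X} → good-∈ {U} {ω} {X}) (λ {U} {ω} {X} → good-unique {U} {ω} {X})
      (λ {U} {ω} {X} → good-tiled {U} {ω} {X}) (λ {U} {ω} {X} → good-absorb {U} {ω} {X}) public
      using (Absorber; module Reserve; Reserve; reserve; absorb-all; bodies; bodies-tiled)

-- Almost tilings by bottles

sumTo : ℕ → (ℕ → ℕ) → ℕ
sumTo zero    f = 0
sumTo (suc i) f = sumTo i f + f i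

≤ᵇ-false⇒> : ∀ {m n} → (m ≤ᵇ n) ≡ false → n < m
≤ᵇ-false⇒> {m} {n} e = ≰⇒> λ le → subst IsTrue e (≤⇒≤ᵇ le)

≤ᵇ-true⇒≤ : ∀ {m n} → (m ≤ᵇ n) ≡ true → m ≤ n
≤ᵇ-true⇒≤ {m} {n} e = ≤ᵇ⇒≤ m n (subst IsTrue (≡.sym e) tt)

∸-triangle : ∀ m o n → m ∸ n ≤ (m ∸ o) + (o ∸ n)
∸-triangle m o n = m≤n+o⇒m∸n≤o m n (begin
  m                            ≤⟨ m≤n+m∸n m o ⟩
  o + (m ∸ o)                  ≤⟨ +-monoˡ-≤ (m ∸ o) (m≤n+m∸n o n) ⟩
  n + (o ∸ n) + (m ∸ o)        ≡⟨ identity₂₄ n (o ∸ n) (m ∸ o) ⟩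
  n + (m ∸ o + (o ∸ n))        ∎)
  where
  open ≤-Reasoning

-- threshold q is the largest level that at least q elements of U reach
module Thresholds (U : List A) (ω : A → ℕ) (M : ℕ) (ω≤M : ∀ z → ω z ≤ M) where

  above : ℕ → ℕ
  above w = S U (λ z → 𝟙 (w ≤ᵇ ω z))

  search : ℕ → ℕ → ℕ
  search zero    q = 0
  search (suc m) q = if q ≤ᵇ above (suc m) then suc m else search m q

  search-reached : ∀ m q → q ≤ length U → q ≤ above (search m q)
  search-reached zero    q le = subst (q ≤_) (≡.sym (S-one U)) le
  search-reached (suc m) q le with q ≤ᵇ above (suc m) in e
  ... | true  = ≤ᵇ-true⇒≤ e
  ... | false = search-reached m q le

  search-maximal : ∀ m q v → v ≤ m → q ≤ above v → v ≤ search m q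
  search-maximal zero    q v le h = le
  search-maximal (suc m) q v le h with q ≤ᵇ above (suc m) in e
  ... | true  = le
  ... | false with m≤n⇒m<n∨m≡n le
  ...   | inj₁ (s≤s v≤m) = search-maximal m q v v≤m h
  ...   | inj₂ ≡.refl    = contradiction h (<⇒≱ (≤ᵇ-false⇒> e))

  search≤ : ∀ m q → search m q ≤ m
  search≤ zero    q = z≤n
  search≤ (suc m) q with q ≤ᵇ above (suc m)
  ... | true  = ≤-refl
  ... | false = m≤n⇒m≤1+n (search≤ m q)

  threshold : ℕ → ℕ
  threshold = search M

  few-above : ∀ q → above (suc (threshold q)) ≤ q
  few-above q = ≮⇒≥ λ lt → cases lt (<-≤-connex (threshold q) M)
    where
    cases : q < above (suc (threshold q)) → threshold q < M ⊎ M ≤ threshold q → ⊥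
    cases lt (inj₁ t<M) = <⇒≱ (n<1+n (threshold q)) (search-maximal M q (suc (threshold q)) t<M (<⇒≤ lt))
    cases lt (inj₂ M≤t) = n≮0 (subst (q <_) (≡.trans (S-cong U (λ z → cong 𝟙 (none z))) (S-zero U)) lt)
      where
      none : ∀ z → (suc (threshold q) ≤ᵇ ω z) ≡ false
      none z with suc (threshold q) ≤ᵇ ω z in e
      ... | false = ≡.refl
      ... | true  = contradiction (≤-trans (≤ᵇ-true⇒≤ e) (≤-trans (ω≤M z) M≤t)) (<⇒≱ (n<1+n _))

  module _ (q₁ κ : ℕ) where

    w : ℕ → ℕ
    w i = threshold (q₁ + i * κ)

    excess : ℕ → ℕ
    excess v = S U (λ z → ω z ∸ v)

    -- Lowering the level from `v` to `w i` adds at most `v ∸ w i` for each element strictly above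
    -- `w i`, and by maximality of the threshold there are at most `q₁ + i * κ` of these.
    excess-step : ∀ i v → excess (w i) ≤ excess v + (q₁ + i * κ) * (v ∸ w i)
    excess-step i v = begin
      excess (w i)
        ≤⟨ S-mono U pointwise ⟩
      S U (λ z → (ω z ∸ v) + 𝟙 (suc (w i) ≤ᵇ ω z) * (v ∸ w i))
        ≡⟨ ≡.trans (S-+ U _ _) (cong (excess v +_) (S-*ʳ U (v ∸ w i) _)) ⟩
      excess v + above (suc (w i)) * (v ∸ w i)
        ≤⟨ +-monoʳ-≤ (excess v) (*-monoˡ-≤ (v ∸ w i) (few-above (q₁ + i * κ))) ⟩
      excess v + (q₁ + i * κ) * (v ∸ w i) ∎
      where
      open ≤-Reasoning
      pointwise : ∀ z → ω z ∸ w i ≤ (ω z ∸ v) + 𝟙 (suc (w i) ≤ᵇ ω z) * (v ∸ w i)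
      pointwise z with suc (w i) ≤ᵇ ω z in e
      ... | true  = ≤-trans (∸-triangle (ω z) v (w i)) (≤-reflexive (cong (ω z ∸ v +_) (≡.sym (*-identityˡ _))))
      ... | false = ≤-trans (≤-reflexive (m≤n⇒m∸n≡0 {ω z} {w i} (≤-pred (≤ᵇ-false⇒> {suc (w i)} {ω z} e)))) z≤n

    module _ (k : ℕ) (fits : q₁ + k * κ ≤ length U) where

      private
        reached : ∀ i → i ≤ k → q₁ + i * κ ≤ above (w i)
        reached i le = search-reached M _ (≤-trans (+-monoʳ-≤ q₁ (*-monoˡ-≤ κ le)) fits)

      w-reached : ∀ i → i ≤ k → q₁ + i * κ ≤ above (w i)
      w-reached = reached

      w-antitone : ∀ i j → i ≤ j → j ≤ k → w j ≤ w i
      w-antitone i j i≤j j≤k = search-maximal M _ (w j) (search≤ M _)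
        (≤-trans (+-monoʳ-≤ q₁ (*-monoˡ-≤ κ i≤j)) (reached j j≤k))

      -- The layers between consecutive thresholds are summed by parts. The number of contributing
      -- elements grows by `κ` from layer to layer, and this becomes the coefficient of each `w i`.
      excess-bound : ∀ i → i ≤ k → excess (w i) + (q₁ + i * κ) * w i ≤ q₁ * M + κ * sumTo i w
      excess-bound zero le = begin
        excess (w 0) + (q₁ + 0) * w 0
          ≤⟨ +-monoˡ-≤ _ (excess-step 0 M) ⟩
        excess M + (q₁ + 0) * (M ∸ w 0) + (q₁ + 0) * w 0
          ≡⟨ cong (λ x → x + (q₁ + 0) * (M ∸ w 0) + (q₁ + 0) * w 0) (≡.trans (S-cong U (λ z → m≤n⇒m∸n≡0 (ω≤M z))) (S-zero U)) ⟩
        (q₁ + 0) * (M ∸ w 0) + (q₁ + 0) * w 0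
          ≡⟨ *-distribˡ-+ (q₁ + 0) (M ∸ w 0) (w 0) ⟨
        (q₁ + 0) * (M ∸ w 0 + w 0)
          ≡⟨ cong₂ _*_ (+-identityʳ q₁) (m∸n+n≡m (search≤ M _)) ⟩
        q₁ * M
          ≤⟨ m≤m+n _ _ ⟩
        q₁ * M + κ * 0 ∎
        where open ≤-Reasoning
      excess-bound (suc i) le = begin
        excess (w (suc i)) + c * w (suc i)
          ≤⟨ +-monoˡ-≤ _ (excess-step (suc i) (w i)) ⟩
        excess (w i) + c * (w i ∸ w (suc i)) + c * w (suc i)
          ≡⟨ ≡.trans (+-assoc (excess (w i)) _ _) (cong (excess (w i) +_) (≡.trans (≡.sym (*-distribˡ-+ c _ _)) (cong (c *_) (m∸n+n≡m (w-antitone i (suc i) (n≤1+n i) le))))) ⟩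
        excess (w i) + c * w i
          ≡⟨ identity₃₀ (excess (w i)) q₁ κ i (w i) ⟩
        excess (w i) + (q₁ + i * κ) * w i + κ * w i
          ≤⟨ +-monoˡ-≤ (κ * w i) (excess-bound i (<⇒≤ le)) ⟩
        q₁ * M + κ * sumTo i w + κ * w i
          ≡⟨ identity₂₉ (q₁ * M) κ (sumTo i w) (w i) ⟩
        q₁ * M + κ * sumTo (suc i) w ∎
        where
        open ≤-Reasoning
        c = q₁ + suc i * κ

      sum-large : ∀ i → i ≤ k → i * w k ≤ sumTo i w
      sum-large zero    le = z≤n
      sum-large (suc i) le = ≤-trans (≤-reflexive (+-comm (w k) _)) (+-mono-≤ (sum-large i (<⇒≤ le)) (w-antitone i k (<⇒≤ le) ≤-refl))

      -- By `excess-bound`, the total of `ω` is at most that of a step function with value `M` on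
      -- `q₁` elements, each `w i` on `κ` elements, and `w k` on the rest. The bottle gives each of
      -- the first `k` values a share of at least `κ`, and these values are at least `w k`, so apart
      -- from the `q₁` elements its average is no smaller. The slack `s * t` comes from this
      -- comparison.
      weighted-thresholds : ∀ a b → (k * b + a) * κ ≤ length U * b →
        (k * b + a) * S U ω ≤ length U * (b * sumTo k w + a * w k) + (k * b + a) * q₁ * M
      weighted-thresholds a b κ≤ = ≤-from (s * t + D * q₁ * w k)
          (+-mono-≤ (*-monoʳ-≤ D total) (*-monoʳ-≤ D (excess-bound k ≤-refl))) eq
        where
        D = k * b + a
        u = length U
        s = u * b ∸ D * κ
        t = sumTo k w ∸ k * w k
        total : S U ω ≤ excess (w k) + u * w k
        total = ≤-trans (S-mono U (λ z → ≤-trans (m≤n+m∸n (ω z) (w k)) (≤-reflexive (+-comm (w k) _))))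
          (≤-reflexive (≡.trans (S-+ U _ _) (cong (excess (w k) +_) (S-const U (w k)))))
        eq : D * S U ω + (D * (excess (w k) + u * w k) + D * (q₁ * M + κ * sumTo k w)) + (s * t + D * q₁ * w k) ≡
             u * (b * sumTo k w + a * w k) + D * q₁ * M + (D * S U ω + D * (excess (w k) + (q₁ + k * κ) * w k))
        eq = subst (λ σ → D * S U ω + (D * (excess (w k) + u * w k) + D * (q₁ * M + κ * σ)) + (s * t + D * q₁ * w k) ≡
             u * (b * σ + a * w k) + D * q₁ * M + (D * S U ω + D * (excess (w k) + (q₁ + k * κ) * w k)))
             (m+[n∸m]≡n (sum-large k ≤-refl))
             (≡.trans (identity₂₈ k b a u (S U ω) (excess (w k)) q₁ κ (w k) M s t)
               (≡.trans (cong (λ x → x * t + (D * S U ω + D * (excess (w k) + u * w k) + D * (q₁ * M + κ * (k * w k)) + D * q₁ * w k)) (m+[n∸m]≡n κ≤)) (identity₂₇ k b a u (S U ω) (excess (w k)) q₁ κ (w k) M t)))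

-- The quadratic potential

Sz : List A → (A → ℤ) → ℤ
Sz []       f = 0ℤ
Sz (x ∷ xs) f = f x ℤ.+ Sz xs f

Sz-cong : ∀ (xs : List A) {f g : A → ℤ} → (∀ x → f x ≡ g x) → Sz xs f ≡ Sz xs g
Sz-cong []       h = ≡.refl
Sz-cong (x ∷ xs) h = cong₂ ℤ._+_ (h x) (Sz-cong xs h)

Sz-+ : ∀ (xs : List A) (f g : A → ℤ) → Sz xs (λ x → f x ℤ.+ g x) ≡ Sz xs f ℤ.+ Sz xs g
Sz-+ []       f g = ≡.refl
Sz-+ (x ∷ xs) f g rewrite Sz-+ xs f g = integer-identity₁₁ (f x) (g x) (Sz xs f) (Sz xs g)

Sz-*ˡ : ∀ (xs : List A) c (f : A → ℤ) → Sz xs (λ x → c ℤ.* f x) ≡ c ℤ.* Sz xs f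
Sz-*ˡ []       c f = ≡.sym (ℤ.*-zeroʳ c)
Sz-*ˡ (x ∷ xs) c f rewrite Sz-*ˡ xs c f = ≡.sym (ℤ.*-distribˡ-+ c (f x) _)

Sz-swap : ∀ (xs : List A) (ys : List ℬ) (f : A → ℬ → ℤ) →
          Sz xs (λ x → Sz ys (f x)) ≡ Sz ys (λ y → Sz xs (λ x → f x y))
Sz-swap []       ys f = ≡.sym (zeros ys)
  where zeros : ∀ (ys : List ℬ) → Sz ys (λ _ → 0ℤ) ≡ 0ℤ
        zeros []       = ≡.refl
        zeros (y ∷ ys) = ≡.trans (ℤ.+-identityˡ _) (zeros ys)
Sz-swap (x ∷ xs) ys f rewrite Sz-swap xs ys f = ≡.sym (Sz-+ ys (f x) _)

Sz-mono : ∀ (xs : List A) {f g : A → ℤ} → (∀ x → f x ℤ.≤ g x) → Sz xs f ℤ.≤ Sz xs g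
Sz-mono []       h = ℤ.≤-refl
Sz-mono (x ∷ xs) h = ℤ.+-mono-≤ (h x) (Sz-mono xs h)

Sz-pos : ∀ (xs : List A) (f : A → ℕ) → Sz xs (λ x → ℤ.+ f x) ≡ ℤ.+ S xs f
Sz-pos []       f = ≡.refl
Sz-pos (x ∷ xs) f = cong (ℤ._+_ (ℤ.+ f x)) (Sz-pos xs f)

≤ℤ-from : ∀ {a b lo hi} → lo ℤ.≤ hi → a ℤ.+ hi ≡ b ℤ.+ lo → a ℤ.≤ b
≤ℤ-from {a} {b} {lo} {hi} le eq = subst₂≤ (ℤ.+-monoˡ-≤ (ℤ.- lo) (ℤ.≤-trans (ℤ.+-monoʳ-≤ a le) (ℤ.≤-reflexive eq)))
  where
  subst₂≤ : (a ℤ.+ lo) ℤ.+ ℤ.- lo ℤ.≤ (b ℤ.+ lo) ℤ.+ ℤ.- lo → a ℤ.≤ b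
  subst₂≤ = ≡.subst₂ ℤ._≤_ (integer-identity₁₉ a lo) (integer-identity₁₉ b lo)

i*i≡∣i∣² : ∀ i → i ℤ.* i ≡ ℤ.+ (ℤ.∣ i ∣ * ℤ.∣ i ∣)
i*i≡∣i∣² (ℤ.+ n)    = ≡.sym (ℤ.pos-* n n)
i*i≡∣i∣² ℤ.-[1+ n ] = ≡.refl

i≤∣i∣ : ∀ i → i ℤ.≤ ℤ.+ ℤ.∣ i ∣
i≤∣i∣ (ℤ.+ n)    = ℤ.≤-refl
i≤∣i∣ ℤ.-[1+ n ] = ℤ.-≤+

∣-∣≤⊔ : ∀ p r → ℤ.∣ ℤ.+ p ℤ.- ℤ.+ r ∣ ≤ p ⊔ r
∣-∣≤⊔ p r = subst (λ i → ℤ.∣ i ∣ ≤ p ⊔ r) (≡.sym (ℤ.m-n≡m⊖n p r)) (ℤ.∣m⊝n∣≤m⊔n p r)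

≤+∣-∣ : ∀ p r → p ≤ r + ℤ.∣ ℤ.+ p ℤ.- ℤ.+ r ∣
≤+∣-∣ p r = ℤ.drop‿+≤+ (ℤ.≤-trans (ℤ.≤-reflexive (integer-identity₁₇ (ℤ.+ p) (ℤ.+ r))) (ℤ.+-monoʳ-≤ (ℤ.+ r) (i≤∣i∣ (ℤ.+ p ℤ.- ℤ.+ r))))

-- Heaviness of the tile makes `u * A₁` at least `B * Φ` up to an error `B * (u₀ * q₁) * (Y + Y)`,
-- which by the arithmetic-geometric inequality is at most `B * Φ` plus a constant. In
-- `Φ - 2 * A₁ + G₂` the two multiples of `Φ` cancel, and only the constant terms remain.
potential-step : ∀ (u B u₀ q₁ n Φ Φ′ A₁ G₂ ΣT ΣU X Y : ℤ) .{{_ : ℤ.NonNegative u}} .{{_ : ℤ.NonNegative B}} .{{_ : ℤ.NonNegative u₀}} →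
  Φ′ ≡ Φ ℤ.- (A₁ ℤ.+ A₁) ℤ.+ G₂ → A₁ ≡ u₀ ℤ.* ΣT ℤ.- B ℤ.* X → Φ ≡ u₀ ℤ.* ΣU ℤ.- u ℤ.* X →
  B ℤ.* ΣU ℤ.≤ u ℤ.* ΣT ℤ.+ B ℤ.* q₁ ℤ.* (Y ℤ.+ Y) →
  (u₀ ℤ.* q₁) ℤ.* (Y ℤ.+ Y) ℤ.≤ Φ ℤ.+ n ℤ.* ((u₀ ℤ.* q₁) ℤ.* (u₀ ℤ.* q₁)) →
  G₂ ℤ.≤ n ℤ.* ((u₀ ℤ.* B) ℤ.* (u₀ ℤ.* B)) →
  u ℤ.* Φ′ ℤ.≤ u ℤ.* Φ ℤ.+ ((B ℤ.+ B) ℤ.* (n ℤ.* ((u₀ ℤ.* q₁) ℤ.* (u₀ ℤ.* q₁))) ℤ.+ u ℤ.* (n ℤ.* ((u₀ ℤ.* B) ℤ.* (u₀ ℤ.* B))))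
potential-step u B u₀ q₁ n Φ Φ′ A₁ G₂ ΣT ΣU X Y ≡.refl ≡.refl ≡.refl h₁ h₂ h₃ =
  ≤ℤ-from (ℤ.+-mono-≤ (ℤ.+-mono-≤ (ℤ.+-mono-≤ p₁ p₁) (ℤ.+-mono-≤ p₂ p₂)) (ℤ.*-monoˡ-≤-nonNeg u h₃))
    (integer-identity₁₈ u B u₀ q₁ n G₂ ΣT ΣU X Y)
  where
  p₁ = ℤ.*-monoˡ-≤-nonNeg u₀ h₁
  p₂ = ℤ.*-monoˡ-≤-nonNeg B h₂

Sz-*ʳ : ∀ (xs : List A) c (f : A → ℤ) → Sz xs (λ x → f x ℤ.* c) ≡ Sz xs f ℤ.* c
Sz-*ʳ xs c f = ≡.trans (Sz-cong xs (λ x → ℤ.*-comm (f x) c)) (≡.trans (Sz-*ˡ xs c f) (ℤ.*-comm c (Sz xs f)))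

Sz-const : ∀ (xs : List A) c → Sz xs (λ _ → c) ≡ ℤ.+ length xs ℤ.* c
Sz-const []       c = ≡.sym (ℤ.*-zeroˡ c)
Sz-const (x ∷ xs) c = ≡.trans (cong (ℤ._+_ c) (Sz-const xs c)) (≡.sym (ℤ.suc-* (ℤ.+ length xs) c))

am-gm : ∀ c y → c * (y + y) ≤ y * y + c * c
am-gm c y with ≤-total c y
... | inj₁ c≤y = subst (λ y → c * (y + y) ≤ y * y + c * c) (m+[n∸m]≡n c≤y) (≤-trans (m≤m+n _ (e * e)) (≤-reflexive (identity₃₂ c e)))
  where e = y ∸ c
... | inj₂ y≤c = subst (λ c → c * (y + y) ≤ y * y + c * c) (m+[n∸m]≡n y≤c) (≤-trans (m≤m+n _ (e * e)) (≤-reflexive (identity₃₁ y e)))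
  where e = c ∸ y

-- how far the sublists U of U₀ deviate from inheriting the proportion of non-neighbours of each vertex
module Potential {n : ℕ} (G : Graph n) (U₀ : List (Fin n)) where

  V : List (Fin n)
  V = allFin n

  u₀ : ℕ
  u₀ = length U₀

  nn : Fin n → List (Fin n) → ℕ
  nn v U = S U (λ z → 𝟙 (not (adj G v z)))

  y : List (Fin n) → Fin n → ℤ
  y U v = ℤ.+ (u₀ * nn v U) ℤ.- ℤ.+ (nn v U₀ * length U)

  Φ Y : List (Fin n) → ℕ
  Φ U = S V (λ v → ℤ.∣ y U v ∣ * ℤ.∣ y U v ∣)
  Y U = S V (λ v → ℤ.∣ y U v ∣)

  W : List (Fin n) → Fin n → ℤ
  W U z = Sz V (λ v → ℤ.+ 𝟙 (not (adj G v z)) ℤ.* y U v)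

  -- To first order, removing `z` lowers the potential by an increasing linear function of `W U z`,
  -- so heavy vertices are the ones to cover. The shift by `Y U` only makes the weight a natural
  -- number; it is the same for all vertices and cancels in the comparison of averages.
  ω : List (Fin n) → Fin n → ℕ
  ω U z = ℤ.∣ W U z ℤ.+ ℤ.+ Y U ∣

  private
    𝟙*≤ : ∀ b i → ℤ.+ 𝟙 b ℤ.* i ℤ.≤ ℤ.+ ℤ.∣ i ∣
    𝟙*≤ true  i = ℤ.≤-trans (ℤ.≤-reflexive (ℤ.*-identityˡ i)) (i≤∣i∣ i)
    𝟙*≤ false i = ℤ.≤-trans (ℤ.≤-reflexive (ℤ.*-zeroˡ i)) (ℤ.+≤+ z≤n)

    W≤Y : ∀ U z → W U z ℤ.≤ ℤ.+ Y U
    W≤Y U z = ℤ.≤-trans (Sz-mono V (λ v → 𝟙*≤ (not (adj G v z)) (y U v))) (ℤ.≤-reflexive (Sz-pos V _))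

    0≤W+Y : ∀ U z → 0ℤ ℤ.≤ W U z ℤ.+ ℤ.+ Y U
    0≤W+Y U z = ℤ.≤-trans (ℤ.≤-reflexive (≡.sym zeros)) (ℤ.≤-trans (Sz-mono V (λ v → pointwise (not (adj G v z)) (y U v)))
        (ℤ.≤-reflexive (≡.trans (Sz-+ V _ _) (cong (ℤ._+_ (W U z)) (Sz-pos V _)))))
      where
      zeros : Sz V (λ _ → 0ℤ) ≡ 0ℤ
      zeros = ≡.trans (Sz-const V 0ℤ) (ℤ.*-zeroʳ (ℤ.+ length V))
      pointwise : ∀ b i → 0ℤ ℤ.≤ ℤ.+ 𝟙 b ℤ.* i ℤ.+ ℤ.+ ℤ.∣ i ∣
      pointwise false i = ℤ.≤-trans (ℤ.+≤+ z≤n) (ℤ.≤-reflexive (≡.sym (≡.trans (cong (λ j → j ℤ.+ ℤ.+ ℤ.∣ i ∣) (ℤ.*-zeroˡ i)) (ℤ.+-identityˡ _))))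
      pointwise true  i = ≤ℤ-from (i≤∣i∣ (ℤ.- i)) (≡.trans (cong (λ k → 0ℤ ℤ.+ ℤ.+ k) (ℤ.∣-i∣≡∣i∣ i)) (integer-identity₂₀ i (ℤ.+ ℤ.∣ i ∣)))

  +ω : ∀ U z → ℤ.+ ω U z ≡ W U z ℤ.+ ℤ.+ Y U
  +ω U z = ℤ.0≤i⇒+∣i∣≡i (0≤W+Y U z)

  ω≤2Y : ∀ U z → ω U z ≤ Y U + Y U
  ω≤2Y U z = ℤ.drop‿+≤+ (ℤ.≤-trans (ℤ.≤-reflexive (+ω U z)) (ℤ.+-monoˡ-≤ (ℤ.+ Y U) (W≤Y U z)))

  S-ω : ∀ U T → ℤ.+ S T (ω U) ≡ Sz T (W U) ℤ.+ ℤ.+ length T ℤ.* ℤ.+ Y U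
  S-ω U T = ≡.trans (≡.sym (Sz-pos T (ω U))) (≡.trans (Sz-cong T (+ω U)) (≡.trans (Sz-+ T (W U) _) (cong (ℤ._+_ (Sz T (W U))) (Sz-const T _))))

  inner : ∀ U T → Sz V (λ v → y U v ℤ.* y T v) ≡ ℤ.+ u₀ ℤ.* Sz T (W U) ℤ.- ℤ.+ length T ℤ.* Sz V (λ v → ℤ.+ nn v U₀ ℤ.* y U v)
  inner U T = begin
    Sz V (λ v → y U v ℤ.* y T v)
      ≡⟨ Sz-cong V (λ v → ≡.trans (cong₂ (λ p r → y U v ℤ.* (p ℤ.- r)) (ℤ.pos-* u₀ (nn v T)) (ℤ.pos-* (nn v U₀) (length T)))
           (integer-identity₂₅ (y U v) (ℤ.+ u₀) (ℤ.+ nn v T) (ℤ.+ nn v U₀) (ℤ.+ length T))) ⟩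
    Sz V (λ v → ℤ.+ u₀ ℤ.* (ℤ.+ nn v T ℤ.* y U v) ℤ.+ (ℤ.- ℤ.+ length T) ℤ.* (ℤ.+ nn v U₀ ℤ.* y U v))
      ≡⟨ ≡.trans (Sz-+ V _ _) (cong₂ ℤ._+_ (Sz-*ˡ V (ℤ.+ u₀) _) (Sz-*ˡ V (ℤ.- ℤ.+ length T) _)) ⟩
    ℤ.+ u₀ ℤ.* Sz V (λ v → ℤ.+ nn v T ℤ.* y U v) ℤ.+ (ℤ.- ℤ.+ length T) ℤ.* X
      ≡⟨ cong₂ (λ s r → ℤ.+ u₀ ℤ.* s ℤ.+ r) exchange (≡.sym (ℤ.neg-distribˡ-* (ℤ.+ length T) X)) ⟩
    ℤ.+ u₀ ℤ.* Sz T (W U) ℤ.- ℤ.+ length T ℤ.* X ∎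
    where
    open ≡-Reasoning
    X = Sz V (λ v → ℤ.+ nn v U₀ ℤ.* y U v)
    exchange : Sz V (λ v → ℤ.+ nn v T ℤ.* y U v) ≡ Sz T (W U)
    exchange = ≡.trans (Sz-cong V (λ v → ≡.trans (cong (λ s → s ℤ.* y U v) (≡.sym (Sz-pos T _))) (≡.sym (Sz-*ʳ T (y U v) _))))
      (≡.sym (Sz-swap T V _))

  Φ-ℤ : ∀ U → ℤ.+ Φ U ≡ Sz V (λ v → y U v ℤ.* y U v)
  Φ-ℤ U = ≡.trans (≡.sym (Sz-pos V _)) (Sz-cong V (λ v → ≡.sym (i*i≡∣i∣² (y U v))))

  y-split : ∀ {U T U′} → U ↭ T ++ U′ → ∀ v → y U′ v ≡ y U v ℤ.- y T v
  y-split {U} {T} {U′} p v = begin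
    y U′ v
      ≡⟨ cong₂ (λ a b → a ℤ.- b) (ℤ.pos-* u₀ (nn v U′)) (ℤ.pos-* (nn v U₀) (length U′)) ⟩
    ℤ.+ u₀ ℤ.* ℤ.+ nn v U′ ℤ.- ℤ.+ nn v U₀ ℤ.* ℤ.+ length U′
      ≡⟨ integer-identity₂₄ (ℤ.+ u₀) (ℤ.+ nn v T) (ℤ.+ nn v U′) (ℤ.+ nn v U₀) (ℤ.+ length T) (ℤ.+ length U′) ⟩
    (ℤ.+ u₀ ℤ.* (ℤ.+ (nn v T + nn v U′)) ℤ.- ℤ.+ nn v U₀ ℤ.* (ℤ.+ (length T + length U′))) ℤ.- (ℤ.+ u₀ ℤ.* ℤ.+ nn v T ℤ.- ℤ.+ nn v U₀ ℤ.* ℤ.+ length T)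
      ≡⟨ cong₂ (λ a b → (ℤ.+ u₀ ℤ.* ℤ.+ a ℤ.- ℤ.+ nn v U₀ ℤ.* ℤ.+ b) ℤ.- (ℤ.+ u₀ ℤ.* ℤ.+ nn v T ℤ.- ℤ.+ nn v U₀ ℤ.* ℤ.+ length T))
           (≡.sym (≡.trans (S-↭ _ p) (S-++ T U′ _))) (≡.sym (≡.trans (↭-length p) (L.length-++ T))) ⟩
    (ℤ.+ u₀ ℤ.* ℤ.+ nn v U ℤ.- ℤ.+ nn v U₀ ℤ.* ℤ.+ length U) ℤ.- (ℤ.+ u₀ ℤ.* ℤ.+ nn v T ℤ.- ℤ.+ nn v U₀ ℤ.* ℤ.+ length T)
      ≡⟨ cong₂ (λ a b → a ℤ.- b) (cong₂ (λ a b → a ℤ.- b) (≡.sym (ℤ.pos-* u₀ (nn v U))) (≡.sym (ℤ.pos-* (nn v U₀) (length U))))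
           (cong₂ (λ a b → a ℤ.- b) (≡.sym (ℤ.pos-* u₀ (nn v T))) (≡.sym (ℤ.pos-* (nn v U₀) (length T)))) ⟩
    y U v ℤ.- y T v ∎
    where
    open ≡-Reasoning

  potential-drop : ∀ {U T U′} q₁ → U ↭ T ++ U′ →
    length T * S U (ω U) ≤ length U * S T (ω U) + length T * q₁ * (Y U + Y U) →
    length U * Φ U′ ≤ length U * Φ U + ((length T + length T) * (length V * ((u₀ * q₁) * (u₀ * q₁)))
      + length U * (length V * ((u₀ * length T) * (u₀ * length T))))
  potential-drop {U} {T} {U′} q₁ p tile = ℤ.drop‿+≤+ (≡.subst₂ ℤ._≤_ (≡.sym (ℤ.pos-* u (Φ U′))) (≡.sym cast)
    (potential-step (ℤ.+ u) (ℤ.+ B) (ℤ.+ u₀) (ℤ.+ q₁) (ℤ.+ length V) (ℤ.+ Φ U) (ℤ.+ Φ U′) A₁ G₂ (Sz T (W U)) (Sz U (W U))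
      (Sz V (λ v → ℤ.+ nn v U₀ ℤ.* y U v)) (ℤ.+ Y U) Φ′-eq (inner U T) (≡.trans (Φ-ℤ U) (inner U U)) h₁ h₂ h₃))
    where
    u = length U
    B = length T
    A₁ = Sz V (λ v → y U v ℤ.* y T v)
    G₂ = Sz V (λ v → y T v ℤ.* y T v)
    cast : ℤ.+ (u * Φ U + ((B + B) * (length V * ((u₀ * q₁) * (u₀ * q₁))) + u * (length V * ((u₀ * B) * (u₀ * B))))) ≡
      ℤ.+ u ℤ.* ℤ.+ Φ U ℤ.+ ((ℤ.+ B ℤ.+ ℤ.+ B) ℤ.* (ℤ.+ length V ℤ.* ((ℤ.+ u₀ ℤ.* ℤ.+ q₁) ℤ.* (ℤ.+ u₀ ℤ.* ℤ.+ q₁)))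
        ℤ.+ ℤ.+ u ℤ.* (ℤ.+ length V ℤ.* ((ℤ.+ u₀ ℤ.* ℤ.+ B) ℤ.* (ℤ.+ u₀ ℤ.* ℤ.+ B))))
    cast = cong₂ ℤ._+_ (ℤ.pos-* u (Φ U)) (cong₂ ℤ._+_
      (≡.trans (ℤ.pos-* (B + B) _) (cong (ℤ._*_ (ℤ.+ B ℤ.+ ℤ.+ B)) (square q₁)))
      (≡.trans (ℤ.pos-* u _) (cong (ℤ._*_ (ℤ.+ u)) (square B))))
      where
      square : ∀ q → ℤ.+ (length V * ((u₀ * q) * (u₀ * q))) ≡ ℤ.+ length V ℤ.* ((ℤ.+ u₀ ℤ.* ℤ.+ q) ℤ.* (ℤ.+ u₀ ℤ.* ℤ.+ q))
      square q = ≡.trans (ℤ.pos-* (length V) _) (cong (ℤ._*_ (ℤ.+ length V))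
        (≡.trans (ℤ.pos-* (u₀ * q) (u₀ * q)) (cong₂ ℤ._*_ (ℤ.pos-* u₀ q) (ℤ.pos-* u₀ q))))
    Φ′-eq : ℤ.+ Φ U′ ≡ ℤ.+ Φ U ℤ.- (A₁ ℤ.+ A₁) ℤ.+ G₂
    Φ′-eq = begin
      ℤ.+ Φ U′
        ≡⟨ Φ-ℤ U′ ⟩
      Sz V (λ v → y U′ v ℤ.* y U′ v)
        ≡⟨ Sz-cong V (λ v → ≡.trans (cong₂ ℤ._*_ (y-split {U} {T} {U′} p v) (y-split {U} {T} {U′} p v)) (integer-identity₂₃ (y U v) (y T v))) ⟩
      Sz V (λ v → (y U v ℤ.* y U v ℤ.+ (ℤ.- (1ℤ ℤ.+ 1ℤ)) ℤ.* (y U v ℤ.* y T v)) ℤ.+ y T v ℤ.* y T v)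
        ≡⟨ ≡.trans (Sz-+ V _ _) (cong (λ s → s ℤ.+ G₂) (≡.trans (Sz-+ V _ _) (cong₂ ℤ._+_ (≡.sym (Φ-ℤ U)) (Sz-*ˡ V (ℤ.- (1ℤ ℤ.+ 1ℤ)) _)))) ⟩
      (ℤ.+ Φ U ℤ.+ (ℤ.- (1ℤ ℤ.+ 1ℤ)) ℤ.* A₁) ℤ.+ G₂
        ≡⟨ integer-identity₂₂ (ℤ.+ Φ U) A₁ G₂ ⟩
      ℤ.+ Φ U ℤ.- (A₁ ℤ.+ A₁) ℤ.+ G₂ ∎
      where
      open ≡-Reasoning
    h₁ : ℤ.+ B ℤ.* Sz U (W U) ℤ.≤ ℤ.+ u ℤ.* Sz T (W U) ℤ.+ ℤ.+ B ℤ.* ℤ.+ q₁ ℤ.* (ℤ.+ Y U ℤ.+ ℤ.+ Y U)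
    h₁ = ≤ℤ-from (≡.subst₂ ℤ._≤_ (≡.trans (ℤ.pos-* B _) (cong (ℤ._*_ (ℤ.+ B)) (S-ω U U)))
        (cong₂ ℤ._+_ (≡.trans (ℤ.pos-* u _) (cong (ℤ._*_ (ℤ.+ u)) (S-ω U T)))
          (≡.trans (ℤ.pos-* (B * q₁) _) (cong (λ s → s ℤ.* (ℤ.+ Y U ℤ.+ ℤ.+ Y U)) (ℤ.pos-* B q₁))))
        (ℤ.+≤+ tile)) (integer-identity₂₁ (ℤ.+ B) (ℤ.+ u) (ℤ.+ q₁) (Sz U (W U)) (Sz T (W U)) (ℤ.+ Y U))
    h₂ : (ℤ.+ u₀ ℤ.* ℤ.+ q₁) ℤ.* (ℤ.+ Y U ℤ.+ ℤ.+ Y U) ℤ.≤ ℤ.+ Φ U ℤ.+ ℤ.+ length V ℤ.* ((ℤ.+ u₀ ℤ.* ℤ.+ q₁) ℤ.* (ℤ.+ u₀ ℤ.* ℤ.+ q₁))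
    h₂ = ≡.subst₂ ℤ._≤_ (≡.trans (ℤ.pos-* c _) (cong (λ s → s ℤ.* (ℤ.+ Y U ℤ.+ ℤ.+ Y U)) (ℤ.pos-* u₀ q₁)))
      (cong (ℤ._+_ (ℤ.+ Φ U)) (≡.trans (ℤ.pos-* (length V) _) (cong (ℤ._*_ (ℤ.+ length V)) (≡.trans (ℤ.pos-* c c) (cong₂ ℤ._*_ (ℤ.pos-* u₀ q₁) (ℤ.pos-* u₀ q₁))))))
      (ℤ.+≤+ (begin
        c * (Y U + Y U)
          ≡⟨ ≡.trans (cong (c *_) (≡.sym (S-+ V _ _))) (≡.sym (S-*ˡ V c _)) ⟩
        S V (λ v → c * (ℤ.∣ y U v ∣ + ℤ.∣ y U v ∣))
          ≤⟨ S-mono V (λ v → am-gm c ℤ.∣ y U v ∣) ⟩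
        S V (λ v → ℤ.∣ y U v ∣ * ℤ.∣ y U v ∣ + c * c)
          ≡⟨ ≡.trans (S-+ V _ _) (cong (Φ U +_) (S-const V (c * c))) ⟩
        Φ U + length V * (c * c) ∎))
      where
      open ≤-Reasoning
      c = u₀ * q₁
    h₃ : G₂ ℤ.≤ ℤ.+ length V ℤ.* ((ℤ.+ u₀ ℤ.* ℤ.+ B) ℤ.* (ℤ.+ u₀ ℤ.* ℤ.+ B))
    h₃ = ℤ.≤-trans (ℤ.≤-reflexive (≡.sym (Φ-ℤ T))) (ℤ.≤-trans (ℤ.+≤+ (S≤length* V (c * c) (λ v → *-mono-≤ (bound v) (bound v))))
      (ℤ.≤-reflexive (≡.trans (ℤ.pos-* (length V) _) (cong (ℤ._*_ (ℤ.+ length V)) (≡.trans (ℤ.pos-* c c) (cong₂ ℤ._*_ (ℤ.pos-* u₀ B) (ℤ.pos-* u₀ B)))))))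
      where
      c = u₀ * B
      nn≤ : ∀ v l → nn v l ≤ length l
      nn≤ v l = ≤-trans (S≤length* l 1 (λ z → 𝟙≤1 _)) (≤-reflexive (*-identityʳ _))
      bound : ∀ v → ℤ.∣ y T v ∣ ≤ c
      bound v = ≤-trans (∣-∣≤⊔ (u₀ * nn v T) (nn v U₀ * B)) (⊔-lub (*-monoʳ-≤ u₀ (nn≤ v T)) (*-monoˡ-≤ B (nn≤ v U₀)))

-- Placing a heavy bottle in the uncovered set

vecs-∈ : ∀ {xs : List A} {p} {v : Vec A p} → v ∈ vecs xs p → ∀ i → lookup v i ∈ xs
vecs-∈ {xs = xs} {suc p} {x ∷ v} v∈ i = at i (member xs v∈)
  where
  split : ∀ y (l : List (Vec _ p)) → (x ∷ v) ∈ map (y ∷_) l → x ≡ y × v ∈ l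
  split y (r ∷ l) (here ≡.refl) = ≡.refl , here ≡.refl
  split y (r ∷ l) (there q)     = let (e , q′) = split y l q in e , there q′
  member : ∀ ys → (x ∷ v) ∈ concatMap (λ y → map (y ∷_) (vecs xs p)) ys → x ∈ ys × v ∈ vecs xs p
  member (y ∷ ys) q with ∈-++⁻ (map (y ∷_) (vecs xs p)) q
  ... | inj₁ r = let (e , v∈) = split y _ r in here e , v∈
  ... | inj₂ r = let (x∈ , v∈) = member ys r in there x∈ , v∈
  at : ∀ i → x ∈ xs × v ∈ vecs xs p → lookup (x ∷ v) i ∈ xs
  at Fin.zero    (x∈ , _)  = x∈
  at (Fin.suc i) (_ , v∈)  = vecs-∈ v∈ i

distinctᵇ : ∀ {q} → Fin q → Fin q → Bool
distinctᵇ i j = not ⌊ i Fin.≟ j ⌋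

distinctᵇ-sym : ∀ {q} (i j : Fin q) → distinctᵇ i j ≡ distinctᵇ j i
distinctᵇ-sym i j with i Fin.≟ j | j Fin.≟ i
... | yes _      | yes _ = ≡.refl
... | no _       | no _  = ≡.refl
... | yes ≡.refl | no ¬p = contradiction ≡.refl ¬p
... | no ¬p      | yes e = contradiction (≡.sym e) ¬p

distinctᵇ-irr : ∀ {q} (i : Fin q) → distinctᵇ i i ≡ false
distinctᵇ-irr i with i Fin.≟ i
... | yes _ = ≡.refl
... | no ¬p = contradiction ≡.refl ¬p

-- a union of copies of H spanning a complete (k+1)-partite graph with k parts of size b and one of size a
record Bottle {h : ℕ} (H : Graph h) (k b a : ℕ) : Set where
  field
    homs  : List (Vec (Fin (suc k)) h)
    valid : All (Hom H distinctᵇ) homs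
    weigh : ∀ (f : ℕ → ℕ) → S (concatMap toList homs) (f ∘ toℕ) ≡ b * sumTo k f + a * f k

tileK tileSparsity : ℕ → ℕ → ℕ → ℕ
tileK q t C = blowK t q (C ^ q)
tileSparsity q t C = 4 * tileK q t C * triples q t

module FindTile {h n : ℕ} (H : Graph h) (G : Graph n) (F : IncompatibilitySystem G) {q : ℕ} (E : Fin q → Fin q → Bool)
    (E-sym : ∀ i j → E i j ≡ E j i) (E-irr : ∀ i → E i i ≡ false) (homs : List (Vec (Fin q) h)) (valid : All (Hom H E) homs)
    (k b a : ℕ) (toℕ≤k : ∀ (i : Fin q) → toℕ i ≤ k) (labels : List (Fin q)) (labels-eq : labels ≡ concatMap toList homs)
    (weigh : ∀ (f : ℕ → ℕ) → S labels (f ∘ toℕ) ≡ b * sumTo k f + a * f k)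
    (t′ : ℕ) (labels≤t : length labels ≤ suc t′) where
  open Tiling H G F
  open Greedy G
  open Clean F

  order : ℕ
  order = k * b + a

  length-labels : length labels ≡ order
  length-labels = ≡.trans (≡.sym (S-one labels)) (≡.trans (weigh (λ _ → 1))
      (cong₂ _+_ (≡.trans (cong (b *_) (sumTo-one k)) (*-comm b k)) (*-identityʳ a)))
    where
    sumTo-one : ∀ k → sumTo k (λ _ → 1) ≡ k
    sumTo-one zero    = ≡.refl
    sumTo-one (suc k) = ≡.trans (cong (_+ 1) (sumTo-one k)) (+-comm k 1)

  t : ℕ
  t = suc t′

  open Picking H F E E-sym E-irr t

  module _ (U : List (Fin n)) (uniq : Unique U) (0<u : 0 < length U) (ω : Fin n → ℕ) (M : ℕ) (ω≤M : ∀ z → ω z ≤ M)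
           (good : Fin n → Bool) (κ q₁ C γ m : ℕ)
           (good-nn : ∀ v → good v ≡ true → S U (λ z → 𝟙 (not (adj G v z))) ≤ κ)
           (few-bad : γ + S U (λ z → 𝟙 (not (good z))) ≤ q₁) (γ-large : length U ≤ C * γ)
           (fits : q₁ + k * κ ≤ length U) (κ-small : order * κ ≤ length U * b)
           (few : ∀ v w → S (allFin n) (𝟙 ∘ inc F v w) ≤ m)
           (sparse : tileSparsity q t C * suc m ≤ length U) where

    open Thresholds U ω M ω≤M hiding (w)

    private
      u = length U
      w : ℕ → ℕ
      w = Thresholds.w U ω M ω≤M q₁ κ

      instance
        u≢0 : NonZero u
        u≢0 = >-nonZero 0<u

      Z : Fin q → Fin n → Bool
      Z i z = good z ∧ (w (toℕ i) ≤ᵇ ω z)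

      no-roots : Fin q → List (Fin n)
      no-roots _ = []

      P : Vec (Fin n) q → Bool
      P = greedy q E Z no-roots

      -- At least `q₁ + toℕ i * κ` elements reach the level of part `i`. The bad ones are at most
      -- `q₁ ∸ γ`, and the at most `toℕ i` good vertices chosen before miss at most `κ` each, so `γ`
      -- choices are left.
      many : ∀ i l → All (λ v → good v ≡ true) l → length l ≤ toℕ i → γ ≤ S U (λ z → 𝟙 (Z i z ∧ allAdj l z))
      many i l gl le = +-cancelʳ-≤ (S U (λ z → 𝟙 (not (good z))) + toℕ i * κ) _ _ (begin
        γ + (S U (λ z → 𝟙 (not (good z))) + toℕ i * κ)
          ≡⟨ +-assoc γ _ _ ⟨
        γ + S U (λ z → 𝟙 (not (good z))) + toℕ i * κ
          ≤⟨ +-monoˡ-≤ (toℕ i * κ) few-bad ⟩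
        q₁ + toℕ i * κ
          ≤⟨ w-reached q₁ κ k fits (toℕ i) (toℕ≤k i) ⟩
        S U (λ z → 𝟙 (w (toℕ i) ≤ᵇ ω z))
          ≤⟨ ≤-trans (S-mono U (λ z → pointwise (good z) (w (toℕ i) ≤ᵇ ω z))) (≤-reflexive (S-+ U _ _)) ⟩
        S U (𝟙 ∘ Z i) + S U (λ z → 𝟙 (not (good z)))
          ≤⟨ +-monoˡ-≤ _ (missed-all G U (Z i) κ l (All.map (good-nn _) gl)) ⟩
        S U (λ z → 𝟙 (Z i z ∧ allAdj l z)) + length l * κ + S U (λ z → 𝟙 (not (good z)))
          ≤⟨ +-monoˡ-≤ _ (+-monoʳ-≤ (S U (λ z → 𝟙 (Z i z ∧ allAdj l z))) (*-monoˡ-≤ κ le)) ⟩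
        S U (λ z → 𝟙 (Z i z ∧ allAdj l z)) + toℕ i * κ + S U (λ z → 𝟙 (not (good z)))
          ≡⟨ identity₂₄ (S U (λ z → 𝟙 (Z i z ∧ allAdj l z))) (toℕ i * κ) _ ⟩
        S U (λ z → 𝟙 (Z i z ∧ allAdj l z)) + (S U (λ z → 𝟙 (not (good z))) + toℕ i * κ) ∎)
        where
        open ≤-Reasoning
        pointwise : ∀ g x → 𝟙 x ≤ 𝟙 (g ∧ x) + 𝟙 (not g)
        pointwise true  x = m≤m+n _ _
        pointwise false x = 𝟙≤1 x

      dense : (u ^ t) ^ q ≤ tileK q t C * S (vecs (vecs U t) q) (𝟙 ∘ blow t q P)
      dense = blow-dense U t′ q (C ^ q) P (begin
        u ^ q                  ≤⟨ ^-monoˡ-≤ q γ-large ⟩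
        (C * γ) ^ q            ≡⟨ ^-distribʳ-* q C γ ⟩
        C ^ q * γ ^ q      ≤⟨ *-monoʳ-≤ (C ^ q) (greedy-dense U (λ v → good v ≡ true) γ q E Z no-roots toℕ
                                        (fits-prefix q (λ i → ≤-refl)) (λ i → []) (λ i z e → ∧-elimˡ e) many) ⟩
        C ^ q * S (vecs U q) (𝟙 ∘ P) ∎)
        where open ≤-Reasoning

      -- `clean` refers to a root; here any vertex of `U` will do.
      root : Fin n
      root = proj₁ (S-positive U (λ _ → 1) (subst (0 <_) (≡.sym (S-one U)) 0<u))

      found : ∃[ x ] (x ∈ vecs (vecs U t) q × blow t q P x ∧ (clean q t root x ∧ clean q t root x) ≡ true)
      found = S-𝟙 (vecs (vecs U t) q) _ (positive (2 * tileK q t C) (≤-trans (m^n>0 (u ^ t) {{m^n≢0 u t}} q)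
        (clean-dense q t U uniq m (λ v w → ≤-trans (S-sub uniq _) (few v w)) root root (tileK q t C) _ dense
          (≤-trans (≤-reflexive (identity₃₃ (tileK q t C) (triples q t) (suc m))) sparse))))
        where
        positive : ∀ k {x} → 0 < k * x → 0 < x
        positive k {zero}  lt = contradiction (subst (0 <_) (*-zeroʳ k) lt) λ ()
        positive k {suc x} lt = z<s

    record Tile : Set where
      field
        T      : List (Fin n)
        unique : Unique T
        inside : ∀ {v} → v ∈ T → v ∈ U
        tiled  : Tiled T
        size   : length T ≡ order
        heavy  : order * S U ω ≤ u * S T ω + order * q₁ * M

    module Placed (x : Vec (Vec (Fin n) t) q) (x∈ : x ∈ vecs (vecs U t) q)
        (x-ok : blow t q P x ∧ (clean q t root x ∧ clean q t root x) ≡ true) where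

      private
        open BlownGreedy G

        x-adj : ∀ i i′ j j′ → E i i′ ≡ true → adj G (get x i j) (get x i′ j′) ≡ true
        x-adj = blown-adj t q E Z no-roots x (∧-elimˡ x-ok) E-sym E-irr

        x-clean : clean q t root x ≡ true
        x-clean = ∧-elimˡ (∧-elimʳ {blow t q P x} x-ok)

        labelV : Vec (Fin q) (length labels)
        labelV = Vec.fromList labels

        picked : List (Fin n × Fin q)
        picked = toList (pick labels≤t labelV x)

        picked-labels : map proj₂ picked ≡ labels
        picked-labels = ≡.trans (labels-pick labels≤t labelV x) (V.toList∘fromList labels)

      T : List (Fin n)
      T = map proj₁ picked

      T-unique : Unique T
      T-unique = subst Unique (V.toList-map proj₁ (pick labels≤t labelV x)) (unique-pick x x-adj root x-clean labels≤t labelV)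

      T-∈ : ∀ {v} → v ∈ T → v ∈ U
      T-∈ v∈ with ∈.∈-map⁻ proj₁ v∈
      ... | p , p∈ , ≡.refl with pick∈ labels≤t labelV x p∈
      ...   | i , j , ≡.refl = vecs-∈ (vecs-∈ x∈ i) j

      T-tiled : Tiled T
      T-tiled = place E homs valid picked (↭-reflexive (≡.trans picked-labels labels-eq)) (realises-pick x x-adj root x-clean labels≤t labelV)

      length-T : length T ≡ order
      length-T = ≡.trans (L.length-map proj₁ picked) (≡.trans (≡.sym (L.length-map proj₂ picked)) (≡.trans (cong length picked-labels) length-labels))

      T-heavy : order * S U ω ≤ u * S T ω + order * q₁ * M
      T-heavy = ≤-trans (weighted-thresholds q₁ κ k fits a b κ-small) (+-monoˡ-≤ _ (*-monoʳ-≤ u (begin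
        b * sumTo k w + a * w k                              ≡⟨ weigh w ⟨
        S labels (w ∘ toℕ)                                   ≡⟨ cong (λ l → S l (w ∘ toℕ)) picked-labels ⟨
        S (map proj₂ picked) (w ∘ toℕ)                       ≡⟨ S-map proj₂ picked _ ⟩
        S picked (w ∘ toℕ ∘ proj₂)                           ≤⟨ S-mono∈ picked heavy ⟩
        S picked (ω ∘ proj₁)                                 ≡⟨ S-map proj₁ picked ω ⟨
        S T ω                                                ∎)))
        where
        open ≤-Reasoning
        heavy : ∀ {p} → p ∈ picked → w (toℕ (proj₂ p)) ≤ ω (proj₁ p)
        heavy p∈ with pick∈ labels≤t labelV x p∈
        ... | i , j , ≡.refl = ≤ᵇ-true⇒≤ (∧-elimʳ {good (get x i j)} (blown-Z t q E Z no-roots x (∧-elimˡ x-ok) i j))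

    tile : Tile
    tile = record { T = T ; unique = T-unique ; inside = T-∈ ; tiled = T-tiled ; size = length-T ; heavy = T-heavy }
      where open Placed (proj₁ found) (proj₁ (proj₂ found)) (proj₂ (proj₂ found))

-- The degree condition falls short of the bound `b / B` by `1 / N`. In `bound` this slack is split
-- evenly: `2 * (N * r) ≤ n` spends one half on the reserved vertices, and `E ≡ 2 * (N * L)` the
-- other on the deviation `y`.
good-nonneighbours : ∀ N B d b n u₀ r u L E nn M y → .{{_ : NonZero (E * N * u₀)}} → E ≡ 2 * (N * L) →
  u₀ * nn ≤ M * u + y → E * y ≤ u₀ * u₀ → M ≤ d → N * B * d + B * n ≤ N * b * n →
  n ≤ u₀ + r → 2 * (N * r) ≤ n → u₀ ≤ n → u₀ ≤ L * u → b ≤ B → B * nn ≤ b * u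
good-nonneighbours N B d b n u₀ r u L E nn M y E≡ h₁ h₂ M≤d deg near small u₀≤n u₀≤Lu b≤B =
  *-cancelˡ-≤ (E * N * u₀) (+-cancelʳ-≤ (E * u * B * n) _ _ (begin
    E * N * u₀ * (B * nn) + E * u * B * n
      ≡⟨ identity₅₄ E N u₀ B nn u n ⟩
    N * B * E * (u₀ * nn) + E * u * B * n
      ≤⟨ +-monoˡ-≤ _ (*-monoʳ-≤ (N * B * E) h₁) ⟩
    N * B * E * (M * u + y) + E * u * B * n
      ≡⟨ identity₅₃ N B E M u y n ⟩
    N * B * E * u * M + N * B * (E * y) + E * u * B * n
      ≤⟨ +-monoˡ-≤ _ (+-mono-≤ (*-monoʳ-≤ (N * B * E * u) M≤d) (*-monoʳ-≤ (N * B) h₂)) ⟩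
    N * B * E * u * d + N * B * (u₀ * u₀) + E * u * B * n
      ≡⟨ identity₅₂ N B E u d u₀ n ⟩
    E * u * (N * B * d + B * n) + N * B * (u₀ * u₀)
      ≤⟨ +-monoˡ-≤ _ (*-monoʳ-≤ (E * u) (≤-trans deg (*-monoʳ-≤ (N * b) near))) ⟩
    E * u * (N * b * (u₀ + r)) + N * B * (u₀ * u₀)
      ≡⟨ identity₅₁ E u N b u₀ r B ⟩
    E * N * u₀ * (b * u) + b * (N * E * u * r) + B * (N * (u₀ * u₀))
      ≤⟨ +-monoˡ-≤ _ (+-monoʳ-≤ (E * N * u₀ * (b * u)) (*-monoˡ-≤ (N * E * u * r) b≤B)) ⟩
    E * N * u₀ * (b * u) + B * (N * E * u * r) + B * (N * (u₀ * u₀))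
      ≡⟨ identity₂₉ (E * N * u₀ * (b * u)) B (N * E * u * r) (N * (u₀ * u₀)) ⟩
    E * N * u₀ * (b * u) + B * (N * E * u * r + N * (u₀ * u₀))
      ≤⟨ +-monoʳ-≤ (E * N * u₀ * (b * u)) (*-monoʳ-≤ B (*-cancelˡ-≤ 2 bound)) ⟩
    E * N * u₀ * (b * u) + B * (E * u * n)
      ≡⟨ identity₅₀ (E * N * u₀ * (b * u)) B E u n ⟩
    E * N * u₀ * (b * u) + E * u * B * n ∎))
  where
  open ≤-Reasoning
  bound : 2 * (N * E * u * r + N * (u₀ * u₀)) ≤ 2 * (E * u * n)
  bound = begin
    2 * (N * E * u * r + N * (u₀ * u₀))          ≡⟨ identity₄₅ N E u r u₀ ⟩
    E * u * (2 * (N * r)) + 2 * N * u₀ * u₀      ≤⟨ +-mono-≤ (*-monoʳ-≤ (E * u) small) (*-mono-≤ (*-monoʳ-≤ (2 * N) u₀≤Lu) u₀≤n) ⟩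
    E * u * n + 2 * N * (L * u) * n              ≡⟨ cong (E * u * n +_) (≡.trans (identity₄₄ N L u n) (cong (λ e → e * u * n) (≡.sym E≡))) ⟩
    E * u * n + E * u * n                        ≡⟨ identity₄₃ (E * u * n) ⟩
    2 * (E * u * n)                              ∎

-- Chebyshev's inequality for the deviations: `h₁` bounds the bad vertices by the potential and `h₂`
-- is the invariant of the potential. One factor `R` is spent on the constant
-- `24 * (E * E * L) * B`, the other stays in the conclusion.
few-bad-vertices : ∀ n u₀ u w L E B R Φ bad → .{{_ : NonZero (u₀ * u₀ * (u₀ * u₀))}} → .{{_ : NonZero (6 * (E * E * L))}} → .{{_ : NonZero B}} →
  R ≡ 24 * (E * E * L) * B → u₀ * u₀ * (u₀ * u₀) * bad ≤ E * E * Φ →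
  R * R * Φ ≤ 3 * n * (u₀ * u₀ * u₀) * w → w ≤ u₀ → n ≤ 2 * u₀ → u₀ ≤ L * u → 4 * R * bad ≤ u
few-bad-vertices n u₀ u w L E B R Φ bad R≡ h₁ h₂ w≤u₀ n≤2u₀ u₀≤Lu = begin
  4 * R * bad      ≡⟨ *-identityʳ _ ⟨
  4 * R * bad * 1  ≤⟨ *-monoʳ-≤ (4 * R * bad) (>-nonZero⁻¹ B) ⟩
  4 * R * bad * B  ≤⟨ *-cancelˡ-≤ (6 * (E * E * L)) main ⟩
  u ∎
  where
  open ≤-Reasoning
  V⁴ = u₀ * u₀ * (u₀ * u₀)
  first : V⁴ * (R * R * bad) ≤ V⁴ * (3 * (E * E) * n)
  first = begin
    V⁴ * (R * R * bad)                              ≡⟨ identity₄₂ V⁴ R bad ⟩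
    R * R * (V⁴ * bad)                              ≤⟨ *-monoʳ-≤ (R * R) h₁ ⟩
    R * R * (E * E * Φ)                             ≡⟨ identity₄₁ R E Φ ⟩
    E * E * (R * R * Φ)                             ≤⟨ *-monoʳ-≤ (E * E) (≤-trans h₂ (*-monoʳ-≤ (3 * n * (u₀ * u₀ * u₀)) w≤u₀)) ⟩
    E * E * (3 * n * (u₀ * u₀ * u₀) * u₀)           ≡⟨ identity₄₀ E n u₀ ⟩
    V⁴ * (3 * (E * E) * n)                          ∎
  main : 6 * (E * E * L) * (4 * R * bad * B) ≤ 6 * (E * E * L) * u
  main = begin
    6 * (E * E * L) * (4 * R * bad * B)   ≡⟨ identity₃₉ (E * E * L) R bad B ⟩
    24 * (E * E * L) * B * R * bad        ≡⟨ cong (λ r → r * R * bad) R≡ ⟨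
    R * R * bad                           ≤⟨ *-cancelˡ-≤ V⁴ first ⟩
    3 * (E * E) * n                       ≤⟨ *-monoʳ-≤ (3 * (E * E)) (≤-trans n≤2u₀ (*-monoʳ-≤ 2 u₀≤Lu)) ⟩
    3 * (E * E) * (2 * (L * u))           ≡⟨ identity₃₈ E L u ⟩
    6 * (E * E * L) * u                   ∎

module _ (u R : ℕ) .{{_ : NonZero R}} (bad : ℕ) (few : 4 * R * bad ≤ u) (large : 2 * R ≤ u) where

  private
    u< : u ≤ R + R * (u / R)
    u< = ≤-trans (≤-reflexive (m≡m%n+[m/n]*n u R)) (+-mono-≤ (<⇒≤ (m%n<n u R)) (≤-reflexive (*-comm (u / R) R)))

  bad≤quota : bad ≤ u / R
  bad≤quota = *-cancelˡ-≤ (4 * R) {{m*n≢0 4 R}} (≤-from 0 (+-mono-≤ (+-mono-≤ few (*-monoʳ-≤ 4 u<)) (+-mono-≤ (*-monoʳ-≤ 2 large) (z≤n {u}))) (identity₃₇ R bad u (u / R)))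

  -- Rounding costs at most half of `u / R` because `2 * R ≤ u`, and the bad vertices cost at most a
  -- further quarter.
  quota-large : u ≤ 4 * R * (u / R ∸ bad)
  quota-large = ≤-from 0 (+-mono-≤ (+-mono-≤ few (*-monoʳ-≤ 4 u<)) (+-mono-≤ (*-monoʳ-≤ 2 large) (≤-reflexive (cong (4 * R *_) (≡.sym (m+[n∸m]≡n bad≤quota))))))
    (identity₃₆ R bad u (u / R) (u / R ∸ bad))

-- A step covers `B` further vertices and adds at most `3 * n * u₀ ^ 3 * B` to `R * R * Φ`. Two of
-- the three parts come from the quota, by `R * q₁ ≤ u ≤ u₀`, and one from the squared deviation of
-- the tile, by `R * R * B ≤ u₀`.
potential-invariant : ∀ n u₀ u w B R q₁ Φ Φ′ → .{{_ : NonZero u}} → R * q₁ ≤ u → R * R * B ≤ u₀ → u ≤ u₀ →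
  u * Φ′ ≤ u * Φ + ((B + B) * (n * ((u₀ * q₁) * (u₀ * q₁))) + u * (n * ((u₀ * B) * (u₀ * B)))) →
  R * R * Φ ≤ 3 * n * (u₀ * u₀ * u₀) * w → R * R * Φ′ ≤ 3 * n * (u₀ * u₀ * u₀) * (B + w)
potential-invariant n u₀ u w B R q₁ Φ Φ′ Rq₁ RRB u≤u₀ step inv = *-cancelˡ-≤ u (begin
  u * (R * R * Φ′)
    ≡⟨ identity₄₂ u R Φ′ ⟩
  R * R * (u * Φ′)
    ≤⟨ *-monoʳ-≤ (R * R) step ⟩
  R * R * (u * Φ + ((B + B) * (n * ((u₀ * q₁) * (u₀ * q₁))) + u * (n * ((u₀ * B) * (u₀ * B)))))
    ≡⟨ identity₄₉ R u Φ B n u₀ q₁ ⟩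
  u * (R * R * Φ) + ((B + B) * n * (u₀ * u₀) * ((R * q₁) * (R * q₁)) + u * n * (u₀ * u₀) * B * (R * R * B))
    ≤⟨ +-mono-≤ (*-monoʳ-≤ u inv) (+-mono-≤ (*-monoʳ-≤ ((B + B) * n * (u₀ * u₀)) (*-mono-≤ Rq₁ (≤-trans Rq₁ u≤u₀))) (*-monoʳ-≤ (u * n * (u₀ * u₀) * B) RRB)) ⟩
  u * (3 * n * (u₀ * u₀ * u₀) * w) + ((B + B) * n * (u₀ * u₀) * (u * u₀) + u * n * (u₀ * u₀) * B * u₀)
    ≡⟨ identity₄₈ u n u₀ w B ⟩
  u * (3 * n * (u₀ * u₀ * u₀) * (B + w)) ∎)
  where
  open ≤-Reasoning

-- As `B * κ ≤ u * b`, the `k` multiples of `κ` leave at least `u * a / B ≥ u / B` elements, and the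
-- quota `q₁ ≤ u / R` fits into these because `B ≤ R`.
thresholds-fit : ∀ k b a u R q₁ κ → .{{_ : NonZero (k * b + a)}} → k * b + a ≤ R → R * q₁ ≤ u → 1 ≤ a →
  (k * b + a) * κ ≤ u * b → q₁ + k * κ ≤ u
thresholds-fit k b a u R q₁ κ B≤R Rq₁ 1≤a κ≤ = *-cancelˡ-≤ B (begin
  B * (q₁ + k * κ)          ≡⟨ identity₄₇ B q₁ k κ ⟩
  B * q₁ + k * (B * κ)      ≤⟨ +-mono-≤ (≤-trans (*-monoˡ-≤ q₁ B≤R) Rq₁) (*-monoʳ-≤ k κ≤) ⟩
  u + k * (u * b)           ≤⟨ +-monoˡ-≤ _ (≤-trans (≤-reflexive (≡.sym (*-identityʳ u))) (*-monoʳ-≤ u 1≤a)) ⟩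
  u * a + k * (u * b)       ≡⟨ identity₄₆ u a k b ⟩
  B * u                     ∎)
  where
  open ≤-Reasoning
  B = k * b + a

module AlmostTiling {h n : ℕ} (H : Graph h) (G : Graph n) (F : IncompatibilitySystem G) {q : ℕ} (E : Fin q → Fin q → Bool)
    (E-sym : ∀ i j → E i j ≡ E j i) (E-irr : ∀ i → E i i ≡ false) (homs : List (Vec (Fin q) h)) (valid : All (Hom H E) homs)
    (k b a : ℕ) (toℕ≤k : ∀ (i : Fin q) → toℕ i ≤ k) (labels : List (Fin q)) (labels-eq : labels ≡ concatMap toList homs)
    (weigh : ∀ (f : ℕ → ℕ) → S labels (f ∘ toℕ) ≡ b * sumTo k f + a * f k)
    (t′ : ℕ) (labels≤t : length labels ≤ suc t′)
    (U₀ : List (Fin n)) (U₀-unique : Unique U₀) (N L d m r thr R E₁ : ℕ)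
    .{{_ : NonZero N}} .{{_ : NonZero L}} .{{_ : NonZero R}} .{{_ : NonZero (k * b + a)}}
    (E₁≡ : E₁ ≡ 2 * (N * L)) (R≡ : R ≡ 24 * (E₁ * E₁ * L) * (k * b + a)) (B≤R : k * b + a ≤ R) (1≤a : 1 ≤ a) (b≤B : b ≤ k * b + a)
    (nd : ∀ v → S (allFin n) (λ z → 𝟙 (not (adj G v z))) ≤ d)
    (few : ∀ v w → S (allFin n) (𝟙 ∘ inc F v w) ≤ m)
    (deg : N * (k * b + a) * d + (k * b + a) * n ≤ N * b * n)
    (near : n ≤ length U₀ + r) (small : 2 * (N * r) ≤ n)
    (0<thr : 0 < thr) (u₀≤Lthr : length U₀ ≤ L * thr) (2R≤thr : 2 * R ≤ thr) (RRB≤u₀ : R * R * (k * b + a) ≤ length U₀)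
    (sparse : tileSparsity q (suc t′) (4 * R) * suc m ≤ thr) where
  open Tiling H G F
  open FindTile H G F E E-sym E-irr homs valid k b a toℕ≤k labels labels-eq weigh t′ labels≤t
  open Potential G U₀

  record Almost (U : List (Fin n)) : Set where
    field
      covered′   : List (Fin n)
      leftover   : List (Fin n)
      partition  : U ↭ covered′ ++ leftover
      cover-tiled : Tiled covered′
      few-left   : length leftover < thr

  private
    u₀≤n : u₀ ≤ n
    u₀≤n = ≡.subst₂ _≤_ (S-one U₀) (≡.trans (S-one V) (length-allFin n)) (S-sub U₀-unique (λ _ → 1))

    instance
      E₁≢0 : NonZero E₁
      E₁≢0 = ≢-nonZero λ e → ≢-nonZero⁻¹ (2 * (N * L)) {{m*n≢0 2 (N * L) {{_}} {{m*n≢0 N L}}}} (≡.trans (≡.sym E₁≡) e)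
      u₀≢0 : NonZero u₀
      u₀≢0 = >-nonZero (≤-trans (>-nonZero⁻¹ (R * R * (k * b + a)) {{m*n≢0 (R * R) (k * b + a) {{m*n≢0 R R}}}}) RRB≤u₀)
      u₀²≢0 : NonZero (u₀ * u₀)
      u₀²≢0 = m*n≢0 u₀ u₀
      u₀⁴≢0 : NonZero (u₀ * u₀ * (u₀ * u₀))
      u₀⁴≢0 = m*n≢0 (u₀ * u₀) (u₀ * u₀)
      ENu₀≢0 : NonZero (E₁ * N * u₀)
      ENu₀≢0 = m*n≢0 (E₁ * N) u₀ {{m*n≢0 E₁ N}}
      6EEL≢0 : NonZero (6 * (E₁ * E₁ * L))
      6EEL≢0 = m*n≢0 6 (E₁ * E₁ * L) {{_}} {{m*n≢0 (E₁ * E₁) L {{m*n≢0 E₁ E₁}}}}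

    n≤2u₀ : n ≤ 2 * u₀
    n≤2u₀ = ≤-from 0 (+-mono-≤ (*-monoʳ-≤ 2 near) (≤-trans (*-monoʳ-≤ 2 (m≤n*m r N)) small)) (identity₁₈ n u₀ r)

    -- `w` is the number of vertices covered so far. The potential is thus allowed to grow linearly
    -- with the progress of the covering, which keeps it small enough until the end.
    Invariant : List (Fin n) → Set
    Invariant U = ∃[ w ] (length U + w ≡ u₀ × R * R * Φ U ≤ 3 * n * (u₀ * u₀ * u₀) * w)

    good : List (Fin n) → Fin n → Bool
    good U v = E₁ * ℤ.∣ y U v ∣ ≤ᵇ u₀ * u₀

    module Step (U : List (Fin n)) (uniq : Unique U) (thr≤u : thr ≤ length U) (w : ℕ) (w-eq : length U + w ≡ u₀)
                (inv : R * R * Φ U ≤ 3 * n * (u₀ * u₀ * u₀) * w) where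
      u = length U
      instance
        u≢0 : NonZero u
        u≢0 = >-nonZero (≤-trans 0<thr thr≤u)
      u₀≤Lu : u₀ ≤ L * u
      u₀≤Lu = ≤-trans u₀≤Lthr (*-monoʳ-≤ L thr≤u)
      bad = S V (λ z → 𝟙 (not (good U z)))
      q₁ = u / R
      κ = (u * b) / (k * b + a)
      few-bad : 4 * R * bad ≤ u
      few-bad = few-bad-vertices n u₀ u w L E₁ (k * b + a) R (Φ U) bad R≡ bad-Φ inv (≤-trans (m≤n+m w u) (≤-reflexive w-eq)) n≤2u₀ u₀≤Lu
        where
        open ≤-Reasoning
        bad-Φ : u₀ * u₀ * (u₀ * u₀) * bad ≤ E₁ * E₁ * Φ U
        bad-Φ = begin
          u₀ * u₀ * (u₀ * u₀) * bad
            ≡⟨ S-*ˡ V (u₀ * u₀ * (u₀ * u₀)) _ ⟨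
          S V (λ v → u₀ * u₀ * (u₀ * u₀) * 𝟙 (not (good U v)))
            ≤⟨ S-mono V pointwise ⟩
          S V (λ v → E₁ * E₁ * (ℤ.∣ y U v ∣ * ℤ.∣ y U v ∣))
            ≡⟨ S-*ˡ V (E₁ * E₁) _ ⟩
          E₁ * E₁ * Φ U ∎
          where
          pointwise : ∀ v → u₀ * u₀ * (u₀ * u₀) * 𝟙 (not (good U v)) ≤ E₁ * E₁ * (ℤ.∣ y U v ∣ * ℤ.∣ y U v ∣)
          pointwise v with good U v in e
          ... | true  = ≤-trans (≤-reflexive (*-zeroʳ (u₀ * u₀ * (u₀ * u₀)))) z≤n
          ... | false = ≤-trans (≤-reflexive (*-identityʳ _)) (≤-trans (*-mono-≤ lt lt) (≤-reflexive (identity₃₅ E₁ ℤ.∣ y U v ∣)))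
            where lt : u₀ * u₀ ≤ E₁ * ℤ.∣ y U v ∣
                  lt = <⇒≤ (≤ᵇ-false⇒> e)
      good-nn : ∀ v → good U v ≡ true → S U (λ z → 𝟙 (not (adj G v z))) ≤ κ
      good-nn v g = *≤⇒≤/ (good-nonneighbours N (k * b + a) d b n u₀ r u L E₁ (nn v U) (nn v U₀) ℤ.∣ y U v ∣ E₁≡
          (≤+∣-∣ (u₀ * nn v U) (nn v U₀ * u)) (≤ᵇ-true⇒≤ g) (≤-trans (S-sub U₀-unique _) (nd v)) deg near small u₀≤n u₀≤Lu b≤B)
        where
        *≤⇒≤/ : ∀ {x} → (k * b + a) * x ≤ b * u → x ≤ κ
        *≤⇒≤/ {x} le = ≤-trans (≤-reflexive (≡.sym (m*n/n≡m x (k * b + a))))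
          (/-monoˡ-≤ (k * b + a) (≡.subst₂ _≤_ (*-comm (k * b + a) x) (*-comm b u) le))
      Rq₁≤u : R * q₁ ≤ u
      Rq₁≤u = ≤-trans (≤-reflexive (*-comm R q₁)) (m/n*n≤m u R)
      κ≤ : (k * b + a) * κ ≤ u * b
      κ≤ = ≤-trans (≤-reflexive (*-comm (k * b + a) κ)) (m/n*n≤m (u * b) (k * b + a))
      2R≤u : 2 * R ≤ u
      2R≤u = ≤-trans 2R≤thr thr≤u
      the-tile : Tile U uniq (≤-trans 0<thr thr≤u) (ω U) (Y U + Y U) (ω≤2Y U) (good U) κ q₁ (4 * R) (q₁ ∸ bad) m good-nn
        (≤-trans (+-monoʳ-≤ (q₁ ∸ bad) (S-sub uniq _)) (≤-reflexive (m∸n+n≡m (bad≤quota u R bad few-bad 2R≤u))))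
        (quota-large u R bad few-bad 2R≤u) (thresholds-fit k b a u R q₁ κ B≤R Rq₁≤u 1≤a κ≤) κ≤ few (≤-trans sparse thr≤u)
      the-tile = tile U uniq _ (ω U) (Y U + Y U) (ω≤2Y U) (good U) κ q₁ (4 * R) (q₁ ∸ bad) m good-nn _ _ _ κ≤ few _

      module Next (T : List (Fin n)) (T-unique : Unique T) (inside : ∀ {v} → v ∈ T → v ∈ U) (size : length T ≡ k * b + a)
                  (heavy : (k * b + a) * S U (ω U) ≤ u * S T (ω U) + (k * b + a) * q₁ * (Y U + Y U)) where
        rest = complement T T-unique inside
        U′ = proj₁ rest
        split = proj₂ rest
        U′-unique : Unique U′
        U′-unique = proj₁ (proj₂ (unique-++ T (Unique-↭ split uniq)))
        lengths : u ≡ k * b + a + length U′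
        lengths = ≡.trans (↭-length split) (≡.trans (L.length-++ T) (cong (_+ length U′) size))
        invariant : Invariant U′
        invariant = k * b + a + w , ≡.trans (identity₃₄ (length U′) (k * b + a) w) (≡.trans (cong (_+ w) (≡.sym lengths)) w-eq)
          , potential-invariant n u₀ u w (k * b + a) R q₁ (Φ U) (Φ U′) Rq₁≤u RRB≤u₀ (≤-trans (m≤m+n u w) (≤-reflexive w-eq))
              (≡.subst₂ (λ B l → u * Φ U′ ≤ u * Φ U + ((B + B) * (l * ((u₀ * q₁) * (u₀ * q₁))) + u * (l * ((u₀ * B) * (u₀ * B))))) size (length-allFin n)
                (potential-drop {U} {T} {U′} q₁ split (subst (λ B → B * S U (ω U) ≤ u * S T (ω U) + B * q₁ * (Y U + Y U)) (≡.sym size) heavy))) inv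

  almost-from : ∀ fuel U → length U ≤ fuel → Unique U → Invariant U → Almost U
  almost-from fuel U le uniq (w , w-eq , inv) with thr ≤? length U
  ... | no ¬p = record { covered′ = [] ; leftover = U ; partition = ↭-refl ; cover-tiled = tiled-[] ; few-left = ≰⇒> ¬p }
  almost-from zero U le uniq (w , w-eq , inv) | yes p = contradiction (≤-trans 0<thr (≤-trans p le)) λ ()
  almost-from (suc fuel) U le uniq (w , w-eq , inv) | yes p = record
      { covered′ = T ++ covered′ ; leftover = leftover
      ; partition = trans split (trans (++⁺ˡ T partition) (↭-reflexive (≡.sym (L.++-assoc T covered′ leftover))))
      ; cover-tiled = tiled-++ tiled cover-tiled ; few-left = few-left }
    where
    open Step U uniq p w w-eq inv
    open Tile the-tile renaming (unique to T-unique)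
    open Next T T-unique inside size heavy
    shorter : length U′ ≤ fuel
    shorter = ≤-pred (≤-trans (+-monoˡ-≤ (length U′) (>-nonZero⁻¹ (k * b + a))) (≤-trans (≤-reflexive (≡.sym lengths)) le))
    open Almost (almost-from fuel U′ shorter U′-unique invariant)

  almost : Almost U₀
  almost = almost-from u₀ U₀ ≤-refl U₀-unique (0 , +-identityʳ u₀ , ≤-reflexive start)
    where
    zero-y : ∀ v → y U₀ v ≡ 0ℤ
    zero-y v = ≡.trans (cong (λ x → ℤ.+ x ℤ.- ℤ.+ (nn v U₀ * u₀)) (*-comm u₀ (nn v U₀))) (ℤ.+-inverseʳ (ℤ.+ (nn v U₀ * u₀)))
    start : R * R * Φ U₀ ≡ 3 * n * (u₀ * u₀ * u₀) * 0
    start = ≡.trans (cong (R * R *_) (≡.trans (S-cong V (λ v → cong (λ i → ℤ.∣ i ∣ * ℤ.∣ i ∣) (zero-y v))) (S-zero V)))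
      (≡.trans (*-zeroʳ (R * R)) (≡.sym (*-zeroʳ (3 * n * (u₀ * u₀ * u₀)))))

-- Patterns and bottles from colourings

sumTo-cong : ∀ m {f g : ℕ → ℕ} → (∀ i → i < m → f i ≡ g i) → sumTo m f ≡ sumTo m g
sumTo-cong zero    h = ≡.refl
sumTo-cong (suc m) h = cong₂ _+_ (sumTo-cong m (λ i lt → h i (m<n⇒m<1+n lt))) (h m ≤-refl)

sumTo-head : ∀ m (f : ℕ → ℕ) → sumTo (suc m) f ≡ f 0 + sumTo m (f ∘ suc)
sumTo-head zero    f = +-comm 0 (f 0)
sumTo-head (suc m) f = ≡.trans (cong (λ x → x + f (suc m)) (sumTo-head m f)) (+-assoc (f 0) _ _)

sumTo-period : ∀ m (g : ℕ → ℕ) → (∀ i → g (i + m) ≡ g i) → ∀ x → sumTo m (λ j → g (x + j)) ≡ sumTo m g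
sumTo-period m g per zero    = ≡.refl
sumTo-period m g per (suc x) = ≡.trans (+-cancelˡ-≡ (g x) _ _ (begin
  g x + sumTo m (λ j → g (suc x + j))                   ≡⟨ cong₂ _+_ (cong g (≡.sym (+-identityʳ x))) (sumTo-cong m (λ j _ → cong g (≡.sym (+-suc x j)))) ⟩
  g (x + 0) + sumTo m (λ j → g (x + suc j))             ≡⟨ sumTo-head m (λ j → g (x + j)) ⟨
  sumTo m (λ j → g (x + j)) + g (x + m)                 ≡⟨ ≡.trans (cong (λ y → sumTo m (λ j → g (x + j)) + y) (per x)) (+-comm _ (g x)) ⟩
  g x + sumTo m (λ j → g (x + j))                       ∎)) (sumTo-period m g per x)
  where open ≡-Reasoning

S-allFin : ∀ m (f : ℕ → ℕ) → S (allFin m) (f ∘ toℕ) ≡ sumTo m f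
S-allFin zero    f = ≡.refl
S-allFin (suc m) f = ≡.trans (cong (λ x → f 0 + x) (≡.trans (S-tabulate m Fin.suc (f ∘ toℕ)) (S-allFin m (f ∘ suc)))) (≡.sym (sumTo-head m f))

rotate : (m : ℕ) → .{{NonZero m}} → ℕ → ℕ → ℕ
rotate m j x with x <? m
... | yes _ = (x + j) % m
... | no _  = x

rotate-sum : ∀ m .{{_ : NonZero m}} (f : ℕ → ℕ) x → x < m → S (allFin m) (λ j → f (rotate m (toℕ j) x)) ≡ sumTo m f
rotate-sum m f x x<m = begin
  S (allFin m) (λ j → f (rotate m (toℕ j) x))   ≡⟨ S-allFin m (λ j → f (rotate m j x)) ⟩
  sumTo m (λ j → f (rotate m j x))              ≡⟨ sumTo-cong m (λ j _ → cong f (inside j)) ⟩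
  sumTo m (λ j → f ((x + j) % m))               ≡⟨ sumTo-period m (λ i → f (i % m)) (λ i → cong f ([m+n]%n≡m%n i m)) x ⟩
  sumTo m (λ i → f (i % m))                     ≡⟨ sumTo-cong m (λ i lt → cong f (m<n⇒m%n≡m lt)) ⟩
  sumTo m f ∎
  where
  open ≡-Reasoning
  inside : ∀ j → rotate m j x ≡ (x + j) % m
  inside j with x <? m
  ... | yes _ = ≡.refl
  ... | no ¬p = contradiction x<m ¬p

rotate-fixed : ∀ m .{{_ : NonZero m}} j x → m ≤ x → rotate m j x ≡ x
rotate-fixed m j x m≤x with x <? m
... | yes p = contradiction m≤x (<⇒≱ p)
... | no _  = ≡.refl

-- x + j determines x modulo m, because x ≡ (x + j) + j (m ∸ 1)
rotate-injective : ∀ m .{{_ : NonZero m}} j {x y} → rotate m j x ≡ rotate m j y → x ≡ y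
rotate-injective (suc m) j {x} {y} e with x <? suc m | y <? suc m
... | yes p | yes q = ≡.trans (recover x p) (≡.trans (cong (λ z → (z + (j * m) % suc m) % suc m) e) (≡.sym (recover y q)))
  where
  recover : ∀ x → x < suc m → x ≡ ((x + j) % suc m + (j * m) % suc m) % suc m
  recover x p = begin
    x                                                    ≡⟨ m<n⇒m%n≡m p ⟨
    x % suc m                                            ≡⟨ [m+kn]%n≡m%n x j (suc m) ⟨
    (x + j * suc m) % suc m                              ≡⟨ cong (_% suc m) (identity₅₅ x j m) ⟩
    (x + j + j * m) % suc m                              ≡⟨ %-distribˡ-+ (x + j) (j * m) (suc m) ⟩
    ((x + j) % suc m + (j * m) % suc m) % suc m          ∎
    where
    open ≡-Reasoning
... | yes p | no ¬q = contradiction (subst (_< suc m) e (m%n<n (x + j) (suc m))) ¬q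
... | no ¬p | yes q = contradiction (subst (_< suc m) (≡.sym e) (m%n<n (y + j) (suc m))) ¬p
... | no _  | no _  = e

rotate< : ∀ m .{{_ : NonZero m}} j x k → m ≤ k → x < k → rotate m j x < k
rotate< m j x k m≤k x<k with x <? m
... | yes _ = <-≤-trans (m%n<n (x + j) m) m≤k
... | no _  = x<k

distinctᵇ-true : ∀ {q} {i j : Fin q} → i ≢ j → distinctᵇ i j ≡ true
distinctᵇ-true {i = i} {j} ne with i Fin.≟ j
... | yes e = contradiction e ne
... | no _  = ≡.refl

module _ {h : ℕ} (H : Graph h) (k : ℕ) (c : Fin h → Fin k) (pr : ProperColouring H k c) where

  rotateF : ∀ m .{{_ : NonZero m}} → m ≤ k → ℕ → Fin k → Fin k
  rotateF m m≤k j x = Fin.fromℕ< (rotate< m j (toℕ x) k m≤k (Fin.toℕ<n x))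

  rotated : ∀ m .{{_ : NonZero m}} → m ≤ k → List (Vec (Fin k) h)
  rotated m m≤k = map (λ j → Vec.tabulate (λ v → rotateF m m≤k (toℕ j) (c v))) (allFin m)

  rotated-valid : ∀ m .{{_ : NonZero m}} (m≤k : m ≤ k) → All (Hom H distinctᵇ) (rotated m m≤k)
  rotated-valid m m≤k = All.map⁺ (All.tabulate λ {j} _ a b ab → ≡.subst₂ (λ x y → distinctᵇ x y ≡ true)
    (≡.sym (V.lookup∘tabulate _ a)) (≡.sym (V.lookup∘tabulate _ b))
    (distinctᵇ-true λ e → pr a b ab (Fin.toℕ-injective (rotate-injective m (toℕ j)
      (≡.trans (≡.sym (Fin.toℕ-fromℕ< _)) (≡.trans (cong toℕ e) (Fin.toℕ-fromℕ< _)))))))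

  rotated-weigh : ∀ m .{{_ : NonZero m}} (m≤k : m ≤ k) (f : ℕ → ℕ) →
    S (concatMap toList (rotated m m≤k)) (f ∘ toℕ) ≡ S (allFin h) (λ v → S (allFin m) (λ j → f (rotate m (toℕ j) (toℕ (c v)))))
  rotated-weigh m m≤k f = begin
    S (concatMap toList (rotated m m≤k)) (f ∘ toℕ)
      ≡⟨ S-concatMap toList (rotated m m≤k) _ ⟩
    S (rotated m m≤k) (λ w → S (toList w) (f ∘ toℕ))
      ≡⟨ S-map _ (allFin m) _ ⟩
    S (allFin m) (λ j → S (toList (Vec.tabulate (λ v → rotateF m m≤k (toℕ j) (c v)))) (f ∘ toℕ))
      ≡⟨ S-cong (allFin m) (λ j → ≡.trans (S-toList-tabulate h _ _) (S-cong (allFin h) (λ v → cong f (Fin.toℕ-fromℕ< _)))) ⟩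
    S (allFin m) (λ j → S (allFin h) (λ v → f (rotate m (toℕ j) (toℕ (c v)))))
      ≡⟨ S-swap (allFin m) (allFin h) _ ⟩
    S (allFin h) (λ v → S (allFin m) (λ j → f (rotate m (toℕ j) (toℕ (c v))))) ∎
    where
    open ≡-Reasoning
    S-toList-tabulate : ∀ h (φ : Fin h → A) (g : A → ℕ) → S (toList (Vec.tabulate φ)) g ≡ S (allFin h) (g ∘ φ)
    S-toList-tabulate zero    φ g = ≡.refl
    S-toList-tabulate (suc h) φ g = cong (λ x → g (φ Fin.zero) + x)
      (≡.trans (S-toList-tabulate h (φ ∘ Fin.suc) g) (≡.sym (S-tabulate h Fin.suc (g ∘ φ))))

-- Under the `suc k` rotations of a colouring, each vertex of `H` visits every part exactly once.
balanced-bottle : ∀ {h} (H : Graph h) k → Colourable H (suc k) → Bottle H k h h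
balanced-bottle {h} H k (c , pr) = record
  { homs  = rotated H (suc k) c pr (suc k) ≤-refl
  ; valid = rotated-valid H (suc k) c pr (suc k) ≤-refl
  ; weigh = λ f → ≡.trans (rotated-weigh H (suc k) c pr (suc k) ≤-refl f)
      (≡.trans (S-cong (allFin h) (λ v → rotate-sum (suc k) f (toℕ (c v)) (Fin.toℕ<n (c v))))
      (≡.trans (S-const (allFin h) _) (≡.trans (cong (_* sumTo (suc k) f) (length-allFin h)) (*-distribˡ-+ h _ _)))) }

-- the k rotations of a colouring whose last class has s elements
critical-bottle : ∀ {h} (H : Graph h) k .{{_ : NonZero k}} s (c : Fin h → Fin (suc k)) → ProperColouring H (suc k) c →
  classSize c (Fin.fromℕ k) ≡ s → Bottle H k (h ∸ s) (k * s)
critical-bottle {h} H k s c pr size = record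
  { homs  = rotated H (suc k) c pr k (n≤1+n k)
  ; valid = rotated-valid H (suc k) c pr k (n≤1+n k)
  ; weigh = λ f → ≡.trans (rotated-weigh H (suc k) c pr k (n≤1+n k) f) (total f) }
  where
  last = Fin.fromℕ k
  isLast : Fin h → ℕ
  isLast v = 𝟙 ⌊ c v Fin.≟ last ⌋
  notLast : Fin h → ℕ
  notLast v = 𝟙 (not ⌊ c v Fin.≟ last ⌋)
  lasts : S (allFin h) isLast ≡ s
  lasts = ≡.trans (≡.sym (count≡S h _)) size
  nonlasts : S (allFin h) notLast ≡ h ∸ s
  nonlasts = ≡.trans (≡.sym (m+n∸m≡n s _)) (cong (_∸ s) (≡.trans (cong (_+ S (allFin h) notLast) (≡.sym lasts))
    (≡.trans (≡.sym (S-+ (allFin h) isLast notLast)) (≡.trans (S-cong (allFin h) (λ v → lem ⌊ c v Fin.≟ last ⌋))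
    (≡.trans (S-one (allFin h)) (length-allFin h))))))
    where lem : ∀ b → 𝟙 b + 𝟙 (not b) ≡ 1
          lem true  = ≡.refl
          lem false = ≡.refl
  total : ∀ f → S (allFin h) (λ v → S (allFin k) (λ j → f (rotate k (toℕ j) (toℕ (c v))))) ≡ (h ∸ s) * sumTo k f + k * s * f k
  total f = begin
    S (allFin h) (λ v → S (allFin k) (λ j → f (rotate k (toℕ j) (toℕ (c v)))))
      ≡⟨ S-cong (allFin h) pointwise ⟩
    S (allFin h) (λ v → notLast v * sumTo k f + isLast v * (k * f k))
      ≡⟨ ≡.trans (S-+ (allFin h) _ _) (cong₂ _+_ (S-*ʳ (allFin h) (sumTo k f) notLast) (S-*ʳ (allFin h) (k * f k) isLast)) ⟩
    S (allFin h) notLast * sumTo k f + S (allFin h) isLast * (k * f k)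
      ≡⟨ cong₂ (λ x y → x * sumTo k f + y * (k * f k)) nonlasts lasts ⟩
    (h ∸ s) * sumTo k f + s * (k * f k)
      ≡⟨ cong (λ x → (h ∸ s) * sumTo k f + x) (identity₂₃ s k (f k)) ⟩
    (h ∸ s) * sumTo k f + k * s * f k ∎
    where
    open ≡-Reasoning
    pointwise : ∀ v → S (allFin k) (λ j → f (rotate k (toℕ j) (toℕ (c v)))) ≡ notLast v * sumTo k f + isLast v * (k * f k)
    pointwise v with c v Fin.≟ last
    ... | yes e = ≡.trans (S-cong (allFin k) (λ j → cong f (≡.trans (rotate-fixed k (toℕ j) (toℕ (c v)) (≤-reflexive (≡.sym cv≡k))) cv≡k)))
          (≡.trans (S-const (allFin k) (f k)) (≡.trans (cong (_* f k) (length-allFin k)) (≡.sym (+-identityʳ _))))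
      where cv≡k : toℕ (c v) ≡ k
            cv≡k = ≡.trans (cong toℕ e) (Fin.toℕ-fromℕ k)
    ... | no ne = ≡.trans (rotate-sum k f (toℕ (c v)) (≤∧≢⇒< (≤-pred (Fin.toℕ<n (c v))) (λ e → ne (Fin.toℕ-injective (≡.trans e (≡.sym (Fin.toℕ-fromℕ k)))))))
          (≡.sym (≡.trans (+-identityʳ _) (*-identityˡ _)))

-- In the balanced case a vertex is exchanged inside single copies of H.
balanced-pattern : ∀ {h} (H : Graph h) k → Colourable H (suc k) → Fin h → Pattern H
balanced-pattern {h} H k (c , pr) v₀ = record
  { vertices = suc k ; E = distinctᵇ ; E-sym = distinctᵇ-sym ; E-irr = distinctᵇ-irr ; a = last ; b = last
  ; exchange = record { homsₐ = w ∷ [] ; homsᵦ = w ∷ [] ; rest = proj₁ ex ; validₐ = w-hom ∷ [] ; validᵦ = w-hom ∷ []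
                      ; completeₐ = ↭-sym (proj₂ ex) ; completeᵦ = ↭-sym (proj₂ ex) }
  ; tile = w ; tile-hom = w-hom ; depth = suc k ; fits = fits-prefix (suc k) {distinctᵇ} {λ i → bump (distinctᵇ last i) (bump (distinctᵇ last i) 0)} {λ _ → suc k} room }
  where
  last = Fin.fromℕ k
  c′ : Fin h → Fin (suc k)
  c′ = transpose (c v₀) last ∘ c
  w = Vec.tabulate c′
  w-hom : Hom H distinctᵇ w
  w-hom a b ab = ≡.subst₂ (λ x y → distinctᵇ x y ≡ true) (≡.sym (V.lookup∘tabulate c′ a)) (≡.sym (V.lookup∘tabulate c′ b))
    (distinctᵇ-true (λ e → pr a b ab (transpose-injective (c v₀) last e)))
  ex : ∃[ ys ] (concatMap toList (w ∷ []) ↭ last ∷ ys)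
  ex = extract (∈-++⁺ˡ (subst (_∈ toList w) (≡.trans (V.lookup∘tabulate c′ v₀) (transpose-ˡ (c v₀) last)) (∈-toList-lookup w v₀)))
  room : ∀ i → bump (distinctᵇ last i) (bump (distinctᵇ last i) 0) + toℕ i ≤ suc k
  room i with last Fin.≟ i
  ... | yes _ = <⇒≤ (Fin.toℕ<n i)
  ... | no ne = s≤s (≤∧≢⇒< (≤-pred (Fin.toℕ<n i)) (λ e → ne (Fin.toℕ-injective (≡.trans (Fin.toℕ-fromℕ k) (≡.sym e)))))

module _ {h : ℕ} (H : Graph h) (colourable : Colourable H 2) (flip≡1 : Bipartite.flipGcd H ≡ 1) (order≡1 : Bipartite.orderGcd H ≡ 1) where

  private
    edges : Fin 4 → Fin 4 → Bool
    edges Fin.zero                         (Fin.suc Fin.zero)                     = true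
    edges (Fin.suc Fin.zero)               Fin.zero                               = true
    edges (Fin.suc (Fin.suc Fin.zero))     (Fin.suc (Fin.suc (Fin.suc Fin.zero))) = true
    edges (Fin.suc (Fin.suc (Fin.suc Fin.zero))) (Fin.suc (Fin.suc Fin.zero))     = true
    edges _ _ = false

    -- The vertices `0` and `2` are the neighbours of the exchanged vertices `1` and `3`, and
    -- precede them. Each of `0` and `2` meets one root, and each of `1` and `3` only its earlier
    -- neighbour, so depth one suffices. If an exchanged vertex came before its neighbour, the
    -- latter would be constrained twice.
    ι : Fin 2 → Fin 2 → Fin 4
    ι Fin.zero           Fin.zero           = Fin.suc Fin.zero
    ι Fin.zero           (Fin.suc Fin.zero) = Fin.zero
    ι (Fin.suc Fin.zero) Fin.zero           = Fin.suc (Fin.suc (Fin.suc Fin.zero))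
    ι (Fin.suc Fin.zero) (Fin.suc Fin.zero) = Fin.suc (Fin.suc Fin.zero)

    ι-hom : ∀ s i → edges (ι s i) (ι s (flip₂ i)) ≡ true
    ι-hom Fin.zero           Fin.zero           = ≡.refl
    ι-hom Fin.zero           (Fin.suc Fin.zero) = ≡.refl
    ι-hom (Fin.suc Fin.zero) Fin.zero           = ≡.refl
    ι-hom (Fin.suc Fin.zero) (Fin.suc Fin.zero) = ≡.refl

  -- two disjoint edges, between which the components of H can be moved
  bipartite-pattern : Pattern H
  bipartite-pattern = record
    { vertices = 4 ; E = edges
    ; E-sym = λ i j → toWitness {a? = Fin.all? λ i → Fin.all? λ j → edges i j Bool.≟ edges j i} tt i j
    ; E-irr = λ i → toWitness {a? = Fin.all? λ i → edges i i Bool.≟ false} tt i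
    ; a = ι Fin.zero Fin.zero ; b = ι (Fin.suc Fin.zero) Fin.zero
    ; exchange = transfer-exchange (λ ()) (subst (λ g → Transfer (ι Fin.zero Fin.zero) (ι (Fin.suc Fin.zero) Fin.zero) (ℤ.+ g)) order≡1 (orderGcd-transfer edges ι ι-hom colourable flip≡1))
    ; tile = Vec.tabulate (λ v → ι Fin.zero (proj₁ colourable v))
    ; tile-hom = homF→hom (plain-hom edges ι ι-hom Fin.zero (proj₁ colourable) (proj₂ colourable))
    ; depth = 1 ; fits = s≤s z≤n , s≤s z≤n , s≤s z≤n , s≤s z≤n , tt }
    where
    open Bipartite H
    open Lattice H edges

module _ {h : ℕ} (H : Graph h) (k : ℕ) (colourable : Colourable H (3 + k)) (gap≡1 : Colourings.gapGcd H (3 + k) ≡ 1) where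

  private
    p q : ℕ
    p = 2 + k
    q = suc (p + p)

    blocks : Fin p ⊎ Fin p → Fin p ⊎ Fin p → Bool
    blocks (inj₁ i) (inj₁ j) = distinctᵇ i j
    blocks (inj₂ i) (inj₂ j) = distinctᵇ i j
    blocks _        _        = false

    E : Fin q → Fin q → Bool
    E Fin.zero    Fin.zero    = false
    E Fin.zero    (Fin.suc _) = true
    E (Fin.suc _) Fin.zero    = true
    E (Fin.suc i) (Fin.suc j) = blocks (Fin.splitAt p i) (Fin.splitAt p j)

    left right : Fin (suc p) → Fin q
    left  Fin.zero    = Fin.zero
    left  (Fin.suc i) = Fin.suc (i ↑ˡ p)
    right Fin.zero    = Fin.zero
    right (Fin.suc i) = Fin.suc (p ↑ʳ i)

    blocks-sym : ∀ x y → blocks x y ≡ blocks y x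
    blocks-sym (inj₁ i) (inj₁ j) = distinctᵇ-sym i j
    blocks-sym (inj₁ i) (inj₂ j) = ≡.refl
    blocks-sym (inj₂ i) (inj₁ j) = ≡.refl
    blocks-sym (inj₂ i) (inj₂ j) = distinctᵇ-sym i j

    blocks-irr : ∀ x → blocks x x ≡ false
    blocks-irr (inj₁ i) = distinctᵇ-irr i
    blocks-irr (inj₂ i) = distinctᵇ-irr i

    E-sym : ∀ i j → E i j ≡ E j i
    E-sym Fin.zero    Fin.zero    = ≡.refl
    E-sym Fin.zero    (Fin.suc j) = ≡.refl
    E-sym (Fin.suc i) Fin.zero    = ≡.refl
    E-sym (Fin.suc i) (Fin.suc j) = blocks-sym (Fin.splitAt p i) (Fin.splitAt p j)

    E-irr : ∀ i → E i i ≡ false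
    E-irr Fin.zero    = ≡.refl
    E-irr (Fin.suc i) = blocks-irr (Fin.splitAt p i)

    E-ll : ∀ i j → E (Fin.suc (i ↑ˡ p)) (Fin.suc (j ↑ˡ p)) ≡ distinctᵇ i j
    E-ll i j = cong₂ blocks (Fin.splitAt-↑ˡ p i p) (Fin.splitAt-↑ˡ p j p)

    E-rr : ∀ i j → E (Fin.suc (p ↑ʳ i)) (Fin.suc (p ↑ʳ j)) ≡ distinctᵇ i j
    E-rr i j = cong₂ blocks (Fin.splitAt-↑ʳ p p i) (Fin.splitAt-↑ʳ p p j)

    E-lr : ∀ i j → E (Fin.suc (i ↑ˡ p)) (Fin.suc (p ↑ʳ j)) ≡ false
    E-lr i j = cong₂ blocks (Fin.splitAt-↑ˡ p i p) (Fin.splitAt-↑ʳ p p j)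

    E-rl : ∀ i j → E (Fin.suc (p ↑ʳ i)) (Fin.suc (j ↑ˡ p)) ≡ false
    E-rl i j = cong₂ blocks (Fin.splitAt-↑ʳ p p i) (Fin.splitAt-↑ˡ p j p)

    left-hom : ∀ i j → i ≢ j → E (left i) (left j) ≡ true
    left-hom Fin.zero    Fin.zero    ne = contradiction ≡.refl ne
    left-hom Fin.zero    (Fin.suc j) ne = ≡.refl
    left-hom (Fin.suc i) Fin.zero    ne = ≡.refl
    left-hom (Fin.suc i) (Fin.suc j) ne = ≡.trans (E-ll i j) (distinctᵇ-true (ne ∘ cong Fin.suc))

    right-hom : ∀ i j → i ≢ j → E (right i) (right j) ≡ true
    right-hom Fin.zero    Fin.zero    ne = contradiction ≡.refl ne
    right-hom Fin.zero    (Fin.suc j) ne = ≡.refl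
    right-hom (Fin.suc i) Fin.zero    ne = ≡.refl
    right-hom (Fin.suc i) (Fin.suc j) ne = ≡.trans (E-rr i j) (distinctᵇ-true (ne ∘ cong Fin.suc))

    last : Fin p
    last = Fin.fromℕ (suc k)

    a b : Fin q
    a = left (Fin.suc last)
    b = right (Fin.suc last)

    a≢b : a ≢ b
    a≢b e = contradiction (≡.trans (≡.sym (Fin.splitAt-↑ˡ p last p)) (≡.trans (cong (Fin.splitAt p) (Fin.suc-injective e)) (Fin.splitAt-↑ʳ p p last))) λ ()

    open Lattice H E
    open Colourings H (3 + k)

    -- Vertex zero lies in both cliques and is the intermediate stop: one label is transferred
    -- between it and `a` in the left clique, and between it and `b` in the right one.
    a→b : Transfer a b 1ℤ
    a→b = InL-resp (λ i → integer-identity₂₆ (δ a i) (δ b i) (δ Fin.zero i)) (InL-+ (unit left left-hom) (InL-neg (unit right right-hom)))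
      where
      unit : ∀ ι (ι-hom : ∀ i j → i ≢ j → E (ι i) (ι j) ≡ true) → Transfer (ι (Fin.suc last)) (ι Fin.zero) 1ℤ
      unit ι ι-hom = subst (λ g → Transfer (ι (Fin.suc last)) (ι Fin.zero) (ℤ.+ g)) gap≡1 (gap-transfer E ι ι-hom (Fin.suc last) Fin.zero λ ())

    room : ∀ i → suc (bump (distinctᵇ last i) 0) + toℕ i ≤ p
    room i with last Fin.≟ i
    ... | yes _ = s≤s (≤-pred (Fin.toℕ<n i))
    ... | no ne = s≤s (≤∧≢⇒< (≤-pred (Fin.toℕ<n i)) (λ e → ne (Fin.toℕ-injective (≡.trans (Fin.toℕ-fromℕ (suc k)) (≡.sym e)))))

    -- Vertex zero meets both roots, which is possible because `2 ≤ p`. Every other vertex meets at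
    -- most the root of its own side, vertex zero, and earlier vertices of its own clique. This
    -- keeps the depth at `p`, one less than the number of colours.
    fits : Fits q E (λ i → bump (E a i) (bump (E b i) 0)) (λ _ → p)
    fits = s≤s (s≤s z≤n) , fits-separate p p {λ i j → E (Fin.suc i) (Fin.suc j)} {len} {λ _ → p} E-lr
      (fits-prefix p {λ i j → E (Fin.suc (i ↑ˡ p)) (Fin.suc (j ↑ˡ p))} {len ∘ (_↑ˡ p)} {λ _ → p}
        (λ i → subst (λ x → suc x + toℕ i ≤ p) (≡.sym (cong₂ (λ x y → bump x (bump y 0)) (E-ll last i) (E-rl last i))) (room i)))
      (fits-prefix p {λ i j → E (Fin.suc (p ↑ʳ i)) (Fin.suc (p ↑ʳ j))} {len ∘ (p ↑ʳ_)} {λ _ → p}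
        (λ i → subst (λ x → suc x + toℕ i ≤ p) (≡.sym (cong₂ (λ x y → bump x (bump y 0)) (E-lr last i) (E-rr last i))) (room i)))
      where
      len : Fin (p + p) → ℕ
      len i = suc (bump (E a (Fin.suc i)) (bump (E b (Fin.suc i)) 0))

  -- two complete graphs on k + 3 vertices sharing a common neighbour of the two exchanged vertices
  critical-pattern : Pattern H
  critical-pattern = record
    { vertices = q ; E = E ; E-sym = E-sym ; E-irr = E-irr ; a = a ; b = b
    ; exchange = transfer-exchange a≢b a→b
    ; tile = Vec.tabulate (left ∘ proj₁ colourable)
    ; tile-hom = homF→hom (colour-hom E left left-hom (proj₁ colourable) (proj₂ colourable) id id)
    ; depth = p ; fits = fits }

-- Assembling the factor

suc≤2^ : ∀ C → suc C ≤ 2 ^ C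
suc≤2^ zero    = ≤-refl
suc≤2^ (suc C) = ≤-trans (≤-from C (+-mono-≤ (suc≤2^ C) (suc≤2^ C)) (identity₅₇ C (2 ^ C))) ≤-refl

-- The exponent starts at `3 * C` because the left side is then at most `(C + 1) ^ 3`; afterwards
-- the right side doubles in each step.
linear≤exponential : ∀ C e → C * suc (3 * C + e) ≤ 2 ^ (3 * C + e)
linear≤exponential C zero = begin
  C * suc (3 * C + 0)         ≤⟨ ≤-from (C * C * C + 2 * C + 1) ≤-refl (identity₆₅ C 0) ⟩
  suc C * (suc C * suc C)     ≤⟨ *-mono-≤ (suc≤2^ C) (*-mono-≤ (suc≤2^ C) (suc≤2^ C)) ⟩
  2 ^ C * (2 ^ C * 2 ^ C)     ≡⟨ cong (2 ^ C *_) (^-distribˡ-+-* 2 C C) ⟨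
  2 ^ C * 2 ^ (C + C)         ≡⟨ ^-distribˡ-+-* 2 C (C + C) ⟨
  2 ^ (C + (C + C))           ≡⟨ cong (2 ^_) (identity₆₄ C) ⟩
  2 ^ (3 * C + 0) ∎
  where
  open ≤-Reasoning
linear≤exponential C (suc e) = begin
  C * suc (3 * C + suc e)         ≤⟨ ≤-from (C * (3 * C + e)) ≤-refl (identity₆₃ C e 0) ⟩
  2 * (C * suc (3 * C + e))       ≤⟨ *-monoʳ-≤ 2 (linear≤exponential C e) ⟩
  2 * 2 ^ (3 * C + e)             ≡⟨ cong (2 ^_) (+-suc (3 * C) e) ⟨
  2 ^ (3 * C + suc e) ∎
  where
  open ≤-Reasoning

≤*⇒/≥ : ∀ x D n → .{{_ : NonZero D}} → D * x ≤ n → x ≤ n / D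
≤*⇒/≥ x D n le = ≤-trans (≤-reflexive (≡.sym (m*n/n≡m x D))) (/-monoˡ-≤ D (≤-trans (≤-reflexive (*-comm x D)) le))

*/≤ : ∀ D n → .{{_ : NonZero D}} → D * (n / D) ≤ n
*/≤ D n = ≤-trans (≤-reflexive (*-comm D (n / D))) (m/n*n≤m n D)

<+*/ : ∀ D n → .{{_ : NonZero D}} → n ≤ D + D * (n / D)
<+*/ D n = ≤-trans (≤-reflexive (m≡m%n+[m/n]*n n D)) (+-mono-≤ (<⇒≤ (m%n<n n D)) (≤-reflexive (*-comm (n / D) D)))

-- With `x = n / (D * h)` it suffices that `n ≤ 2 ^ x`, since `x * h ≤ n / D`.
power≤exponential : ∀ D h n → .{{_ : NonZero D}} → .{{_ : NonZero h}} → (D * h) * (3 * (D * h)) ≤ n → n ^ h ≤ 2 ^ (n / D)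
power≤exponential D h n large = begin
  n ^ h                 ≤⟨ ^-monoˡ-≤ h (≤-trans (<+*/ C n) (≤-trans (≤-reflexive (≡.sym (*-suc C x))) C≤)) ⟩
  (2 ^ x) ^ h           ≡⟨ ^-*-assoc 2 x h ⟩
  2 ^ (x * h)           ≤⟨ ^-monoʳ-≤ 2 (≤*⇒/≥ (x * h) D n (≤-trans (≤-reflexive (identity₃ D x h)) (*/≤ C n))) ⟩
  2 ^ (n / D) ∎
  where
  open ≤-Reasoning
  C = D * h
  instance
    C≢0 : NonZero C
    C≢0 = m*n≢0 D h
  x = n / C
  C≤ : C * suc x ≤ 2 ^ x
  C≤ = subst (λ y → C * suc y ≤ 2 ^ y) (m+[n∸m]≡n (≤*⇒/≥ (3 * C) C n large)) (linear≤exponential C (x ∸ 3 * C))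

chunks : ∀ {A : Set} h .{{_ : NonZero h}} w (xs : List A) → length xs ≡ w * h → ∃[ Xs ] (length Xs ≡ w × concatMap (toList {n = h}) Xs ≡ xs)
chunks h zero    []       e = [] , ≡.refl , ≡.refl
chunks {A} h (suc w) xs e = go (split h xs (≤-trans (m≤m+n h (w * h)) (≤-reflexive (≡.sym e))))
  where
  split : ∀ m (xs : List A) → m ≤ length xs → ∃[ v ] ∃[ ys ] (toList {n = m} v ++ ys ≡ xs)
  split zero    xs       le       = [] , xs , ≡.refl
  split (suc m) (x ∷ xs) (s≤s le) = let (v , ys , e) = split m xs le in x ∷ v , ys , cong (x ∷_) e
  go : ∃[ v ] ∃[ ys ] (toList {n = h} v ++ ys ≡ xs) → ∃[ Xs ] (length Xs ≡ suc w × concatMap (toList {n = h}) Xs ≡ xs)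
  go (v , ys , ≡.refl) =
    let len = +-cancelˡ-≡ h _ _ (≡.trans (cong (_+ length ys) (≡.sym (V.length-toList v))) (≡.trans (≡.sym (L.length-++ (toList v))) e))
        (Xs , e₁ , e₂) = chunks h w ys len
    in v ∷ Xs , cong suc e₁ , cong (toList v ++_) e₂

-- The bottle used in either case satisfies `b / (k * b + a) = 1 / χ*(H)`, the proportion of
-- non-neighbours that a vertex would have without the term `α`. Then `depth≤` says that `depth`
-- such non-neighbourhoods cover at most everything, so the slack `α` leaves common neighbours.
record Setup {h : ℕ} (H : Graph h) : Set where
  field
    k b a   : ℕ
    bottle  : Bottle H k b a
    pattern′ : Pattern H
    0<h     : 0 < h
    1≤k     : 1 ≤ k
    1≤a     : 1 ≤ a
    1≤depth : 1 ≤ Pattern.depth pattern′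
    depth≤  : Pattern.depth pattern′ * b ≤ k * b + a

module Constants {h : ℕ} {H : Graph h} (setup : Setup H) (N : ℕ) where
  open Setup setup
  open Bottle bottle
  open PatternConstants pattern′

  -- Each tuple gets `l = n / D₀` absorbers, and `c * l` is `2 * N` times the bound on the reserved
  -- vertices, so `D₀ = 2 * suc c` keeps this below `n / 2`. Then `n ≤ L * l`; `E₁` is the precision
  -- demanded of a good vertex; `1 / R` is the proportion of `u` given up as quota; `1 / J` becomes
  -- `μ`. Each summand of `n₀` serves one of the requirements that `n` be large.
  B K₀ c D₀ L E₁ R t′ TS sp J n₀ : ℕ
  B  = k * b + a
  K₀ = reachK N ^ suc h
  c  = 2 * (N * (suc (suc (2 * K₀)) * 2 * bodySize))
  D₀ = 2 * suc c
  L  = 2 * D₀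
  E₁ = 2 * (N * L)
  R  = 24 * (E₁ * E₁ * L) * B
  t′ = length (concatMap toList homs)
  TS = tileSparsity (suc k) (suc t′) (4 * R)
  sp = sparsity N
  J  = suc (2 * L * TS + 2 * sp)
  n₀ = suc (D₀ * (2 * R) + (2 * (R * R * B) + ((D₀ * h) * (3 * (D₀ * h)) + (4 * (N * (suc h * size)) + (D₀ + J)))))

module Assemble {h n : ℕ} {H : Graph h} (G : Graph n) (F : IncompatibilitySystem G) (setup : Setup H) (N d m : ℕ)
    .{{_ : NonZero N}} .{{_ : NonZero n}}
    (D₀ L E₁ R l : ℕ) .{{_ : NonZero L}} .{{_ : NonZero R}}
    (E₁≡ : E₁ ≡ 2 * (N * L)) (R≡ : R ≡ 24 * (E₁ * E₁ * L) * (Setup.k setup * Setup.b setup + Setup.a setup))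
    (B≤R : Setup.k setup * Setup.b setup + Setup.a setup ≤ R)
    (h∣n : h ∣ n)
    (nd : ∀ v → S (allFin n) (λ z → 𝟙 (not (adj G v z))) ≤ d)
    (few : ∀ v w → S (allFin n) (𝟙 ∘ inc F v w) ≤ m)
    (deg : N * (Setup.k setup * Setup.b setup + Setup.a setup) * d + (Setup.k setup * Setup.b setup + Setup.a setup) * n ≤ N * Setup.b setup * n)
    (sparse : PatternConstants.sparsity (Setup.pattern′ setup) N * suc m ≤ n)
    (pow : n ^ h ≤ 2 ^ l)
    (small : 2 * (N * (reserveSize (PatternConstants.reachK (Setup.pattern′ setup) N ^ suc h) l * PatternConstants.bodySize (Setup.pattern′ setup)
              + suc h * PatternConstants.size (Setup.pattern′ setup))) ≤ n)
    (0<l : 0 < l) (n≤Ll : n ≤ L * l) (2R≤l : 2 * R ≤ l) (RRB : 2 * (R * R * (Setup.k setup * Setup.b setup + Setup.a setup)) ≤ n)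
    (tile-sparse : tileSparsity (suc (Setup.k setup)) (suc (length (concatMap toList (Bottle.homs (Setup.bottle setup))))) (4 * R) * suc m ≤ l)
    where
  open Setup setup
  open Bottle bottle
  open Tiling H G F

  private
    B = k * b + a
    depth = Pattern.depth pattern′

    instance
      B≢0 : NonZero (k * b + a)
      B≢0 = >-nonZero (≤-trans 1≤a (m≤n+m a (k * b)))
      h≢0 : NonZero h
      h≢0 = >-nonZero 0<h

    -- The degree condition is multiplied by `depth`; then `depth * b ≤ B` removes `b`, and
    -- `1 ≤ depth` ensures that the slack `n` survives.
    room : N * (depth * d) + n ≤ N * n
    room = *-cancelˡ-≤ B (begin
      B * (N * (depth * d) + n)              ≤⟨ ≤-trans (≤-reflexive (*-distribˡ-+ B _ n)) (+-monoʳ-≤ (B * (N * (depth * d))) (≤-trans (≤-reflexive (≡.sym (*-identityˡ _))) (*-monoˡ-≤ (B * n) 1≤depth))) ⟩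
      B * (N * (depth * d)) + depth * (B * n) ≡⟨ identity₅₉ B N depth d n ⟩
      depth * (N * B * d + B * n)            ≤⟨ *-monoʳ-≤ depth deg ⟩
      depth * (N * b * n)                    ≡⟨ identity₅₈ depth N b n ⟩
      N * n * (depth * b)                    ≤⟨ *-monoʳ-≤ (N * n) depth≤ ⟩
      N * n * B                              ≡⟨ *-comm (N * n) B ⟩
      B * (N * n) ∎)
      where
      open ≤-Reasoning

    open Absorption F pattern′ N d m nd few room sparse

    v₀ : Fin n
    v₀ = Fin.fromℕ< (>-nonZero⁻¹ n)

    open Reserve v₀ (reserve v₀ l pow small)

    reserved : List (Fin n)
    reserved = bodies v₀ chosen

    remainder : ∃[ U₀ ] (allFin n ↭ reserved ++ U₀)
    remainder = complement reserved unique (λ _ → ∈.∈-allFin _)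

  module Rest (U₀ : List (Fin n)) (split : allFin n ↭ reserved ++ U₀) where

    private
      r = length reserved

      U₀-unique : Unique U₀
      U₀-unique = proj₁ (proj₂ (unique-++ reserved (Unique-↭ split (allFin⁺ n))))

      near : n ≤ length U₀ + r
      near = ≤-reflexive (≡.trans (≡.sym (length-allFin n)) (≡.trans (↭-length split) (≡.trans (L.length-++ reserved) (+-comm r _))))

      2Nr≤n : 2 * (N * r) ≤ n
      2Nr≤n = ≤-trans (*-monoʳ-≤ 2 (*-monoʳ-≤ N (≤-trans short (m≤m+n _ _)))) small

      u₀≤n : length U₀ ≤ n
      u₀≤n = ≡.subst₂ _≤_ (S-one U₀) (≡.trans (S-one (allFin n)) (length-allFin n)) (S-sub U₀-unique (λ _ → 1))

      n≤2u₀ : n ≤ 2 * length U₀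
      n≤2u₀ = ≤-from 0 (+-mono-≤ (*-monoʳ-≤ 2 near) (≤-trans (*-monoʳ-≤ 2 (m≤n*m r N)) 2Nr≤n)) (identity₁₈ n (length U₀) r)

      b≤B : b ≤ k * b + a
      b≤B = ≤-trans (≤-trans (≤-reflexive (≡.sym (*-identityˡ b))) (*-monoˡ-≤ b 1≤k)) (m≤m+n (k * b) a)

    open AlmostTiling H G F (distinctᵇ {suc k}) distinctᵇ-sym distinctᵇ-irr homs valid k b a (λ i → ≤-pred (Fin.toℕ<n i))
      (concatMap toList homs) ≡.refl weigh (length (concatMap toList homs)) (n≤1+n _)
      U₀ U₀-unique N L d m r l R E₁ E₁≡ R≡ B≤R 1≤a b≤B nd few deg near 2Nr≤n 0<l
      (≤-trans u₀≤n n≤Ll) 2R≤l (*-cancelˡ-≤ 2 (≤-trans RRB n≤2u₀)) tile-sparse public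

    private
      tiled-∣ : ∀ {xs} → Tiled xs → h ∣ length xs
      tiled-∣ (cs , _ , e) = subst (h ∣_) (≡.sym (↭-length e)) (go cs)
        where
        go : ∀ cs → h ∣ length (concatMap (toList {n = h}) cs)
        go []       = h ∣0
        go (x ∷ cs) = subst (h ∣_) (≡.sym (L.length-++ (toList x))) (∣m∣n⇒∣m+n (∣-reflexive (≡.sym (V.length-toList x))) (go cs))

    module Finish (A : Almost U₀) where
      open Almost A

      private
        bodies-length : h ∣ r
        bodies-length = tiled-∣ (bodies-tiled v₀ chosen)

        -- `h` divides `n`, the number of reserved vertices and the number of covered ones, as the
        -- latter two sets are tiled. The leftover therefore splits into `h`-tuples, at most `l` in
        -- number, and every tuple has `l` absorbers.
        left-∣ : h ∣ length leftover
        left-∣ = ∣m+n∣m⇒∣n (subst (h ∣_) (≡.trans (↭-length partition) (L.length-++ covered′))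
            (∣m+n∣m⇒∣n (subst (h ∣_) (≡.trans (≡.sym (length-allFin n)) (≡.trans (↭-length split) (L.length-++ reserved))) h∣n) bodies-length))
          (tiled-∣ cover-tiled)

        chunked : ∃[ Xs ] (length Xs ≡ _∣_.quotient left-∣ × concatMap (toList {n = h}) Xs ≡ leftover)
        chunked = chunks h (_∣_.quotient left-∣) leftover (_∣_.equality left-∣)

        few-chunks : length (proj₁ chunked) ≤ l
        few-chunks = ≤-trans (≤-reflexive (proj₁ (proj₂ chunked))) (≤-trans (m≤m*n _ h) (≤-trans (≤-reflexive (≡.sym (_∣_.equality left-∣))) (<⇒≤ few-left)))

        absorbed : Tiled (leftover ++ reserved)
        absorbed = subst (λ W → Tiled (W ++ reserved)) (proj₂ (proj₂ chunked))
          (absorb-all v₀ (proj₁ chunked) chosen (λ X → ≤-trans few-chunks (plenty X)))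

      factor : HasCompatibleHFactor H G F
      factor = tiled-factor (tiled-↭ (trans split (trans (++⁺ˡ reserved partition) (trans (++-comm reserved (covered′ ++ leftover))
        (↭-reflexive (L.++-assoc covered′ leftover reserved))))) (tiled-++ cover-tiled absorbed))

    factor : HasCompatibleHFactor H G F
    factor = Finish.factor almost

  factor : HasCompatibleHFactor H G F
  factor = Rest.factor (proj₁ remainder) (proj₂ remainder)

factor-exists : ∀ {h} {H : Graph h} (setup : Setup H) (N : ℕ) .{{_ : NonZero N}} → let open Constants setup N in
  ∀ n → n₀ ≤ n → h ∣ n → (G : Graph n) (F : IncompatibilitySystem G) → ∀ d m →
  (∀ v → S (allFin n) (λ z → 𝟙 (not (adj G v z))) ≤ d) → (∀ v w → S (allFin n) (𝟙 ∘ inc F v w) ≤ m) →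
  N * B * d + B * n ≤ N * Setup.b setup * n → J * m ≤ n → HasCompatibleHFactor H G F
factor-exists {h} {H} setup N n n₀≤n h∣n G F d m nd few deg Jm≤n =
  Assemble.factor G F setup N d m D₀ L E₁ R l ≡.refl ≡.refl B≤R h∣n nd few deg sparse pow small 0<l n≤Ll 2R≤l RRB tile-sparse
  where
  open Constants setup N
  open Setup setup
  open PatternConstants pattern′ using (bodySize; size)
  l = n / D₀
  instance
    n≢0 : NonZero n
    n≢0 = >-nonZero (≤-trans (s≤s z≤n) n₀≤n)
    B≢0 : NonZero B
    B≢0 = >-nonZero (≤-trans 1≤a (m≤n+m a (k * b)))
    h≢0 : NonZero h
    h≢0 = >-nonZero 0<h
    E₁≢0 : NonZero E₁
    E₁≢0 = m*n≢0 2 (N * L) {{_}} {{m*n≢0 N L}}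
    24EEL≢0 : NonZero (24 * (E₁ * E₁ * L))
    24EEL≢0 = m*n≢0 24 (E₁ * E₁ * L) {{_}} {{m*n≢0 (E₁ * E₁) L {{m*n≢0 E₁ E₁}}}}
    R≢0 : NonZero R
    R≢0 = m*n≢0 (24 * (E₁ * E₁ * L)) B
  x₁ = D₀ * (2 * R)
  x₂ = 2 * (R * R * B)
  x₃ = (D₀ * h) * (3 * (D₀ * h))
  x₄ = 4 * (N * (suc h * size))
  tail₁ : x₁ + (x₂ + (x₃ + (x₄ + (D₀ + J)))) ≤ n
  tail₁ = ≤-trans (n≤1+n _) n₀≤n
  tail₂ : x₂ + (x₃ + (x₄ + (D₀ + J))) ≤ n
  tail₂ = m+n≤o⇒n≤o x₁ tail₁
  tail₃ : x₃ + (x₄ + (D₀ + J)) ≤ n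
  tail₃ = m+n≤o⇒n≤o x₂ tail₂
  tail₄ : x₄ + (D₀ + J) ≤ n
  tail₄ = m+n≤o⇒n≤o x₃ tail₃
  tail₅ : D₀ + J ≤ n
  tail₅ = m+n≤o⇒n≤o x₄ tail₄
  J≤n : J ≤ n
  J≤n = m+n≤o⇒n≤o D₀ tail₅
  2R≤l : 2 * R ≤ l
  2R≤l = ≤*⇒/≥ (2 * R) D₀ n (m+n≤o⇒m≤o x₁ tail₁)
  RRB : x₂ ≤ n
  RRB = m+n≤o⇒m≤o x₂ tail₂
  pow : n ^ h ≤ 2 ^ l
  pow = power≤exponential D₀ h n (m+n≤o⇒m≤o x₃ tail₃)
  0<l : 0 < l
  0<l = ≤*⇒/≥ 1 D₀ n (≤-trans (≤-reflexive (*-identityʳ D₀)) (m+n≤o⇒m≤o D₀ tail₅))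
  n≤Ll : n ≤ L * l
  n≤Ll = ≤-trans (<+*/ D₀ n) (≤-trans (+-monoˡ-≤ (D₀ * l) (≤-trans (≤-reflexive (≡.sym (*-identityʳ D₀))) (*-monoʳ-≤ D₀ 0<l))) (≤-reflexive (identity₅₆ D₀ l)))
  B≤R : B ≤ R
  B≤R = m≤n*m B (24 * (E₁ * E₁ * L))
  sparse : sp * suc m ≤ n
  sparse = *-cancelˡ-≤ 2 (≤-trans (≤-reflexive (identity₆₂ sp m)) (≤-trans (+-mono-≤ (≤-trans (*-monoˡ-≤ m 2sp≤J) Jm≤n) (≤-trans 2sp≤J J≤n)) (≤-reflexive (identity₄₃ n))))
    where
    2sp≤J : 2 * sp ≤ J
    2sp≤J = ≤-trans (m≤n+m (2 * sp) (2 * L * TS)) (n≤1+n _)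
  tile-sparse : TS * suc m ≤ l
  tile-sparse = *-cancelˡ-≤ (2 * L) (≤-trans (≤-reflexive (identity₆₁ L TS m)) (≤-trans (+-mono-≤ (≤-trans (*-monoˡ-≤ m LTS≤J) (≤-trans Jm≤n n≤Ll)) (≤-trans LTS≤J (≤-trans J≤n n≤Ll))) (≤-reflexive (identity₅₆ L l))))
    where
    LTS≤J : 2 * L * TS ≤ J
    LTS≤J = ≤-trans (m≤m+n (2 * L * TS) (2 * sp)) (n≤1+n _)
  small : 2 * (N * (reserveSize K₀ l * bodySize + suc h * size)) ≤ n
  small = *-cancelˡ-≤ 2 (≤-trans (≤-reflexive (identity₆₀ N K₀ l bodySize (suc h * size)))
      (≤-trans (+-mono-≤ (≤-trans (*-monoˡ-≤ l (*-monoʳ-≤ 2 (n≤1+n c))) (*/≤ D₀ n)) (m+n≤o⇒m≤o x₄ tail₄)) (≤-reflexive (identity₄₃ n))))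

-- Clearing denominators

toℚᵘ-ℕ : ∀ n → ℚ.toℚᵘ (ℕ→ℚ n) ℚᵘ.≃ ℚᵘ.mkℚᵘ (ℤ.+ n) 0
toℚᵘ-ℕ n = ℚ.toℚᵘ-fromℚᵘ (ℚᵘ.mkℚᵘ (ℤ.+ n) 0)

ℕ→ℚ-+ : ∀ m n → ℕ→ℚ (m + n) ≡ ℕ→ℚ m ℚ.+ ℕ→ℚ n
ℕ→ℚ-+ m n = ℚ.toℚᵘ-injective (ℚᵘ.≃-trans (toℚᵘ-ℕ (m + n)) (ℚᵘ.≃-trans
    (ℚᵘ.*≡* (cong₂ (λ x y → (x ℤ.+ y) ℤ.* ℤ.+ 1) (≡.sym (ℤ.*-identityʳ (ℤ.+ m))) (≡.sym (ℤ.*-identityʳ (ℤ.+ n)))))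
    (ℚᵘ.≃-trans (ℚᵘ.+-cong (ℚᵘ.≃-sym (toℚᵘ-ℕ m)) (ℚᵘ.≃-sym (toℚᵘ-ℕ n))) (ℚᵘ.≃-sym (ℚ.toℚᵘ-homo-+ (ℕ→ℚ m) (ℕ→ℚ n))))))

ℕ→ℚ-* : ∀ m n → ℕ→ℚ (m * n) ≡ ℕ→ℚ m ℚ.* ℕ→ℚ n
ℕ→ℚ-* m n = ℚ.toℚᵘ-injective (ℚᵘ.≃-trans (toℚᵘ-ℕ (m * n)) (ℚᵘ.≃-trans
    (ℚᵘ.*≡* (cong (λ z → z ℤ.* ℤ.+ 1) (ℤ.pos-* m n)))
    (ℚᵘ.≃-trans (ℚᵘ.*-cong (ℚᵘ.≃-sym (toℚᵘ-ℕ m)) (ℚᵘ.≃-sym (toℚᵘ-ℕ n))) (ℚᵘ.≃-sym (ℚ.toℚᵘ-homo-* (ℕ→ℚ m) (ℕ→ℚ n))))))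

ℕ→ℚ-mono-≤ : ∀ {m n} → m ≤ n → ℕ→ℚ m ℚ.≤ ℕ→ℚ n
ℕ→ℚ-mono-≤ {m} {n} le = ℚ.toℚᵘ-cancel-≤ (ℚᵘ.≤-trans (ℚᵘ.≤-reflexive (toℚᵘ-ℕ m)) (ℚᵘ.≤-trans
  (ℚᵘ.*≤* (ℤ.*-monoʳ-≤-nonNeg (ℤ.+ 1) (ℤ.+≤+ le))) (ℚᵘ.≤-reflexive (ℚᵘ.≃-sym (toℚᵘ-ℕ n)))))

ℕ→ℚ-cancel-≤ : ∀ {m n} → ℕ→ℚ m ℚ.≤ ℕ→ℚ n → m ≤ n
ℕ→ℚ-cancel-≤ {m} {n} le with ℚᵘ.≤-trans (ℚᵘ.≤-reflexive (ℚᵘ.≃-sym (toℚᵘ-ℕ m))) (ℚᵘ.≤-trans (ℚ.toℚᵘ-mono-≤ le) (ℚᵘ.≤-reflexive (toℚᵘ-ℕ n)))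
... | ℚᵘ.*≤* le′ = ℤ.drop‿+≤+ (≡.subst₂ ℤ._≤_ (ℤ.*-identityʳ (ℤ.+ m)) (ℤ.*-identityʳ (ℤ.+ n)) le′)

ℕ→ℚ-injective : ∀ {m n} → ℕ→ℚ m ≡ ℕ→ℚ n → m ≡ n
ℕ→ℚ-injective e = ≤-antisym (ℕ→ℚ-cancel-≤ (ℚ.≤-reflexive e)) (ℕ→ℚ-cancel-≤ (ℚ.≤-reflexive (≡.sym e)))

ℕ→ℚ-nonNeg : ∀ n → ℚ.NonNegative (ℕ→ℚ n)
ℕ→ℚ-nonNeg n = ℚ.nonNegative (ℕ→ℚ-mono-≤ {0} {n} z≤n)

ℕ→ℚ-pos : ∀ n → .{{NonZero n}} → ℚ.Positive (ℕ→ℚ n)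
ℕ→ℚ-pos (suc n) = ℚ.positive (ℚ.<-≤-trans (ℚ.positive⁻¹ 1ℚ) (ℕ→ℚ-mono-≤ {1} {suc n} (s≤s z≤n)))

inv-* : ∀ {x} → x ≢ 0ℚ → inv x ℚ.* x ≡ 1ℚ
inv-* {x} x≢0 with x ℚ.≟ 0ℚ
... | yes e = contradiction e x≢0
... | no ne = ℚ.*-inverseˡ x {{ℚ.≢-nonZero ne}}

frac-* : ∀ A Q → frac A (suc Q) ℚ.* ℕ→ℚ (suc Q) ≡ ℕ→ℚ A
frac-* A Q = ℚ.toℚᵘ-injective (ℚᵘ.≃-trans (ℚ.toℚᵘ-homo-* (frac A (suc Q)) (ℕ→ℚ (suc Q))) (ℚᵘ.≃-trans
  (ℚᵘ.*-cong (ℚ.toℚᵘ-fromℚᵘ (ℚᵘ.mkℚᵘ (ℤ.+ A) Q)) (toℚᵘ-ℕ (suc Q))) (ℚᵘ.≃-trans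
  (ℚᵘ.*≡* (integer-identity₂₇ (ℤ.+ A) (ℤ.+ suc Q))) (ℚᵘ.≃-sym (toℚᵘ-ℕ A)))))

numerator-* : ∀ p → .{{ℚ.NonNegative p}} → ∃[ s ] ∃[ q ] (p ℚ.* ℕ→ℚ (suc q) ≡ ℕ→ℚ s)
numerator-* p@(ℚ.mkℚ (ℤ.+ s) q c) = s , q , ≡.trans (cong (ℚ._* ℕ→ℚ (suc q)) (≡.sym (ℚ.fromℚᵘ-toℚᵘ p))) (frac-* s q)

0<⇒numerator : ∀ p → 0ℚ ℚ.< p → ∃[ s ] ∃[ q ] (p ℚ.* ℕ→ℚ (suc q) ≡ ℕ→ℚ (suc s))
0<⇒numerator p 0<p with numerator-* p {{ℚ.pos⇒nonNeg p {{ℚ.positive 0<p}}}}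
... | suc s , q , e = s , q , e
... | zero  , q , e = contradiction (≡.trans (≡.sym e) ≡.refl) λ e′ →
  ℚ.<⇒≢ (ℚ.positive⁻¹ (p ℚ.* ℕ→ℚ (suc q)) {{ℚ.pos*pos⇒pos p {{ℚ.positive 0<p}} (ℕ→ℚ (suc q)) {{ℕ→ℚ-pos (suc q)}}}}) (≡.sym e)

reciprocal-pos : ∀ J → 0ℚ ℚ.< frac 1 (suc J)
reciprocal-pos J = ℚ.positive⁻¹ (frac 1 (suc J)) {{ℚ.normalize-pos 1 (suc J)}}

private
  open +-*-Solver

  degree-lem : ∀ i α n NB → NB ℚ.* (((1ℚ ℚ.- i) ℚ.+ α) ℚ.* n) ℚ.+ NB ℚ.* i ℚ.* n ≡ NB ℚ.* n ℚ.+ NB ℚ.* α ℚ.* n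
  degree-lem = solve 4 (λ i α n NB → NB :* (((con 1ℚ :- i) :+ α) :* n) :+ NB :* i :* n := NB :* n :+ NB :* α :* n) ≡.refl

-- Multiplication by `N * B` turns `i` into `b` and `α` into at least one.
degree-ℕ : ∀ {i α : ℚ} {N B b n deg} → i ℚ.* ℕ→ℚ B ≡ ℕ→ℚ b → 1ℚ ℚ.≤ α ℚ.* ℕ→ℚ N →
  ((1ℚ ℚ.- i) ℚ.+ α) ℚ.* ℕ→ℚ n ℚ.≤ ℕ→ℚ deg → N * B * n + B * n ≤ N * B * deg + N * b * n
degree-ℕ {i} {α} {N} {B} {b} {n} {deg} iB αN hyp = ℕ→ℚ-cancel-≤ (begin
  ℕ→ℚ (N * B * n + B * n)
    ≡⟨ ≡.trans (ℕ→ℚ-+ (N * B * n) (B * n)) (cong₂ ℚ._+_ (≡.trans (ℕ→ℚ-* (N * B) n) (cong (ℚ._* n′) (ℕ→ℚ-* N B))) (ℕ→ℚ-* B n)) ⟩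
  N′ ℚ.* B′ ℚ.* n′ ℚ.+ B′ ℚ.* n′
    ≤⟨ ℚ.+-monoʳ-≤ (N′ ℚ.* B′ ℚ.* n′) (bound-step) ⟩
  N′ ℚ.* B′ ℚ.* n′ ℚ.+ N′ ℚ.* B′ ℚ.* α ℚ.* n′
    ≡⟨ degree-lem i α n′ (N′ ℚ.* B′) ⟨
  N′ ℚ.* B′ ℚ.* (((1ℚ ℚ.- i) ℚ.+ α) ℚ.* n′) ℚ.+ N′ ℚ.* B′ ℚ.* i ℚ.* n′
    ≤⟨ ℚ.+-monoˡ-≤ (N′ ℚ.* B′ ℚ.* i ℚ.* n′) (ℚ.*-monoˡ-≤-nonNeg (N′ ℚ.* B′) {{nonNegNB}} hyp) ⟩
  N′ ℚ.* B′ ℚ.* ℕ→ℚ deg ℚ.+ N′ ℚ.* B′ ℚ.* i ℚ.* n′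
    ≡⟨ cong (ℚ._+_ (N′ ℚ.* B′ ℚ.* ℕ→ℚ deg)) (≡.trans (lem₂ N′ B′ i n′) (cong (λ z → N′ ℚ.* z ℚ.* n′) iB)) ⟩
  N′ ℚ.* B′ ℚ.* ℕ→ℚ deg ℚ.+ N′ ℚ.* ℕ→ℚ b ℚ.* n′
    ≡⟨ ≡.sym (≡.trans (ℕ→ℚ-+ (N * B * deg) (N * b * n)) (cong₂ ℚ._+_ (≡.trans (ℕ→ℚ-* (N * B) deg) (cong (ℚ._* ℕ→ℚ deg) (ℕ→ℚ-* N B))) (≡.trans (ℕ→ℚ-* (N * b) n) (cong (ℚ._* n′) (ℕ→ℚ-* N b))))) ⟩
  ℕ→ℚ (N * B * deg + N * b * n) ∎)
  where
  open ℚ.≤-Reasoning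
  N′ = ℕ→ℚ N
  B′ = ℕ→ℚ B
  n′ = ℕ→ℚ n
  nonNegNB : ℚ.NonNegative (N′ ℚ.* B′)
  nonNegNB = subst ℚ.NonNegative (ℕ→ℚ-* N B) (ℕ→ℚ-nonNeg (N * B))
  nonNegBn : ℚ.NonNegative (B′ ℚ.* n′)
  nonNegBn = subst ℚ.NonNegative (ℕ→ℚ-* B n) (ℕ→ℚ-nonNeg (B * n))
  lem₂ : ∀ N B i n → N ℚ.* B ℚ.* i ℚ.* n ≡ N ℚ.* (i ℚ.* B) ℚ.* n
  lem₂ = solve 4 (λ N B i n → N :* B :* i :* n := N :* (i :* B) :* n) ≡.refl
  lem₃ : ∀ N B α n → α ℚ.* N ℚ.* (B ℚ.* n) ≡ N ℚ.* B ℚ.* α ℚ.* n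
  lem₃ = solve 4 (λ N B α n → α :* N :* (B :* n) := N :* B :* α :* n) ≡.refl
  bound-step : B′ ℚ.* n′ ℚ.≤ N′ ℚ.* B′ ℚ.* α ℚ.* n′
  bound-step = ℚ.≤-trans (ℚ.≤-reflexive (≡.sym (ℚ.*-identityˡ (B′ ℚ.* n′)))) (ℚ.≤-trans (ℚ.*-monoʳ-≤-nonNeg (B′ ℚ.* n′) {{nonNegBn}} αN)
    (ℚ.≤-reflexive (lem₃ N′ B′ α n′)))

chromatic-unique : ∀ {h} {H : Graph h} {k l} → IsChromaticNumber H k → IsChromaticNumber H l → k ≡ l
chromatic-unique {k = k} {l} (ck , mk) (cl , ml) with <-cmp k l
... | tri< lt _ _ = contradiction ck (ml k lt)
... | tri≈ _ e _  = e
... | tri> _ _ gt = contradiction cl (mk l gt)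

empty-class : ∀ {h} (H : Graph h) k (c : Fin h → Fin (suc k)) → ProperColouring H (suc k) c → ∀ i → classSize c i ≡ 0 → Colourable H k
empty-class {h} H k c pr i e = (λ v → Fin.punchOut (missed v)) , λ a b ab eq → pr a b ab (Fin.punchOut-injective (missed a) (missed b) eq)
  where
  missed : ∀ v → i ≢ c v
  missed v i≡ = contradiction (≤-trans (≤-reflexive (≡.sym (≡.trans (cong (λ x → 𝟙 ⌊ x Fin.≟ i ⌋) (≡.sym i≡)) (𝟙≟-refl i))))
    (≤-trans (S-∈ (λ v → 𝟙 ⌊ c v Fin.≟ i ⌋) (∈.∈-allFin v)) (≤-reflexive (≡.trans (≡.sym (count≡S h _)) e)))) λ ()

transposed-class : ∀ {h k} (c : Fin h → Fin k) i j → classSize (transpose i j ∘ c) j ≡ classSize c i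
transposed-class {h} c i j = count-cong h (λ v → same (c v))
  where
  agree : ∀ {P Q : Set} (d : Dec P) (e : Dec Q) → (P → Q) → (Q → P) → ⌊ d ⌋ ≡ ⌊ e ⌋
  agree (yes _) (yes _) _ _ = ≡.refl
  agree (no _)  (no _)  _ _ = ≡.refl
  agree (yes p) (no ¬q) f _ = contradiction (f p) ¬q
  agree (no ¬p) (yes q) _ g = contradiction (g q) ¬p
  same : ∀ x → ⌊ transpose i j x Fin.≟ j ⌋ ≡ ⌊ x Fin.≟ i ⌋
  same x = agree (transpose i j x Fin.≟ j) (x Fin.≟ i)
    (λ e → transpose-injective i j (≡.trans e (≡.sym (transpose-ˡ i j)))) (λ { ≡.refl → transpose-ˡ x j })

classSize≤ : ∀ {h k} (c : Fin h → Fin k) i → classSize c i ≤ h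
classSize≤ {h} c i = ≤-trans (≤-reflexive (count≡S h _)) (≤-trans (S≤length* (allFin h) 1 (λ v → 𝟙≤1 _))
  (≤-reflexive (≡.trans (*-identityʳ _) (length-allFin h))))

order-positive : ∀ {h} {H : Graph h} {k} → IsChromaticNumber H k → 0 < k → 0 < h
order-positive {zero}  (_ , minimal) 0<k = contradiction ((λ ()) , λ ()) (minimal 0 0<k)
order-positive {suc h} _ _ = z<s

critical-setup-pattern : ∀ {h} (H : Graph h) k → Colourable H (suc k) → 1 ≤ k → HcfOne H (suc k) →
  Σ (Pattern H) λ P → Pattern.depth P ≡ k
critical-setup-pattern H (suc (suc k)) col _ (inj₁ (_ , hcf)) =
  critical-pattern H k col (Colourings.hcf-gapGcd H (3 + k) hcf) , ≡.refl
critical-setup-pattern H 1 col _ (inj₁ (s≤s (s≤s ()) , _))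
critical-setup-pattern H 1 col _ (inj₂ (≡.refl , comp , g , hcf , 0<g , g≤2)) =
  bipartite-pattern H col (Bipartite.flipGcd≡1 H col comp g hcf 0<g g≤2) (Bipartite.orderGcd≡1 H comp) , ≡.refl
critical-setup-pattern H (suc (suc k)) col _ (inj₂ (() , _))

record RationalSetup {h : ℕ} (H : Graph h) (x : ℚ) : Set where
  field
    setup   : Setup H
    inverse : inv x ℚ.* ℕ→ℚ (Setup.k setup * Setup.b setup + Setup.a setup) ≡ ℕ→ℚ (Setup.b setup)

inv-frac : ∀ A Q → 0 < A → inv (frac A Q) ℚ.* ℕ→ℚ A ≡ ℕ→ℚ Q
inv-frac A zero    _   = ≡.trans (cong (ℚ._* ℕ→ℚ A) inv-0) (ℚ.*-zeroˡ (ℕ→ℚ A))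
  where inv-0 : inv 0ℚ ≡ 0ℚ
        inv-0 = ≡.refl
inv-frac A (suc Q) 0<A = begin
  inv x ℚ.* ℕ→ℚ A                       ≡⟨ cong (inv x ℚ.*_) (frac-* A Q) ⟨
  inv x ℚ.* (x ℚ.* ℕ→ℚ (suc Q))         ≡⟨ ℚ.*-assoc (inv x) x (ℕ→ℚ (suc Q)) ⟨
  inv x ℚ.* x ℚ.* ℕ→ℚ (suc Q)           ≡⟨ cong (ℚ._* ℕ→ℚ (suc Q)) (inv-* x≢0) ⟩
  1ℚ ℚ.* ℕ→ℚ (suc Q)                    ≡⟨ ℚ.*-identityˡ _ ⟩
  ℕ→ℚ (suc Q)                           ∎
  where
  open ≡-Reasoning
  x = frac A (suc Q)
  x≢0 : x ≢ 0ℚ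
  x≢0 e = <⇒≢ 0<A (ℕ→ℚ-injective (≡.trans (≡.sym (ℚ.*-zeroˡ (ℕ→ℚ (suc Q)))) (≡.trans (cong (ℚ._* ℕ→ℚ (suc Q)) (≡.sym e)) (frac-* A Q))))

balanced-setup : ∀ {h} (H : Graph h) k → 1 ≤ k → Colourable H (suc k) → 0 < h → RationalSetup H (ℕ→ℚ (suc k))
balanced-setup {h} H k 1≤k col 0<h = record
  { setup = record
    { k = k ; b = h ; a = h ; bottle = balanced-bottle H k col ; pattern′ = balanced-pattern H k col (Fin.fromℕ< 0<h)
    ; 0<h = 0<h ; 1≤k = 1≤k ; 1≤a = 0<h ; 1≤depth = s≤s z≤n ; depth≤ = ≤-reflexive (+-comm h (k * h)) }
  ; inverse = begin
      inv x ℚ.* ℕ→ℚ (k * h + h)              ≡⟨ cong (λ z → inv x ℚ.* ℕ→ℚ z) (+-comm (k * h) h) ⟩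
      inv x ℚ.* ℕ→ℚ (suc k * h)              ≡⟨ cong (inv x ℚ.*_) (ℕ→ℚ-* (suc k) h) ⟩
      inv x ℚ.* (x ℚ.* ℕ→ℚ h)                ≡⟨ ℚ.*-assoc (inv x) x (ℕ→ℚ h) ⟨
      inv x ℚ.* x ℚ.* ℕ→ℚ h                  ≡⟨ cong (ℚ._* ℕ→ℚ h) (inv-* (λ e → contradiction (ℕ→ℚ-injective {suc k} {0} e) λ ())) ⟩
      1ℚ ℚ.* ℕ→ℚ h                           ≡⟨ ℚ.*-identityˡ _ ⟩
      ℕ→ℚ h                                  ∎ }
  where
  open ≡-Reasoning
  x = ℕ→ℚ (suc k)

critical-setup : ∀ {h} (H : Graph h) k → 1 ≤ k → IsChromaticNumber H (suc k) → HcfOne H (suc k) → 0 < h →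
  ∀ s → (∃[ c ] (ProperColouring H (suc k) c × SmallestClass c s)) → RationalSetup H (criticalChromatic h (suc k) s)
critical-setup {h} H k 1≤k (col , minimal) hcf 0<h s (c , pr , (i , size) , _) = record
  { setup = record
    { k = k ; b = h ∸ s ; a = k * s
    ; bottle = critical-bottle H k s c′ (λ a b ab e → pr a b ab (transpose-injective i (Fin.fromℕ k) e)) (≡.trans (transposed-class c i (Fin.fromℕ k)) size)
    ; pattern′ = proj₁ pat ; 0<h = 0<h ; 1≤k = 1≤k ; 1≤a = *-mono-≤ 1≤k 1≤s
    ; 1≤depth = subst (1 ≤_) (≡.sym (proj₂ pat)) 1≤k
    ; depth≤ = ≤-trans (≤-reflexive (cong (_* (h ∸ s)) (proj₂ pat))) (m≤m+n _ _) }
  ; inverse = ≡.trans (cong (λ z → inv (criticalChromatic h (suc k) s) ℚ.* ℕ→ℚ z) total) (inv-frac (k * h) (h ∸ s) (*-mono-≤ 1≤k 0<h)) }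
  where
  instance
    k≢0 : NonZero k
    k≢0 = >-nonZero 1≤k
  c′ = transpose i (Fin.fromℕ k) ∘ c
  pat = critical-setup-pattern H k col 1≤k hcf
  1≤s : 1 ≤ s
  1≤s = n≢0⇒n>0 λ e → minimal k ≤-refl (empty-class H k c pr i (≡.trans size e))
  total : k * (h ∸ s) + k * s ≡ k * h
  total = ≡.trans (≡.sym (*-distribˡ-+ k (h ∸ s) s)) (cong (k *_) (m∸n+n≡m (subst (_≤ h) size (classSize≤ c i))))

rational-setup : ∀ {h} (H : Graph h) x → (∀ k → IsChromaticNumber H k → 2 ≤ k) → IsChiStar H x → RationalSetup H x
rational-setup H x χ≥2 (k , chrom , cases) with χ≥2 k chrom
rational-setup H x χ≥2 (suc k , chrom , inj₂ (_ , ≡.refl)) | s≤s 1≤k =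
  balanced-setup H k 1≤k (proj₁ chrom) (order-positive {H = H} chrom z<s)
rational-setup H x χ≥2 (suc k , chrom , inj₁ (hcf , l , s , chromₗ , (j , chromⱼ , smallest , _) , ≡.refl)) | s≤s 1≤k
  with chromatic-unique {H = H} chrom chromₗ | chromatic-unique {H = H} chrom chromⱼ
... | ≡.refl | ≡.refl = critical-setup H k 1≤k chrom hcf (order-positive {H = H} chrom z<s) s smallest

nonneighbours : ∀ {n} (G : Graph n) v → degree G v + S (allFin n) (λ z → 𝟙 (not (adj G v z))) ≡ n
nonneighbours {n} G v = ≡.trans (cong (_+ S (allFin n) (λ z → 𝟙 (not (adj G v z)))) (count≡S n (adj G v)))
  (≡.trans (≡.sym (S-+ (allFin n) _ _)) (≡.trans (S-cong (allFin n) (λ z → lem (adj G v z))) (≡.trans (S-one (allFin n)) (length-allFin n))))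
  where lem : ∀ b → 𝟙 b + 𝟙 (not b) ≡ 1
        lem true  = ≡.refl
        lem false = ≡.refl

-- `Bounded` speaks of edges only. For a non-edge nothing is incompatible, by `inc-edge`, so the
-- bound extends to all pairs.
few-incompatible : ∀ {n} {G : Graph n} (F : IncompatibilitySystem G) J → Bounded F (frac 1 (suc J) ℚ.* ℕ→ℚ n) →
  ∀ v w → S (allFin n) (𝟙 ∘ inc F v w) ≤ n / suc J
few-incompatible {n} {G} F J bounded v w = by (adj G v w) ≡.refl
  where
  open ℚ.≤-Reasoning
  none : adj G v w ≡ false → ∀ z b → inc F v w z ≡ b → 𝟙 b ≡ 0
  none _ _ false _ = ≡.refl
  none e z true  i = contradiction (≡.trans (≡.sym (proj₁ (inc-edge F v w z i))) e) λ ()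
  by : ∀ b → adj G v w ≡ b → S (allFin n) (𝟙 ∘ inc F v w) ≤ n / suc J
  by false e = ≤-trans (≤-reflexive (≡.trans (S-cong (allFin n) (λ z → none e z _ ≡.refl)) (S-zero (allFin n)))) z≤n
  by true  e = ≤*⇒/≥ _ (suc J) n (subst (λ c → suc J * c ≤ n) (count≡S n (inc F v w)) (ℕ→ℚ-cancel-≤ (begin
    ℕ→ℚ (suc J * count n (inc F v w))              ≡⟨ ℕ→ℚ-* (suc J) (count n (inc F v w)) ⟩
    ℕ→ℚ (suc J) ℚ.* ℕ→ℚ (count n (inc F v w))      ≤⟨ ℚ.*-monoˡ-≤-nonNeg (ℕ→ℚ (suc J)) {{ℕ→ℚ-nonNeg (suc J)}} (bounded v w e) ⟩
    ℕ→ℚ (suc J) ℚ.* (frac 1 (suc J) ℚ.* ℕ→ℚ n)     ≡⟨ ℚ.*-assoc (ℕ→ℚ (suc J)) (frac 1 (suc J)) (ℕ→ℚ n) ⟨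
    ℕ→ℚ (suc J) ℚ.* frac 1 (suc J) ℚ.* ℕ→ℚ n       ≡⟨ cong (ℚ._* ℕ→ℚ n) (≡.trans (ℚ.*-comm (ℕ→ℚ (suc J)) (frac 1 (suc J))) (frac-* 1 J)) ⟩
    1ℚ ℚ.* ℕ→ℚ n                                   ≡⟨ ℚ.*-identityˡ _ ⟩
    ℕ→ℚ n                                          ∎)))

module ClearDenominators {h : ℕ} {H : Graph h} {x : ℚ} (k b a : ℕ) (1≤a : 1 ≤ a)
    (inverse : inv x ℚ.* ℕ→ℚ (k * b + a) ≡ ℕ→ℚ b) (N : ℕ) .{{_ : NonZero N}} (α : ℚ) (1≤αN : 1ℚ ℚ.≤ α ℚ.* ℕ→ℚ N) (J n₀ : ℕ)
    (exists : ∀ n → suc n₀ ≤ n → h ∣ n → (G : Graph n) (F : IncompatibilitySystem G) → ∀ d m →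
      (∀ v → S (allFin n) (λ z → 𝟙 (not (adj G v z))) ≤ d) → (∀ v w → S (allFin n) (𝟙 ∘ inc F v w) ≤ m) →
      N * (k * b + a) * d + (k * b + a) * n ≤ N * b * n → suc J * m ≤ n → HasCompatibleHFactor H G F) where

  private
    B = k * b + a

  rational-exists : (n : ℕ) → suc n₀ ≤ n → h ∣ n → (G : Graph n) (𝓕 : IncompatibilitySystem G) →
    IsIncSystem n G 𝓕 ((1ℚ ℚ.- inv x) ℚ.+ α) (frac 1 (suc J)) → HasCompatibleHFactor H G 𝓕
  rational-exists n n₀≤n h∣n G 𝓕 (degrees , bounded) = exists n n₀≤n h∣n G 𝓕 d (n / suc J) nd (few-incompatible 𝓕 J bounded) deg (*/≤ (suc J) n)
    where
    instance
      n≢0 : NonZero n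
      n≢0 = >-nonZero (≤-trans (s≤s z≤n) n₀≤n)
      B≢0 : NonZero B
      B≢0 = >-nonZero (≤-trans 1≤a (m≤n+m a (k * b)))
      NB≢0 : NonZero (N * B)
      NB≢0 = m*n≢0 N B
    nonadj : Fin n → ℕ
    nonadj v = S (allFin n) (λ z → 𝟙 (not (adj G v z)))
    bound : ∀ v → N * B * nonadj v + B * n ≤ N * b * n
    bound v = +-cancelˡ-≤ (N * B * degree G v) _ _ (≤-trans (≤-reflexive lem) (degree-ℕ {inv x} {α} {N} {B} {b} {n} inverse 1≤αN (degrees v)))
      where
      lem : N * B * degree G v + (N * B * nonadj v + B * n) ≡ N * B * n + B * n
      lem = ≡.trans (≡.sym (+-assoc (N * B * degree G v) _ _)) (cong (_+ B * n) (≡.trans (≡.sym (*-distribˡ-+ (N * B) _ _)) (cong (N * B *_) (nonneighbours G v))))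
    room : ℕ
    room = N * b * n ∸ B * n
    d = room / (N * B)
    nd : ∀ v → nonadj v ≤ d
    nd v = ≤*⇒/≥ (nonadj v) (N * B) room (m+n≤o⇒m≤o∸n (N * B * nonadj v) (bound v))
    deg : N * B * d + B * n ≤ N * b * n
    deg = ≤-trans (+-monoˡ-≤ (B * n) (*/≤ (N * B) room)) (≤-reflexive (m∸n+n≡m (≤-trans (m≤n+m (B * n) _) (bound (Fin.fromℕ< (>-nonZero⁻¹ n))))))

  answer : ∃[ μ ] (0ℚ ℚ.< μ × ∃[ n₁ ] ((n : ℕ) → n₁ ≤ n → h ∣ n →
    (G : Graph n) (𝓕 : IncompatibilitySystem G) → IsIncSystem n G 𝓕 ((1ℚ ℚ.- inv x) ℚ.+ α) μ → HasCompatibleHFactor H G 𝓕))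
  answer = frac 1 (suc J) , reciprocal-pos J , suc n₀ , rational-exists

sufficiency : (h : ℕ) (H : Graph h) → (∀ k → IsChromaticNumber H k → 2 ≤ k) →
  (x : ℚ) → IsChiStar H x → (α : ℚ) → 0ℚ ℚ.< α →
  ∃[ μ ] (0ℚ ℚ.< μ × ∃[ n₀ ] ((n : ℕ) → n₀ ≤ n → h ∣ n →
    (G : Graph n) (𝓕 : IncompatibilitySystem G) → IsIncSystem n G 𝓕 ((1ℚ ℚ.- inv x) ℚ.+ α) μ → HasCompatibleHFactor H G 𝓕))
-- `N` is the denominator of `α`; as the numerator is at least one, `α * N` is too.
sufficiency h H χ≥2 x χ* α 0<α = ClearDenominators.answer {x = x} k b a 1≤a inverse (suc den) α
    (ℚ.≤-trans (ℕ→ℚ-mono-≤ {1} {suc num} (s≤s z≤n)) (ℚ.≤-reflexive (≡.sym αN))) (pred (Constants.J setup (suc den))) (pred (Constants.n₀ setup (suc den)))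
    (factor-exists setup (suc den))
  where
  open RationalSetup (rational-setup H x χ≥2 χ*)
  open Setup setup
  fraction = 0<⇒numerator α 0<α
  num = proj₁ fraction
  den = proj₁ (proj₂ fraction)
  αN  = proj₂ (proj₂ fraction)

-- The extremal construction

argmin : ∀ m (f : Fin (suc m) → ℕ) → ∃[ i ] (∀ j → f i ≤ f j)
argmin zero    f = Fin.zero , λ { Fin.zero → ≤-refl }
argmin (suc m) f with argmin m (f ∘ Fin.suc)
... | i , least with ≤-total (f Fin.zero) (f (Fin.suc i))
...   | inj₁ le = Fin.zero , λ { Fin.zero → ≤-refl ; (Fin.suc j) → ≤-trans le (least j) }
...   | inj₂ ge = Fin.suc i , λ { Fin.zero → ge ; (Fin.suc j) → least j }

-- `InD` contains only differences of consecutive class sizes in increasing order, so statements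
-- about all differences need an explicit sorting permutation.
record Sorting {m : ℕ} (f : Fin m → ℕ) : Set where
  field
    π          : Fin m → Fin m
    injective  : ∀ {x y} → π x ≡ π y → x ≡ y
    surjective : ∀ y → ∃[ x ] (π x ≡ y)
    sorted     : ∀ i j → i Fin.≤ j → f (π i) ≤ f (π j)

sorting : ∀ m (f : Fin m → ℕ) → Sorting f
sorting zero    f = record { π = id ; injective = id ; surjective = λ () ; sorted = λ () }
sorting (suc m) f = record { π = π′ ; injective = λ {x} {y} → inj x y ; surjective = surj ; sorted = sorted′ }
  where
  least = argmin m f
  i₀ = proj₁ least
  open Sorting (sorting m (f ∘ Fin.punchIn i₀))
  π′ : Fin (suc m) → Fin (suc m)
  π′ Fin.zero    = i₀
  π′ (Fin.suc i) = Fin.punchIn i₀ (π i)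
  inj : ∀ x y → π′ x ≡ π′ y → x ≡ y
  inj Fin.zero    Fin.zero    e = ≡.refl
  inj Fin.zero    (Fin.suc y) e = contradiction (≡.sym e) (Fin.punchInᵢ≢i i₀ (π y))
  inj (Fin.suc x) Fin.zero    e = contradiction e (Fin.punchInᵢ≢i i₀ (π x))
  inj (Fin.suc x) (Fin.suc y) e = cong Fin.suc (injective (Fin.punchIn-injective i₀ (π x) (π y) e))
  surj : ∀ y → ∃[ x ] (π′ x ≡ y)
  surj y with i₀ Fin.≟ y
  ... | yes e = Fin.zero , e
  ... | no ne = let (x , e) = surjective (Fin.punchOut ne) in Fin.suc x , ≡.trans (cong (Fin.punchIn i₀) e) (Fin.punchIn-punchOut ne)
  sorted′ : ∀ i j → i Fin.≤ j → f (π′ i) ≤ f (π′ j)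
  sorted′ Fin.zero    j           le       = proj₂ least (π′ j)
  sorted′ (Fin.suc i) (Fin.suc j) (s≤s le) = sorted i j le

∣-differences : ∀ {m} (f : Fin m → ℕ) d → (∀ i j → i Fin.≤ j → f i ≤ f j) → (∀ i j → toℕ j ≡ suc (toℕ i) → d ∣ f j ∸ f i) →
  ∀ j i → i Fin.≤ j → d ∣ f j ∸ f i
∣-differences {suc m} f d mono step′ Fin.zero Fin.zero le = subst (d ∣_) (≡.sym (n∸n≡0 (f Fin.zero))) (d ∣0)
∣-differences {suc (suc m)} f d mono step′ (Fin.suc j) Fin.zero le = subst (d ∣_)
    (telescope (f Fin.zero) (mono Fin.zero (Fin.suc Fin.zero) z≤n) (mono (Fin.suc Fin.zero) (Fin.suc j) (s≤s z≤n)))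
    (∣m∣n⇒∣m+n (∣-differences (f ∘ Fin.suc) d (λ i j le → mono (Fin.suc i) (Fin.suc j) (s≤s le)) (λ i j e → step′ (Fin.suc i) (Fin.suc j) (cong suc e)) j Fin.zero z≤n)
      (step′ Fin.zero (Fin.suc Fin.zero) ≡.refl))
  where
  telescope : ∀ a {b c} → a ≤ b → b ≤ c → (c ∸ b) + (b ∸ a) ≡ c ∸ a
  telescope a {b} {c} a≤b b≤c = ≡.trans (≡.sym (+-∸-assoc (c ∸ b) a≤b)) (cong (_∸ a) (m∸n+n≡m b≤c))
∣-differences {suc m} f d mono step′ (Fin.suc j) (Fin.suc i) (s≤s le) =
  ∣-differences (f ∘ Fin.suc) d (λ i j le → mono (Fin.suc i) (Fin.suc j) (s≤s le)) (λ i j e → step′ (Fin.suc i) (Fin.suc j) (cong suc e)) j i le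

-- A divisor of all consecutive differences in sorted order divides every difference, by
-- telescoping.
gap≡1⇒hcf : ∀ {h} (H : Graph h) k → Colourings.gapGcd H k ≡ 1 → IsHcf (DH H k) 1
gap≡1⇒hcf {h} H k e = (λ x _ → divides x (≡.sym (*-identityʳ x))) , λ d d∣gap → subst (d ∣_) e (gcds-greatest gap allTriples (each d d∣gap))
  where
  open Colourings H k
  each : ∀ d → (∀ x → DH H k x → d ∣ x) → ∀ t → d ∣ gap t
  each d / ((c , i) , j) with proper? H k (lookup c)
  ... | no _   = d ∣0
  ... | yes pr with surjective i | surjective j
    where open Sorting (sorting k (classSize (lookup c)))
  ...   | i′ , ≡.refl | j′ , ≡.refl with ≤-total (toℕ i′) (toℕ j′)
    where open Sorting (sorting k (classSize (lookup c)))
  ...     | inj₁ le = subst (d ∣_) (≡.sym (m≤n⇒m∸n≡0 (sorted i′ j′ le))) (d ∣0)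
    where open Sorting (sorting k (classSize (lookup c)))
  ...     | inj₂ ge = ∣-differences (classSize (lookup c) ∘ π) d sorted
      (λ a b e′ → / _ (lookup c , pr , π , injective , (λ y → proj₁ (surjective y) , λ { ≡.refl → proj₂ (surjective y) }) , sorted , a , b , e′ , ≡.refl)) i′ j′ ge
    where open Sorting (sorting k (classSize (lookup c)))

S-classes : ∀ {h k} (c : Fin h → Fin k) → S (allFin k) (classSize c) ≡ h
S-classes {h} {k} c = begin
  S (allFin k) (classSize c)                                        ≡⟨ S-cong (allFin k) (λ i → count≡S h _) ⟩
  S (allFin k) (λ i → S (allFin h) (λ v → 𝟙 ⌊ c v Fin.≟ i ⌋))       ≡⟨ S-swap (allFin k) (allFin h) _ ⟩
  S (allFin h) (λ v → S (allFin k) (λ i → 𝟙 ⌊ c v Fin.≟ i ⌋))       ≡⟨ S-cong (allFin h) (λ v → S-point (c v) (λ _ → 1)) ⟩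
  S (allFin h) (λ _ → 1)                                            ≡⟨ ≡.trans (S-one (allFin h)) (length-allFin h) ⟩
  h ∎
  where
  open ≡-Reasoning
  S-point : ∀ {k} (x : Fin k) (f : Fin k → ℕ) → S (allFin k) (λ i → 𝟙 ⌊ x Fin.≟ i ⌋) ≡ 1
  S-point {suc k} Fin.zero f = cong suc (≡.trans (S-tabulate k Fin.suc _) (S-zero (allFin k)))
  S-point {suc k} (Fin.suc x) f = ≡.trans (S-tabulate k Fin.suc _)
    (≡.trans (S-cong (allFin k) (λ i → cong 𝟙 (suc-≟ x i))) (S-point x (f ∘ Fin.suc)))
    where
    suc-≟ : ∀ {k} (x i : Fin k) → ⌊ Fin.suc x Fin.≟ Fin.suc i ⌋ ≡ ⌊ x Fin.≟ i ⌋
    suc-≟ x i with x Fin.≟ i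
    ... | yes _ = ≡.refl
    ... | no _  = ≡.refl

sumTo-split : ∀ s m f → sumTo (s + m) f ≡ sumTo s f + sumTo m (λ i → f (s + i))
sumTo-split s zero    f = ≡.trans (cong (λ z → sumTo z f) (+-identityʳ s)) (≡.sym (+-identityʳ _))
sumTo-split s (suc m) f = ≡.trans (cong (λ z → sumTo z f) (+-suc s m)) (≡.trans (cong (_+ f (s + m)) (sumTo-split s m f)) (+-assoc (sumTo s f) _ _))

-- the part containing position v, and the position of v inside it, when consecutive
-- intervals have the given sizes
locate : ∀ {ρ} → Vec ℕ (suc ρ) → ℕ → Fin (suc ρ) × ℕ
locate (s ∷ [])     v = Fin.zero , v
locate (s ∷ t ∷ ss) v with v <? s
... | yes _ = Fin.zero , v
... | no _  = let (i , j) = locate (t ∷ ss) (v ∸ s) in Fin.suc i , j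

sumTo-locate : ∀ {ρ} (ss : Vec ℕ (suc ρ)) (f : Fin (suc ρ) × ℕ → ℕ) →
  sumTo (Vec.sum ss) (f ∘ locate ss) ≡ S (allFin (suc ρ)) (λ i → sumTo (lookup ss i) (λ j → f (i , j)))
sumTo-locate (s ∷ [])     f = ≡.trans (cong (λ z → sumTo z (λ j → f (Fin.zero , j))) (+-identityʳ s)) (≡.sym (+-identityʳ _))
sumTo-locate {suc ρ} (s ∷ t ∷ ss) f = begin
  sumTo (s + Vec.sum (t ∷ ss)) (f ∘ locate (s ∷ t ∷ ss))
    ≡⟨ sumTo-split s (Vec.sum (t ∷ ss)) _ ⟩
  sumTo s (f ∘ locate (s ∷ t ∷ ss)) + sumTo (Vec.sum (t ∷ ss)) (λ i → f (locate (s ∷ t ∷ ss) (s + i)))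
    ≡⟨ cong₂ _+_ (sumTo-cong s (λ i lt → cong f (inside i lt))) (sumTo-cong (Vec.sum (t ∷ ss)) (λ i _ → cong f (outside i))) ⟩
  sumTo s (λ j → f (Fin.zero , j)) + sumTo (Vec.sum (t ∷ ss)) (λ i → f (Fin.suc (proj₁ (locate (t ∷ ss) i)) , proj₂ (locate (t ∷ ss) i)))
    ≡⟨ cong (λ z → sumTo s (λ j → f (Fin.zero , j)) + z) (≡.trans (sumTo-locate (t ∷ ss) (λ p → f (Fin.suc (proj₁ p) , proj₂ p))) (≡.sym (S-tabulate (suc ρ) Fin.suc _))) ⟩
  S (allFin (suc (suc ρ))) (λ i → sumTo (lookup (s ∷ t ∷ ss) i) (λ j → f (i , j))) ∎
  where
  open ≡-Reasoning
  inside : ∀ i → i < s → locate (s ∷ t ∷ ss) i ≡ (Fin.zero , i)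
  inside i lt with i <? s
  ... | yes _ = ≡.refl
  ... | no ¬p = contradiction lt ¬p
  outside : ∀ i → locate (s ∷ t ∷ ss) (s + i) ≡ (Fin.suc (proj₁ (locate (t ∷ ss) i)) , proj₂ (locate (t ∷ ss) i))
  outside i with s + i <? s
  ... | yes p = contradiction (m≤m+n s i) (<⇒≱ p)
  ... | no _ rewrite m+n∸m≡n s i = ≡.refl

<ᵇ-true : ∀ {i d} → i < d → (i <ᵇ d) ≡ true
<ᵇ-true {i} {d} lt with i <ᵇ d in e
... | true  = ≡.refl
... | false = contradiction (<⇒<ᵇ lt) (subst (λ b → IsTrue b → ⊥) (≡.sym e) id)

<ᵇ-false : ∀ {i d} → d ≤ i → (i <ᵇ d) ≡ false
<ᵇ-false {i} {d} le with i <ᵇ d in e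
... | false = ≡.refl
... | true  = contradiction le (<⇒≱ (<ᵇ⇒< i d (subst IsTrue (≡.sym e) tt)))

-- junk value 0 when s = 0
mod : ℕ → ℕ → ℕ
mod a zero    = 0
mod a (suc s) = a % suc s

sumTo-below : ∀ s d → d ≤ s → sumTo s (λ i → 𝟙 (i <ᵇ d)) ≡ d
sumTo-below zero    zero z≤n = ≡.refl
sumTo-below (suc s) d    le with m≤n⇒m<n∨m≡n le
... | inj₁ (s≤s d≤s) = ≡.trans (cong₂ _+_ (sumTo-below s d d≤s) (cong 𝟙 (<ᵇ-false d≤s))) (+-identityʳ d)
... | inj₂ ≡.refl = ≡.trans (cong₂ _+_ (≡.trans (sumTo-cong s (λ i lt → cong 𝟙 (≡.trans (<ᵇ-true (m<n⇒m<1+n lt)) (≡.sym (<ᵇ-true lt))))) (sumTo-below s s ≤-refl)) (cong 𝟙 (<ᵇ-true (≤-refl {suc s})))) (+-comm s 1)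

sumTo-window : ∀ s d a → d ≤ s → sumTo s (λ b → 𝟙 (mod (a + b) s <ᵇ d)) ≡ d
sumTo-window zero    zero a z≤n = ≡.refl
sumTo-window (suc s) d a d≤s = ≡.trans (sumTo-period (suc s) (λ i → 𝟙 (i % suc s <ᵇ d)) (λ i → cong (λ z → 𝟙 (z <ᵇ d)) ([m+n]%n≡m%n i (suc s))) a)
  (≡.trans (sumTo-cong (suc s) (λ i lt → cong (λ z → 𝟙 (z <ᵇ d)) (m<n⇒m%n≡m lt))) (sumTo-below (suc s) d d≤s))

S-select : ∀ {k} (x : Fin k) (f : Fin k → ℕ) → S (allFin k) (λ i → 𝟙 ⌊ x Fin.≟ i ⌋ * f i) ≡ f x
S-select {k} x f = ≡.trans (S-cong (allFin k) same) (≡.trans (S-*ʳ (allFin k) (f x) _) (≡.trans (cong (_* f x) one) (*-identityˡ (f x))))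
  where
  same : ∀ i → 𝟙 ⌊ x Fin.≟ i ⌋ * f i ≡ 𝟙 ⌊ x Fin.≟ i ⌋ * f x
  same i with x Fin.≟ i
  ... | yes ≡.refl = ≡.refl
  ... | no _       = ≡.refl
  one : S (allFin k) (λ i → 𝟙 ⌊ x Fin.≟ i ⌋) ≡ 1
  one = ≤-antisym (≤-trans (≤-reflexive (S-cong (allFin k) (λ i → cong 𝟙 (flip-≟ x i)))) (S-≟≤1 (allFin k) (allFin⁺ k) x))
    (≤-trans (≤-reflexive (≡.sym (𝟙≟-refl x))) (S-∈ (λ i → 𝟙 ⌊ x Fin.≟ i ⌋) (∈.∈-allFin x)))
    where
    flip-≟ : ∀ x i → ⌊ x Fin.≟ i ⌋ ≡ ⌊ i Fin.≟ x ⌋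
    flip-≟ x i with x Fin.≟ i | i Fin.≟ x
    ... | yes _      | yes _ = ≡.refl
    ... | no _       | no _  = ≡.refl
    ... | yes ≡.refl | no ¬p = contradiction ≡.refl ¬p
    ... | no ¬p      | yes e = contradiction (≡.sym e) ¬p

-- Complete multipartite, plus inside every part the graph joining positions a and b when a + b mod the part
-- size is below d; at the apex of every triangle containing an inner edge the two other edges are incompatible.
module Construction {ρ : ℕ} (ss : Vec ℕ (suc ρ)) (d : ℕ) where

  n : ℕ
  n = Vec.sum ss

  part : Fin n → Fin (suc ρ)
  part v = proj₁ (locate ss (toℕ v))

  position : Fin n → ℕ
  position v = proj₂ (locate ss (toℕ v))

  -- A sum of positions, rather than a difference, makes the relation symmetric and still gives
  -- every vertex exactly `d` close ones, whatever the parities of `d` and of the part size.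
  close : Fin n → Fin n → Bool
  close u v = ⌊ part u Fin.≟ part v ⌋ ∧ (mod (position u + position v) (lookup ss (part u)) <ᵇ d)

  inner : Fin n → Fin n → Bool
  inner u v = not ⌊ u Fin.≟ v ⌋ ∧ close u v

  private
    ≟-sym : ∀ {k} (x y : Fin k) → ⌊ x Fin.≟ y ⌋ ≡ ⌊ y Fin.≟ x ⌋
    ≟-sym x y with x Fin.≟ y | y Fin.≟ x
    ... | yes _      | yes _ = ≡.refl
    ... | no _       | no _  = ≡.refl
    ... | yes ≡.refl | no ¬p = contradiction ≡.refl ¬p
    ... | no ¬p      | yes e = contradiction (≡.sym e) ¬p

    ≟-refl : ∀ {k} (x : Fin k) → ⌊ x Fin.≟ x ⌋ ≡ true
    ≟-refl x with x Fin.≟ x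
    ... | yes _ = ≡.refl
    ... | no ¬p = contradiction ≡.refl ¬p

  close-sym : ∀ u v → close u v ≡ close v u
  close-sym u v with part u Fin.≟ part v | part v Fin.≟ part u
  ... | no _  | no _  = ≡.refl
  ... | yes e | no ¬p = contradiction (≡.sym e) ¬p
  ... | no ¬p | yes e = contradiction (≡.sym e) ¬p
  ... | yes e | yes _ = cong₂ (λ a s → mod a (lookup ss s) <ᵇ d) (+-comm (position u) (position v)) e

  inner-sym : ∀ u v → inner u v ≡ inner v u
  inner-sym u v = cong₂ (λ a b → not a ∧ b) (≟-sym u v) (close-sym u v)

  inner-irr : ∀ u → inner u u ≡ false
  inner-irr u = cong (λ b → not b ∧ close u u) (≟-refl u)

  G : Graph n
  G = record
    { adj    = λ u v → not ⌊ part u Fin.≟ part v ⌋ ∨ inner u v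
    ; sym    = λ u v → cong₂ (λ a b → not a ∨ b) (≟-sym (part u) (part v)) (inner-sym u v)
    ; irrefl = λ u → cong₂ (λ a b → not a ∨ b) (≟-refl (part u)) (inner-irr u) }

  F : IncompatibilitySystem G
  F = record
    { inc      = λ w u v → (adj G w u ∧ adj G w v) ∧ inner u v
    ; inc-sym  = λ w u v → cong₂ _∧_ (Bool.∧-comm (adj G w u) (adj G w v)) (inner-sym u v)
    ; inc-edge = λ w u v e → ∧-elimˡ (∧-elimˡ e) , ∧-elimʳ {adj G w u} (∧-elimˡ e) , λ { ≡.refl →
        contradiction (≡.trans (≡.sym (∧-elimʳ {adj G w u ∧ adj G w v} e)) (inner-irr u)) λ () } }

  S-vertices : ∀ (f : Fin (suc ρ) × ℕ → ℕ) → S (allFin n) (λ v → f (locate ss (toℕ v))) ≡ S (allFin (suc ρ)) (λ i → sumTo (lookup ss i) (λ j → f (i , j)))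
  S-vertices f = ≡.trans (S-allFin n (f ∘ locate ss)) (sumTo-locate ss f)

  private
    sumTo-scale : ∀ m c f → sumTo m (λ j → c * f j) ≡ c * sumTo m f
    sumTo-scale zero    c f = ≡.sym (*-zeroʳ c)
    sumTo-scale (suc m) c f = ≡.trans (cong (_+ c * f m) (sumTo-scale m c f)) (≡.sym (*-distribˡ-+ c (sumTo m f) (f m)))

    sumTo-ones : ∀ m → sumTo m (λ _ → 1) ≡ m
    sumTo-ones zero    = ≡.refl
    sumTo-ones (suc m) = ≡.trans (cong (_+ 1) (sumTo-ones m)) (+-comm m 1)

  part-size : ∀ i → S (allFin n) (λ v → 𝟙 ⌊ i Fin.≟ part v ⌋) ≡ lookup ss i
  part-size i = ≡.trans (S-vertices (λ p → 𝟙 ⌊ i Fin.≟ proj₁ p ⌋)) (≡.trans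
    (S-cong (allFin (suc ρ)) (λ j → ≡.trans (sumTo-cong (lookup ss j) (λ _ _ → ≡.sym (*-identityʳ _)))
      (≡.trans (sumTo-scale (lookup ss j) (𝟙 ⌊ i Fin.≟ j ⌋) (λ _ → 1)) (cong (𝟙 ⌊ i Fin.≟ j ⌋ *_) (sumTo-ones (lookup ss j))))))
    (S-select i (lookup ss)))

  close-count : ∀ u → d ≤ lookup ss (part u) → S (allFin n) (𝟙 ∘ close u) ≡ d
  close-count u d≤ = ≡.trans (S-vertices (λ p → 𝟙 (⌊ part u Fin.≟ proj₁ p ⌋ ∧ (mod (position u + proj₂ p) s <ᵇ d)))) (≡.trans
    (S-cong (allFin (suc ρ)) (λ i → ≡.trans (sumTo-cong (lookup ss i) (λ j _ → 𝟙-∧ ⌊ part u Fin.≟ i ⌋ _)) (sumTo-scale (lookup ss i) (𝟙 ⌊ part u Fin.≟ i ⌋) _)))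
    (≡.trans (S-select (part u) (λ i → sumTo (lookup ss i) (λ j → 𝟙 (mod (position u + j) s <ᵇ d)))) (sumTo-window s d (position u) d≤)))
    where s = lookup ss (part u)

  -- The one is for `u` itself, which may be close to `u` but is not adjacent to it.
  degree-bound : ∀ u → d ≤ lookup ss (part u) → n + d ≤ degree G u + 1 + lookup ss (part u)
  degree-bound u d≤ = begin
    n + d
      ≡⟨ cong₂ _+_ (≡.trans (≡.sym (length-allFin n)) (≡.sym (S-one (allFin n)))) (≡.sym (close-count u d≤)) ⟩
    S (allFin n) (λ _ → 1) + S (allFin n) (𝟙 ∘ close u)
      ≡⟨ S-+ (allFin n) _ _ ⟨
    S (allFin n) (λ v → 1 + 𝟙 (close u v))
      ≤⟨ S-mono (allFin n) pointwise ⟩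
    S (allFin n) (λ v → (𝟙 (adj G u v) + 𝟙 ⌊ v Fin.≟ u ⌋) + 𝟙 ⌊ part u Fin.≟ part v ⌋)
      ≡⟨ ≡.trans (S-+ (allFin n) _ _) (cong (_+ S (allFin n) (λ v → 𝟙 ⌊ part u Fin.≟ part v ⌋)) (S-+ (allFin n) _ _)) ⟩
    S (allFin n) (𝟙 ∘ adj G u) + S (allFin n) (λ v → 𝟙 ⌊ v Fin.≟ u ⌋) + S (allFin n) (λ v → 𝟙 ⌊ part u Fin.≟ part v ⌋)
      ≤⟨ +-mono-≤ (+-mono-≤ (≤-reflexive (≡.sym (count≡S n (adj G u)))) (S-≟≤1 (allFin n) (allFin⁺ n) u)) (≤-reflexive (part-size (part u))) ⟩
    degree G u + 1 + lookup ss (part u) ∎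
    where
    open ≤-Reasoning
    table : ∀ p e c → 1 + 𝟙 (p ∧ c) ≤ 𝟙 (not p ∨ (not e ∧ (p ∧ c))) + 𝟙 e + 𝟙 p
    table true  true  true  = ≤-refl
    table true  true  false = s≤s z≤n
    table true  false true  = ≤-refl
    table true  false false = ≤-refl
    table false true  c     = s≤s z≤n
    table false false c     = ≤-refl
    pointwise : ∀ v → 1 + 𝟙 (close u v) ≤ (𝟙 (adj G u v) + 𝟙 ⌊ v Fin.≟ u ⌋) + 𝟙 ⌊ part u Fin.≟ part v ⌋
    pointwise v = subst (λ e → 1 + 𝟙 (close u v) ≤ 𝟙 (adj G u v) + 𝟙 e + 𝟙 ⌊ part u Fin.≟ part v ⌋) (≟-sym u v)
      (table ⌊ part u Fin.≟ part v ⌋ ⌊ u Fin.≟ v ⌋ (mod (position u + position v) (lookup ss (part u)) <ᵇ d))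

  -- The edges at `w` incompatible with the edge to `u` lead to vertices close to `u`.
  inc-bound : (∀ i → d ≤ lookup ss i) → ∀ w u → count n (inc F w u) ≤ d
  inc-bound d≤ w u = ≤-trans (≤-reflexive (count≡S n _)) (≤-trans (S-mono (allFin n) (λ v → 𝟙-mono {inc F w u v} {close u v}
    (λ e → ∧-elimʳ {not ⌊ u Fin.≟ v ⌋} (∧-elimʳ {adj G w u ∧ adj G w v} e)))) (≤-reflexive (close-count u (d≤ (part u)))))

  inner-edge : ∀ u v → adj G u v ≡ true → part u ≡ part v → inner u v ≡ true
  inner-edge u v e eq = subst (λ p → not ⌊ p Fin.≟ part v ⌋ ∨ inner u v ≡ true → inner u v ≡ true) (≡.sym eq)
    (subst (λ b → not b ∨ inner u v ≡ true → inner u v ≡ true) (≡.sym (≟-refl (part v))) id) e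

  module _ {h : ℕ} (H : Graph h) (triangle : ∀ a b → adj H a b ≡ true → ∃[ c ] (adj H c a ≡ true × adj H c b ≡ true))
           (T : HTiling H G) (factor : IsFactor T) (compatible : CompatibleSubgraph F (tilingEdges T)) where

    tile-proper : ∀ t → ProperColouring H (suc ρ) (part ∘ φ T t)
    tile-proper t a b ab eq with triangle a b ab
    ... | c , ca , cb = contradiction (≡.trans (≡.sym (∧-intro (∧-intro (hom T t c a ca) (hom T t c b cb)) inn))
        (compatible (φ T t c) (φ T t a) (φ T t b) (t , c , a , ca , ≡.refl , ≡.refl) (t , c , b , cb , ≡.refl , ≡.refl) different)) λ ()
      where
      inn : inner (φ T t a) (φ T t b) ≡ true
      inn = inner-edge (φ T t a) (φ T t b) (hom T t a b ab) eq
      different : φ T t a ≢ φ T t b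
      different e = contradiction (≡.trans (≡.sym (subst (λ z → inner (φ T t a) z ≡ true) (≡.sym e) inn)) (inner-irr (φ T t a))) λ ()

    private
      placements : List (Fin (tiles T) × Fin h)
      placements = pairs (allFin (tiles T)) (allFin h)

      unique-pairs : ∀ {A B : Set} {xs : List A} {ys : List B} → Unique xs → Unique ys → Unique (pairs xs ys)
      unique-pairs []       v = []
      unique-pairs {xs = x ∷ xs} {ys} (p ∷ u) v = unique-++⁺ (unique-map⁺ (λ { ≡.refl → ≡.refl }) v) (unique-pairs u v)
          (λ q r → All.lookup p (snd xs r) (fst ys q))
        where
        fst : ∀ ys {z} → z ∈ map (x ,_) ys → x ≡ proj₁ z
        fst (y ∷ ys) (here ≡.refl) = ≡.refl
        fst (y ∷ ys) (there q)     = fst ys q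
        snd : ∀ xs {z} → z ∈ pairs xs ys → proj₁ z ∈ xs
        snd (x′ ∷ xs) q with ∈-++⁻ (map (x′ ,_) ys) q
        ... | inj₁ r = here (≡.sym (fst′ ys r))
          where
          fst′ : ∀ ys {z} → z ∈ map (x′ ,_) ys → x′ ≡ proj₁ z
          fst′ (y ∷ ys) (here ≡.refl) = ≡.refl
          fst′ (y ∷ ys) (there q)     = fst′ ys q
        ... | inj₂ r = there (snd xs r)

      S-⊆ : ∀ {A : Set} {xs ys : List A} → Unique xs → (∀ {x} → x ∈ xs → x ∈ ys) → ∀ f → S xs f ≤ S ys f
      S-⊆ {xs = xs} u sub f = let (zs , e) = complement xs u sub in
        ≤-trans (m≤m+n _ (S zs f)) (≤-reflexive (≡.trans (≡.sym (S-++ xs zs f)) (≡.sym (S-↭ f e))))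

    S-tiles : ∀ f → S (allFin n) f ≡ S (allFin (tiles T)) (λ t → S (allFin h) (λ a → f (φ T t a)))
    S-tiles f = ≡.trans (≤-antisym
        (S-⊆ (allFin⁺ n) (λ {v} _ → let (t , a , e) = factor v in subst (_∈ images) e (∈-map⁺ place′ (∈-pairs (∈.∈-allFin t) (∈.∈-allFin a)))) f)
        (S-⊆ (unique-map⁺ injective (unique-pairs (allFin⁺ (tiles T)) (allFin⁺ h))) (λ _ → ∈.∈-allFin _) f))
      (≡.trans (S-map place′ placements f) (S-pairs (allFin (tiles T)) (allFin h) _))
      where
      place′ : Fin (tiles T) × Fin h → Fin n
      place′ (t , a) = φ T t a
      images : List (Fin n)
      images = map place′ placements
      injective : ∀ {x y} → place′ x ≡ place′ y → x ≡ y
      injective {t , a} {t′ , a′} e = let (p , q) = disjoint T t t′ a a′ e in cong₂ _,_ p q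

    part-tiles : ∀ i → lookup ss i ≡ S (allFin (tiles T)) (λ t → classSize (part ∘ φ T t) i)
    part-tiles i = ≡.trans (≡.sym (part-size i)) (≡.trans (S-tiles _) (S-cong (allFin (tiles T)) (λ t →
      ≡.trans (S-cong (allFin h) (λ a → cong 𝟙 (≟-sym i (part (φ T t a))))) (≡.sym (count≡S h _)))))

    tiles-order : tiles T * h ≡ n
    tiles-order = ≡.sym (≡.trans (≡.sym (length-allFin n)) (≡.trans (≡.sym (S-one (allFin n))) (≡.trans (S-tiles (λ _ → 1))
      (≡.trans (S-cong (allFin (tiles T)) (λ t → ≡.trans (S-one (allFin h)) (length-allFin h))) (≡.trans (S-const (allFin (tiles T)) h) (cong (_* h) (length-allFin (tiles T))))))))

ℕ→ℚ-cancel-< : ∀ {m n} → ℕ→ℚ m ℚ.< ℕ→ℚ n → m < n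
ℕ→ℚ-cancel-< lt = ≰⇒> λ le → ℚ.<-irrefl ≡.refl (ℚ.<-≤-trans lt (ℕ→ℚ-mono-≤ le))

private
  open +-*-Solver

  clear-degree : ∀ i μ n M B → (1ℚ ℚ.+ 1ℚ) ℚ.* M ℚ.* B ℚ.* (((1ℚ ℚ.- i) ℚ.+ μ ℚ.* ½) ℚ.* n) ℚ.+ (1ℚ ℚ.+ 1ℚ) ℚ.* M ℚ.* (i ℚ.* B) ℚ.* n ≡
    (1ℚ ℚ.+ 1ℚ) ℚ.* M ℚ.* B ℚ.* n ℚ.+ B ℚ.* (μ ℚ.* M) ℚ.* n
  clear-degree = solve 5 (λ i μ n M B → con (1ℚ ℚ.+ 1ℚ) :* M :* B :* (((con 1ℚ :- i) :+ μ :* con ½) :* n) :+ con (1ℚ ℚ.+ 1ℚ) :* M :* (i :* B) :* n :=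
    con (1ℚ ℚ.+ 1ℚ) :* M :* B :* n :+ B :* (μ :* M) :* n) ≡.refl

  clear-threshold : ∀ y r i w M → ((y ℚ.+ 1ℚ) ℚ.- r) ℚ.* i ℚ.* (r ℚ.* w ℚ.* M) ℚ.+ (i ℚ.* r) ℚ.* (r ℚ.* w ℚ.* M) ≡ (i ℚ.* r) ℚ.* ((y ℚ.* w ℚ.+ w) ℚ.* M)
  clear-threshold = solve 5 (λ y r i w M → ((y :+ con 1ℚ) :- r) :* i :* (r :* w :* M) :+ (i :* r) :* (r :* w :* M) := (i :* r) :* ((y :* w :+ w) :* M)) ≡.refl

-- the upper bound on μ with denominators cleared, where h = w + s and y = ρ h / w
threshold-ℕ : ∀ ρ s w M P μ → .{{_ : NonZero M}} → μ ℚ.* ℕ→ℚ M ≡ ℕ→ℚ P →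
  μ ℚ.< ((frac (ρ * (suc w + s)) (suc w) ℚ.+ 1ℚ) ℚ.- ℕ→ℚ (suc ρ)) ℚ.* inv (ℕ→ℚ (suc ρ)) → P * (suc ρ * suc w) < ρ * s * M
threshold-ℕ ρ s w M P μ μM lt = +-cancelˡ-< (suc ρ * suc w * M) _ _ (≤-trans (ℕ→ℚ-cancel-< main) (≤-reflexive (identity₇₈ ρ (suc w) s M)))
  where
  open ℚ.≤-Reasoning
  y = frac (ρ * (suc w + s)) (suc w)
  r′ = ℕ→ℚ (suc ρ)
  w′ = ℕ→ℚ (suc w)
  M′ = ℕ→ℚ M
  K = suc ρ * suc w * M
  K-eq : ℕ→ℚ K ≡ r′ ℚ.* w′ ℚ.* M′
  K-eq = ≡.trans (ℕ→ℚ-* (suc ρ * suc w) M) (cong (ℚ._* M′) (ℕ→ℚ-* (suc ρ) (suc w)))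
  unit : inv r′ ℚ.* r′ ≡ 1ℚ
  unit = inv-* (λ e → contradiction (ℕ→ℚ-injective {suc ρ} {0} e) λ ())
  positive-K : ℚ.Positive (r′ ℚ.* w′ ℚ.* M′)
  positive-K = subst ℚ.Positive K-eq (ℕ→ℚ-pos K {{m*n≢0 (suc ρ * suc w) M}})
  lemℚ : ∀ μ r w M → μ ℚ.* (r ℚ.* w ℚ.* M) ≡ μ ℚ.* M ℚ.* (r ℚ.* w)
  lemℚ = solve 4 (λ μ r w M → μ :* (r :* w :* M) := μ :* M :* (r :* w)) ≡.refl
  main : ℕ→ℚ (K + P * (suc ρ * suc w)) ℚ.< ℕ→ℚ ((ρ * (suc w + s) + suc w) * M)
  main = begin-strict
    ℕ→ℚ (K + P * (suc ρ * suc w))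
      ≡⟨ ≡.trans (ℕ→ℚ-+ K (P * (suc ρ * suc w))) (ℚ.+-comm (ℕ→ℚ K) _) ⟩
    ℕ→ℚ (P * (suc ρ * suc w)) ℚ.+ ℕ→ℚ K
      ≡⟨ cong₂ ℚ._+_ (≡.trans (ℕ→ℚ-* P (suc ρ * suc w)) (≡.trans (cong₂ ℚ._*_ (≡.sym μM) (ℕ→ℚ-* (suc ρ) (suc w))) (≡.sym (lemℚ μ r′ w′ M′)))) K-eq ⟩
    μ ℚ.* (r′ ℚ.* w′ ℚ.* M′) ℚ.+ r′ ℚ.* w′ ℚ.* M′
      <⟨ ℚ.+-monoˡ-< (r′ ℚ.* w′ ℚ.* M′) (ℚ.*-monoˡ-<-pos (r′ ℚ.* w′ ℚ.* M′) {{positive-K}} lt) ⟩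
    ((y ℚ.+ 1ℚ) ℚ.- r′) ℚ.* inv r′ ℚ.* (r′ ℚ.* w′ ℚ.* M′) ℚ.+ r′ ℚ.* w′ ℚ.* M′
      ≡⟨ cong (ℚ._+_ (((y ℚ.+ 1ℚ) ℚ.- r′) ℚ.* inv r′ ℚ.* (r′ ℚ.* w′ ℚ.* M′))) (≡.trans (≡.sym (ℚ.*-identityˡ _)) (cong (ℚ._* (r′ ℚ.* w′ ℚ.* M′)) (≡.sym unit))) ⟩
    ((y ℚ.+ 1ℚ) ℚ.- r′) ℚ.* inv r′ ℚ.* (r′ ℚ.* w′ ℚ.* M′) ℚ.+ (inv r′ ℚ.* r′) ℚ.* (r′ ℚ.* w′ ℚ.* M′)
      ≡⟨ clear-threshold y r′ (inv r′) w′ M′ ⟩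
    (inv r′ ℚ.* r′) ℚ.* ((y ℚ.* w′ ℚ.+ w′) ℚ.* M′)
      ≡⟨ ≡.trans (cong (ℚ._* ((y ℚ.* w′ ℚ.+ w′) ℚ.* M′)) unit) (ℚ.*-identityˡ _) ⟩
    (y ℚ.* w′ ℚ.+ w′) ℚ.* M′
      ≡⟨ cong (λ z → (z ℚ.+ w′) ℚ.* M′) (frac-* (ρ * (suc w + s)) w) ⟩
    (ℕ→ℚ (ρ * (suc w + s)) ℚ.+ w′) ℚ.* M′
      ≡⟨ ≡.sym (≡.trans (ℕ→ℚ-* (ρ * (suc w + s) + suc w) M) (cong (ℚ._* M′) (ℕ→ℚ-+ (ρ * (suc w + s)) (suc w)))) ⟩
    ℕ→ℚ ((ρ * (suc w + s) + suc w) * M) ∎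

module LowerBound {ρ : ℕ} (ss : Vec ℕ (suc ρ)) (B b M P : ℕ) .{{_ : NonZero B}} .{{_ : NonZero M}} (x μ : ℚ)
    (inverse : inv x ℚ.* ℕ→ℚ B ≡ ℕ→ℚ b) (μM : μ ℚ.* ℕ→ℚ M ≡ ℕ→ℚ P)
    (above : ∀ i → B * lookup ss i ≤ b * Vec.sum ss + 2 * B) (below : ∀ i → P * Vec.sum ss ≤ M * lookup ss i) (large : 8 * M ≤ P * Vec.sum ss) where

  d : ℕ
  d = (P * Vec.sum ss) / M

  open Construction ss d public

  private
    d≤ : ∀ i → d ≤ lookup ss i
    d≤ i = *-cancelˡ-≤ M (≤-trans (*/≤ M (P * n)) (below i))

    -- A part may exceed its share by two, and rounding `d` and excluding `u` itself cost one each.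
    -- This loss of four is at most half of `μ * n`, because `large` says `μ * n ≥ 8`; hence the
    -- term `μ / 2` in the degree.
    degree-cleared : ∀ u → 2 * M * B * n + B * P * n ≤ 2 * M * B * degree G u + 2 * M * b * n
    degree-cleared u = ≤-from 0 (+-mono-≤ (+-mono-≤ (*-monoʳ-≤ (2 * M * B) (degree-bound u (d≤ (part u)))) (*-monoʳ-≤ (2 * M) (above (part u))))
        (+-mono-≤ (*-monoʳ-≤ (2 * B) (<+*/ M (P * n))) (*-monoʳ-≤ B large))) (identity₇₇ M B n P (degree G u) b d (lookup ss (part u)))

    cast₄ : ∀ a b c d → ℕ→ℚ (a * b * c * d) ≡ ℕ→ℚ a ℚ.* ℕ→ℚ b ℚ.* ℕ→ℚ c ℚ.* ℕ→ℚ d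
    cast₄ a b c d = ≡.trans (ℕ→ℚ-* (a * b * c) d) (cong (ℚ._* ℕ→ℚ d) (≡.trans (ℕ→ℚ-* (a * b) c) (cong (ℚ._* ℕ→ℚ c) (ℕ→ℚ-* a b))))

    cast₃ : ∀ a b c → ℕ→ℚ (a * b * c) ≡ ℕ→ℚ a ℚ.* ℕ→ℚ b ℚ.* ℕ→ℚ c
    cast₃ a b c = ≡.trans (ℕ→ℚ-* (a * b) c) (cong (ℚ._* ℕ→ℚ c) (ℕ→ℚ-* a b))

    min-degree : MinDegreeAtLeast G ((1ℚ ℚ.- inv x) ℚ.+ μ ℚ.* ½)
    min-degree u = ℚ.*-cancelˡ-≤-pos (ℕ→ℚ 2 ℚ.* M′ ℚ.* B′) {{positive-2MB}} (ℚ-cancel (ℕ→ℚ 2 ℚ.* M′ ℚ.* ℕ→ℚ b ℚ.* n′) (begin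
      ℕ→ℚ 2 ℚ.* M′ ℚ.* B′ ℚ.* (((1ℚ ℚ.- inv x) ℚ.+ μ ℚ.* ½) ℚ.* n′) ℚ.+ ℕ→ℚ 2 ℚ.* M′ ℚ.* ℕ→ℚ b ℚ.* n′
        ≡⟨ cong (λ z → ℕ→ℚ 2 ℚ.* M′ ℚ.* B′ ℚ.* (((1ℚ ℚ.- inv x) ℚ.+ μ ℚ.* ½) ℚ.* n′) ℚ.+ ℕ→ℚ 2 ℚ.* M′ ℚ.* z ℚ.* n′) (≡.sym inverse) ⟩
      ℕ→ℚ 2 ℚ.* M′ ℚ.* B′ ℚ.* (((1ℚ ℚ.- inv x) ℚ.+ μ ℚ.* ½) ℚ.* n′) ℚ.+ ℕ→ℚ 2 ℚ.* M′ ℚ.* (inv x ℚ.* B′) ℚ.* n′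
        ≡⟨ clear-degree (inv x) μ n′ M′ B′ ⟩
      ℕ→ℚ 2 ℚ.* M′ ℚ.* B′ ℚ.* n′ ℚ.+ B′ ℚ.* (μ ℚ.* M′) ℚ.* n′
        ≡⟨ cong (λ z → ℕ→ℚ 2 ℚ.* M′ ℚ.* B′ ℚ.* n′ ℚ.+ B′ ℚ.* z ℚ.* n′) μM ⟩
      ℕ→ℚ 2 ℚ.* M′ ℚ.* B′ ℚ.* n′ ℚ.+ B′ ℚ.* ℕ→ℚ P ℚ.* n′
        ≡⟨ ≡.sym (≡.trans (ℕ→ℚ-+ (2 * M * B * n) (B * P * n)) (cong₂ ℚ._+_ (cast₄ 2 M B n) (cast₃ B P n))) ⟩
      ℕ→ℚ (2 * M * B * n + B * P * n)
        ≤⟨ ℕ→ℚ-mono-≤ (degree-cleared u) ⟩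
      ℕ→ℚ (2 * M * B * degree G u + 2 * M * b * n)
        ≡⟨ ≡.trans (ℕ→ℚ-+ (2 * M * B * degree G u) (2 * M * b * n)) (cong₂ ℚ._+_ (cast₄ 2 M B (degree G u)) (cast₄ 2 M b n)) ⟩
      ℕ→ℚ 2 ℚ.* M′ ℚ.* B′ ℚ.* ℕ→ℚ (degree G u) ℚ.+ ℕ→ℚ 2 ℚ.* M′ ℚ.* ℕ→ℚ b ℚ.* n′ ∎))
      where
      open ℚ.≤-Reasoning
      M′ = ℕ→ℚ M
      B′ = ℕ→ℚ B
      n′ = ℕ→ℚ n
      positive-2MB : ℚ.Positive (ℕ→ℚ 2 ℚ.* M′ ℚ.* B′)
      positive-2MB = subst ℚ.Positive (cast₃ 2 M B) (ℕ→ℚ-pos (2 * M * B) {{m*n≢0 (2 * M) B {{m*n≢0 2 M}}}})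
      ℚ-cancel : ∀ {p q} c → p ℚ.+ c ℚ.≤ q ℚ.+ c → p ℚ.≤ q
      ℚ-cancel {p} {q} c le = ≡.subst₂ ℚ._≤_ (back p c) (back q c) (ℚ.+-monoˡ-≤ (ℚ.- c) le)
        where back : ∀ p c → p ℚ.+ c ℚ.+ ℚ.- c ≡ p
              back = solve 2 (λ p c → p :+ c :+ :- c := p) ≡.refl

    bounded : Bounded F (μ ℚ.* ℕ→ℚ n)
    bounded w u _ = ℚ.*-cancelˡ-≤-pos (ℕ→ℚ M) {{ℕ→ℚ-pos M}} (begin
      ℕ→ℚ M ℚ.* ℕ→ℚ (count n (inc F w u))  ≡⟨ ℕ→ℚ-* M (count n (inc F w u)) ⟨
      ℕ→ℚ (M * count n (inc F w u))        ≤⟨ ℕ→ℚ-mono-≤ (≤-trans (*-monoʳ-≤ M (inc-bound d≤ w u)) (*/≤ M (P * n))) ⟩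
      ℕ→ℚ (P * n)                          ≡⟨ ℕ→ℚ-* P n ⟩
      ℕ→ℚ P ℚ.* ℕ→ℚ n                      ≡⟨ cong (ℚ._* ℕ→ℚ n) (≡.trans (≡.sym μM) (ℚ.*-comm μ (ℕ→ℚ M))) ⟩
      ℕ→ℚ M ℚ.* μ ℚ.* ℕ→ℚ n                ≡⟨ ℚ.*-assoc (ℕ→ℚ M) μ (ℕ→ℚ n) ⟩
      ℕ→ℚ M ℚ.* (μ ℚ.* ℕ→ℚ n)              ∎)
      where open ℚ.≤-Reasoning

  system : IsIncSystem n G F ((1ℚ ℚ.- inv x) ℚ.+ μ ℚ.* ½) μ
  system = min-degree , bounded

-- Two choices of part sizes: the space barrier and the divisibility barrier

balanced : ∀ ρ .{{_ : NonZero ρ}} → ℕ → Vec ℕ ρ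
balanced ρ m = Vec.tabulate (λ i → m / ρ + 𝟙 (toℕ i <ᵇ m % ρ))

sum-balanced : ∀ ρ .{{_ : NonZero ρ}} m → Vec.sum (balanced ρ m) ≡ m
sum-balanced ρ m = begin
  Vec.sum (balanced ρ m)
    ≡⟨ sum-tabulate ρ _ ⟩
  S (allFin ρ) (λ i → m / ρ + 𝟙 (toℕ i <ᵇ m % ρ))
    ≡⟨ S-+ (allFin ρ) _ _ ⟩
  S (allFin ρ) (λ _ → m / ρ) + S (allFin ρ) (λ i → 𝟙 (toℕ i <ᵇ m % ρ))
    ≡⟨ cong₂ _+_ (≡.trans (S-const (allFin ρ) (m / ρ)) (cong (_* (m / ρ)) (length-allFin ρ))) (≡.trans (S-allFin ρ (λ i → 𝟙 (i <ᵇ m % ρ))) (sumTo-below ρ (m % ρ) (<⇒≤ (m%n<n m ρ)))) ⟩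
  ρ * (m / ρ) + m % ρ
    ≡⟨ ≡.trans (+-comm _ (m % ρ)) (cong (λ z → m % ρ + z) (*-comm ρ (m / ρ))) ⟩
  m % ρ + (m / ρ) * ρ
    ≡⟨ m≡m%n+[m/n]*n m ρ ⟨
  m ∎
  where
  open ≡-Reasoning
  sum-tabulate : ∀ k (f : Fin k → ℕ) → Vec.sum (Vec.tabulate f) ≡ S (allFin k) f
  sum-tabulate zero    f = ≡.refl
  sum-tabulate (suc k) f = cong (λ z → f Fin.zero + z) (≡.trans (sum-tabulate k (f ∘ Fin.suc)) (≡.sym (S-tabulate k Fin.suc f)))

balanced-lower : ∀ ρ .{{_ : NonZero ρ}} m i → m / ρ ≤ lookup (balanced ρ m) i
balanced-lower ρ m i = ≤-trans (m≤m+n _ _) (≤-reflexive (≡.sym (V.lookup∘tabulate _ i)))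

balanced-upper : ∀ ρ .{{_ : NonZero ρ}} m i → lookup (balanced ρ m) i ≤ m / ρ + 1
balanced-upper ρ m i = ≤-trans (≤-reflexive (V.lookup∘tabulate _ i)) (+-monoʳ-≤ (m / ρ) (𝟙≤1 (toℕ i <ᵇ m % ρ)))

module Sizes (ρ : ℕ) .{{_ : NonZero ρ}} (n e : ℕ) (e≤n : e ≤ n) where

  sizes : Vec ℕ (suc ρ)
  sizes = e ∷ balanced ρ (n ∸ e)

  sum-sizes : Vec.sum sizes ≡ n
  sum-sizes = ≡.trans (cong (λ z → e + z) (sum-balanced ρ (n ∸ e))) (m+[n∸m]≡n e≤n)

-- no tiling exists because the first part is too small for its share of every copy
module CriticalExample {h : ℕ} (H : Graph h) (ρ s M P q : ℕ) .{{_ : NonZero ρ}} .{{_ : NonZero M}} .{{_ : NonZero h}} (x μ : ℚ)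
    (triangle : ∀ a b → adj H a b ≡ true → ∃[ c ] (adj H c a ≡ true × adj H c b ≡ true))
    (classes : ∀ c → ProperColouring H (suc ρ) c → ∀ i → s ≤ classSize c i)
    (inverse : inv x ℚ.* ℕ→ℚ (ρ * h) ≡ ℕ→ℚ (h ∸ s)) (μM : μ ℚ.* ℕ→ℚ M ≡ ℕ→ℚ P)
    (1≤s : 1 ≤ s) (rs≤h : suc ρ * s ≤ h) (strict : P * (suc ρ * (h ∸ s)) < ρ * s * M) (M≤q : M ≤ q) (large : 8 * M ≤ P * (q * h)) where

  private
    w = h ∸ s
    s≤h : s ≤ h
    s≤h = ≤-trans (m≤m+n s (ρ * s)) rs≤h
    w+s : w + s ≡ h
    w+s = m∸n+n≡m s≤h
    ρs≤w : ρ * s ≤ w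
    ρs≤w = m+n≤o⇒m≤o∸n (ρ * s) (≤-trans (≤-reflexive (+-comm (ρ * s) s)) rs≤h)
    n = q * h
    -- A factor has `q` copies, each with at least `s` vertices in every part; the first part is one
    -- vertex short.
    e = s * q ∸ 1
    1≤q : 1 ≤ q
    1≤q = ≤-trans (>-nonZero⁻¹ M) M≤q
    e+1 : e + 1 ≡ s * q
    e+1 = m∸n+n≡m (*-mono-≤ 1≤s 1≤q)
    e≤n : e ≤ n
    e≤n = ≤-trans (m≤m+n e 1) (≤-trans (≤-reflexive e+1) (≤-trans (*-monoˡ-≤ q s≤h) (≤-reflexive (*-comm h q))))
    rest-eq : n ∸ e ≡ w * q + 1
    rest-eq = +-cancelˡ-≡ e _ _ (≡.trans (m+[n∸m]≡n e≤n) (≡.trans (cong (q *_) (≡.sym w+s)) (≡.trans (identity₇₆ q w s) (≡.trans (cong (λ z → w * q + z) (≡.sym e+1)) (identity₇₅ (w * q) e)))))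
    open Sizes ρ n e e≤n
    Q = (n ∸ e) / ρ
    sq≤Q : s * q ≤ Q
    sq≤Q = ≤*⇒/≥ (s * q) ρ (n ∸ e) (≤-trans (≤-reflexive (≡.sym (*-assoc ρ s q))) (≤-trans (*-monoˡ-≤ q ρs≤w) (≤-trans (m≤m+n (w * q) 1) (≤-reflexive (≡.sym rest-eq)))))
    -- This is `μ * h < s`: an inner degree of about `μ * n` fits even into the first part, which
    -- has about `s * q` vertices. It follows from the upper bound on `μ` because
    -- `ρ * h ≤ suc ρ * (h ∸ s)`.
    Ph<sM : P * h < s * M
    Ph<sM = *-cancelˡ-< ρ _ _ (≤-<-trans (≤-trans (≤-reflexive (identity₆ ρ P h)) (*-monoʳ-≤ P ρh≤)) (<-≤-trans strict (≤-reflexive (*-assoc ρ s M))))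
      where
      ρh≤ : ρ * h ≤ suc ρ * w
      ρh≤ = ≤-trans (≤-reflexive (≡.trans (cong (ρ *_) (≡.sym w+s)) (identity₆₇ ρ w s))) (≤-trans (+-monoʳ-≤ (ρ * w) ρs≤w) (≤-reflexive (identity₆₆ ρ w)))
    Pn≤Me : P * n ≤ M * e
    Pn≤Me = +-cancelʳ-≤ M _ _ (begin
      P * n + M              ≤⟨ +-monoʳ-≤ (P * n) M≤q ⟩
      P * (q * h) + q        ≡⟨ identity₇₄ P q h ⟩
      suc (P * h) * q        ≤⟨ *-monoˡ-≤ q Ph<sM ⟩
      s * M * q              ≡⟨ identity₇₃ s M q ⟩
      M * (s * q)            ≡⟨ cong (M *_) (≡.sym e+1) ⟩
      M * (e + 1)            ≡⟨ identity₇₂ M e ⟩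
      M * e + M              ∎)
      where
      open ≤-Reasoning
    below : ∀ i → P * n ≤ M * lookup sizes i
    below Fin.zero    = Pn≤Me
    below (Fin.suc i) = ≤-trans Pn≤Me (*-monoʳ-≤ M (≤-trans (≤-trans (m≤m+n e 1) (≤-reflexive e+1)) (≤-trans sq≤Q (balanced-lower ρ (n ∸ e) i))))
    above : ∀ i → (ρ * h) * lookup sizes i ≤ w * n + 2 * (ρ * h)
    above Fin.zero = begin
      ρ * h * e                ≤⟨ *-monoʳ-≤ (ρ * h) (≤-trans (m≤m+n e 1) (≤-reflexive e+1)) ⟩
      ρ * h * (s * q)          ≡⟨ identity₇₁ ρ h s q ⟩
      ρ * s * (q * h)          ≤⟨ *-monoˡ-≤ n ρs≤w ⟩
      w * n                    ≤⟨ m≤m+n _ _ ⟩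
      w * n + 2 * (ρ * h)      ∎
      where
      open ≤-Reasoning
    above (Fin.suc i) = begin
      ρ * h * lookup (balanced ρ (n ∸ e)) i   ≤⟨ *-monoʳ-≤ (ρ * h) (balanced-upper ρ (n ∸ e) i) ⟩
      ρ * h * (Q + 1)                         ≡⟨ identity₇₀ ρ h Q ⟩
      h * (ρ * Q) + ρ * h                     ≤⟨ +-monoˡ-≤ (ρ * h) (*-monoʳ-≤ h (≤-trans (*/≤ ρ (n ∸ e)) (≤-reflexive rest-eq))) ⟩
      h * (w * q + 1) + ρ * h                 ≡⟨ identity₆₉ h w q ρ ⟩
      w * (q * h) + (1 * h + ρ * h)           ≤⟨ +-monoʳ-≤ (w * n) (+-monoˡ-≤ (ρ * h) (*-monoˡ-≤ h (>-nonZero⁻¹ ρ))) ⟩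
      w * n + (ρ * h + ρ * h)                 ≡⟨ identity₆₈ (w * n) (ρ * h) ⟩
      w * n + 2 * (ρ * h)                     ∎
      where
      open ≤-Reasoning
    open LowerBound sizes (ρ * h) w M P {{m*n≢0 ρ h}} x μ inverse μM
      (λ i → subst (λ n → (ρ * h) * lookup sizes i ≤ w * n + 2 * (ρ * h)) (≡.sym sum-sizes) (above i))
      (λ i → subst (λ n → P * n ≤ M * lookup sizes i) (≡.sym sum-sizes) (below i))
      (subst (λ n → 8 * M ≤ P * n) (≡.sym sum-sizes) large) hiding (n)
    no-factor : ¬ HasCompatibleHFactor H G F
    no-factor (T , factor , compatible) = <⇒≱ (≤-reflexive (≡.trans (+-comm 1 e) e+1)) (begin
      s * q                                                          ≡⟨ *-comm s q ⟩
      q * s                                                          ≡⟨ cong (_* s) q-eq ⟩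
      tiles T * s                                                    ≡⟨ ≡.trans (cong (_* s) (≡.sym (length-allFin (tiles T)))) (≡.sym (S-const (allFin (tiles T)) s)) ⟩
      S (allFin (tiles T)) (λ _ → s)                                 ≤⟨ S-mono (allFin (tiles T)) (λ t → classes _ (tile-proper H triangle T factor compatible t) Fin.zero) ⟩
      S (allFin (tiles T)) (λ t → classSize (part ∘ φ T t) Fin.zero) ≡⟨ part-tiles H triangle T factor compatible Fin.zero ⟨
      e                                                              ∎)
      where
      open ≤-Reasoning
      q-eq : q ≡ tiles T
      q-eq = *-cancelʳ-≡ q (tiles T) h (≡.trans (≡.sym sum-sizes) (≡.sym (tiles-order H triangle T factor compatible)))

  example : Σ (Graph (q * h)) λ G → Σ (IncompatibilitySystem G) λ 𝓕 → IsIncSystem (q * h) G 𝓕 ((1ℚ ℚ.- inv x) ℚ.+ μ ℚ.* ½) μ × ¬ HasCompatibleHFactor H G 𝓕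
  example = subst (λ n → Σ (Graph n) λ G → Σ (IncompatibilitySystem G) λ 𝓕 → IsIncSystem n G 𝓕 ((1ℚ ℚ.- inv x) ℚ.+ μ ℚ.* ½) μ × ¬ HasCompatibleHFactor H G 𝓕)
    sum-sizes (G , F , system , no-factor)

m+[n∸m]≡n+[m∸n] : ∀ m n → m + (n ∸ m) ≡ n + (m ∸ n)
m+[n∸m]≡n+[m∸n] zero    n       = ≡.sym (≡.trans (cong (n +_) (0∸n≡0 n)) (+-identityʳ n))
m+[n∸m]≡n+[m∸n] (suc m) zero    = +-identityʳ (suc m)
m+[n∸m]≡n+[m∸n] (suc m) (suc n) = cong suc (m+[n∸m]≡n+[m∸n] m n)

-- two parts whose sizes differ by one cannot both be covered when all class differences share a factor
module DivisibilityExample {h : ℕ} (H : Graph h) (ρ M P n : ℕ) .{{_ : NonZero M}} .{{_ : NonZero ρ}} (μ : ℚ)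
    (1<ρ : 1 < ρ)
    (triangle : ∀ a b → adj H a b ≡ true → ∃[ c ] (adj H c a ≡ true × adj H c b ≡ true))
    (gap≢1 : Colourings.gapGcd H (suc ρ) ≢ 1) (μM : μ ℚ.* ℕ→ℚ M ≡ ℕ→ℚ P)
    (sparse : P * suc ρ < M) (long : 2 * suc ρ * M ≤ n) (large : 8 * M ≤ P * n) where

  private
    r g : ℕ
    r = suc ρ
    g = Colourings.gapGcd H r

    -- A size for the first part close to `n / r` such that the remaining vertices cannot be divided
    -- evenly among `ρ` parts; balancing them then produces two parts whose sizes differ by one.
    record Cut (e : ℕ) : Set where
      field
        small    : r * e ≤ n
        near     : n ≤ r * (e + 2)
        unevenly : (n ∸ e) % ρ ≢ 0

    cut : ∃ Cut
    cut with (n ∸ n / r) % ρ ≟ 0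
    ... | no ne = n / r , record
      { small = */≤ r n
      ; near = ≤-trans (<+*/ r n) (≤-trans (m≤m+n _ r) (≤-reflexive (identity₇₉ r (n / r))))
      ; unevenly = ne }
    ... | yes e with n / r in a-eq
    ...   | zero  = contradiction (subst (1 ≤_) a-eq (≤*⇒/≥ 1 r n (≤-trans (≤-reflexive (*-identityʳ r)) r≤n))) λ ()
      where r≤n : r ≤ n
            r≤n = ≤-trans (≤-trans (m≤n*m r 2) (m≤m*n (2 * r) M)) long
    -- If `ρ` divides what `n / r` leaves, a first part smaller by one leaves the remainder one,
    -- which is nonzero modulo `ρ` as `1 < ρ`.
    ...   | suc a = a , record
      { small = ≤-trans (*-monoʳ-≤ r (n≤1+n a)) ra≤n
      ; near = ≤-trans (<+*/ r n) (≤-reflexive (≡.trans (cong (λ z → r + r * z) a-eq) (identity₈₅ r a)))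
      ; unevenly = λ e′ → contradiction (≡.trans (≡.sym one) e′) λ () }
      where
      ra≤n : r * suc a ≤ n
      ra≤n = subst (λ z → r * z ≤ n) a-eq (*/≤ r n)
      one : (n ∸ a) % ρ ≡ 1
      one = begin
        (n ∸ a) % ρ                           ≡⟨ cong (_% ρ) (+-∸-assoc 1 (≤-trans (m≤n*m (suc a) r) ra≤n)) ⟩
        (1 + (n ∸ suc a)) % ρ                 ≡⟨ %-distribˡ-+ 1 (n ∸ suc a) ρ ⟩
        (1 % ρ + (n ∸ suc a) % ρ) % ρ         ≡⟨ cong₂ (λ u v → (u + v) % ρ) (m<n⇒m%n≡m 1<ρ) e ⟩
        1 % ρ                                 ≡⟨ m<n⇒m%n≡m 1<ρ ⟩
        1                                     ∎
        where open ≡-Reasoning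

    e = proj₁ cut
    open Cut (proj₂ cut)

    e≤n : e ≤ n
    e≤n = ≤-trans (m≤n*m e r) small

    open Sizes ρ n e e≤n

    Q = (n ∸ e) / ρ

    e≤Q : e ≤ Q
    e≤Q = ≤*⇒/≥ e ρ (n ∸ e) (m+n≤o⇒m≤o∸n (ρ * e) (≤-trans (≤-reflexive (+-comm (ρ * e) e)) small))

    Pn≤Me : P * n ≤ M * e
    Pn≤Me = *-cancelˡ-≤ r (+-cancelʳ-≤ n _ _ (begin
      r * (P * n) + n          ≡⟨ identity₈₄ r P n ⟩
      suc (P * r) * n          ≤⟨ *-monoˡ-≤ n sparse ⟩
      M * n                    ≤⟨ *-monoʳ-≤ M near ⟩
      M * (r * (e + 2))        ≡⟨ identity₈₃ M r e ⟩
      r * (M * e) + 2 * r * M  ≤⟨ +-monoʳ-≤ (r * (M * e)) long ⟩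
      r * (M * e) + n          ∎))
      where
      open ≤-Reasoning

    below : ∀ i → P * n ≤ M * lookup sizes i
    below Fin.zero    = Pn≤Me
    below (Fin.suc i) = ≤-trans Pn≤Me (*-monoʳ-≤ M (≤-trans e≤Q (balanced-lower ρ (n ∸ e) i)))

    rQ≤ : r * Q ≤ n + r
    rQ≤ = *-cancelˡ-≤ ρ (≤-from 0 (+-mono-≤ (+-mono-≤ (*-monoʳ-≤ r ρQ+e≤n) near) (*-monoˡ-≤ r 1<ρ)) (identity₈₂ ρ Q e n))
      where
      ρQ+e≤n : ρ * Q + e ≤ n
      ρQ+e≤n = ≤-trans (+-monoˡ-≤ e (*/≤ ρ (n ∸ e))) (≤-reflexive (m∸n+n≡m e≤n))

    above : ∀ i → r * lookup sizes i ≤ 1 * n + 2 * r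
    above Fin.zero    = ≤-trans small (≤-trans (≤-reflexive (≡.sym (*-identityˡ n))) (m≤m+n _ _))
    above (Fin.suc i) = ≤-trans (*-monoʳ-≤ r (balanced-upper ρ (n ∸ e) i)) (≤-trans (≤-reflexive (identity₇₂ r Q)) (≤-trans (+-monoˡ-≤ r rQ≤) (≤-reflexive (identity₈₁ n r))))

    inverse : inv (ℕ→ℚ r) ℚ.* ℕ→ℚ r ≡ ℕ→ℚ 1
    inverse = inv-* (λ e → contradiction (ℕ→ℚ-injective {r} {0} e) λ ())

    open LowerBound sizes r 1 M P (ℕ→ℚ r) μ inverse μM
      (λ i → subst (λ n → r * lookup sizes i ≤ 1 * n + 2 * r) (≡.sym sum-sizes) (above i))
      (λ i → subst (λ n → P * n ≤ M * lookup sizes i) (≡.sym sum-sizes) (below i))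
      (subst (λ n → 8 * M ≤ P * n) (≡.sym sum-sizes) large) hiding (n)

    first last : Fin ρ
    first = Fin.fromℕ< (>-nonZero⁻¹ ρ)
    last  = Fin.fromℕ< {pred ρ} (≤-reflexive (suc-pred ρ))

    i₁ i₂ : Fin r
    i₁ = Fin.suc first
    i₂ = Fin.suc last

    uneven : lookup sizes i₁ ≡ suc (lookup sizes i₂)
    uneven = ≡.trans (≡.trans (V.lookup∘tabulate _ first) (cong (λ b → Q + 𝟙 b) (<ᵇ-true (subst (_< (n ∸ e) % ρ) (≡.sym (Fin.toℕ-fromℕ< _)) (n≢0⇒n>0 unevenly)))))
      (≡.trans (+-comm Q 1) (cong suc (≡.sym (≡.trans (V.lookup∘tabulate _ last) (≡.trans (cong (λ b → Q + 𝟙 b)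
        (<ᵇ-false (≤-trans (≤-pred (≤-trans (m%n<n (n ∸ e) ρ) (≤-reflexive (≡.sym (suc-pred ρ))))) (≤-reflexive (≡.sym (Fin.toℕ-fromℕ< _)))))) (+-identityʳ Q))))))

    -- Summed over all copies, the differences between the classes in the parts `i₁` and `i₂` are
    -- multiples of `g` but add up to one. Positive and negative differences are collected
    -- separately, in `D₂` and `D₁`, to stay within natural numbers.
    no-factor : ¬ HasCompatibleHFactor H G F
    no-factor (T , factor , compatible) = gap≢1 (∣1⇒≡1 (∣m+n∣m⇒∣n (subst (g ∣_) balance (∣-sum (λ t → size t i₁ ∸ size t i₂) (λ t → divides-gap t i₁ i₂))) (∣-sum _ (λ t → divides-gap t i₂ i₁))))
      where
      ts = allFin (tiles T)
      size : Fin (tiles T) → Fin r → ℕ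
      size t i = classSize (part ∘ φ T t) i
      divides-gap : ∀ t i j → g ∣ size t i ∸ size t j
      divides-gap t i j = Colourings.gapGcd-∣ H r (part ∘ φ T t) (tile-proper H triangle T factor compatible t) i j
      ∣-sum : ∀ (f : Fin (tiles T) → ℕ) → (∀ t → g ∣ f t) → g ∣ S ts f
      ∣-sum f g∣f = go ts
        where
        go : ∀ ts → g ∣ S ts f
        go []       = g ∣0
        go (t ∷ ts) = ∣m∣n⇒∣m+n (g∣f t) (go ts)
      sums : S ts (λ t → size t i₁) + S ts (λ t → size t i₂ ∸ size t i₁) ≡ S ts (λ t → size t i₂) + S ts (λ t → size t i₁ ∸ size t i₂)
      sums = ≡.trans (≡.sym (S-+ ts _ _)) (≡.trans (S-cong ts (λ t → m+[n∸m]≡n+[m∸n] (size t i₁) (size t i₂))) (S-+ ts _ _))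
      D₁ = S ts (λ t → size t i₂ ∸ size t i₁)
      D₂ = S ts (λ t → size t i₁ ∸ size t i₂)
      balance : D₂ ≡ D₁ + 1
      balance = +-cancelˡ-≡ (lookup sizes i₂) _ _ (begin
        lookup sizes i₂ + D₂                  ≡⟨ cong (_+ D₂) (part-tiles H triangle T factor compatible i₂) ⟩
        S ts (λ t → size t i₂) + D₂           ≡⟨ sums ⟨
        S ts (λ t → size t i₁) + D₁           ≡⟨ cong (_+ D₁) (≡.trans (≡.sym (part-tiles H triangle T factor compatible i₁)) uneven) ⟩
        suc (lookup sizes i₂) + D₁            ≡⟨ identity₈₀ (lookup sizes i₂) D₁ ⟩
        lookup sizes i₂ + (D₁ + 1)            ∎)
        where
        open ≡-Reasoning

  example : Σ (Graph n) λ G → Σ (IncompatibilitySystem G) λ 𝓕 → IsIncSystem n G 𝓕 ((1ℚ ℚ.- inv (ℕ→ℚ (suc ρ))) ℚ.+ μ ℚ.* ½) μ × ¬ HasCompatibleHFactor H G 𝓕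
  example = subst (λ n → Σ (Graph n) λ G → Σ (IncompatibilitySystem G) λ 𝓕 → IsIncSystem n G 𝓕 ((1ℚ ℚ.- inv (ℕ→ℚ r)) ℚ.+ μ ℚ.* ½) μ × ¬ HasCompatibleHFactor H G 𝓕)
    sum-sizes (G , F , system , no-factor)

third : ∀ {k} (x y : Fin (suc (suc (suc k)))) → ∃[ i ] (i ≢ x × i ≢ y)
third x y with Fin.zero Fin.≟ x | Fin.zero Fin.≟ y | Fin.suc Fin.zero Fin.≟ x | Fin.suc Fin.zero Fin.≟ y
... | no p       | no q       | _          | _          = Fin.zero , p , q
... | _          | _          | no p       | no q       = Fin.suc Fin.zero , p , q
... | yes ≡.refl | _          | _          | yes ≡.refl = Fin.suc (Fin.suc Fin.zero) , (λ ()) , (λ ())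
... | _          | yes ≡.refl | yes ≡.refl | _          = Fin.suc (Fin.suc Fin.zero) , (λ ()) , (λ ())
... | yes ≡.refl | _          | yes ()     | _
... | _          | yes ≡.refl | _          | yes ()

module Partite {h r : ℕ} (H : Graph h) (hs : Fin r → ℕ) (positive : ∀ i → 1 ≤ hs i) (partite : IsCompletePartite H r hs) where

  private
    p = proj₁ partite

  adjacent : ∀ {a b} → p a ≢ p b → adj H a b ≡ true
  adjacent {a} {b} ne = Equivalence.from (proj₂ (proj₂ partite) a b) ne

  separated : ∀ {a b} → adj H a b ≡ true → p a ≢ p b
  separated {a} {b} e = Equivalence.to (proj₂ (proj₂ partite) a b) e

  representative : ∀ i → ∃[ v ] (p v ≡ i)
  representative i with S-𝟙 (allFin h) (λ v → ⌊ p v Fin.≟ i ⌋) (≤-trans (positive i) (≤-reflexive (≡.trans (≡.sym (proj₁ (proj₂ partite) i)) (count≡S h _))))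
  ... | v , _ , e with p v Fin.≟ i
  ...   | yes q = v , q

  chromatic : IsChromaticNumber H r
  chromatic = (p , λ a b → separated) , λ j j<r (c , pr) → clash j j<r c pr
    where
    clash : ∀ j → j < r → (c : Fin h → Fin j) → ¬ ProperColouring H j c
    clash j j<r c pr with Fin.pigeonhole j<r (c ∘ proj₁ ∘ representative)
    ... | i , i′ , i<i′ , e = pr _ _ (adjacent (λ q → <⇒≢ i<i′ (cong toℕ (≡.trans (≡.sym (proj₂ (representative i))) (≡.trans q (proj₂ (representative i′))))))) e

triangles : ∀ {h k} (H : Graph h) (hs : Fin (suc (suc (suc k))) → ℕ) → (∀ i → 1 ≤ hs i) → IsCompletePartite H (suc (suc (suc k))) hs →
  ∀ a b → adj H a b ≡ true → ∃[ c ] (adj H c a ≡ true × adj H c b ≡ true)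
triangles H hs positive partite a b _ with third (proj₁ partite a) (proj₁ partite b)
... | i , i≢a , i≢b = let (c , pc≡i) = representative i in
    c , adjacent (λ e → i≢a (≡.trans (≡.sym pc≡i) e)) , adjacent (λ e → i≢b (≡.trans (≡.sym pc≡i) e))
  where open Partite H hs positive partite

smallest-class : ∀ {h r} (c : Fin h → Fin (suc r)) → ∃[ t ] SmallestClass c t
smallest-class {r = r} c = let (i , least) = argmin r (classSize c) in classSize c i , (i , ≡.refl) , least

sigma-classes : ∀ {h r} {H : Graph h} {s} → IsChromaticNumber H (suc r) → IsSigma H s →
  (∀ c → ProperColouring H (suc r) c → ∀ i → s ≤ classSize c i) × (∃[ c ] (ProperColouring H (suc r) c × SmallestClass c s))
sigma-classes {H = H} chrom (k , chrom′ , attained , least) with chromatic-unique {H = H} chrom chrom′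
... | ≡.refl = (λ c pr i → let (t , small) = smallest-class c in ≤-trans (least c pr t small) (proj₂ small i)) , attained

sigma-unique : ∀ {h r} {H : Graph h} {s t} → IsChromaticNumber H (suc r) → IsSigma H s → IsSigma H t → s ≡ t
sigma-unique {H = H} chrom σ τ with sigma-classes {H = H} chrom σ | sigma-classes {H = H} chrom τ
... | lowσ , (c , pr , (i , eq) , _) | lowτ , (c′ , pr′ , (j , eq′) , _) =
  ≤-antisym (≤-trans (lowσ c′ pr′ j) (≤-reflexive eq′)) (≤-trans (lowτ c pr i) (≤-reflexive eq))

critical-value : ∀ {h r} {H : Graph h} {x} → IsChromaticNumber H r → IsCriticalChromatic H x → ∃[ s ] (IsSigma H s × x ≡ criticalChromatic h r s)
critical-value {h} {H = H} chrom (k , s , chrom′ , σ , e) = s , σ , ≡.trans e (cong (λ k → criticalChromatic h k s) (chromatic-unique {H = H} chrom′ chrom))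

module Optimality (ρ : ℕ) .{{_ : NonZero ρ}} (1<ρ : 1 < ρ) {h : ℕ} (H : Graph h) (chrom : IsChromaticNumber H (suc ρ))
    (triangle : ∀ a b → adj H a b ≡ true → ∃[ c ] (adj H c a ≡ true × adj H c b ≡ true))
    (s : ℕ) (σ : IsSigma H s) (μ : ℚ) (M P : ℕ) .{{_ : NonZero M}} .{{_ : NonZero P}} (μM : μ ℚ.* ℕ→ℚ M ≡ ℕ→ℚ P)
    (μ< : μ ℚ.< ((criticalChromatic h (suc ρ) s ℚ.+ 1ℚ) ℚ.- ℕ→ℚ (suc ρ)) ℚ.* inv (ℕ→ℚ (suc ρ))) where

  private
    r = suc ρ
    sig = sigma-classes {H = H} chrom σ
    classes = proj₁ sig
    c = proj₁ (proj₂ sig)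
    pr = proj₁ (proj₂ (proj₂ sig))

    1≤s : 1 ≤ s
    1≤s = n≢0⇒n>0 λ e → let (i , eq) = proj₁ (proj₂ (proj₂ (proj₂ sig))) in
      proj₂ chrom ρ ≤-refl (empty-class H ρ c pr i (≡.trans eq e))

    rs≤h : r * s ≤ h
    rs≤h = begin
      r * s                              ≡⟨ ≡.trans (cong (_* s) (≡.sym (length-allFin r))) (≡.sym (S-const (allFin r) s)) ⟩
      S (allFin r) (λ _ → s)             ≤⟨ S-mono (allFin r) (classes c pr) ⟩
      S (allFin r) (classSize c)         ≡⟨ S-classes c ⟩
      h                                  ∎
      where open ≤-Reasoning

    0<h : 0 < h
    0<h = order-positive {H = H} chrom z<s

    instance
      h≢0 : NonZero h
      h≢0 = >-nonZero 0<h

    s<h : s < h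
    s<h = ≤-trans (≤-trans (+-monoˡ-≤ s 1≤s) (+-monoʳ-≤ s (m≤n*m s ρ))) rs≤h

    w-eq : h ∸ s ≡ suc (pred (h ∸ s))
    w-eq = ≡.sym (suc-pred (h ∸ s) {{>-nonZero (m<n⇒0<n∸m s<h)}})

    h-eq : h ≡ suc (pred (h ∸ s)) + s
    h-eq = ≡.trans (≡.sym (m∸n+n≡m (<⇒≤ s<h))) (cong (_+ s) w-eq)

    sparse : P * (r * (h ∸ s)) < ρ * s * M
    sparse = subst (λ w → P * (r * w) < ρ * s * M) (≡.sym w-eq) (threshold-ℕ ρ s (pred (h ∸ s)) M P μ μM
      (subst (λ z → μ ℚ.< ((z ℚ.+ 1ℚ) ℚ.- ℕ→ℚ r) ℚ.* inv (ℕ→ℚ r)) (cong₂ (λ a b → frac (ρ * a) b) h-eq w-eq) μ<))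

    large : ∀ n → 8 * M ≤ n → 8 * M ≤ P * n
    large n le = ≤-trans le (m≤n*m n P)

  Example : ℚ → ℕ → Set
  Example x n = Σ (Graph n) λ G → Σ (IncompatibilitySystem G) λ 𝓕 →
    IsIncSystem n G 𝓕 ((1ℚ ℚ.- inv x) ℚ.+ μ ℚ.* ½) μ × ¬ HasCompatibleHFactor H G 𝓕

  critical-example : ∀ n → h * M + 8 * M ≤ n → h ∣ n → Example (criticalChromatic h r s) n
  critical-example n n₀≤n (divides q ≡.refl) = CriticalExample.example H ρ s M P q (criticalChromatic h r s) μ triangle classes
    (inv-frac (ρ * h) (h ∸ s) (*-mono-≤ (>-nonZero⁻¹ ρ) 0<h)) μM 1≤s rs≤h sparse
    (*-cancelʳ-≤ M q h (≤-trans (≤-reflexive (*-comm M h)) (≤-trans (m≤m+n (h * M) (8 * M)) n₀≤n)))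
    (large (q * h) (≤-trans (m≤n+m (8 * M) (h * M)) n₀≤n))

  divisibility-example : Colourings.gapGcd H r ≢ 1 → ∀ n → 2 * r * M + 8 * M ≤ n → Example (ℕ→ℚ r) n
  divisibility-example gap≢1 n n₀≤n = DivisibilityExample.example H ρ M P n μ 1<ρ triangle gap≢1 μM Pr<M
      (≤-trans (m≤m+n (2 * r * M) (8 * M)) n₀≤n) (large n (≤-trans (m≤n+m (8 * M) (2 * r * M)) n₀≤n))
    where
    ρs≤w : ρ * s ≤ h ∸ s
    ρs≤w = m+n≤o⇒m≤o∸n (ρ * s) (≤-trans (≤-reflexive (+-comm (ρ * s) s)) rs≤h)
    -- The bound on `μ` involves the critical chromatic number even when `χ*(H)` is `χ(H)`. By
    -- `ρ * s ≤ h ∸ s` it implies `μ * r < 1`, so the inner degree fits into parts of size about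
    -- `n / r`.
    Pr<M : P * r < M
    Pr<M = *-cancelʳ-< (h ∸ s) _ _ (≤-<-trans (≤-reflexive (*-assoc P r (h ∸ s))) (<-≤-trans sparse
      (≤-trans (*-monoˡ-≤ M ρs≤w) (≤-reflexive (*-comm (h ∸ s) M)))))

  examples : ∀ x → IsChiStar H x → ∃[ n₀ ] ((n : ℕ) → n₀ ≤ n → h ∣ n → Example x n)
  examples x (l , _ , inj₁ (_ , critical)) = h * M + 8 * M , λ n n₀≤n h∣n → subst (λ x → Example x n) (≡.sym x≡) (critical-example n n₀≤n h∣n)
    where
    value = critical-value {H = H} chrom critical
    x≡ : x ≡ criticalChromatic h r s
    x≡ = ≡.trans (proj₂ (proj₂ value)) (cong (criticalChromatic h r) (sigma-unique {H = H} chrom (proj₁ (proj₂ value)) σ))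
  examples x (l , chromₗ , inj₂ (¬hcf , x≡l)) = 2 * r * M + 8 * M , λ n n₀≤n _ →
    subst (λ x → Example x n) (≡.sym (≡.trans x≡l (cong ℕ→ℚ l≡r)))
      (divisibility-example (λ e → ¬hcf (subst (HcfOne H) (≡.sym l≡r) (inj₁ (s≤s 1<ρ , gap≡1⇒hcf H r e)))) n n₀≤n)
    where
    l≡r : l ≡ r
    l≡r = chromatic-unique {H = H} chromₗ chrom

optimality : (r : ℕ) (hs : Fin r → ℕ) → 3 ≤ r → (∀ i → 1 ≤ hs i) →
  (h : ℕ) (H : Graph h) → IsCompletePartite H r hs →
  (y : ℚ) → IsCriticalChromatic H y → (x : ℚ) → IsChiStar H x →
  (μ : ℚ) → 0ℚ ℚ.< μ → μ ℚ.< ((y ℚ.+ 1ℚ) ℚ.- ℕ→ℚ r) ℚ.* inv (ℕ→ℚ r) →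
  ∃[ n₀ ] ((n : ℕ) → n₀ ≤ n → h ∣ n →
    Σ (Graph n) λ G → Σ (IncompatibilitySystem G) λ 𝓕 →
    IsIncSystem n G 𝓕 ((1ℚ ℚ.- inv x) ℚ.+ μ ℚ.* ½) μ × ¬ HasCompatibleHFactor H G 𝓕)
optimality (suc (suc (suc k))) hs (s≤s (s≤s (s≤s z≤n))) positive h H partite y critical x χ* μ 0<μ μ<
  = Optimality.examples (suc (suc k)) (s≤s (s≤s z≤n)) H chrom (triangles H hs positive partite)
      (proj₁ value) (proj₁ (proj₂ value)) μ (suc (proj₁ (proj₂ fraction))) (suc (proj₁ fraction)) (proj₂ (proj₂ fraction))
      (subst (λ z → μ ℚ.< ((z ℚ.+ 1ℚ) ℚ.- ℕ→ℚ (suc (suc (suc k)))) ℚ.* inv (ℕ→ℚ (suc (suc (suc k))))) (proj₂ (proj₂ value)) μ<) x χ*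
  where
  chrom = Partite.chromatic H hs positive partite
  value = critical-value {H = H} chrom critical
  fraction = 0<⇒numerator μ 0<μ

theorem1p7 :
    -- Part 1: the minimum-degree condition 1 - 1/χ*(H) + α suffices
    ((h : ℕ) (H : Graph h) →
      (∀ k → IsChromaticNumber H k → 2 ≤ k) →
      (x : ℚ) → IsChiStar H x →
      (α : ℚ) → 0ℚ ℚ.< α →
      ∃[ μ ] (0ℚ ℚ.< μ × ∃[ n₀ ] ((n : ℕ) → n₀ ≤ n → h ∣ n →
        (G : Graph n) (𝓕 : IncompatibilitySystem G) →
        IsIncSystem n G 𝓕 ((1ℚ ℚ.- inv x) ℚ.+ α) μ →
        HasCompatibleHFactor H G 𝓕)))
    ×
    -- Part 2: α cannot be omitted for K_r(h_1,…,h_r), r ≥ 3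
    ((r : ℕ) (hs : Fin r → ℕ) → 3 ≤ r → (∀ i → 1 ≤ hs i) →
      (h : ℕ) (H : Graph h) → IsCompletePartite H r hs →
      (y : ℚ) → IsCriticalChromatic H y →
      (x : ℚ) → IsChiStar H x →
      (μ : ℚ) → 0ℚ ℚ.< μ → μ ℚ.< ((y ℚ.+ 1ℚ) ℚ.- ℕ→ℚ r) ℚ.* inv (ℕ→ℚ r) →
      ∃[ n₀ ] ((n : ℕ) → n₀ ≤ n → h ∣ n →
        Σ (Graph n) λ G → Σ (IncompatibilitySystem G) λ 𝓕 →
          IsIncSystem n G 𝓕 ((1ℚ ℚ.- inv x) ℚ.+ μ ℚ.* ½) μ ×
          ¬ HasCompatibleHFactor H G 𝓕))
theorem1p7 = sufficiency , optimality
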